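{- Let $\Gamma,\Sigma$ be finite alphabets. In the elementary affine $\lambda$-calculus (EA$\lambda$): (1) every function $\Gamma^*\to\Sigma^*$ expressed by a closed term of type $\mathtt{Str}_\Gamma\multimap\mathtt{Str}_\Sigma$ (resp. $!\mathtt{Str}_\Gamma\multimap !\mathtt{Str}_\Sigma$) is computable in time linear (resp. polynomial) in the length of the input, and is regularity-preserving (the preimage of every regular language is regular); (2) every regular function $\Gamma^*\to\Sigma^*$ can be expressed by a closed EA$\lambda$ term of type $\mathtt{Str}_\Gamma\multimap\mathtt{Str}_\Sigma$ and also by a closed EA$\lambda$ term of type $!\mathtt{Str}_\Gamma\multimap !\mathtt{Str}_\Sigma$; (3) the functions expressible with types of the form $!\mathtt{Str}_\Gamma\multimap!\mathtt{Str}_\Sigma$ are closed under composition by substitution: if $I$ is a finite alphabet, $f:\Gamma^*\to I^*$ is expressible by a term of type $!\mathtt{Str}_\Gamma\multimap!\mathtt{Str}_I$ and, for each $i\in I$, $g_i:\Gamma^*\to\Sigma^*$ is expressible by a term of type $!\mathtt{Str}_\Gamma\multimap!\mathtt{Str}_\Sigma$, then $\mathrm{CbS}(f,(g_i)_{i\in I})$ is expressible by a term of type $!\mathtt{Str}_\Gamma\multimap!\mathtt{Str}_\Sigma$; consequently, for every $k\in\mathbb{N}$ there is a function $f$ expressible by a term of such a type (for suitable finite alphabets) with $|f(w)|=\Omega(|w|^k)$.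
   Context: EA$\lambda$ terms: $t,u ::= x \mid \lambda x.\,t \mid \lambda !x.\,t \mid t\,u \mid !t$; $=_\beta$ is the smallest congruence containing $(\lambda x.\,t)\,u=_\beta t\{x:=u\}$ and $(\lambda!x.\,t)\,(!u)=_\beta t\{x:=u\}$. Types: $A ::= \alpha \mid S$ (linear types), $S ::= \sigma\multimap\tau \mid \forall\alpha.\,S$ (strictly linear types), $\sigma,\tau ::= A \mid !\sigma$ (types); $\multimap$ associates to the right and $A^k\multimap B$ abbreviates $A\multimap\cdots\multimap A\multimap B$ ($k$ copies). Judgements have the form $\Gamma\mid\Delta\mid\Theta\vdash t:\sigma$ where $\Gamma$ maps variables to linear types, $\Delta$ maps variables to types of the form $!\sigma$, $\Theta$ maps variables to arbitrary types, with pairwise disjoint domains. Rules: $\Gamma,x:A\mid\Delta\mid\Theta\vdash x:A$; $\Gamma\mid\Delta\mid\Theta,x:\sigma\vdash x:\sigma$; from $\Gamma,x:A\mid\Delta\mid\Theta\vdash t:\tau$ infer $\Gamma\mid\Delta\mid\Theta\vdash\lambda x.\,t:A\multimap\tau$; from $\Gamma\mid\Delta,x:!\sigma\mid\Theta\vdash t:\tau$ infer $\Gamma\mid\Delta\mid\Theta\vdash\lambda!x.\,t:!\sigma\multimap\tau$; from $\Gamma\mid\Delta\mid\Theta\vdash t:\sigma\multimap\tau$ and $\Gamma'\mid\Delta\mid\Theta\vdash u:\sigma$ (domains of $\Gamma,\Gamma'$ disjoint) infer $\Gamma\cup\Gamma'\mid\Delta\mid\Theta\vdash t\,u:\tau$;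 from $\Gamma\mid\Delta\mid\Theta\vdash t:S$ with $\alpha$ not free in $\Gamma,\Delta,\Theta$ infer $\Gamma\mid\Delta\mid\Theta\vdash t:\forall\alpha.\,S$; from $\Gamma\mid\Delta\mid\Theta\vdash t:\forall\alpha.\,S$ infer $\Gamma\mid\Delta\mid\Theta\vdash t:S\{\alpha:=A\}$ for a linear type $A$; from $\varnothing\mid\varnothing\mid\Theta\vdash t:\sigma$ infer $\Gamma\mid !\Theta,\Delta\mid\Theta'\vdash !t:!\sigma$ (where $!\Theta$ assigns $!\sigma$ to each $x:\sigma$ of $\Theta$). A closed term of type $\sigma$ is a $t$ with $\varnothing\mid\varnothing\mid\varnothing\vdash t:\sigma$. For $\Sigma=\{a_1,\dots,a_n\}$: $\mathtt{Str}_\Sigma=\forall\alpha.\,(!(\alpha\multimap\alpha))^{n}\multimap!(\alpha\multimap\alpha)$, and $w=a_{i_1}\cdots a_{i_m}$ is encoded as $\overline{w}=\lambda!f_1.\cdots\lambda!f_n.\,!(\lambda x.\,f_{i_1}(\cdots(f_{i_m}\,x)\cdots))$. A term $t$ of type $\mathtt{Str}_\Gamma\multimap\mathtt{Str}_\Sigma$ expresses $f:\Gamma^*\to\Sigma^*$ if $t\,\overline{w}=_\beta\overline{f(w)}$ for all $w$; a term of type $!\mathtt{Str}_\Gamma\multimap!\mathtt{Str}_\Sigma$ expresses $f$ if $t\,(!\overline{w})=_\beta!\overline{f(w)}$ for all $w$. Register transducer $\Gamma^*\to\Sigma^*$: a finite set $Q$ of states with initial state $q_I$, a finite set $R$ of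 registers disjoint from $\Gamma,\Sigma$, a transition function $\delta:Q\times\Gamma\to Q\times((\Sigma\cup R)^*)^R$ and an output function $F:Q\to(\Sigma\cup R)^*$. Configurations are pairs $(q,s)$ with $s:R\to\Sigma^*$; for $c\in\Gamma$, $(q,s)\to_c(q',s')$ when $(q',u)=\delta(q,c)$ and $s'=s^*\circ u$, where $s^*:(\Sigma\cup R)^*\to\Sigma^*$ is the monoid morphism fixing letters of $\Sigma$ and sending $r\in R$ to $s(r)$. The image of $w=w_1\cdots w_n$ is $s^*(F(q))$ where $(q_I,(r\mapsto\varepsilon))\to_{w_1}\cdots\to_{w_n}(q,s)$. A streaming string transducer (SST) is a register transducer such that for every update $u$ appearing in some $\delta(q,c)$ and every $r\in R$, $r$ occurs at most once in total among all the words $u(r')$, $r'\in R$, and for every $q\in Q$, every $r\in R$ occurs at most once in $F(q)$. A function is regular if it is computed by some SST. Composition by substitution: for $f:\Gamma^*\to I^*$ and $g_i:\Gamma^*\to\Sigma^*$ ($i\in I$), $\mathrm{CbS}(f,(g_i)_{i\in I})(w)=g_{i_1}(w)\cdots g_{i_k}(w)$ where $f(w)=i_1\cdots i_k$. -}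

module Defs where

open import Data.Nat using (ℕ; zero; suc; _+_; _*_; _∸_; _^_; _≤_)
open import Data.Fin using (Fin; toℕ; _≟_)
open import Data.List using (List; []; _∷_; length; foldl; concatMap; allFin)
open import Data.Vec using (Vec) renaming (map to vmap; zipWith to vzipWith)
open import Data.Maybe using (Maybe; just; nothing; _>>=_)
open import Data.Sum using (_⊎_; inj₁; inj₂)
open import Data.Product using (Σ; _×_; _,_; ∃)
open import Data.Bool using (Bool; true)
open import Relation.Nullary using (does)
open import Relation.Binary.PropositionalEquality using (_≡_)
open import Function.Bundles using (_⇔_)

Word : ℕ → Set
Word n = List (Fin n)

data LTy : Set
data STy : Set
data Ty  : Set

data LTy where
  tv : ℕ → LTy
  st : STy → LTy

data STy where
  _⊸_ : Ty → Ty → STy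
  ∀'  : STy → STy

data Ty where
  lin : LTy → Ty
  !_  : Ty → Ty

infixr 5 _⊸_

extR : (ℕ → ℕ) → ℕ → ℕ
extR ρ zero    = zero
extR ρ (suc n) = suc (ρ n)

renL : (ℕ → ℕ) → LTy → LTy
renS : (ℕ → ℕ) → STy → STy
renT : (ℕ → ℕ) → Ty → Ty
renL ρ (tv n)  = tv (ρ n)
renL ρ (st S)  = st (renS ρ S)
renS ρ (σ ⊸ τ) = renT ρ σ ⊸ renT ρ τ
renS ρ (∀' S)  = ∀' (renS (extR ρ) S)
renT ρ (lin A) = lin (renL ρ A)
renT ρ (! σ)   = ! renT ρ σ

extS : (ℕ → LTy) → ℕ → LTy
extS s zero    = tv zero
extS s (suc n) = renL suc (s n)

subL : (ℕ → LTy) → LTy → LTy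
subS : (ℕ → LTy) → STy → STy
subT : (ℕ → LTy) → Ty → Ty
subL s (tv n)  = s n
subL s (st S)  = st (subS s S)
subS s (σ ⊸ τ) = subT s σ ⊸ subT s τ
subS s (∀' S)  = ∀' (subS (extS s) S)
subT s (lin A) = lin (subL s A)
subT s (! σ)   = ! subT s σ

instS : STy → LTy → STy
instS S A = subS (λ { zero → A ; (suc n) → tv n }) S

data Tm : Set where
  var  : ℕ → Tm
  lam  : Tm → Tm
  lam! : Tm → Tm
  app  : Tm → Tm → Tm
  bang : Tm → Tm

renTm : (ℕ → ℕ) → Tm → Tm
renTm ρ (var n)   = var (ρ n)
renTm ρ (lam t)   = lam (renTm (extR ρ) t)
renTm ρ (lam! t)  = lam! (renTm (extR ρ) t)
renTm ρ (app t u) = app (renTm ρ t) (renTm ρ u)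
renTm ρ (bang t)  = bang (renTm ρ t)

extTm : (ℕ → Tm) → ℕ → Tm
extTm s zero    = var zero
extTm s (suc n) = renTm suc (s n)

subTm : (ℕ → Tm) → Tm → Tm
subTm s (var n)   = s n
subTm s (lam t)   = lam (subTm (extTm s) t)
subTm s (lam! t)  = lam! (subTm (extTm s) t)
subTm s (app t u) = app (subTm s t) (subTm s u)
subTm s (bang t)  = bang (subTm s t)

_[_] : Tm → Tm → Tm
t [ u ] = subTm (λ { zero → u ; (suc n) → var n }) t

data _=β_ : Tm → Tm → Set where
  β-lam    : ∀ {t u} → app (lam t) u =β (t [ u ])
  β-bang   : ∀ {t u} → app (lam! t) (bang u) =β (t [ u ])
  β-refl   : ∀ {t} → t =β t
  β-sym    : ∀ {t u} → t =β u → u =β t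
  β-trans  : ∀ {t u v} → t =β u → u =β v → t =β v
  β-lamc   : ∀ {t t'} → t =β t' → lam t =β lam t'
  β-lam!c  : ∀ {t t'} → t =β t' → lam! t =β lam! t'
  β-appc   : ∀ {t t' u u'} → t =β t' → u =β u' → app t u =β app t' u'
  β-bangc  : ∀ {t t'} → t =β t' → bang t =β bang t'

-- Typing. A context Γ | Δ | Θ (pairwise disjoint domains) is represented
-- as a single map from variables to slots.
--   inΓ A : x : A  in Γ  (A linear)
--   inΔ σ : x : !σ in Δ
--   inΘ σ : x : σ  in Θ

data Slot : Set where
  none : Slot
  inΓ  : LTy → Slot
  inΔ  : Ty → Slot
  inΘ  : Ty → Slot

Ctx : Set
Ctx = ℕ → Slot

emptyCtx : Ctx
emptyCtx _ = none

_∷ᶜ_ : Slot → Ctx → Ctx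
(s ∷ᶜ C) zero    = s
(s ∷ᶜ C) (suc n) = C n

shiftSlot : Slot → Slot
shiftSlot none    = none
shiftSlot (inΓ A) = inΓ (renL suc A)
shiftSlot (inΔ σ) = inΔ (renT suc σ)
shiftSlot (inΘ σ) = inΘ (renT suc σ)

-- the contexts with every type variable shifted (used for the ∀-intro
-- side condition "α not free in Γ, Δ, Θ")
shiftCtx : Ctx → Ctx
shiftCtx C x = shiftSlot (C x)

-- C is (Γ ∪ Γ') | Δ | Θ, C₁ is Γ | Δ | Θ, C₂ is Γ' | Δ | Θ, Γ,Γ' disjoint
data SplitSlot : Slot → Slot → Slot → Set where
  sp-none : SplitSlot none none none
  sp-Γl   : ∀ {A} → SplitSlot (inΓ A) (inΓ A) none
  sp-Γr   : ∀ {A} → SplitSlot (inΓ A) none (inΓ A)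
  sp-Δ    : ∀ {σ} → SplitSlot (inΔ σ) (inΔ σ) (inΔ σ)
  sp-Θ    : ∀ {σ} → SplitSlot (inΘ σ) (inΘ σ) (inΘ σ)

Split : Ctx → Ctx → Ctx → Set
Split C C₁ C₂ = ∀ x → SplitSlot (C x) (C₁ x) (C₂ x)

-- premise context ∅ | ∅ | Θ and conclusion context Γ | !Θ, Δ | Θ'
data PromSlot : Slot → Slot → Set where
  pr-none : ∀ {s} → PromSlot none s
  pr-Θ    : ∀ {σ} → PromSlot (inΘ σ) (inΔ σ)

Prom : Ctx → Ctx → Set
Prom C₀ C = ∀ x → PromSlot (C₀ x) (C x)

infix 4 _⊢_∶_
data _⊢_∶_ : Ctx → Tm → Ty → Set where
  ax-Γ  : ∀ {C x A} → C x ≡ inΓ A → C ⊢ var x ∶ lin A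
  ax-Θ  : ∀ {C x σ} → C x ≡ inΘ σ → C ⊢ var x ∶ σ
  ⊸I    : ∀ {C t A τ} → (inΓ A ∷ᶜ C) ⊢ t ∶ τ → C ⊢ lam t ∶ lin (st (lin A ⊸ τ))
  ⊸I!   : ∀ {C t σ τ} → (inΔ σ ∷ᶜ C) ⊢ t ∶ τ → C ⊢ lam! t ∶ lin (st ((! σ) ⊸ τ))
  ⊸E    : ∀ {C C₁ C₂ t u σ τ} → Split C C₁ C₂ →
          C₁ ⊢ t ∶ lin (st (σ ⊸ τ)) → C₂ ⊢ u ∶ σ → C ⊢ app t u ∶ τ
  ∀I    : ∀ {C t S} → shiftCtx C ⊢ t ∶ lin (st S) → C ⊢ t ∶ lin (st (∀' S))
  ∀E    : ∀ {C t S} (A : LTy) → C ⊢ t ∶ lin (st (∀' S)) → C ⊢ t ∶ lin (st (instS S A))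
  !I    : ∀ {C₀ C t σ} → Prom C₀ C → C₀ ⊢ t ∶ σ → C ⊢ bang t ∶ ! σ

Closed : Tm → Ty → Set
Closed t σ = emptyCtx ⊢ t ∶ σ

-- Church encodings of strings (alphabet of size suc n, i.e. n+1 letters)

endo : Ty
endo = lin (st (lin (tv zero) ⊸ lin (tv zero)))

strBody : ℕ → STy
strBody zero    = (! endo) ⊸ (! endo)
strBody (suc n) = (! endo) ⊸ lin (st (strBody n))

-- Str_Σ for |Σ| = suc n
Str : ℕ → STy
Str n = ∀' (strBody n)

StrT : ℕ → Ty
StrT n = lin (st (Str n))

LinFunTy : ℕ → ℕ → Ty
LinFunTy nΓ nΣ = lin (st (StrT nΓ ⊸ StrT nΣ))

BangFunTy : ℕ → ℕ → Ty
BangFunTy nΓ nΣ = lin (st ((! StrT nΓ) ⊸ (! StrT nΣ)))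

lam!s : ℕ → Tm → Tm
lam!s zero    t = t
lam!s (suc k) t = lam! (lam!s k t)

-- f_{i_1}(⋯(f_{i_m} x)⋯), with x = var 0 and f_{j+1} = var (1 + (N-1-j)), N = suc n
encBody : (n : ℕ) → Word (suc n) → Tm
encBody n []      = var zero
encBody n (i ∷ w) = app (var (suc (n ∸ toℕ i))) (encBody n w)

enc : (n : ℕ) → Word (suc n) → Tm
enc n w = lam!s (suc n) (bang (lam (encBody n w)))

ExpressesLin : (nΓ nΣ : ℕ) → Tm → (Word (suc nΓ) → Word (suc nΣ)) → Set
ExpressesLin nΓ nΣ t f = ∀ w → app t (enc nΓ w) =β enc nΣ (f w)

ExpressesBang : (nΓ nΣ : ℕ) → Tm → (Word (suc nΓ) → Word (suc nΣ)) → Set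
ExpressesBang nΓ nΣ t f = ∀ w → app t (bang (enc nΓ w)) =β bang (enc nΣ (f w))

ExpressibleLin : (nΓ nΣ : ℕ) → (Word (suc nΓ) → Word (suc nΣ)) → Set
ExpressibleLin nΓ nΣ f = Σ Tm λ t → Closed t (LinFunTy nΓ nΣ) × ExpressesLin nΓ nΣ t f

ExpressibleBang : (nΓ nΣ : ℕ) → (Word (suc nΓ) → Word (suc nΣ)) → Set
ExpressibleBang nΓ nΣ f = Σ Tm λ t → Closed t (BangFunTy nΓ nΣ) × ExpressesBang nΓ nΣ t f

record RegTrans (nΓ nΣ : ℕ) : Set where
  field
    Q  : ℕ
    qI : Fin Q
    R  : ℕ
    δ  : Fin Q → Fin nΓ → Fin Q × (Fin R → List (Fin nΣ ⊎ Fin R))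
    F  : Fin Q → List (Fin nΣ ⊎ Fin R)

module _ {nΓ nΣ : ℕ} (T : RegTrans nΓ nΣ) where
  open RegTrans T

  Valuation : Set
  Valuation = Fin R → Word nΣ

  star : Valuation → List (Fin nΣ ⊎ Fin R) → Word nΣ
  star s = concatMap (λ { (inj₁ a) → a ∷ [] ; (inj₂ r) → s r })

  stepRT : Fin Q × Valuation → Fin nΓ → Fin Q × Valuation
  stepRT (q , s) c with δ q c
  ... | (q' , u) = q' , (λ r → star s (u r))

  runRT : Word nΓ → Word nΣ
  runRT w with foldl stepRT (qI , (λ _ → [])) w
  ... | (q , s) = star s (F q)

  occ : Fin R → List (Fin nΣ ⊎ Fin R) → ℕ
  occ r []             = zero
  occ r (inj₁ _ ∷ xs)  = occ r xs
  occ r (inj₂ r' ∷ xs) with does (r ≟ r')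
  ... | true  = suc (occ r xs)
  ... | _     = occ r xs

  Copyless : Set
  Copyless =
    (∀ q c r → occ r (concatMap (Data.Product.proj₂ (δ q c)) (allFin R)) ≤ 1)
    × (∀ q r → occ r (F q) ≤ 1)

RegularFun : (nΓ nΣ : ℕ) → (Word nΓ → Word nΣ) → Set
RegularFun nΓ nΣ f = Σ (RegTrans nΓ nΣ) λ T → Copyless T × (∀ w → runRT T w ≡ f w)

record DFA (n : ℕ) : Set where
  field
    Q     : ℕ
    start : Fin Q
    δ     : Fin Q → Fin n → Fin Q
    acc   : Fin Q → Bool

accepts : ∀ {n} → DFA n → Word n → Bool
accepts D w = DFA.acc D (foldl (DFA.δ D) (DFA.start D) w)

Language : ℕ → Set₁
Language n = Word n → Set

RegularLang : ∀ {n} → Language n → Set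
RegularLang {n} L = Σ (DFA n) λ D → ∀ w → L w ⇔ (accepts D w ≡ true)

RegularityPreserving : (nΓ nΣ : ℕ) → (Word nΓ → Word nΣ) → Set₁
RegularityPreserving nΓ nΣ f =
  (L : Language nΣ) → RegularLang L → RegularLang (λ w → L (f w))

-- Time complexity: deterministic multi-tape Turing machines.
-- Tape cells: nothing = blank, just s = symbol s.  Two-way infinite tapes.
-- Tape 0 holds the input (head on its first letter), tape 1 is the output
-- tape; the output is read on tape 1 from the head rightwards.

Cell : ℕ → Set
Cell m = Maybe (Fin m)

record Tape (m : ℕ) : Set where
  constructor tape
  field
    left  : List (Cell m)   -- nearest cell first
    hd    : Cell m
    right : List (Cell m)

data Move : Set where
  L R S : Move

moveT : ∀ {m} → Move → Tape m → Tape m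
moveT L (tape []      h r) = tape [] nothing (h ∷ r)
moveT L (tape (c ∷ l) h r) = tape l c (h ∷ r)
moveT R (tape l h [])      = tape (h ∷ l) nothing []
moveT R (tape l h (c ∷ r)) = tape (h ∷ l) c r
moveT S t                  = t

actT : ∀ {m} → Cell m × Move → Tape m → Tape m
actT (c , mv) (tape l _ r) = moveT mv (tape l c r)

record TM (nΓ nΣ : ℕ) : Set where
  field
    Q    : ℕ
    k    : ℕ
    m    : ℕ
    q₀   : Fin Q
    δ    : Fin Q → Vec (Cell m) (suc (suc k)) →
           Maybe (Fin Q × Vec (Cell m × Move) (suc (suc k)))   -- nothing = halt
    inp  : Fin nΓ → Fin m
    outp : Fin m → Maybe (Fin nΣ)

module _ {nΓ nΣ : ℕ} (M : TM nΓ nΣ) where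
  open TM M

  Config : Set
  Config = Fin Q × Vec (Tape m) (suc (suc k))

  heads : Vec (Tape m) (suc (suc k)) → Vec (Cell m) (suc (suc k))
  heads = vmap Tape.hd

  stepTM : Config → Maybe Config
  stepTM (q , ts) with δ q (heads ts)
  ... | nothing         = nothing
  ... | just (q' , as)  = just (q' , vzipWith actT as ts)

  iterTM : ℕ → Config → Maybe Config
  iterTM zero    c = just c
  iterTM (suc t) c = stepTM c >>= iterTM t

  blankTape : Tape m
  blankTape = tape [] nothing []

  inputTape : Word nΓ → Tape m
  inputTape []      = blankTape
  inputTape (a ∷ w) = tape [] (just (inp a)) (Data.List.map (λ b → just (inp b)) w)

  initTM : Word nΓ → Config
  initTM w = q₀ , (inputTape w Data.Vec.∷ Data.Vec.replicate (suc k) blankTape)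

  readOut : List (Cell m) → Word nΣ
  readOut []             = []
  readOut (nothing ∷ _)  = []
  readOut (just s ∷ cs) with outp s
  ... | nothing = []
  ... | just a  = a ∷ readOut cs

  outputTM : Config → Word nΣ
  outputTM (q , ts) with Data.Vec.lookup ts (Data.Fin.suc Data.Fin.zero)
  ... | tape _ h r = readOut (h ∷ r)

  HaltsWith : Word nΓ → ℕ → Word nΣ → Set
  HaltsWith w t y = Σ Config λ c →
    (iterTM t (initTM w) ≡ just c) × (stepTM c ≡ nothing) × (outputTM c ≡ y)

  ComputesWithin : (Word nΓ → Word nΣ) → (ℕ → ℕ) → Set
  ComputesWithin f T = ∀ w → Σ ℕ λ t → (t ≤ T (length w)) × HaltsWith w t (f w)

LinearTime : (nΓ nΣ : ℕ) → (Word nΓ → Word nΣ) → Set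
LinearTime nΓ nΣ f = Σ (TM nΓ nΣ) λ M → Σ ℕ λ a →
  ComputesWithin M f (λ n → a * n + a)

PolyTime : (nΓ nΣ : ℕ) → (Word nΓ → Word nΣ) → Set
PolyTime nΓ nΣ f = Σ (TM nΓ nΣ) λ M → Σ ℕ λ a → Σ ℕ λ d →
  ComputesWithin M f (λ n → a * n ^ d + a)

CbS : ∀ {nΓ nI nΣ} → (Word nΓ → Word nI) → (Fin nI → Word nΓ → Word nΣ) →
      Word nΓ → Word nΣ
CbS f g w = concatMap (λ i → g i w) (f w)

GrowsAtLeastPoly : ∀ {nΓ nΣ} → ℕ → (Word nΓ → Word nΣ) → Set
GrowsAtLeastPoly k f = Σ ℕ λ c → Σ ℕ λ N → (1 ≤ c) ×
  (∀ w → N ≤ length w → length w ^ k ≤ c * length (f w))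

{-# OPTIONS --safe #-}
module Submission where

-- (1) Evaluate the term on a symbolic input string, outside the !-boxes only. Variables of outermost depth are affine there,
-- so this terminates and leaves a body that does not depend on the input, in which the input occurs only as iterations of boxes,
-- nested to a fixed depth (1 for Str ⊸ Str). In a relational model with finite webs an iteration along w is a path of a finite
-- automaton reading w. Hence every value of the output in a finite monoid is recognised by an automaton, which gives regularity;
-- labelling each output letter with the input positions it comes from, one position (one tuple of positions) accounts for boundedly
-- many letters, and a finite automaton lists them in order, separated by blocks of other letters. For nesting depth 1 a two-pass
-- annotation followed by a walk between neighbouring positions outputs the word in linear time; in general the machine searches
-- for the position tuple of the next letter with an odometer, in polynomial time.
-- (2) A continuation-passing encoding of transducer configurations, iterated by the input string; affinity is copylessness.
-- (3) Apply the encoding of f(w) to the iterators of the words g i w; |w|^k is reached by substituting the identity k times.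

open import Defs
open import Data.Bool using (Bool; true; false; if_then_else_; not; _∧_; _∨_)
import Data.Bool as Bool
open import Data.Bool.Properties using (∨-zeroʳ)
open import Data.Empty using (⊥; ⊥-elim)
open import Data.Fin using (Fin; toℕ; fromℕ<; combine; remQuot) renaming (zero to fz; suc to fs)
import Data.Fin as Fin
open import Data.Fin.Properties using (remQuot-combine; any?; toℕ-injective; toℕ<n; fromℕ<-toℕ)
open import Data.List using (List; []; _∷_; _++_; map; length; foldr; foldl; concat; concatMap; upTo; cartesianProductWith; reverse; _ʳ++_; take)
import Data.List as List
open import Data.List.Membership.Propositional using (_∈_)
open import Data.List.Membership.Propositional.Properties using (∈-++⁺ˡ; ∈-++⁺ʳ; ∈-map⁺; ∈-map⁻; ∈-cartesianProductWith⁺; ∈-cartesianProductWith⁻; ∈-upTo⁺; ∈-upTo⁻; ∈-allFin)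
open import Data.List.Properties using (++-assoc; ++-identityʳ; length-++; length-map; length-reverse; map-++; map-∘; map-id; map-tabulate; foldr-++; foldl-++; unfold-reverse; reverse-involutive; ∷-injective; ≡-dec)
open import Data.List.Relation.Unary.All as All using (All; []; _∷_; all?)
open import Data.List.Relation.Unary.All.Properties using (++⁺; ++⁻ˡ; ++⁻ʳ)
open import Data.List.Relation.Unary.Any as Any using (here; there)
open import Data.List.Relation.Unary.Any.Properties using (lookup-index)
open import Data.Maybe using (Maybe; just; nothing; fromMaybe)
import Data.Maybe as Maybe
open import Data.Nat using (ℕ; zero; suc; _+_; _*_; _∸_; _^_; _≤_; _<_; z≤n; s≤s; s≤s⁻¹; _≡ᵇ_)
import Data.Nat as ℕ
open import Data.Nat.ListAction using (sum)
open import Data.Nat.Properties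
open import Data.Nat.Solver using (module +-*-Solver)
open import Data.Product using (Σ; _×_; _,_; ∃; proj₁; proj₂)
open import Data.Sum using (_⊎_; inj₁; inj₂)
open import Data.Unit using (⊤; tt)
open import Data.Vec using (Vec; []; _∷_; lookup; tabulate)
import Data.Vec as Vec
open import Data.Vec.Properties using (lookup∘tabulate)
open import Function using (_∘_; id; _∋_)
open import Function.Bundles using (_⇔_; mk⇔; Equivalence)
open import Relation.Binary.Definitions using (tri<; tri≈; tri>)
open import Relation.Binary.PropositionalEquality hiding ([_])
open import Relation.Nullary using (¬_; Dec; yes; no; does)
open import Relation.Nullary.Decidable using (_×-dec_; map′)

-- The relational model must meet two opposite demands: its webs have to be finite although the
-- quantifier is impredicative, and it has to compute the output exactly. Affinity reconciles them.
-- A token has at most as many leaves at a type variable as the type has occurrences of it outside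
-- `!`, so a token of a quantified type can be a pattern with about that many colours, and
-- naturality in the type variables (`func`) relates patterns and instances exactly (`retract`). The
-- same naturality carries linear time. Recognizability alone does not bound the number of blocks
-- around a position. But a block value that is no leaf of a token on the border between the letters
-- to the right and the rest could be doubled without changing the final value, while the run would
-- end in the second copy; so the leaves of the border tokens bound the blocks. The output is given
-- only up to `=β`; instead of confluence, a separate graph model shows that different words are not
-- `=β`. One weighted size of derivations serves as termination measure, as bound on the nesting of
-- iterations and as count of output letters.

-- Substitution calculus

infixr 5 _∷ˢ_
_∷ˢ_ : Tm → (ℕ → Tm) → ℕ → Tm
(u ∷ˢ s) zero    = u
(u ∷ˢ s) (suc n) = s n

extTm-cong : ∀ {s s'} → (∀ x → s x ≡ s' x) → ∀ x → extTm s x ≡ extTm s' x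
extTm-cong e zero    = refl
extTm-cong e (suc x) = cong (renTm suc) (e x)

subTm-cong : ∀ {s s'} → (∀ x → s x ≡ s' x) → ∀ t → subTm s t ≡ subTm s' t
subTm-cong e (var x)   = e x
subTm-cong e (lam t)   = cong lam (subTm-cong (extTm-cong e) t)
subTm-cong e (lam! t)  = cong lam! (subTm-cong (extTm-cong e) t)
subTm-cong e (app t u) = cong₂ app (subTm-cong e t) (subTm-cong e u)
subTm-cong e (bang t)  = cong bang (subTm-cong e t)

subTm-id : ∀ {s} → (∀ x → s x ≡ var x) → ∀ t → subTm s t ≡ t
subTm-id e (var x)   = e x
subTm-id e (lam t)   = cong lam (subTm-id (λ { zero → refl ; (suc x) → cong (renTm suc) (e x) }) t)
subTm-id e (lam! t)  = cong lam! (subTm-id (λ { zero → refl ; (suc x) → cong (renTm suc) (e x) }) t)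
subTm-id e (app t u) = cong₂ app (subTm-id e t) (subTm-id e u)
subTm-id e (bang t)  = cong bang (subTm-id e t)

subTm-ren : ∀ {s ρ r} → (∀ x → s (ρ x) ≡ r x) → ∀ t → subTm s (renTm ρ t) ≡ subTm r t
subTm-ren e (var x)   = e x
subTm-ren e (lam t)   = cong lam (subTm-ren (λ { zero → refl ; (suc x) → cong (renTm suc) (e x) }) t)
subTm-ren e (lam! t)  = cong lam! (subTm-ren (λ { zero → refl ; (suc x) → cong (renTm suc) (e x) }) t)
subTm-ren e (app t u) = cong₂ app (subTm-ren e t) (subTm-ren e u)
subTm-ren e (bang t)  = cong bang (subTm-ren e t)

renTm-ren : ∀ {ρ ρ' r} → (∀ x → ρ (ρ' x) ≡ r x) → ∀ t → renTm ρ (renTm ρ' t) ≡ renTm r t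
renTm-ren e (var x)   = cong var (e x)
renTm-ren e (lam t)   = cong lam (renTm-ren (λ { zero → refl ; (suc x) → cong suc (e x) }) t)
renTm-ren e (lam! t)  = cong lam! (renTm-ren (λ { zero → refl ; (suc x) → cong suc (e x) }) t)
renTm-ren e (app t u) = cong₂ app (renTm-ren e t) (renTm-ren e u)
renTm-ren e (bang t)  = cong bang (renTm-ren e t)

ren-subTm : ∀ {ρ s r} → (∀ x → renTm ρ (s x) ≡ r x) → ∀ t → renTm ρ (subTm s t) ≡ subTm r t
ren-subTm-ext : ∀ {ρ s r} → (∀ x → renTm ρ (s x) ≡ r x) → ∀ x → renTm (extR ρ) (extTm s x) ≡ extTm r x
ren-subTm-ext e zero = refl
ren-subTm-ext {ρ} {s} e (suc x) = trans (renTm-ren (λ _ → refl) (s x)) (trans (sym (renTm-ren (λ _ → refl) (s x))) (cong (renTm suc) (e x)))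
ren-subTm e (var x)   = e x
ren-subTm e (lam t)   = cong lam (ren-subTm (ren-subTm-ext e) t)
ren-subTm e (lam! t)  = cong lam! (ren-subTm (ren-subTm-ext e) t)
ren-subTm e (app t u) = cong₂ app (ren-subTm e t) (ren-subTm e u)
ren-subTm e (bang t)  = cong bang (ren-subTm e t)

sub-subTm : ∀ {s s' r} → (∀ x → subTm s (s' x) ≡ r x) → ∀ t → subTm s (subTm s' t) ≡ subTm r t
sub-subTm-ext : ∀ {s s' r} → (∀ x → subTm s (s' x) ≡ r x) → ∀ x → subTm (extTm s) (extTm s' x) ≡ extTm r x
sub-subTm-ext e zero = refl
sub-subTm-ext {s} {s'} e (suc x) = trans (subTm-ren (λ _ → refl) (s' x)) (trans (sym (ren-subTm (λ _ → refl) (s' x))) (cong (renTm suc) (e x)))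
sub-subTm e (var x)   = e x
sub-subTm e (lam t)   = cong lam (sub-subTm (sub-subTm-ext e) t)
sub-subTm e (lam! t)  = cong lam! (sub-subTm (sub-subTm-ext e) t)
sub-subTm e (app t u) = cong₂ app (sub-subTm e t) (sub-subTm e u)
sub-subTm e (bang t)  = cong bang (sub-subTm e t)

ext-inst : ∀ s t u → subTm (extTm s) t [ u ] ≡ subTm (u ∷ˢ s) t
ext-inst s t u = sub-subTm (λ { zero → refl ; (suc x) → trans (subTm-ren (λ _ → refl) (s x)) (subTm-id (λ _ → refl) (s x)) }) t

≡⇒β : ∀ {t u} → t ≡ u → t =β u
≡⇒β refl = β-refl

β-lamˢ : ∀ {s t u} → app (subTm s (lam t)) u =β subTm (u ∷ˢ s) t
β-lamˢ {s} {t} {u} = β-trans β-lam (≡⇒β (ext-inst s t u))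

β-bangˢ : ∀ {s t u} → app (subTm s (lam! t)) (bang u) =β subTm (u ∷ˢ s) t
β-bangˢ {s} {t} {u} = β-trans β-bang (≡⇒β (ext-inst s t u))

-- An Engeler-style graph model: it separates words of letters applied to a base point.

data D : Set where
  pts  : List ℕ → D
  _⇒_ : List D → D → D
  box : List D → D

infixr 6 _⇒_

DEnv : Set₁
DEnv = ℕ → D → Set

infixr 5 _∷ᵈ_
_∷ᵈ_ : (D → Set) → DEnv → DEnv
(P ∷ᵈ ρ) zero    = P
(P ∷ᵈ ρ) (suc n) = ρ n

-- A token `box l` packs a finite set of tokens, and `lam!` answers only to a single such token.
-- Every application thus uses finitely many tokens of its argument, which makes both β rules sound.
⟪_⟫ : Tm → DEnv → D → Set
⟪ var x ⟫ ρ d = ρ x d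
⟪ lam t ⟫ ρ (l ⇒ d) = ⟪ t ⟫ ((_∈ l) ∷ᵈ ρ) d
⟪ lam t ⟫ ρ _ = ⊥
⟪ lam! t ⟫ ρ ((box l ∷ []) ⇒ d) = ⟪ t ⟫ ((_∈ l) ∷ᵈ ρ) d
⟪ lam! t ⟫ ρ _ = ⊥
⟪ app t u ⟫ ρ d = Σ (List D) λ l → ⟪ t ⟫ ρ (l ⇒ d) × All (⟪ u ⟫ ρ) l
⟪ bang t ⟫ ρ (box l) = All (⟪ t ⟫ ρ) l
⟪ bang t ⟫ ρ _ = ⊥

∷ᵈ-mono : ∀ {P P' : D → Set} {ρ ρ' : DEnv} → (∀ d → P d → P' d) → (∀ x d → ρ x d → ρ' x d) → ∀ x d → (P ∷ᵈ ρ) x d → (P' ∷ᵈ ρ') x d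
∷ᵈ-mono f g zero    = f
∷ᵈ-mono f g (suc x) = g x

⟪⟫-mono : ∀ t {ρ ρ'} → (∀ x d → ρ x d → ρ' x d) → ∀ d → ⟪ t ⟫ ρ d → ⟪ t ⟫ ρ' d
⟪⟫-mono (var x) f d p = f x d p
⟪⟫-mono (lam t) f (l ⇒ d) p = ⟪⟫-mono t (∷ᵈ-mono (λ _ p → p) f) d p
⟪⟫-mono (lam! t) f ((box l ∷ []) ⇒ d) p = ⟪⟫-mono t (∷ᵈ-mono (λ _ p → p) f) d p
⟪⟫-mono (app t u) f d (l , p , q) = l , ⟪⟫-mono t f (l ⇒ d) p , All.map (λ {e} → ⟪⟫-mono u f e) q
⟪⟫-mono (bang t) f (box l) p = All.map (λ {e} → ⟪⟫-mono t f e) p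

⟪⟫-ren : ∀ t {r ρ} → ∀ d → ⟪ renTm r t ⟫ ρ d → ⟪ t ⟫ (ρ ∘ r) d
⟪⟫-ren⁻ : ∀ t {r ρ} → ∀ d → ⟪ t ⟫ (ρ ∘ r) d → ⟪ renTm r t ⟫ ρ d

⟪⟫-ren (var x) d p = p
⟪⟫-ren (lam t) (l ⇒ d) p = ⟪⟫-mono t (λ { zero e q → q ; (suc x) e q → q }) d (⟪⟫-ren t d p)
⟪⟫-ren (lam! t) ((box l ∷ []) ⇒ d) p = ⟪⟫-mono t (λ { zero e q → q ; (suc x) e q → q }) d (⟪⟫-ren t d p)
⟪⟫-ren (app t u) d (l , p , q) = l , ⟪⟫-ren t _ p , All.map (⟪⟫-ren u _) q
⟪⟫-ren (bang t) (box l) p = All.map (⟪⟫-ren t _) p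
⟪⟫-ren⁻ (var x) d p = p
⟪⟫-ren⁻ (lam t) (l ⇒ d) p = ⟪⟫-ren⁻ t d (⟪⟫-mono t (λ { zero e q → q ; (suc x) e q → q }) d p)
⟪⟫-ren⁻ (lam! t) ((box l ∷ []) ⇒ d) p = ⟪⟫-ren⁻ t d (⟪⟫-mono t (λ { zero e q → q ; (suc x) e q → q }) d p)
⟪⟫-ren⁻ (app t u) d (l , p , q) = l , ⟪⟫-ren⁻ t _ p , All.map (⟪⟫-ren⁻ u _) q
⟪⟫-ren⁻ (bang t) (box l) p = All.map (⟪⟫-ren⁻ t _) p

⟪⟫-sub : ∀ t {s ρ} d → ⟪ subTm s t ⟫ ρ d → ⟪ t ⟫ (λ x → ⟪ s x ⟫ ρ) d
⟪⟫-sub⁻ : ∀ t {s ρ} d → ⟪ t ⟫ (λ x → ⟪ s x ⟫ ρ) d → ⟪ subTm s t ⟫ ρ d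
⟪⟫-sub (var x) d p = p
⟪⟫-sub (lam t) {s} (l ⇒ d) p = ⟪⟫-mono t (λ { zero e q → q ; (suc x) e q → ⟪⟫-ren (s x) e q }) d (⟪⟫-sub t d p)
⟪⟫-sub (lam! t) {s} ((box l ∷ []) ⇒ d) p = ⟪⟫-mono t (λ { zero e q → q ; (suc x) e q → ⟪⟫-ren (s x) e q }) d (⟪⟫-sub t d p)
⟪⟫-sub (app t u) d (l , p , q) = l , ⟪⟫-sub t _ p , All.map (⟪⟫-sub u _) q
⟪⟫-sub (bang t) (box l) p = All.map (⟪⟫-sub t _) p
⟪⟫-sub⁻ (var x) d p = p
⟪⟫-sub⁻ (lam t) {s} (l ⇒ d) p = ⟪⟫-sub⁻ t d (⟪⟫-mono t (λ { zero e q → q ; (suc x) e q → ⟪⟫-ren⁻ (s x) e q }) d p)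
⟪⟫-sub⁻ (lam! t) {s} ((box l ∷ []) ⇒ d) p = ⟪⟫-sub⁻ t d (⟪⟫-mono t (λ { zero e q → q ; (suc x) e q → ⟪⟫-ren⁻ (s x) e q }) d p)
⟪⟫-sub⁻ (app t u) d (l , p , q) = l , ⟪⟫-sub⁻ t _ p , All.map (⟪⟫-sub⁻ u _) q
⟪⟫-sub⁻ (bang t) (box l) p = All.map (⟪⟫-sub⁻ t _) p

-- Continuity: only finitely many tokens of the argument at position k are used.

upd : ℕ → (D → Set) → DEnv → DEnv
upd zero    P ρ zero    = P
upd zero    P ρ (suc x) = ρ (suc x)
upd (suc k) P ρ zero    = ρ zero
upd (suc k) P ρ (suc x) = upd k P (ρ ∘ suc) x

upd-mono : ∀ k {P P' : D → Set} {ρ : DEnv} → (∀ d → P d → P' d) → ∀ x d → upd k P ρ x d → upd k P' ρ x d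
upd-mono zero    f zero    d p = f d p
upd-mono zero    f (suc x) d p = p
upd-mono (suc k) f zero    d p = p
upd-mono (suc k) f (suc x) d p = upd-mono k f x d p

upd-ext : ∀ {k P Q ρ} x d → (Q ∷ᵈ upd k P ρ) x d → upd (suc k) P (Q ∷ᵈ ρ) x d
upd-ext zero    d p = p
upd-ext (suc x) d p = p

upd-ext⁻ : ∀ {k P Q ρ} x d → upd (suc k) P (Q ∷ᵈ ρ) x d → (Q ∷ᵈ upd k P ρ) x d
upd-ext⁻ zero    d p = p
upd-ext⁻ (suc x) d p = p

Fin⊆ : (D → Set) → (List D → Set) → Set
Fin⊆ P Q = Σ (List D) λ l → All P l × Q l

cont : ∀ t k {P ρ} d → ⟪ t ⟫ (upd k P ρ) d → Fin⊆ P (λ l → ⟪ t ⟫ (upd k (_∈ l) ρ) d)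
contAll : ∀ t k {P ρ} l → All (⟪ t ⟫ (upd k P ρ)) l → Fin⊆ P (λ M → All (⟪ t ⟫ (upd k (_∈ M) ρ)) l)
cont (var x) k {P} {ρ} d p = go k x ρ p
  where
  go : ∀ k x (ρ : DEnv) → upd k P ρ x d → Fin⊆ P (λ l → upd k (_∈ l) ρ x d)
  go zero zero ρ p = (d ∷ []) , (p ∷ []) , here refl
  go zero (suc x) ρ p = [] , [] , p
  go (suc k) zero ρ p = [] , [] , p
  go (suc k) (suc x) ρ p = go k x (ρ ∘ suc) p
cont (lam t) k (l ⇒ d) p with cont t (suc k) d (⟪⟫-mono t upd-ext d p)
... | M , a , q = M , a , ⟪⟫-mono t upd-ext⁻ d q
cont (lam! t) k ((box l ∷ []) ⇒ d) p with cont t (suc k) d (⟪⟫-mono t upd-ext d p)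
... | M , a , q = M , a , ⟪⟫-mono t upd-ext⁻ d q
cont (app t u) k d (l , p , q) with cont t k (l ⇒ d) p | contAll u k l q
... | M , a , p' | N , b , q' = M ++ N , ++⁺ a b , l ,
   ⟪⟫-mono t (upd-mono k λ _ → ∈-++⁺ˡ) _ p' , All.map (λ {e} → ⟪⟫-mono u (upd-mono k λ _ → ∈-++⁺ʳ M) e) q'
cont (bang t) k (box l) p = contAll t k l p
contAll t k [] [] = [] , [] , []
contAll t k (d ∷ l) (p ∷ ps) with cont t k d p | contAll t k l ps
... | M , a , p' | N , b , q' = M ++ N , ++⁺ a b ,
   ⟪⟫-mono t (upd-mono k λ _ → ∈-++⁺ˡ) _ p' ∷ All.map (λ {e} → ⟪⟫-mono t (upd-mono k λ _ → ∈-++⁺ʳ M) e) q'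

⟪⟫-inst : ∀ t u {ρ} d → ⟪ t [ u ] ⟫ ρ d → Fin⊆ (⟪ u ⟫ ρ) (λ l → ⟪ t ⟫ ((_∈ l) ∷ᵈ ρ) d)
⟪⟫-inst t u {ρ} d p with cont t 0 {⟪ u ⟫ ρ} {(λ _ → ⊥) ∷ᵈ ρ} d
     (⟪⟫-mono t (λ { zero e q → q ; (suc x) e q → q }) d (⟪⟫-sub t d p))
... | l , a , q = l , a , ⟪⟫-mono t (λ { zero e q → q ; (suc x) e q → q }) d q

⟪⟫-inst⁻ : ∀ t u {ρ} d → Fin⊆ (⟪ u ⟫ ρ) (λ l → ⟪ t ⟫ ((_∈ l) ∷ᵈ ρ) d) → ⟪ t [ u ] ⟫ ρ d
⟪⟫-inst⁻ t u d (l , a , p) = ⟪⟫-sub⁻ t d (⟪⟫-mono t (λ { zero e q → All.lookup a q ; (suc x) e q → q }) d p)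

⟪⟫-sound  : ∀ {t u} → t =β u → ∀ ρ d → ⟪ t ⟫ ρ d → ⟪ u ⟫ ρ d
⟪⟫-sound⁻ : ∀ {t u} → t =β u → ∀ ρ d → ⟪ u ⟫ ρ d → ⟪ t ⟫ ρ d
⟪⟫-sound (β-lam {t} {u}) ρ d (l , p , q) = ⟪⟫-inst⁻ t u d (l , q , p)
⟪⟫-sound (β-bang {t} {u}) ρ d ((box l ∷ []) , p , (q ∷ [])) = ⟪⟫-inst⁻ t u d (l , q , p)
⟪⟫-sound (β-bang {t} {u}) ρ d ([] , () , _)
⟪⟫-sound (β-bang {t} {u}) ρ d ((pts _ ∷ []) , () , _)
⟪⟫-sound (β-bang {t} {u}) ρ d (((_ ⇒ _) ∷ []) , () , _)
⟪⟫-sound (β-bang {t} {u}) ρ d ((pts _ ∷ _ ∷ _) , () , _)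
⟪⟫-sound (β-bang {t} {u}) ρ d (((_ ⇒ _) ∷ _ ∷ _) , () , _)
⟪⟫-sound (β-bang {t} {u}) ρ d ((box _ ∷ _ ∷ _) , () , _)
⟪⟫-sound β-refl ρ d p = p
⟪⟫-sound (β-sym e) ρ d p = ⟪⟫-sound⁻ e ρ d p
⟪⟫-sound (β-trans e f) ρ d p = ⟪⟫-sound f ρ d (⟪⟫-sound e ρ d p)
⟪⟫-sound (β-lamc e) ρ (l ⇒ d) p = ⟪⟫-sound e _ d p
⟪⟫-sound (β-lam!c e) ρ ((box l ∷ []) ⇒ d) p = ⟪⟫-sound e _ d p
⟪⟫-sound (β-appc e f) ρ d (l , p , q) = l , ⟪⟫-sound e ρ _ p , All.map (λ {x} → ⟪⟫-sound f ρ x) q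
⟪⟫-sound (β-bangc e) ρ (box l) p = All.map (λ {x} → ⟪⟫-sound e ρ x) p
⟪⟫-sound⁻ (β-lam {t} {u}) ρ d p with ⟪⟫-inst t u d p
... | l , q , p' = l , p' , q
⟪⟫-sound⁻ (β-bang {t} {u}) ρ d p with ⟪⟫-inst t u d p
... | l , q , p' = (box l ∷ []) , p' , (q ∷ [])
⟪⟫-sound⁻ β-refl ρ d p = p
⟪⟫-sound⁻ (β-sym e) ρ d p = ⟪⟫-sound e ρ d p
⟪⟫-sound⁻ (β-trans e f) ρ d p = ⟪⟫-sound⁻ e ρ d (⟪⟫-sound⁻ f ρ d p)
⟪⟫-sound⁻ (β-lamc e) ρ (l ⇒ d) p = ⟪⟫-sound⁻ e _ d p
⟪⟫-sound⁻ (β-lam!c e) ρ ((box l ∷ []) ⇒ d) p = ⟪⟫-sound⁻ e _ d p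
⟪⟫-sound⁻ (β-appc e f) ρ d (l , p , q) = l , ⟪⟫-sound⁻ e ρ _ p , All.map (λ {x} → ⟪⟫-sound⁻ f ρ x) q
⟪⟫-sound⁻ (β-bangc e) ρ (box l) p = All.map (λ {x} → ⟪⟫-sound⁻ e ρ x) p

-- The variable 0 is a base point and the variable suc j the letter j.

chain : List ℕ → Tm
chain []      = var 0
chain (j ∷ u) = app (var (suc j)) (chain u)

letterEnv : DEnv
letterEnv zero    d = d ≡ pts []
letterEnv (suc j) d = Σ (List ℕ) λ v → d ≡ ((pts v ∷ []) ⇒ pts (j ∷ v))

chain-in : ∀ u → ⟪ chain u ⟫ letterEnv (pts u)
chain-in []      = refl
chain-in (j ∷ u) = (pts u ∷ []) , (u , refl) , (chain-in u ∷ [])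

chain-out : ∀ u {d} → ⟪ chain u ⟫ letterEnv d → d ≡ pts u
chain-out [] p = p
chain-out (j ∷ u) (_ , (v , refl) , (q ∷ [])) with chain-out u q
... | refl = refl

-- Stands in for confluence: tokens are invariant under `=β`, and in `letterEnv` the chain of a word
-- has exactly one token, which spells the word.
chain-inj : ∀ {u v} → chain u =β chain v → u ≡ v
chain-inj {u} {v} e with chain-out v (⟪⟫-sound e letterEnv _ (chain-in u))
... | refl = refl

-- Type substitution

TSub : Set
TSub = ℕ → LTy

infixr 5 _∷ᵗ_
_∷ᵗ_ : LTy → TSub → TSub
(A ∷ᵗ η) zero    = A
(A ∷ᵗ η) (suc n) = η n

subL-id : ∀ {s} → (∀ x → s x ≡ tv x) → ∀ A → subL s A ≡ A
subS-id : ∀ {s} → (∀ x → s x ≡ tv x) → ∀ U → subS s U ≡ U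
subT-id : ∀ {s} → (∀ x → s x ≡ tv x) → ∀ σ → subT s σ ≡ σ
subL-id e (tv x) = e x
subL-id e (st U) = cong st (subS-id e U)
subS-id e (σ ⊸ τ) = cong₂ _⊸_ (subT-id e σ) (subT-id e τ)
subS-id e (∀' U) = cong ∀' (subS-id (λ { zero → refl ; (suc x) → cong (renL suc) (e x) }) U)
subT-id e (lin A) = cong lin (subL-id e A)
subT-id e (! σ) = cong !_ (subT-id e σ)

subL-ren : ∀ {s ρ r} → (∀ x → s (ρ x) ≡ r x) → ∀ A → subL s (renL ρ A) ≡ subL r A
subS-ren : ∀ {s ρ r} → (∀ x → s (ρ x) ≡ r x) → ∀ U → subS s (renS ρ U) ≡ subS r U
subT-ren : ∀ {s ρ r} → (∀ x → s (ρ x) ≡ r x) → ∀ σ → subT s (renT ρ σ) ≡ subT r σ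
subL-ren e (tv x) = e x
subL-ren e (st U) = cong st (subS-ren e U)
subS-ren e (σ ⊸ τ) = cong₂ _⊸_ (subT-ren e σ) (subT-ren e τ)
subS-ren e (∀' U) = cong ∀' (subS-ren (λ { zero → refl ; (suc x) → cong (renL suc) (e x) }) U)
subT-ren e (lin A) = cong lin (subL-ren e A)
subT-ren e (! σ) = cong !_ (subT-ren e σ)

renL-ren : ∀ {ρ ρ' r} → (∀ x → ρ (ρ' x) ≡ r x) → ∀ A → renL ρ (renL ρ' A) ≡ renL r A
renS-ren : ∀ {ρ ρ' r} → (∀ x → ρ (ρ' x) ≡ r x) → ∀ U → renS ρ (renS ρ' U) ≡ renS r U
renT-ren : ∀ {ρ ρ' r} → (∀ x → ρ (ρ' x) ≡ r x) → ∀ σ → renT ρ (renT ρ' σ) ≡ renT r σ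
renL-ren e (tv x) = cong tv (e x)
renL-ren e (st U) = cong st (renS-ren e U)
renS-ren e (σ ⊸ τ) = cong₂ _⊸_ (renT-ren e σ) (renT-ren e τ)
renS-ren e (∀' U) = cong ∀' (renS-ren (λ { zero → refl ; (suc x) → cong suc (e x) }) U)
renT-ren e (lin A) = cong lin (renL-ren e A)
renT-ren e (! σ) = cong !_ (renT-ren e σ)

ren-subL : ∀ {ρ s r} → (∀ x → renL ρ (s x) ≡ r x) → ∀ A → renL ρ (subL s A) ≡ subL r A
ren-subS : ∀ {ρ s r} → (∀ x → renL ρ (s x) ≡ r x) → ∀ U → renS ρ (subS s U) ≡ subS r U
ren-subT : ∀ {ρ s r} → (∀ x → renL ρ (s x) ≡ r x) → ∀ σ → renT ρ (subT s σ) ≡ subT r σ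
ren-sub-ext : ∀ {ρ s r} → (∀ x → renL ρ (s x) ≡ r x) → ∀ x → renL (extR ρ) (extS s x) ≡ extS r x
ren-sub-ext e zero = refl
ren-sub-ext {ρ} {s} e (suc x) = trans (renL-ren (λ _ → refl) (s x)) (trans (sym (renL-ren (λ _ → refl) (s x))) (cong (renL suc) (e x)))
ren-subL e (tv x) = e x
ren-subL e (st U) = cong st (ren-subS e U)
ren-subS e (σ ⊸ τ) = cong₂ _⊸_ (ren-subT e σ) (ren-subT e τ)
ren-subS e (∀' U) = cong ∀' (ren-subS (ren-sub-ext e) U)
ren-subT e (lin A) = cong lin (ren-subL e A)
ren-subT e (! σ) = cong !_ (ren-subT e σ)

sub-subL : ∀ {s s' r} → (∀ x → subL s (s' x) ≡ r x) → ∀ A → subL s (subL s' A) ≡ subL r A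
sub-subS : ∀ {s s' r} → (∀ x → subL s (s' x) ≡ r x) → ∀ U → subS s (subS s' U) ≡ subS r U
sub-subT : ∀ {s s' r} → (∀ x → subL s (s' x) ≡ r x) → ∀ σ → subT s (subT s' σ) ≡ subT r σ
sub-sub-ext : ∀ {s s' r} → (∀ x → subL s (s' x) ≡ r x) → ∀ x → subL (extS s) (extS s' x) ≡ extS r x
sub-sub-ext e zero = refl
sub-sub-ext {s} {s'} e (suc x) = trans (subL-ren (λ _ → refl) (s' x)) (trans (sym (ren-subL (λ _ → refl) (s' x))) (cong (renL suc) (e x)))
sub-subL e (tv x) = e x
sub-subL e (st U) = cong st (sub-subS e U)
sub-subS e (σ ⊸ τ) = cong₂ _⊸_ (sub-subT e σ) (sub-subT e τ)
sub-subS e (∀' U) = cong ∀' (sub-subS (sub-sub-ext e) U)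
sub-subT e (lin A) = cong lin (sub-subL e A)
sub-subT e (! σ) = cong !_ (sub-subT e σ)

inst-ext : ∀ η A U → subS (A ∷ᵗ η) U ≡ instS (subS (extS η) U) A
inst-ext η A U = sym (sub-subS (λ { zero → refl ; (suc x) → trans (subL-ren (λ _ → refl) (η x)) (subL-id (λ _ → refl) (η x)) }) U)

sub-inst : ∀ η A U → subS η (instS U A) ≡ instS (subS (extS η) U) (subL η A)
sub-inst η A U = trans (sub-subS {r = subL η A ∷ᵗ η} (λ { zero → refl ; (suc x) → refl }) U) (inst-ext η (subL η A) U)

subL-shift : ∀ η B A → subL (B ∷ᵗ η) (renL suc A) ≡ subL η A
subL-shift η B A = subL-ren (λ _ → refl) A

subT-shift : ∀ η B σ → subT (B ∷ᵗ η) (renT suc σ) ≡ subT η σ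
subT-shift η B σ = subT-ren (λ _ → refl) σ

Live : Slot → Set
Live none = ⊥
Live _    = ⊤

live-eq : ∀ {s s'} → s ≡ s' → Live s' → Live s
live-eq refl l = l

live-l : ∀ {s s₁ s₂} → SplitSlot s s₁ s₂ → Live s₁ → Live s
live-l sp-Γl _ = tt
live-l sp-Δ _ = tt
live-l sp-Θ _ = tt

live-r : ∀ {s s₁ s₂} → SplitSlot s s₁ s₂ → Live s₂ → Live s
live-r sp-Γr _ = tt
live-r sp-Δ _ = tt
live-r sp-Θ _ = tt

live-sh : ∀ s → Live (shiftSlot s) → Live s
live-sh (inΓ _) _ = tt
live-sh (inΔ _) _ = tt
live-sh (inΘ _) _ = tt

live-pr : ∀ {s₀ s} → PromSlot s₀ s → Live s₀ → Live s
live-pr pr-Θ _ = tt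

agree-ext : ∀ {C : Ctx} {a s s'} → (∀ x → Live (C x) → s x ≡ s' x) → ∀ x → Live ((a ∷ᶜ C) x) → extTm s x ≡ extTm s' x
agree-ext e zero    _ = refl
agree-ext e (suc x) l = cong (renTm suc) (e x l)

-- A typable term mentions live variables only. So the filler `var 0` that a readback assigns to
-- empty slots never shows up, and an environment may be split, shifted or promoted without changing
-- the term read back.
agree : ∀ {C t σ} → C ⊢ t ∶ σ → ∀ {s s'} → (∀ x → Live (C x) → s x ≡ s' x) → subTm s t ≡ subTm s' t
agree (ax-Γ e) f = f _ (live-eq e tt)
agree (ax-Θ e) f = f _ (live-eq e tt)
agree (⊸I d) f = cong lam (agree d (agree-ext f))
agree (⊸I! d) f = cong lam! (agree d (agree-ext f))
agree (⊸E p d d') f = cong₂ app (agree d λ x l → f x (live-l (p x) l)) (agree d' λ x l → f x (live-r (p x) l))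
agree (∀I {C} d) f = agree d (λ x l → f x (live-sh (C x) l))
agree (∀E A d) f = agree d f
agree (!I p d) f = cong bang (agree d (λ x l → f x (live-pr (p x) l)))

-- Sizes of derivations with a cost c per rule and a cost e x per use of the variable x.

infixr 5 _∷ⁿ_
_∷ⁿ_ : ℕ → (ℕ → ℕ) → ℕ → ℕ
(m ∷ⁿ e) zero    = m
(m ∷ⁿ e) (suc x) = e x

szD : ℕ → ∀ {C t σ} → C ⊢ t ∶ σ → (ℕ → ℕ) → ℕ
szD c (ax-Γ {x = x} _) e = c + e x
szD c (ax-Θ {x = x} _) e = c + e x
szD c (⊸I d) e = c + szD c d (0 ∷ⁿ e)
szD c (⊸I! d) e = c + szD c d (0 ∷ⁿ e)
szD c (⊸E _ d d') e = c + (szD c d e + szD c d' e)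
szD c (∀I d) e = c + szD c d e
szD c (∀E _ d) e = c + szD c d e
-- A box is opaque to the measure, since its content is not evaluated at this depth.
szD c (!I _ d) e = c

∷ⁿ-mono : ∀ {m e e'} → (∀ x → e x ≤ e' x) → ∀ x → (m ∷ⁿ e) x ≤ (m ∷ⁿ e') x
∷ⁿ-mono f zero    = ≤-refl
∷ⁿ-mono f (suc x) = f x

szD-mono : ∀ c {C t σ} (d : C ⊢ t ∶ σ) {e e'} → (∀ x → e x ≤ e' x) → szD c d e ≤ szD c d e'
szD-mono c (ax-Γ {x = x} _) f = +-monoʳ-≤ c (f x)
szD-mono c (ax-Θ {x = x} _) f = +-monoʳ-≤ c (f x)
szD-mono c (⊸I d) f = +-monoʳ-≤ c (szD-mono c d (∷ⁿ-mono f))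
szD-mono c (⊸I! d) f = +-monoʳ-≤ c (szD-mono c d (∷ⁿ-mono f))
szD-mono c (⊸E _ d d') f = +-monoʳ-≤ c (+-mono-≤ (szD-mono c d f) (szD-mono c d' f))
szD-mono c (∀I d) f = +-monoʳ-≤ c (szD-mono c d f)
szD-mono c (∀E _ d) f = +-monoʳ-≤ c (szD-mono c d f)
szD-mono c (!I _ d) f = ≤-refl

addAt : ℕ → ℕ → (ℕ → ℕ) → ℕ → ℕ
addAt zero    m e zero    = m + e zero
addAt zero    m e (suc x) = e (suc x)
addAt (suc k) m e zero    = e zero
addAt (suc k) m e (suc x) = addAt k m (e ∘ suc) x

addAt-cases : ∀ k m e x → (x ≡ k × addAt k m e x ≡ m + e x) ⊎ addAt k m e x ≡ e x
addAt-cases zero    m e zero    = inj₁ (refl , refl)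
addAt-cases zero    m e (suc x) = inj₂ refl
addAt-cases (suc k) m e zero    = inj₂ refl
addAt-cases (suc k) m e (suc x) with addAt-cases k m (e ∘ suc) x
... | inj₁ (refl , p) = inj₁ (refl , p)
... | inj₂ p = inj₂ p

addAt-∷ : ∀ k m {a} e x → (a ∷ⁿ addAt k m e) x ≤ addAt (suc k) m (a ∷ⁿ e) x
addAt-∷ k m e zero    = ≤-refl
addAt-∷ k m e (suc x) = ≤-refl

data NonΘ : Slot → Set where
  isΔ : ∀ {σ} → NonΘ (inΔ σ)
  isN : NonΘ none

data IsΓ : Slot → Set where
  isΓ : ∀ {A} → IsΓ (inΓ A)

nonΘ-sh : ∀ {s} → NonΘ s → NonΘ (shiftSlot s)
nonΘ-sh isΔ = isΔ
nonΘ-sh isN = isN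

isΓ-sh : ∀ {s} → IsΓ s → IsΓ (shiftSlot s)
isΓ-sh isΓ = isΓ

nonΘ-sp : ∀ {s s₁ s₂} → SplitSlot s s₁ s₂ → NonΘ s → NonΘ s₁ × NonΘ s₂
nonΘ-sp sp-none isN = isN , isN
nonΘ-sp sp-Δ isΔ = isΔ , isΔ

isΓ-sp : ∀ {s s₁ s₂} → SplitSlot s s₁ s₂ → IsΓ s → (IsΓ s₁ × NonΘ s₂) ⊎ (NonΘ s₁ × IsΓ s₂)
isΓ-sp sp-Γl isΓ = inj₁ (isΓ , isN)
isΓ-sp sp-Γr isΓ = inj₂ (isN , isΓ)

nonΘ≢ : ∀ {s A} {B : Set} → NonΘ s → s ≡ inΓ A → B
nonΘ≢ isΔ ()
nonΘ≢ isN ()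

nonΘ≢' : ∀ {s σ} {B : Set} → NonΘ s → s ≡ inΘ σ → B
nonΘ≢' isΔ ()
nonΘ≢' isN ()

isΓ≢' : ∀ {s σ} {B : Set} → IsΓ s → s ≡ inΘ σ → B
isΓ≢' isΓ ()

-- A variable of Δ is reached by no axiom, only through a promotion, and promotions are not
-- inspected.
szD-unused : ∀ c {C t σ} (d : C ⊢ t ∶ σ) k m e → NonΘ (C k) → szD c d (addAt k m e) ≤ szD c d e
szD-unused c (ax-Γ {x = x} p) k m e n with addAt-cases k m e x
... | inj₁ (refl , _) = nonΘ≢ n p
... | inj₂ q = +-monoʳ-≤ c (≤-reflexive q)
szD-unused c (ax-Θ {x = x} p) k m e n with addAt-cases k m e x
... | inj₁ (refl , _) = nonΘ≢' n p
... | inj₂ q = +-monoʳ-≤ c (≤-reflexive q)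
szD-unused c (⊸I d) k m e n = +-monoʳ-≤ c (≤-trans (szD-mono c d (addAt-∷ k m e)) (szD-unused c d (suc k) m (0 ∷ⁿ e) n))
szD-unused c (⊸I! d) k m e n = +-monoʳ-≤ c (≤-trans (szD-mono c d (addAt-∷ k m e)) (szD-unused c d (suc k) m (0 ∷ⁿ e) n))
szD-unused c (⊸E p d d') k m e n = +-monoʳ-≤ c (+-mono-≤ (szD-unused c d k m e (proj₁ (nonΘ-sp (p k) n))) (szD-unused c d' k m e (proj₂ (nonΘ-sp (p k) n))))
szD-unused c (∀I d) k m e n = +-monoʳ-≤ c (szD-unused c d k m e (nonΘ-sh n))
szD-unused c (∀E _ d) k m e n = +-monoʳ-≤ c (szD-unused c d k m e n)
szD-unused c (!I _ d) k m e n = ≤-refl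

+-push : ∀ c m {a b} → a ≤ m + b → c + a ≤ m + (c + b)
+-push c m {a} {b} p = ≤-trans (+-monoʳ-≤ c p) (≤-reflexive (trans (sym (+-assoc c m b)) (trans (cong (_+ b) (+-comm c m)) (+-assoc m c b))))

-- `Split` hands a variable of Γ to one premise only, so at most one axiom pays the extra cost. This
-- is the one place where affinity of terms turns into arithmetic; all bounds on machine steps go
-- back to it.
szD-affine : ∀ c {C t σ} (d : C ⊢ t ∶ σ) k m e → IsΓ (C k) → szD c d (addAt k m e) ≤ m + szD c d e
szD-affine c (ax-Γ {x = x} p) k m e g with addAt-cases k m e x
... | inj₁ (refl , q) = +-push c m (≤-reflexive q)
... | inj₂ q = +-push c m (≤-trans (≤-reflexive q) (m≤n+m _ m))
szD-affine c (ax-Θ {x = x} p) k m e g with addAt-cases k m e x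
... | inj₁ (refl , _) = isΓ≢' g p
... | inj₂ q = +-push c m (≤-trans (≤-reflexive q) (m≤n+m _ m))
szD-affine c (⊸I d) k m e g = +-push c m (≤-trans (szD-mono c d (addAt-∷ k m e)) (szD-affine c d (suc k) m (0 ∷ⁿ e) g))
szD-affine c (⊸I! d) k m e g = +-push c m (≤-trans (szD-mono c d (addAt-∷ k m e)) (szD-affine c d (suc k) m (0 ∷ⁿ e) g))
szD-affine c (⊸E p d d') k m e g with isΓ-sp (p k) g
... | inj₁ (g₁ , n₂) = +-push c m (≤-trans (+-mono-≤ (szD-affine c d k m e g₁) (szD-unused c d' k m e n₂)) (≤-reflexive (+-assoc m _ _)))
... | inj₂ (n₁ , g₂) = +-push c m (≤-trans (+-mono-≤ (szD-unused c d k m e n₁) (szD-affine c d' k m e g₂)) (+-push (szD c d e) m ≤-refl))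
szD-affine c (∀I d) k m e g = +-push c m (szD-affine c d k m e (isΓ-sh g))
szD-affine c (∀E _ d) k m e g = +-push c m (szD-affine c d k m e g)
szD-affine c (!I _ d) k m e g = m≤n+m c m

szD-β : ∀ c {C A t σ} (d : (inΓ A ∷ᶜ C) ⊢ t ∶ σ) m e → szD c d (m ∷ⁿ e) ≤ m + szD c d (0 ∷ⁿ e)
szD-β c d m e = ≤-trans (szD-mono c d (λ { zero → ≤-reflexive (sym (+-identityʳ m)) ; (suc x) → ≤-refl })) (szD-affine c d 0 m (0 ∷ⁿ e) isΓ)

_⊸ᴸ_ : LTy → LTy → Ty
A ⊸ᴸ B = lin (st (lin A ⊸ lin B))

itBody : ∀ {m} → (Fin m → Tm) → Word m → Tm
itBody ds []      = var 0
itBody ds (c ∷ w) = app (renTm suc (ds c)) (itBody ds w)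

itTm : ∀ {m} → (Fin m → Tm) → Word m → Tm
itTm ds w = lam (itBody ds w)

applyBangs : ∀ k → Tm → (Fin (suc k) → Tm) → Tm
applyBangs zero    u ds = app u (bang (ds fz))
applyBangs (suc k) u ds = applyBangs k (app u (bang (ds fz))) (ds ∘ fs)

-- Boxes, closures and the environment machine

module Boxes (n : ℕ) where

  -- S₀ stands for the input string, F₀ a for the output letter a and X₀ for the base point.
  data Prim (s f : Set) : Ty → Set where
    S₀ : s → Prim s f (StrT n)
    F₀ : f → Prim s f endo
    X₀ : Prim s f (lin (tv 0))

  -- Contents of !-boxes.  it A ds is the input string with its letters interpreted at A by ds.
  data Box (s f i : Set) : Ty → Set
  data ThE (s f i : Set) (η : TSub) : Slot → Set
  data Box s f i where
    bx : ∀ {C t σ τ} → C ⊢ t ∶ σ → (η : TSub) → τ ≡ subT η σ → (∀ x → ThE s f i η (C x)) → Box s f i τ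
    pr : ∀ {τ} → Prim s f τ → Box s f i τ
    it : i → (A : LTy) → (Fin (suc n) → Box s f i (A ⊸ᴸ A)) → Box s f i (A ⊸ᴸ A)
  data ThE s f i η where
    t∅ : ThE s f i η none
    th : ∀ {τ σ} → Box s f i τ → τ ≡ subT η σ → ThE s f i η (inΘ σ)

  module Readback {s f : Set} (φ : f → Tm) (w : Word (suc n)) where
    rbPr : ∀ {τ} → Prim s f τ → Tm
    rbPr (S₀ _) = enc n w
    rbPr (F₀ a) = φ a
    rbPr X₀     = var 0

    rbBox : ∀ {i τ} → Box s f i τ → Tm
    rbTh : ∀ {i η a} → ThE s f i η a → Tm
    rbBox (bx {t = t} _ _ _ env) = subTm (λ x → rbTh (env x)) t
    rbBox (pr p) = rbPr p
    rbBox (it _ _ ds) = itTm (λ c → rbBox (ds c)) w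
    rbTh t∅ = var 0
    rbTh (th B _) = rbBox B

  -- The nesting depth of iterations is given by a bound and not computed, because environments are
  -- functions on all variables and have no maximum to take.
  Lvl : ∀ {s f i τ} → ℕ → Box s f i τ → Set
  LvlTh : ∀ {s f i η a} → ℕ → ThE s f i η a → Set
  Lvl ℓ (bx _ _ _ env) = ∀ x → LvlTh ℓ (env x)
  Lvl ℓ (pr _) = ⊤
  Lvl ℓ (it _ _ ds) = Σ ℕ λ k → suc k ≤ ℓ × (∀ c → Lvl k (ds c))
  LvlTh ℓ t∅ = ⊤
  LvlTh ℓ (th B _) = Lvl ℓ B

  Lvl-mono : ∀ {s f i τ k ℓ} (B : Box s f i τ) → k ≤ ℓ → Lvl k B → Lvl ℓ B
  LvlTh-mono : ∀ {s f i η a k ℓ} (B : ThE s f i η a) → k ≤ ℓ → LvlTh k B → LvlTh ℓ B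
  Lvl-mono (bx _ _ _ env) p l x = LvlTh-mono (env x) p (l x)
  Lvl-mono (pr _) p l = tt
  Lvl-mono (it _ _ ds) p (j , q , l) = j , ≤-trans q p , l
  LvlTh-mono t∅ p l = tt
  LvlTh-mono (th B _) p l = Lvl-mono B p l

  -- Closures.  Boxes of the first kind may come to the head of the machine, those of the second kind are only passed around.
  module Closures {s₁ f₁ s₂ f₂ i₂ : Set} where
    Box₁ Box₂ : Ty → Set
    Box₁ = Box s₁ f₁ ⊥
    Box₂ = Box s₂ f₂ i₂

    data Clo : Ty → Set
    data Ent (η : TSub) : Slot → Set
    data Clo where
      clo : ∀ {C t σ τ} → C ⊢ t ∶ σ → (η : TSub) → τ ≡ subT η σ → (∀ x → Ent η (C x)) → Clo τ
      vbox : ∀ {σ} → Box₂ σ → Clo (! σ)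
    data Ent η where
      e∅ : Ent η none
      eΓ : ∀ {τ A} → Clo τ → τ ≡ lin (subL η A) → Ent η (inΓ A)
      eΔ : ∀ {τ σ} → Box₂ τ → τ ≡ subT η σ → Ent η (inΔ σ)
      eΘ : ∀ {τ σ} → Box₁ τ → τ ≡ subT η σ → Ent η (inΘ σ)

    -- The pending arguments and type instantiations of the head. The second index is the type in
    -- which the whole computation ends; it decides which heads are possible.
    data Stk : Ty → Ty → Set where
      nil  : ∀ {τ} → Stk τ τ
      arg  : ∀ {σ τ ρ} → Clo σ → Stk τ ρ → Stk (lin (st (σ ⊸ τ))) ρ
      tyap : ∀ {U V ρ} (A : LTy) → V ≡ instS U A → Stk (lin (st V)) ρ → Stk (lin (st (∀' U))) ρ

    Env : TSub → Ctx → Set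
    Env η C = ∀ x → Ent η (C x)

    infixr 5 _∷ᵉ_
    _∷ᵉ_ : ∀ {η a C} → Ent η a → Env η C → Env η (a ∷ᶜ C)
    (e ∷ᵉ env) zero    = e
    (e ∷ᵉ env) (suc x) = env x

    getΓ : ∀ {η a A} → Ent η a → a ≡ inΓ A → Σ Ty λ τ → Clo τ × τ ≡ lin (subL η A)
    getΓ (eΓ c e) refl = _ , c , e

    getΘ : ∀ {η a σ} → Ent η a → a ≡ inΘ σ → Σ Ty λ τ → Box₁ τ × τ ≡ subT η σ
    getΘ (eΘ c e) refl = _ , c , e

    splitL : ∀ {η a a₁ a₂} → SplitSlot a a₁ a₂ → Ent η a → Ent η a₁
    splitL sp-none e = e
    splitL sp-Γl e = e
    splitL sp-Γr e = e∅
    splitL sp-Δ e = e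
    splitL sp-Θ e = e

    splitR : ∀ {η a a₁ a₂} → SplitSlot a a₁ a₂ → Ent η a → Ent η a₂
    splitR sp-none e = e
    splitR sp-Γl e = e∅
    splitR sp-Γr e = e
    splitR sp-Δ e = e
    splitR sp-Θ e = e

    shiftE : ∀ {η a} B → Ent η a → Ent (B ∷ᵗ η) (shiftSlot a)
    shiftE B e∅ = e∅
    shiftE {η} B (eΓ {A = A} c e) = eΓ c (trans e (cong lin (sym (subL-shift η B A))))
    shiftE {η} B (eΔ {σ = σ} c e) = eΔ c (trans e (sym (subT-shift η B σ)))
    shiftE {η} B (eΘ {σ = σ} c e) = eΘ c (trans e (sym (subT-shift η B σ)))

    promE : ∀ {η a₀ a} → PromSlot a₀ a → Ent η a → ThE s₂ f₂ i₂ η a₀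
    promE pr-none e = t∅
    promE pr-Θ (eΔ c e) = th c e

    thE : ∀ {η a} → ThE s₁ f₁ ⊥ η a → Ent η a
    thE t∅ = e∅
    thE (th c e) = eΘ c e

    -- With cost 1 for a rule this is the termination measure; with cost 0 it counts the input
    -- strings outside boxes (`Ct`) or weighs the letters (`Wt`). The step lemmas say once and for
    -- all that a machine step never increases the size and that the cost of the rule is released.
    module Sizes (c wS : ℕ) (wF : f₁ → ℕ) where
      szPr : ∀ {τ} → Prim s₁ f₁ τ → ℕ
      szPr (S₀ _) = wS
      szPr (F₀ a) = wF a
      szPr X₀ = 0

      szBox : ∀ {τ} → Box₁ τ → ℕ
      szTh : ∀ {η a} → ThE s₁ f₁ ⊥ η a → ℕ
      szBox (bx d _ _ env) = szD c d (λ x → szTh (env x))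
      szBox (pr p) = szPr p
      szTh t∅ = 0
      szTh (th B _) = szBox B

      szClo : ∀ {τ} → Clo τ → ℕ
      szEnt : ∀ {η a} → Ent η a → ℕ
      szClo (clo d _ _ env) = szD c d (λ x → szEnt (env x))
      szClo (vbox _) = 0
      szEnt e∅ = 0
      szEnt (eΓ k _) = szClo k
      szEnt (eΔ _ _) = 0
      szEnt (eΘ B _) = szBox B

      szStk : ∀ {τ ρ} → Stk τ ρ → ℕ
      szStk nil = 0
      szStk (arg k s) = szClo k + szStk s
      szStk (tyap _ _ s) = szStk s

      szSt : ∀ {C t σ η τ ρ} → C ⊢ t ∶ σ → Env η C → Stk τ ρ → ℕ
      szSt d env s = szD c d (λ x → szEnt (env x)) + szStk s

      szEnv : ∀ {η C} → Env η C → ℕ → ℕ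
      szEnv env x = szEnt (env x)

      sz-getΓ : ∀ {η a A} (E : Ent η a) (q : a ≡ inΓ A) → szClo (proj₁ (proj₂ (getΓ E q))) ≡ szEnt E
      sz-getΓ (eΓ k _) refl = refl

      sz-getΘ : ∀ {η a σ} (E : Ent η a) (q : a ≡ inΘ σ) → szBox (proj₁ (proj₂ (getΘ E q))) ≡ szEnt E
      sz-getΘ (eΘ k _) refl = refl

      sz-splitL : ∀ {η a a₁ a₂} (p : SplitSlot a a₁ a₂) (E : Ent η a) → szEnt (splitL p E) ≤ szEnt E
      sz-splitL sp-none e = ≤-refl
      sz-splitL sp-Γl e = ≤-refl
      sz-splitL sp-Γr e = z≤n
      sz-splitL sp-Δ e = ≤-refl
      sz-splitL sp-Θ e = ≤-refl

      sz-splitR : ∀ {η a a₁ a₂} (p : SplitSlot a a₁ a₂) (E : Ent η a) → szEnt (splitR p E) ≤ szEnt E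
      sz-splitR sp-none e = ≤-refl
      sz-splitR sp-Γl e = z≤n
      sz-splitR sp-Γr e = ≤-refl
      sz-splitR sp-Δ e = ≤-refl
      sz-splitR sp-Θ e = ≤-refl

      sz-shiftE : ∀ {η a} B (E : Ent η a) → szEnt (shiftE B E) ≡ szEnt E
      sz-shiftE B e∅ = refl
      sz-shiftE B (eΓ _ _) = refl
      sz-shiftE B (eΔ _ _) = refl
      sz-shiftE B (eΘ _ _) = refl

      sz-thE : ∀ {η a} (E : ThE s₁ f₁ ⊥ η a) → szEnt (thE E) ≡ szTh E
      sz-thE t∅ = refl
      sz-thE (th _ _) = refl

      stepΘ : ∀ {C t σ η τ ρ} (d : C ⊢ t ∶ σ) (env : ∀ x → ThE s₁ f₁ ⊥ η (C x)) (s : Stk τ ρ) →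
              szSt d (λ x → thE (env x)) s ≤ szD c d (λ x → szTh (env x)) + szStk s
      stepΘ d env s = +-monoˡ-≤ (szStk s) (szD-mono c d (λ x → ≤-reflexive (sz-thE (env x))))

      stepI : ∀ {C t A η σ ρ τ₁} (d : (inΓ A ∷ᶜ C) ⊢ t ∶ σ) (env : Env η C) (k : Clo τ₁) (e : τ₁ ≡ lin (subL η A)) {τ} (s : Stk τ ρ) →
              c + szSt d (eΓ k e ∷ᵉ env) s ≤ (c + szD c d (0 ∷ⁿ szEnv env)) + (szClo k + szStk s)
      stepI d env k e s = ≤-trans (+-monoʳ-≤ c (+-monoˡ-≤ (szStk s)
          (≤-trans (szD-mono c d (λ { zero → ≤-refl ; (suc x) → ≤-refl })) (szD-β c d (szClo k) (szEnv env)))))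
          (≤-reflexive (solve 4 (λ c k d s → c :+ ((k :+ d) :+ s) := (c :+ d) :+ (k :+ s)) refl c (szClo k) (szD c d (0 ∷ⁿ szEnv env)) (szStk s)))
        where open +-*-Solver

      stepI! : ∀ {C t a η σ ρ τ₁} (d : (inΔ a ∷ᶜ C) ⊢ t ∶ σ) (env : Env η C) (B : Box₂ τ₁) (e : τ₁ ≡ subT η a) {τ} (s : Stk τ ρ) →
               szSt d (eΔ B e ∷ᵉ env) s ≤ szD c d (0 ∷ⁿ szEnv env) + szStk s
      stepI! d env B e s = +-monoˡ-≤ (szStk s) (szD-mono c d (λ { zero → ≤-refl ; (suc x) → ≤-refl }))

      stepE : ∀ {C C₁ C₂ t u σ₁ σ₂ η ρ τ} (p : Split C C₁ C₂) (d : C₁ ⊢ t ∶ σ₁) (d' : C₂ ⊢ u ∶ σ₂) (env : Env η C) (s : Stk τ ρ) →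
              c + (szD c d (szEnv (λ x → splitL (p x) (env x))) + (szD c d' (szEnv (λ x → splitR (p x) (env x))) + szStk s))
              ≤ (c + (szD c d (szEnv env) + szD c d' (szEnv env))) + szStk s
      stepE p d d' env s = ≤-trans (+-monoʳ-≤ c (+-mono-≤ (szD-mono c d (λ x → sz-splitL (p x) (env x)))
            (+-monoˡ-≤ (szStk s) (szD-mono c d' (λ x → sz-splitR (p x) (env x))))))
          (≤-reflexive (solve 4 (λ c a b s → c :+ (a :+ (b :+ s)) := (c :+ (a :+ b)) :+ s) refl c (szD c d (szEnv env)) (szD c d' (szEnv env)) (szStk s)))
        where open +-*-Solver

      step∀I : ∀ {C t σ η ρ τ} B (d : shiftCtx C ⊢ t ∶ σ) (env : Env η C) (s : Stk τ ρ) →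
               szSt d (λ x → shiftE B (env x)) s ≤ szD c d (szEnv env) + szStk s
      step∀I B d env s = +-monoˡ-≤ (szStk s) (szD-mono c d (λ x → ≤-reflexive (sz-shiftE B (env x))))

    module RB (φ₁ : f₁ → Tm) (φ₂ : f₂ → Tm) (w : Word (suc n)) where
      open Readback {s₁} {f₁} φ₁ w public using () renaming (rbBox to rb₁; rbPr to rbPr₁; rbTh to rbTh₁)
      open Readback {s₂} {f₂} φ₂ w public using () renaming (rbBox to rb₂; rbTh to rbTh₂)

      rbClo : ∀ {τ} → Clo τ → Tm
      rbEnt : ∀ {η a} → Ent η a → Tm
      rbClo (clo {t = t} _ _ _ env) = subTm (λ x → rbEnt (env x)) t
      rbClo (vbox B) = bang (rb₂ B)
      rbEnt e∅ = var 0
      rbEnt (eΓ k _) = rbClo k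
      rbEnt (eΔ B _) = rb₂ B
      rbEnt (eΘ B _) = rb₁ B

      rbEnv : ∀ {η C} → Env η C → ℕ → Tm
      rbEnv env x = rbEnt (env x)

      rbStk : ∀ {τ ρ} → Tm → Stk τ ρ → Tm
      rbStk u nil = u
      rbStk u (arg k s) = rbStk (app u (rbClo k)) s
      rbStk u (tyap _ _ s) = rbStk u s

      rbStk-cong : ∀ {τ ρ u v} (s : Stk τ ρ) → u =β v → rbStk u s =β rbStk v s
      rbStk-cong nil e = e
      rbStk-cong (arg k s) e = rbStk-cong s (β-appc e β-refl)
      rbStk-cong (tyap _ _ s) e = rbStk-cong s e

      rb-getΓ : ∀ {η a A} (E : Ent η a) (q : a ≡ inΓ A) → rbEnt E ≡ rbClo (proj₁ (proj₂ (getΓ E q)))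
      rb-getΓ (eΓ k _) refl = refl

      rb-getΘ : ∀ {η a σ} (E : Ent η a) (q : a ≡ inΘ σ) → rbEnt E ≡ rb₁ (proj₁ (proj₂ (getΘ E q)))
      rb-getΘ (eΘ k _) refl = refl

      rb-splitL : ∀ {η a a₁ a₂} (p : SplitSlot a a₁ a₂) (E : Ent η a) → Live a₁ → rbEnt E ≡ rbEnt (splitL p E)
      rb-splitL sp-Γl E l = refl
      rb-splitL sp-Δ E l = refl
      rb-splitL sp-Θ E l = refl

      rb-splitR : ∀ {η a a₁ a₂} (p : SplitSlot a a₁ a₂) (E : Ent η a) → Live a₂ → rbEnt E ≡ rbEnt (splitR p E)
      rb-splitR sp-Γr E l = refl
      rb-splitR sp-Δ E l = refl
      rb-splitR sp-Θ E l = refl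

      rb-shiftE : ∀ {η a} B (E : Ent η a) → rbEnt E ≡ rbEnt (shiftE B E)
      rb-shiftE B e∅ = refl
      rb-shiftE B (eΓ _ _) = refl
      rb-shiftE B (eΔ _ _) = refl
      rb-shiftE B (eΘ _ _) = refl

      rb-promE : ∀ {η a₀ a} (p : PromSlot a₀ a) (E : Ent η a) → Live a₀ → rbEnt E ≡ rbTh₂ (promE p E)
      rb-promE pr-Θ (eΔ _ _) l = refl

      rb-thE : ∀ {η a} (E : ThE s₁ f₁ ⊥ η a) → rbTh₁ E ≡ rbEnt (thE E)
      rb-thE t∅ = refl
      rb-thE (th _ _) = refl

      rb-∷ : ∀ {η a C} (E : Ent η a) (env : Env η C) x → (rbEnt E ∷ˢ rbEnv env) x ≡ rbEnv (E ∷ᵉ env) x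
      rb-∷ E env zero    = refl
      rb-∷ E env (suc x) = refl

      rb-E : ∀ {C C₁ C₂ t u σ₁ σ₂ η} (p : Split C C₁ C₂) (d : C₁ ⊢ t ∶ σ₁) (d' : C₂ ⊢ u ∶ σ₂) (env : Env η C) →
             subTm (rbEnv env) (app t u) ≡ app (subTm (rbEnv (λ x → splitL (p x) (env x))) t) (subTm (rbEnv (λ x → splitR (p x) (env x))) u)
      rb-E p d d' env = cong₂ app (agree d (λ x → rb-splitL (p x) (env x))) (agree d' (λ x → rb-splitR (p x) (env x)))

extD : ∀ k → (Fin (suc k) → Tm) → (ℕ → Tm) → ℕ → Tm
extD zero    ds s = ds fz ∷ˢ s
extD (suc k) ds s = extD k (ds ∘ fs) (ds fz ∷ˢ s)

extD-old : ∀ k ds s j → extD k ds s (suc k + j) ≡ s j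
extD-old zero    ds s j = refl
extD-old (suc k) ds s j = trans (cong (extD k (ds ∘ fs) (ds fz ∷ˢ s)) (sym (+-suc (suc k) j))) (extD-old k (ds ∘ fs) (ds fz ∷ˢ s) (suc j))

extD-new : ∀ k ds s (i : Fin (suc k)) → extD k ds s (k ∸ toℕ i) ≡ ds i
extD-new zero    ds s fz = refl
extD-new (suc k) ds s fz = trans (cong (extD k (ds ∘ fs) (ds fz ∷ˢ s)) (sym (+-identityʳ (suc k)))) (extD-old k (ds ∘ fs) (ds fz ∷ˢ s) 0)
extD-new (suc k) ds s (fs i) = extD-new k (ds ∘ fs) (ds fz ∷ˢ s) i

applyBangs-cong : ∀ k {u v} ds → u =β v → applyBangs k u ds =β applyBangs k v ds
applyBangs-cong zero    ds e = β-appc e β-refl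
applyBangs-cong (suc k) ds e = applyBangs-cong k (ds ∘ fs) (β-appc e β-refl)

lam!s-β : ∀ k s t ds → applyBangs k (subTm s (lam!s (suc k) t)) ds =β subTm (extD k ds s) t
lam!s-β zero    s t ds = β-bangˢ {s} {t}
lam!s-β (suc k) s t ds = β-trans (applyBangs-cong k (ds ∘ fs) (β-bangˢ {s} {lam!s (suc k) t})) (lam!s-β k _ t (ds ∘ fs))

encBody-sub : ∀ n s (ds : Fin (suc n) → Tm) → (∀ i → s (n ∸ toℕ i) ≡ ds i) → ∀ w → subTm (extTm s) (encBody n w) ≡ itBody ds w
encBody-sub n s ds e [] = refl
encBody-sub n s ds e (c ∷ w) = cong₂ app (cong (renTm suc) (e c)) (encBody-sub n s ds e w)

enc-β : ∀ n w ds → applyBangs n (enc n w) ds =β bang (itTm ds w)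
enc-β n w ds = β-trans (applyBangs-cong n ds (≡⇒β (sym (subTm-id {var} (λ _ → refl) (enc n w)))))
  (β-trans (lam!s-β n var (bang (lam (encBody n w))) ds)
           (≡⇒β (cong (bang ∘ lam) (encBody-sub n _ ds (extD-new n ds var) w))))

szD-pos : ∀ {C t σ} (d : C ⊢ t ∶ σ) e → 1 ≤ szD 1 d e
szD-pos (ax-Γ _) e = s≤s z≤n
szD-pos (ax-Θ _) e = s≤s z≤n
szD-pos (⊸I d) e = s≤s z≤n
szD-pos (⊸I! d) e = s≤s z≤n
szD-pos (⊸E _ d d') e = s≤s z≤n
szD-pos (∀I d) e = s≤s z≤n
szD-pos (∀E _ d) e = s≤s z≤n
szD-pos (!I _ d) e = s≤s z≤n

-- Evaluation of everything outside the boxes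

module Eval (n : ℕ) {s₁ f₁ s₂ f₂ i₂ : Set} (allow : s₁ → i₂) (φ₁ : f₁ → Tm) (φ₂ : f₂ → Tm) where
  open Boxes n
  open Closures {s₁} {f₁} {s₂} {f₂} {i₂}
  open module RBw w = RB φ₁ φ₂ w using (rbClo; rbEnt; rbEnv; rbStk; rbStk-cong; rb₁; rb₂; rbPr₁; rbTh₁)
  module Sz = Sizes 1 1 (λ _ → 1)
  -- number of occurrences of the input string outside boxes
  module Ct = Sizes 0 1 (λ _ → 0)

  LvlClo : ∀ {τ} → ℕ → Clo τ → Set
  LvlEnt : ∀ {η a} → ℕ → Ent η a → Set
  LvlClo ℓ (clo _ _ _ env) = ∀ x → LvlEnt ℓ (env x)
  LvlClo ℓ (vbox B) = Lvl ℓ B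
  LvlEnt ℓ e∅ = ⊤
  LvlEnt ℓ (eΓ k _) = LvlClo ℓ k
  LvlEnt ℓ (eΔ B _) = Lvl ℓ B
  LvlEnt ℓ (eΘ _ _) = ⊤

  LvlClo-mono : ∀ {τ k ℓ} (c : Clo τ) → k ≤ ℓ → LvlClo k c → LvlClo ℓ c
  LvlEnt-mono : ∀ {η a k ℓ} (c : Ent η a) → k ≤ ℓ → LvlEnt k c → LvlEnt ℓ c
  LvlClo-mono (clo _ _ _ env) p l x = LvlEnt-mono (env x) p (l x)
  LvlClo-mono (vbox B) p l = Lvl-mono B p l
  LvlEnt-mono e∅ p l = tt
  LvlEnt-mono (eΓ k _) p l = LvlClo-mono k p l
  LvlEnt-mono (eΔ B _) p l = Lvl-mono B p l
  LvlEnt-mono (eΘ _ _) p l = tt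

  LvlStk : ∀ {τ ρ} → ℕ → Stk τ ρ → Set
  LvlStk ℓ nil = ⊤
  LvlStk ℓ (arg k s) = LvlClo ℓ k × LvlStk ℓ s
  LvlStk ℓ (tyap _ _ s) = LvlStk ℓ s

  LvlStk-mono : ∀ {τ ρ k ℓ} (s : Stk τ ρ) → k ≤ ℓ → LvlStk k s → LvlStk ℓ s
  LvlStk-mono nil p l = tt
  LvlStk-mono (arg k s) p (l , l') = LvlClo-mono k p l , LvlStk-mono s p l'
  LvlStk-mono (tyap _ _ s) p l = LvlStk-mono s p l

  lvl-getΓ : ∀ {η a A ℓ} (E : Ent η a) (q : a ≡ inΓ A) → LvlEnt ℓ E → LvlClo ℓ (proj₁ (proj₂ (getΓ E q)))
  lvl-getΓ (eΓ k _) refl l = l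

  lvl-splitL : ∀ {η a a₁ a₂ ℓ} (p : SplitSlot a a₁ a₂) (E : Ent η a) → LvlEnt ℓ E → LvlEnt ℓ (splitL p E)
  lvl-splitL sp-none E l = l
  lvl-splitL sp-Γl E l = l
  lvl-splitL sp-Γr E l = tt
  lvl-splitL sp-Δ E l = l
  lvl-splitL sp-Θ E l = l

  lvl-splitR : ∀ {η a a₁ a₂ ℓ} (p : SplitSlot a a₁ a₂) (E : Ent η a) → LvlEnt ℓ E → LvlEnt ℓ (splitR p E)
  lvl-splitR sp-none E l = l
  lvl-splitR sp-Γl E l = tt
  lvl-splitR sp-Γr E l = l
  lvl-splitR sp-Δ E l = l
  lvl-splitR sp-Θ E l = l

  lvl-shiftE : ∀ {η a ℓ} B (E : Ent η a) → LvlEnt ℓ E → LvlEnt ℓ (shiftE B E)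
  lvl-shiftE B e∅ l = l
  lvl-shiftE B (eΓ _ _) l = l
  lvl-shiftE B (eΔ _ _) l = l
  lvl-shiftE B (eΘ _ _) l = l

  lvl-promE : ∀ {η a₀ a ℓ} (p : PromSlot a₀ a) (E : Ent η a) → LvlEnt ℓ E → LvlTh ℓ (promE p E)
  lvl-promE pr-none E l = tt
  lvl-promE pr-Θ (eΔ _ _) l = l

  lvl-thE : ∀ {η a ℓ} (E : ThE s₁ f₁ ⊥ η a) → LvlEnt ℓ (thE E)
  lvl-thE t∅ = tt
  lvl-thE (th _ _) = tt

  lvl-∷ : ∀ {η a C ℓ} {E : Ent η a} {env : Env η C} → LvlEnt ℓ E → (∀ x → LvlEnt ℓ (env x)) → ∀ x → LvlEnt ℓ ((E ∷ᵉ env) x)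
  lvl-∷ l ls zero    = l
  lvl-∷ l ls (suc x) = ls x

  -- The level may exceed that of the environment by `ct`, the number of input strings outside
  -- boxes: each of them can come to the head at most once, and then wraps its arguments into one
  -- more iteration.
  record Res (ρ : Ty) (rb : Word (suc n) → Tm) (ct : ℕ) (lvl : ℕ → Set) : Set where
    constructor res
    field
      val : Box₂ ρ
      β   : ∀ w → rb w =β bang (rb₂ w val)
      lv  : ∀ ℓ → lvl ℓ → Lvl (ℓ + ct) val
  open Res

  conv : ∀ {ρ rb rb' ct ct'} {lvl lvl' : ℕ → Set} → (∀ w → rb' w =β rb w) → ct ≤ ct' → (∀ ℓ → lvl' ℓ → lvl ℓ) →
         Res ρ rb ct lvl → Res ρ rb' ct' lvl'
  conv b c l r = res (val r) (λ w → β-trans (b w) (β r w)) (λ ℓ q → Lvl-mono (val r) (+-monoʳ-≤ ℓ c) (lv r ℓ (l ℓ q)))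

  EvSt : ∀ {C t σ η τ ρ} → C ⊢ t ∶ σ → Env η C → Stk τ (! ρ) → Set
  EvSt {t = t} {ρ = ρ} d env s = Res ρ (λ w → rbStk w (subTm (rbEnv w env) t) s) (Ct.szSt d env s) (λ ℓ → (∀ x → LvlEnt ℓ (env x)) × LvlStk ℓ s)

  record Args (k : ℕ) (A : LTy) {ρ U} (s : Stk (lin (st U)) (! ρ)) : Set where
    constructor args
    field
      boxes : Fin (suc k) → Box₂ (A ⊸ᴸ A)
      tyEq  : ρ ≡ A ⊸ᴸ A
      β     : ∀ w u → rbStk w u s =β applyBangs k u (λ i → rb₂ w (boxes i))
      lv    : ∀ ℓ → LvlStk ℓ s → ∀ i → Lvl (ℓ + Ct.szStk s) (boxes i)

  -- All stacks end in a `!` type here. Hence letters and the base point never reach the head, and a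
  -- run can stop only at a promotion, at a finished box, or at the input string with all its
  -- arguments. The number k bounds the size of the state.
  eval : ∀ k {C t σ τ ρ} (d : C ⊢ t ∶ σ) (η : TSub) → τ ≡ subT η σ → (env : Env η C) (s : Stk τ (! ρ)) → Sz.szSt d env s ≤ k → EvSt d env s
  evalClo : ∀ k {τ ρ} (c : Clo τ) (s : Stk τ (! ρ)) → Sz.szClo c + Sz.szStk s ≤ k →
            Res ρ (λ w → rbStk w (rbClo w c) s) (Ct.szClo c + Ct.szStk s) (λ ℓ → LvlClo ℓ c × LvlStk ℓ s)
  evalBox : ∀ k {τ ρ} (B : Box₁ τ) (s : Stk τ (! ρ)) → Sz.szBox B + Sz.szStk s ≤ k →
            Res ρ (λ w → rbStk w (rb₁ w B) s) (Ct.szBox B + Ct.szStk s) (λ ℓ → LvlStk ℓ s)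
  evalArgs : ∀ k m A {ρ U} → U ≡ instS (strBody m) A → (s : Stk (lin (st U)) (! ρ)) → Sz.szStk s ≤ k → Args m A s

  eval zero d η e env s p = ⊥-elim (<⇒≱ (szD-pos d _) (≤-trans (m≤m+n _ _) p))
  eval (suc k) (ax-Γ {x = x} q) η refl env s p with getΓ (env x) q | Sz.sz-getΓ (env x) q | Ct.sz-getΓ (env x) q
        | (λ w → RB.rb-getΓ φ₁ φ₂ w (env x) q) | (λ ℓ → lvl-getΓ {ℓ = ℓ} (env x) q)
  ... | _ , c , refl | z | ct | r | l =
    conv (λ w → rbStk-cong w s (≡⇒β (r w))) (≤-reflexive (cong (_+ Ct.szStk s) ct)) (λ ℓ (a , b) → l ℓ (a x) , b)
         (evalClo k c s (≤-trans (≤-reflexive (cong (_+ Sz.szStk s) z)) (s≤s⁻¹ p)))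
  eval (suc k) (ax-Θ {x = x} q) η refl env s p with getΘ (env x) q | Sz.sz-getΘ (env x) q | Ct.sz-getΘ (env x) q
        | (λ w → RB.rb-getΘ φ₁ φ₂ w (env x) q)
  ... | _ , c , refl | z | ct | r =
    conv (λ w → rbStk-cong w s (≡⇒β (r w))) (≤-reflexive (cong (_+ Ct.szStk s) ct)) (λ ℓ (a , b) → b)
         (evalBox k c s (≤-trans (≤-reflexive (cong (_+ Sz.szStk s) z)) (s≤s⁻¹ p)))
  eval (suc k) (⊸I {t = t} d) η refl env (arg c s) p =
    conv (λ w → rbStk-cong w s (β-trans (β-lamˢ {rbEnv w env} {t}) (≡⇒β (subTm-cong (RB.rb-∷ φ₁ φ₂ w (eΓ c refl) env) t))))
         (Ct.stepI d env c refl s) (λ ℓ (a , b , b') → lvl-∷ b a , b')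
         (eval k d η refl (eΓ c refl ∷ᵉ env) s (s≤s⁻¹ (≤-trans (Sz.stepI d env c refl s) p)))
  eval (suc k) (⊸I! {t = t} {σ = a} d) η refl env (arg c s) p =
    let m = s≤s⁻¹ p
        -- An argument of `!` type is evaluated to a box before it is bound; linear arguments are
        -- passed as closures. The level gained here is added to that of the environment for the
        -- rest of the run.
        r₁ = evalClo k c nil (≤-trans (+-monoʳ-≤ (Sz.szClo c) z≤n) (≤-trans (m≤n+m _ (szD 1 d (0 ∷ⁿ Sz.szEnv env))) m))
        E = eΔ (val r₁) refl
        r₂ = eval k d η refl (E ∷ᵉ env) s
               (≤-trans (Sz.stepI! d env (val r₁) refl s) (≤-trans (+-monoʳ-≤ (szD 1 d (0 ∷ⁿ Sz.szEnv env)) (m≤n+m _ (Sz.szClo c))) m))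
    in res (val r₂)
           (λ w → β-trans (rbStk-cong w s (β-trans (β-appc β-refl (β r₁ w)) (β-trans (β-bangˢ {rbEnv w env} {t})
                     (≡⇒β (subTm-cong (RB.rb-∷ φ₁ φ₂ w E env) t))))) (β r₂ w))
           (λ ℓ (la , lb , lc) → Lvl-mono (val r₂)
              (≤-trans (≤-reflexive (+-assoc ℓ (Ct.szClo c + 0) _))
                (+-monoʳ-≤ ℓ (≤-trans (+-monoʳ-≤ (Ct.szClo c + 0) (Ct.stepI! d env (val r₁) refl s))
                  (≤-reflexive (solve 3 (λ c d s → (c :+ con 0) :+ (d :+ s) := d :+ (c :+ s)) refl (Ct.szClo c) (szD 0 d (0 ∷ⁿ Ct.szEnv env)) (Ct.szStk s))))))
              (lv r₂ (ℓ + (Ct.szClo c + 0))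
                 ((lvl-∷ (lv r₁ ℓ (lb , tt)) (λ x → LvlEnt-mono (env x) (m≤m+n ℓ _) (la x))) , LvlStk-mono s (m≤m+n ℓ _) lc)))
    where open +-*-Solver
  eval (suc k) (⊸E {u = u} q d d') η refl env s p =
    conv (λ w → rbStk-cong w s (≡⇒β (RB.rb-E φ₁ φ₂ w q d d' env)))
         (Ct.stepE q d d' env s)
         (λ ℓ (a , b) → (λ x → lvl-splitL (q x) (env x) (a x)) , (λ x → lvl-splitR (q x) (env x) (a x)) , b)
         (eval k d η refl (λ x → splitL (q x) (env x)) (arg (clo d' η refl (λ x → splitR (q x) (env x))) s)
            (s≤s⁻¹ (≤-trans (Sz.stepE q d d' env s) p)))
  eval (suc k) (∀I {t = t} {S = U} d) η refl env (tyap A e s) p =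
    conv (λ w → rbStk-cong w s (≡⇒β (agree d (λ x _ → RB.rb-shiftE φ₁ φ₂ w A (env x)))))
         (Ct.step∀I A d env s) (λ ℓ (a , b) → (λ x → lvl-shiftE A (env x) (a x)) , b)
         (eval k d (A ∷ᵗ η) (cong (lin ∘ st) (trans e (sym (inst-ext η A U)))) (λ x → shiftE A (env x)) s
            (≤-trans (Sz.step∀I A d env s) (s≤s⁻¹ p)))
  eval (suc k) (∀E {S = U} A d) η refl env s p =
    eval k d η refl env (tyap (subL η A) (sub-inst η A U) s) (s≤s⁻¹ p)
  eval (suc k) (!I q d) η refl env nil p =
    res (bx d η refl (λ x → promE (q x) (env x)))
        (λ w → ≡⇒β (cong bang (agree d (λ x → RB.rb-promE φ₁ φ₂ w (q x) (env x)))))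
        (λ ℓ (a , b) x → LvlTh-mono (promE (q x) (env x)) (m≤m+n ℓ _) (lvl-promE (q x) (env x) (a x)))

  evalClo k (clo d η e env) s p = eval k d η e env s p
  evalClo k (vbox B) nil p = res B (λ w → β-refl) (λ ℓ (a , _) → Lvl-mono B (m≤m+n ℓ _) a)

  evalBox k (bx {t = t} d η e env) s p =
    conv (λ w → rbStk-cong w s (≡⇒β (subTm-cong (λ x → RB.rb-thE φ₁ φ₂ w (env x)) t)))
         (Ct.stepΘ d env s) (λ ℓ b → (λ x → lvl-thE (env x)) , b)
         (eval k d η e (λ x → thE (env x)) s (≤-trans (Sz.stepΘ d env s) p))
  evalBox k (pr (S₀ q)) (tyap A e s) p with evalArgs k n A e s (≤-trans (m≤n+m _ 1) p)
  -- The instantiated input with its arguments evaluated to boxes becomes one iteration. By `enc-β`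
  -- this is correct for the encoding of every word, so the word need not be known.
  ... | args ds refl b l = res (it (allow q) A ds) (λ w → β-trans (b w (enc n w)) (enc-β n w _))
                             (λ ℓ h → _ , ≤-reflexive (sym (+-suc ℓ _)) , l ℓ h)
  evalBox k (pr (F₀ a)) (arg c ()) p
  evalBox k (pr X₀) () p

  evalArgs k zero A refl (arg c (nil)) p with evalClo k c nil p
  ... | r = args (λ _ → val r) refl (λ w u → β-appc β-refl (β r w)) (λ { ℓ (a , _) _ → lv r ℓ (a , tt) })
  evalArgs k (suc m) A refl (arg c s) p
    with evalClo k c nil (≤-trans (+-monoʳ-≤ (Sz.szClo c) z≤n) p) | evalArgs k m A refl s (≤-trans (m≤n+m _ (Sz.szClo c)) p)
  ... | r | args ds e b l = args (λ { fz → val r ; (fs i) → ds i }) e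
     (λ w u → β-trans (rbStk-cong w s (β-appc β-refl (β r w))) (b w _))
     (λ { ℓ (a , a') fz → Lvl-mono (val r) (+-monoʳ-≤ ℓ (+-monoʳ-≤ (Ct.szClo c) z≤n)) (lv r ℓ (a , tt))
        ; ℓ (a , a') (fs i) → Lvl-mono (ds i) (+-monoʳ-≤ ℓ (m≤n+m _ (Ct.szClo c))) (l ℓ a' i) })

bang-inj : ∀ {t u} → bang t =β bang u → t =β u
bang-inj e = β-trans (β-sym (β-bang {var 0})) (β-trans (β-appc (β-refl {lam! (var 0)}) e) (β-bang {var 0}))

letter : ∀ {m} → Fin m → Tm
letter a = var (suc (toℕ a))

it-chain : ∀ {m} (u : Word m) → app (itTm letter u) (var 0) =β chain (map toℕ u)
it-chain u = β-trans (≡⇒β (cong (λ t → app (lam t) (var 0)) (sym (subTm-id ext-var (itBody letter u)))))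
                     (β-trans (β-lamˢ {var} {itBody letter u}) (≡⇒β (go u)))
  where
  ext-var : ∀ x → extTm var x ≡ var x
  ext-var zero    = refl
  ext-var (suc x) = refl
  go : ∀ u → subTm (var 0 ∷ˢ var) (itBody letter u) ≡ chain (map toℕ u)
  go []      = refl
  go (a ∷ u) = cong (app _) (go u)

szD-closed : ∀ {C t σ} (d : C ⊢ t ∶ σ) e → (∀ x → e x ≡ 0) → szD 0 d e ≡ 0
szD-closed (ax-Γ _) e z = z _
szD-closed (ax-Θ _) e z = z _
szD-closed (⊸I d) e z = szD-closed d _ (λ { zero → refl ; (suc x) → z x })
szD-closed (⊸I! d) e z = szD-closed d _ (λ { zero → refl ; (suc x) → z x })
szD-closed (⊸E _ d d') e z = cong₂ _+_ (szD-closed d e z) (szD-closed d' e z)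
szD-closed (∀I d) e z = szD-closed d e z
szD-closed (∀E _ d) e z = szD-closed d e z
szD-closed (!I _ d) e z = refl

strBody-inst : ∀ m → strBody m ≡ instS (strBody m) (tv 0)
strBody-inst zero    = refl
strBody-inst (suc m) = cong (λ U → (! endo) ⊸ lin (st U)) (strBody-inst m)

-- What is left of a term of string type once everything outside the boxes has been evaluated.
record Core (nΓ nΣ ℓ : ℕ) (f : Word (suc nΓ) → Word (suc nΣ)) : Set where
  constructor core
  open Boxes nΓ
  field
    body  : Box ⊥ (Fin (suc nΣ)) ⊤ endo
    sound : ∀ w → app (Readback.rbBox letter w body) (var 0) =β chain (map toℕ (f w))
    level : Lvl ℓ body

module _ (nΓ nΣ : ℕ) where
  open Boxes nΓ

  module _ {s₁ : Set} where
    open Eval nΓ {s₁} {⊥} {⊥} {Fin (suc nΣ)} {⊤} (λ _ → tt) (λ ()) letter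
    open Closures {s₁} {⊥} {⊥} {Fin (suc nΣ)} {⊤}

    fStk : ∀ m → (Fin (suc m) → Fin (suc nΣ)) → Stk (lin (st (strBody m))) (! endo)
    fStk zero    g = arg (vbox (pr (F₀ (g fz)))) nil
    fStk (suc m) g = arg (vbox (pr (F₀ (g fz)))) (fStk m (g ∘ fs))

    fStk-rb : ∀ m g w u → RB.rbStk (λ ()) letter w u (fStk m g) ≡ applyBangs m u (letter ∘ g)
    fStk-rb zero    g w u = refl
    fStk-rb (suc m) g w u = fStk-rb m (g ∘ fs) w _

    fStk-ct : ∀ m g → Ct.szStk (fStk m g) ≡ 0
    fStk-ct zero    g = refl
    fStk-ct (suc m) g = fStk-ct m (g ∘ fs)

    fStk-lvl : ∀ m g → LvlStk 0 (fStk m g)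
    fStk-lvl zero    g = tt , tt
    fStk-lvl (suc m) g = tt , fStk-lvl m (g ∘ fs)

    -- The string that is produced is opened at `tv 0`, which serves as base type from here on, with
    -- the formal output letters as its boxed arguments.
    outStk : Stk (StrT nΣ) (! endo)
    outStk = tyap (tv 0) (strBody-inst nΣ) (fStk nΣ id)

    out-sound : ∀ (f : Word (suc nΓ) → Word (suc nΣ)) {rb : Word (suc nΓ) → Tm} (V : Box ⊥ (Fin (suc nΣ)) ⊤ endo) →
      (∀ w → rb w =β enc nΣ (f w)) →
      (∀ w → RB.rbStk (λ ()) letter w (rb w) outStk =β bang (Readback.rbBox letter w V)) →
      ∀ w → app (Readback.rbBox letter w V) (var 0) =β chain (map toℕ (f w))
    out-sound f {rb} V e b w = β-trans (β-appc (bang-inj (β-trans (β-sym (b w))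
       (β-trans (RB.rbStk-cong (λ ()) letter w outStk (e w)) (β-trans (≡⇒β (fStk-rb nΣ id w _)) (enc-β nΣ (f w) letter))))) β-refl) (it-chain (f w))

  -- The term is closed, so the initial state has one input string outside boxes, the argument. This
  -- gives nesting depth 1.
  coreLin : ∀ (f : Word (suc nΓ) → Word (suc nΣ)) → ExpressibleLin nΓ nΣ f → Core nΓ nΣ 1 f
  coreLin f (t , d , e) = core (val r)
      (out-sound {⊤} f {λ w → app (subTm (λ _ → var 0) t) (enc nΓ w)} (val r)
         (λ w → β-trans (β-appc (≡⇒β (trans (agree d (λ _ ())) (subTm-id {var} (λ _ → refl) t))) β-refl) (e w)) (β r))
      (Lvl-mono (val r) (≤-reflexive (trans (cong (_+ Ct.szStk stk) (szD-closed d _ (λ _ → refl))) (cong suc (fStk-ct nΣ id))))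
        (lv r 0 ((λ _ → tt) , (λ { zero → tt ; (suc x) → tt }) , fStk-lvl nΣ id)))
    where
    open Eval nΓ {⊤} {⊥} {⊥} {Fin (suc nΣ)} {⊤} (λ _ → tt) (λ ()) letter
    open Closures {⊤} {⊥} {⊥} {Fin (suc nΣ)} {⊤}
    open Res
    sEnv : Env tv (inΘ (StrT nΓ) ∷ᶜ emptyCtx)
    sEnv = eΘ (pr (S₀ tt)) (sym (subT-id (λ _ → refl) (StrT nΓ))) ∷ᵉ (λ _ → e∅)
    stk : Stk (lin (st (StrT nΓ ⊸ StrT nΣ))) (! endo)
    stk = arg (clo (ax-Θ {x = 0} refl) tv (sym (subT-id (λ _ → refl) (StrT nΓ))) sEnv) outStk
    r : EvSt {η = tv} d (λ _ → e∅) stk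
    r = eval _ d tv (sym (subT-id (λ _ → refl) (LinFunTy nΓ nΣ))) (λ _ → e∅) stk ≤-refl

  -- Two evaluations are chained. In the first the input is locked in a box, so that it cannot come
  -- to the head, and the result is a box of string type. The second opens this box and feeds it the
  -- letters; the depth is the number of input strings found there.
  coreBang : ∀ (f : Word (suc nΓ) → Word (suc nΣ)) → ExpressibleBang nΓ nΣ f → Σ ℕ λ ℓ → Core nΓ nΣ ℓ f
  coreBang f (t , d , e) = _ , core (E₂.val r₂)
      (out-sound {⊤} f (E₂.val r₂) e₁ (E₂.β r₂))
      (E₂.lv r₂ 0 (fStk-lvl nΣ id))
    where
    module E₁ where
      open Eval nΓ {⊥} {⊥} {⊤} {⊥} {⊥} (λ ()) (λ ()) (λ ()) public
      open Closures {⊥} {⊥} {⊤} {⊥} {⊥} public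
      open Res public
    module E₂ where
      open Eval nΓ {⊤} {⊥} {⊥} {Fin (suc nΣ)} {⊤} (λ _ → tt) (λ ()) letter public
      open Closures {⊤} {⊥} {⊥} {Fin (suc nΣ)} {⊤} public
      open Res public
    stk : E₁.Stk (BangFunTy nΓ nΣ) (! (StrT nΣ))
    stk = E₁.arg (E₁.vbox (pr (S₀ tt))) E₁.nil
    r₁ : E₁.EvSt {η = tv} d (λ _ → E₁.e∅) stk
    r₁ = E₁.eval _ d tv (sym (subT-id (λ _ → refl) (BangFunTy nΓ nΣ))) (λ _ → E₁.e∅) stk ≤-refl
    e₁ : ∀ w → Readback.rbBox (λ ()) w (E₁.val r₁) =β enc nΣ (f w)
    e₁ w = bang-inj (β-trans (β-sym (E₁.β r₁ w)) (β-trans (β-appc (≡⇒β (trans (agree d (λ _ ())) (subTm-id {var} (λ _ → refl) t))) β-refl) (e w)))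
    r₂ = E₂.evalBox _ (E₁.val r₁) outStk ≤-refl

-- Tokens, webs and the interpretation of derivations

-- Tokens of the relational model.  fn nothing b is a function returning b without using its argument.
data Raw : Set where
  pt : ℕ → Raw
  un : Raw
  fn : Maybe Raw → Raw → Raw

infixr 5 _∷ᶠ_
_∷ᶠ_ : ∀ {a} {X : Set a} → X → (ℕ → X) → ℕ → X
(a ∷ᶠ f) zero    = a
(a ∷ᶠ f) (suc n) = f n

AllM : (Raw → Set) → Maybe Raw → Set
AllM P nothing  = ⊤
AllM P (just r) = P r

RMap : Set
RMap = ℕ → Raw → Raw

mapL : LTy → RMap → Raw → Raw
mapS : STy → RMap → Raw → Raw
mapT : Ty → RMap → Raw → Raw
mapM : Ty → RMap → Maybe Raw → Maybe Raw
mapL (tv n) ρ r = ρ n r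
mapL (st U) ρ r = mapS U ρ r
mapS (σ ⊸ τ) ρ (fn m r) = fn (mapM σ ρ m) (mapT τ ρ r)
mapS (σ ⊸ τ) ρ (pt i) = pt i
mapS (σ ⊸ τ) ρ un = un
mapS (∀' U) ρ r = mapS U (id ∷ᶠ ρ) r
mapT (lin A) ρ r = mapL A ρ r
mapT (! σ) ρ r = r
mapM σ ρ nothing = nothing
mapM σ ρ (just r) = just (mapT σ ρ r)

cwL : (ℕ → ℕ) → LTy → ℕ
cwS : (ℕ → ℕ) → STy → ℕ
cwT : (ℕ → ℕ) → Ty → ℕ
cwL ω (tv n) = ω n
cwL ω (st U) = cwS ω U
cwS ω (σ ⊸ τ) = cwT ω σ + cwT ω τ
cwS ω (∀' U) = cwS (0 ∷ᶠ ω) U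
cwT ω (lin A) = cwL ω A
cwT ω (! σ) = 0

-- The occurrences of the bound variable outside `!`. They bound the number of leaves of a token at
-- that variable, hence the number of colours a pattern can use; this keeps the webs of quantified
-- types finite.
cnt : STy → ℕ
cnt U = cwS (1 ∷ᶠ λ _ → 0) U

PWeb : Set₁
PWeb = ℕ → Raw → Set

-- Tokens of ∀'U are patterns: tokens of U whose leaves at the bound variable are colours.
Col : STy → Raw → Set
Col U r = Σ ℕ λ i → i ≤ cnt U × r ≡ pt i

-- A type `! σ` has the single token `un`. By stratification the content of a box influences other
-- boxes but nothing at the current depth, so one token describes it completely.
HasL : LTy → PWeb → Raw → Set
HasS : STy → PWeb → Raw → Set
HasT : Ty → PWeb → Raw → Set
HasM : Ty → PWeb → Maybe Raw → Set
HasL (tv n) E r = E n r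
HasL (st U) E r = HasS U E r
HasS (σ ⊸ τ) E (fn m r) = HasM σ E m × HasT τ E r
HasS (σ ⊸ τ) E (pt i) = ⊥
HasS (σ ⊸ τ) E un = ⊥
HasS (∀' U) E r = HasS U (Col U ∷ᶠ E) r
HasT (lin A) E r = HasL A E r
HasT (! σ) E r = r ≡ un
HasM σ E nothing = ⊤
HasM σ E (just r) = HasT σ E r

∷-id : ∀ {ρ : RMap} → (∀ n r → ρ n r ≡ r) → ∀ n r → (id ∷ᶠ ρ) n r ≡ r
∷-id f zero    r = refl
∷-id f (suc n) r = f n r

mapL-id : ∀ A {ρ} → (∀ n r → ρ n r ≡ r) → ∀ r → mapL A ρ r ≡ r
mapS-id : ∀ U {ρ} → (∀ n r → ρ n r ≡ r) → ∀ r → mapS U ρ r ≡ r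
mapT-id : ∀ σ {ρ} → (∀ n r → ρ n r ≡ r) → ∀ r → mapT σ ρ r ≡ r
mapM-id : ∀ σ {ρ} → (∀ n r → ρ n r ≡ r) → ∀ m → mapM σ ρ m ≡ m
mapL-id (tv n) f r = f n r
mapL-id (st U) f r = mapS-id U f r
mapS-id (σ ⊸ τ) f (fn m r) = cong₂ fn (mapM-id σ f m) (mapT-id τ f r)
mapS-id (σ ⊸ τ) f (pt i) = refl
mapS-id (σ ⊸ τ) f un = refl
mapS-id (∀' U) f r = mapS-id U (∷-id f) r
mapT-id (lin A) f r = mapL-id A f r
mapT-id (! σ) f r = refl
mapM-id σ f nothing = refl
mapM-id σ f (just r) = cong just (mapT-id σ f r)

∷-∘ : ∀ {ρ ρ' κ : RMap} → (∀ n r → ρ n (ρ' n r) ≡ κ n r) → ∀ n r → (id ∷ᶠ ρ) n ((id ∷ᶠ ρ') n r) ≡ (id ∷ᶠ κ) n r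
∷-∘ f zero    r = refl
∷-∘ f (suc n) r = f n r

mapL-∘ : ∀ A {ρ ρ' κ} → (∀ n r → ρ n (ρ' n r) ≡ κ n r) → ∀ r → mapL A ρ (mapL A ρ' r) ≡ mapL A κ r
mapS-∘ : ∀ U {ρ ρ' κ} → (∀ n r → ρ n (ρ' n r) ≡ κ n r) → ∀ r → mapS U ρ (mapS U ρ' r) ≡ mapS U κ r
mapT-∘ : ∀ σ {ρ ρ' κ} → (∀ n r → ρ n (ρ' n r) ≡ κ n r) → ∀ r → mapT σ ρ (mapT σ ρ' r) ≡ mapT σ κ r
mapM-∘ : ∀ σ {ρ ρ' κ} → (∀ n r → ρ n (ρ' n r) ≡ κ n r) → ∀ m → mapM σ ρ (mapM σ ρ' m) ≡ mapM σ κ m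
mapL-∘ (tv n) f r = f n r
mapL-∘ (st U) f r = mapS-∘ U f r
mapS-∘ (σ ⊸ τ) f (fn m r) = cong₂ fn (mapM-∘ σ f m) (mapT-∘ τ f r)
mapS-∘ (σ ⊸ τ) f (pt i) = refl
mapS-∘ (σ ⊸ τ) f un = refl
mapS-∘ (∀' U) f r = mapS-∘ U (∷-∘ f) r
mapT-∘ (lin A) f r = mapL-∘ A f r
mapT-∘ (! σ) f r = refl
mapM-∘ σ f nothing = refl
mapM-∘ σ f (just r) = cong just (mapT-∘ σ f r)

mapL-ren : ∀ A {f ρ κ} → (∀ n r → ρ (f n) r ≡ κ n r) → ∀ r → mapL (renL f A) ρ r ≡ mapL A κ r
mapS-ren : ∀ U {f ρ κ} → (∀ n r → ρ (f n) r ≡ κ n r) → ∀ r → mapS (renS f U) ρ r ≡ mapS U κ r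
mapT-ren : ∀ σ {f ρ κ} → (∀ n r → ρ (f n) r ≡ κ n r) → ∀ r → mapT (renT f σ) ρ r ≡ mapT σ κ r
mapM-ren : ∀ σ {f ρ κ} → (∀ n r → ρ (f n) r ≡ κ n r) → ∀ m → mapM (renT f σ) ρ m ≡ mapM σ κ m
mapL-ren (tv n) e r = e n r
mapL-ren (st U) e r = mapS-ren U e r
mapS-ren (σ ⊸ τ) e (fn m r) = cong₂ fn (mapM-ren σ e m) (mapT-ren τ e r)
mapS-ren (σ ⊸ τ) e (pt i) = refl
mapS-ren (σ ⊸ τ) e un = refl
mapS-ren (∀' U) e r = mapS-ren U (λ { zero r → refl ; (suc n) r → e n r }) r
mapT-ren (lin A) e r = mapL-ren A e r
mapT-ren (! σ) e r = refl
mapM-ren σ e nothing = refl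
mapM-ren σ e (just r) = cong just (mapT-ren σ e r)

mapL-sub : ∀ A {s ρ κ} → (∀ n r → mapL (s n) ρ r ≡ κ n r) → ∀ r → mapL (subL s A) ρ r ≡ mapL A κ r
mapS-sub : ∀ U {s ρ κ} → (∀ n r → mapL (s n) ρ r ≡ κ n r) → ∀ r → mapS (subS s U) ρ r ≡ mapS U κ r
mapT-sub : ∀ σ {s ρ κ} → (∀ n r → mapL (s n) ρ r ≡ κ n r) → ∀ r → mapT (subT s σ) ρ r ≡ mapT σ κ r
mapM-sub : ∀ σ {s ρ κ} → (∀ n r → mapL (s n) ρ r ≡ κ n r) → ∀ m → mapM (subT s σ) ρ m ≡ mapM σ κ m
mapL-sub (tv n) e r = e n r
mapL-sub (st U) e r = mapS-sub U e r
mapS-sub (σ ⊸ τ) e (fn m r) = cong₂ fn (mapM-sub σ e m) (mapT-sub τ e r)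
mapS-sub (σ ⊸ τ) e (pt i) = refl
mapS-sub (σ ⊸ τ) e un = refl
mapS-sub (∀' U) {s} e r = mapS-sub U (λ { zero r → refl ; (suc n) r → trans (mapL-ren (s n) (λ _ _ → refl) r) (e n r) }) r
mapT-sub (lin A) e r = mapL-sub A e r
mapT-sub (! σ) e r = refl
mapM-sub σ e nothing = refl
mapM-sub σ e (just r) = cong just (mapT-sub σ e r)

cwL-zero : ∀ A {ω} → (∀ n → ω n ≡ 0) → cwL ω A ≡ 0
cwS-zero : ∀ U {ω} → (∀ n → ω n ≡ 0) → cwS ω U ≡ 0
cwT-zero : ∀ σ {ω} → (∀ n → ω n ≡ 0) → cwT ω σ ≡ 0
cwL-zero (tv n) e = e n
cwL-zero (st U) e = cwS-zero U e
cwS-zero (σ ⊸ τ) e = cong₂ _+_ (cwT-zero σ e) (cwT-zero τ e)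
cwS-zero (∀' U) e = cwS-zero U (λ { zero → refl ; (suc n) → e n })
cwT-zero (lin A) e = cwL-zero A e
cwT-zero (! σ) e = refl

cwL-ren : ∀ A {f ω κ} → (∀ n → ω (f n) ≡ κ n) → cwL ω (renL f A) ≡ cwL κ A
cwS-ren : ∀ U {f ω κ} → (∀ n → ω (f n) ≡ κ n) → cwS ω (renS f U) ≡ cwS κ U
cwT-ren : ∀ σ {f ω κ} → (∀ n → ω (f n) ≡ κ n) → cwT ω (renT f σ) ≡ cwT κ σ
cwL-ren (tv n) e = e n
cwL-ren (st U) e = cwS-ren U e
cwS-ren (σ ⊸ τ) e = cong₂ _+_ (cwT-ren σ e) (cwT-ren τ e)
cwS-ren (∀' U) e = cwS-ren U (λ { zero → refl ; (suc n) → e n })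
cwT-ren (lin A) e = cwL-ren A e
cwT-ren (! σ) e = refl

cwL-sub : ∀ A {s ω κ} → (∀ n → cwL ω (s n) ≡ κ n) → cwL ω (subL s A) ≡ cwL κ A
cwS-sub : ∀ U {s ω κ} → (∀ n → cwL ω (s n) ≡ κ n) → cwS ω (subS s U) ≡ cwS κ U
cwT-sub : ∀ σ {s ω κ} → (∀ n → cwL ω (s n) ≡ κ n) → cwT ω (subT s σ) ≡ cwT κ σ
cwL-sub (tv n) e = e n
cwL-sub (st U) e = cwS-sub U e
cwS-sub (σ ⊸ τ) e = cong₂ _+_ (cwT-sub σ e) (cwT-sub τ e)
cwS-sub (∀' U) {s} e = cwS-sub U (λ { zero → refl ; (suc n) → trans (cwL-ren (s n) (λ _ → refl)) (e n) })
cwT-sub (lin A) e = cwL-sub A e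
cwT-sub (! σ) e = refl

cnt-sub : ∀ s U → cnt (subS (extS s) U) ≡ cnt U
cnt-sub s U = cwS-sub U (λ { zero → refl ; (suc n) → trans (cwL-ren (s n) (λ _ → refl)) (cwL-zero (s n) (λ _ → refl)) })

cnt-ren : ∀ f U → cnt (renS (extR f) U) ≡ cnt U
cnt-ren f U = cwS-ren U (λ { zero → refl ; (suc n) → refl })

Col-≡ : ∀ {U V} → cnt U ≡ cnt V → ∀ r → Col U r → Col V r
Col-≡ e r (i , p , q) = i , ≤-trans p (≤-reflexive e) , q

HasL-map : ∀ A {E E' ρ} → (∀ n r → E n r → E' n (ρ n r)) → ∀ r → HasL A E r → HasL A E' (mapL A ρ r)
HasS-map : ∀ U {E E' ρ} → (∀ n r → E n r → E' n (ρ n r)) → ∀ r → HasS U E r → HasS U E' (mapS U ρ r)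
HasT-map : ∀ σ {E E' ρ} → (∀ n r → E n r → E' n (ρ n r)) → ∀ r → HasT σ E r → HasT σ E' (mapT σ ρ r)
HasM-map : ∀ σ {E E' ρ} → (∀ n r → E n r → E' n (ρ n r)) → ∀ m → HasM σ E m → HasM σ E' (mapM σ ρ m)
HasL-map (tv n) f r h = f n r h
HasL-map (st U) f r h = HasS-map U f r h
HasS-map (σ ⊸ τ) f (fn m r) (h , h') = HasM-map σ f m h , HasT-map τ f r h'
HasS-map (∀' U) f r h = HasS-map U (λ { zero r c → c ; (suc n) r c → f n r c }) r h
HasT-map (lin A) f r h = HasL-map A f r h
HasT-map (! σ) f r h = h
HasM-map σ f nothing h = tt
HasM-map σ f (just r) h = HasT-map σ f r h

HasL-mono : ∀ A {E E' : PWeb} → (∀ n r → E n r → E' n r) → ∀ r → HasL A E r → HasL A E' r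
HasL-mono A {E' = E'} f r h = subst (HasL A E') (mapL-id A (λ _ _ → refl) r) (HasL-map A f r h)

HasT-mono : ∀ σ {E E' : PWeb} → (∀ n r → E n r → E' n r) → ∀ r → HasT σ E r → HasT σ E' r
HasT-mono σ {E' = E'} f r h = subst (HasT σ E') (mapT-id σ (λ _ _ → refl) r) (HasT-map σ f r h)

HasL-sub : ∀ A {s E E'} → (∀ n r → HasL (s n) E r → E' n r) → ∀ r → HasL (subL s A) E r → HasL A E' r
HasS-sub : ∀ U {s E E'} → (∀ n r → HasL (s n) E r → E' n r) → ∀ r → HasS (subS s U) E r → HasS U E' r
HasT-sub : ∀ σ {s E E'} → (∀ n r → HasL (s n) E r → E' n r) → ∀ r → HasT (subT s σ) E r → HasT σ E' r
HasM-sub : ∀ σ {s E E'} → (∀ n r → HasL (s n) E r → E' n r) → ∀ m → HasM (subT s σ) E m → HasM σ E' m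
HasL-ren : ∀ A {f E E'} → (∀ n r → E (f n) r → E' n r) → ∀ r → HasL (renL f A) E r → HasL A E' r
HasS-ren : ∀ U {f E E'} → (∀ n r → E (f n) r → E' n r) → ∀ r → HasS (renS f U) E r → HasS U E' r
HasT-ren : ∀ σ {f E E'} → (∀ n r → E (f n) r → E' n r) → ∀ r → HasT (renT f σ) E r → HasT σ E' r
HasM-ren : ∀ σ {f E E'} → (∀ n r → E (f n) r → E' n r) → ∀ m → HasM (renT f σ) E m → HasM σ E' m
HasL-ren (tv n) e r h = e n r h
HasL-ren (st U) e r h = HasS-ren U e r h
HasS-ren (σ ⊸ τ) e (fn m r) (h , h') = HasM-ren σ e m h , HasT-ren τ e r h'
HasS-ren (∀' U) {f} e r h = HasS-ren U (λ { zero r c → Col-≡ {renS (extR f) U} {U} (cnt-ren f U) r c ; (suc n) r c → e n r c }) r h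
HasT-ren (lin A) e r h = HasL-ren A e r h
HasT-ren (! σ) e r h = h
HasM-ren σ e nothing h = tt
HasM-ren σ e (just r) h = HasT-ren σ e r h
HasL-sub (tv n) e r h = e n r h
HasL-sub (st U) e r h = HasS-sub U e r h
HasS-sub (σ ⊸ τ) e (fn m r) (h , h') = HasM-sub σ e m h , HasT-sub τ e r h'
HasS-sub (∀' U) {s} e r h = HasS-sub U (λ { zero r c → Col-≡ {subS (extS s) U} {U} (cnt-sub s U) r c
                                       ; (suc n) r c → e n r (HasL-ren (s n) (λ _ _ h → h) r c) }) r h
HasT-sub (lin A) e r h = HasL-sub A e r h
HasT-sub (! σ) e r h = h
HasM-sub σ e nothing h = tt
HasM-sub σ e (just r) h = HasT-sub σ e r h

HasL-sub⁻ : ∀ A {s E E'} → (∀ n r → E' n r → HasL (s n) E r) → ∀ r → HasL A E' r → HasL (subL s A) E r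
HasS-sub⁻ : ∀ U {s E E'} → (∀ n r → E' n r → HasL (s n) E r) → ∀ r → HasS U E' r → HasS (subS s U) E r
HasT-sub⁻ : ∀ σ {s E E'} → (∀ n r → E' n r → HasL (s n) E r) → ∀ r → HasT σ E' r → HasT (subT s σ) E r
HasM-sub⁻ : ∀ σ {s E E'} → (∀ n r → E' n r → HasL (s n) E r) → ∀ m → HasM σ E' m → HasM (subT s σ) E m
HasL-ren⁻ : ∀ A {f E E'} → (∀ n r → E' n r → E (f n) r) → ∀ r → HasL A E' r → HasL (renL f A) E r
HasS-ren⁻ : ∀ U {f E E'} → (∀ n r → E' n r → E (f n) r) → ∀ r → HasS U E' r → HasS (renS f U) E r
HasT-ren⁻ : ∀ σ {f E E'} → (∀ n r → E' n r → E (f n) r) → ∀ r → HasT σ E' r → HasT (renT f σ) E r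
HasM-ren⁻ : ∀ σ {f E E'} → (∀ n r → E' n r → E (f n) r) → ∀ m → HasM σ E' m → HasM (renT f σ) E m
HasL-ren⁻ (tv n) e r h = e n r h
HasL-ren⁻ (st U) e r h = HasS-ren⁻ U e r h
HasS-ren⁻ (σ ⊸ τ) e (fn m r) (h , h') = HasM-ren⁻ σ e m h , HasT-ren⁻ τ e r h'
HasS-ren⁻ (∀' U) {f} e r h = HasS-ren⁻ U (λ { zero r c → Col-≡ {U} {renS (extR f) U} (sym (cnt-ren f U)) r c ; (suc n) r c → e n r c }) r h
HasT-ren⁻ (lin A) e r h = HasL-ren⁻ A e r h
HasT-ren⁻ (! σ) e r h = h
HasM-ren⁻ σ e nothing h = tt
HasM-ren⁻ σ e (just r) h = HasT-ren⁻ σ e r h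
HasL-sub⁻ (tv n) e r h = e n r h
HasL-sub⁻ (st U) e r h = HasS-sub⁻ U e r h
HasS-sub⁻ (σ ⊸ τ) e (fn m r) (h , h') = HasM-sub⁻ σ e m h , HasT-sub⁻ τ e r h'
HasS-sub⁻ (∀' U) {s} e r h = HasS-sub⁻ U (λ { zero r c → Col-≡ {U} {subS (extS s) U} (sym (cnt-sub s U)) r c
                                       ; (suc n) r c → HasL-ren⁻ (s n) (λ _ _ h → h) r (e n r c) }) r h
HasT-sub⁻ (lin A) e r h = HasL-sub⁻ A e r h
HasT-sub⁻ (! σ) e r h = h
HasM-sub⁻ σ e nothing h = tt
HasM-sub⁻ σ e (just r) h = HasT-sub⁻ σ e r h

mapL-congH : ∀ A {E : PWeb} {ρ ρ'} → (∀ n r → E n r → ρ n r ≡ ρ' n r) → ∀ r → HasL A E r → mapL A ρ r ≡ mapL A ρ' r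
mapS-congH : ∀ U {E : PWeb} {ρ ρ'} → (∀ n r → E n r → ρ n r ≡ ρ' n r) → ∀ r → HasS U E r → mapS U ρ r ≡ mapS U ρ' r
mapT-congH : ∀ σ {E : PWeb} {ρ ρ'} → (∀ n r → E n r → ρ n r ≡ ρ' n r) → ∀ r → HasT σ E r → mapT σ ρ r ≡ mapT σ ρ' r
mapM-congH : ∀ σ {E : PWeb} {ρ ρ'} → (∀ n r → E n r → ρ n r ≡ ρ' n r) → ∀ m → HasM σ E m → mapM σ ρ m ≡ mapM σ ρ' m
mapL-congH (tv n) f r h = f n r h
mapL-congH (st U) f r h = mapS-congH U f r h
mapS-congH (σ ⊸ τ) f (fn m r) (h , h') = cong₂ fn (mapM-congH σ f m h) (mapT-congH τ f r h')
mapS-congH (∀' U) f r h = mapS-congH U (λ { zero r _ → refl ; (suc n) r c → f n r c }) r h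
mapT-congH (lin A) f r h = mapL-congH A f r h
mapT-congH (! σ) f r h = refl
mapM-congH σ f nothing h = refl
mapM-congH σ f (just r) h = cong just (mapT-congH σ f r h)

Pick : Set
Pick = ℕ → Raw → List Raw

lvL : LTy → Pick → Raw → List Raw
lvS : STy → Pick → Raw → List Raw
lvT : Ty → Pick → Raw → List Raw
lvM : Ty → Pick → Maybe Raw → List Raw
lvL (tv n) ω r = ω n r
lvL (st U) ω r = lvS U ω r
lvS (σ ⊸ τ) ω (fn m r) = lvM σ ω m ++ lvT τ ω r
lvS (σ ⊸ τ) ω (pt i) = []
lvS (σ ⊸ τ) ω un = []
lvS (∀' U) ω r = lvS U ((λ _ → []) ∷ᶠ ω) r
lvT (lin A) ω r = lvL A ω r
lvT (! σ) ω r = []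
lvM σ ω nothing = []
lvM σ ω (just r) = lvT σ ω r

-- An argument is used through at most one token, so each occurrence of a variable in the type
-- accounts for at most one leaf.
lvL-len : ∀ A {ω κ} → (∀ n r → length (ω n r) ≤ κ n) → ∀ r → length (lvL A ω r) ≤ cwL κ A
lvS-len : ∀ U {ω κ} → (∀ n r → length (ω n r) ≤ κ n) → ∀ r → length (lvS U ω r) ≤ cwS κ U
lvT-len : ∀ σ {ω κ} → (∀ n r → length (ω n r) ≤ κ n) → ∀ r → length (lvT σ ω r) ≤ cwT κ σ
lvM-len : ∀ σ {ω κ} → (∀ n r → length (ω n r) ≤ κ n) → ∀ m → length (lvM σ ω m) ≤ cwT κ σ
lvL-len (tv n) f r = f n r
lvL-len (st U) f r = lvS-len U f r
lvS-len (σ ⊸ τ) {ω} f (fn m r) = ≤-trans (≤-reflexive (length-++ (lvM σ ω m))) (+-mono-≤ (lvM-len σ f m) (lvT-len τ f r))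
lvS-len (σ ⊸ τ) f (pt i) = z≤n
lvS-len (σ ⊸ τ) f un = z≤n
lvS-len (∀' U) f r = lvS-len U (λ { zero r → z≤n ; (suc n) r → f n r }) r
lvT-len (lin A) f r = lvL-len A f r
lvT-len (! σ) f r = z≤n
lvM-len σ f nothing = z≤n
lvM-len σ f (just r) = lvT-len σ f r

Agr : (Raw → Set) → Pick → RMap → RMap → Set
Agr P ω ρ ρ' = ∀ n r → All P (ω n r) → ρ n r ≡ ρ' n r

agr-∷ : ∀ {P ω ρ ρ'} → Agr P ω ρ ρ' → Agr P ((λ _ → []) ∷ᶠ ω) (id ∷ᶠ ρ) (id ∷ᶠ ρ')
agr-∷ f zero    r a = refl
agr-∷ f (suc n) r a = f n r a

mapL-agr : ∀ A {P ω ρ ρ'} → Agr P ω ρ ρ' → ∀ r → All P (lvL A ω r) → mapL A ρ r ≡ mapL A ρ' r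
mapS-agr : ∀ U {P ω ρ ρ'} → Agr P ω ρ ρ' → ∀ r → All P (lvS U ω r) → mapS U ρ r ≡ mapS U ρ' r
mapT-agr : ∀ σ {P ω ρ ρ'} → Agr P ω ρ ρ' → ∀ r → All P (lvT σ ω r) → mapT σ ρ r ≡ mapT σ ρ' r
mapM-agr : ∀ σ {P ω ρ ρ'} → Agr P ω ρ ρ' → ∀ m → All P (lvM σ ω m) → mapM σ ρ m ≡ mapM σ ρ' m
mapL-agr (tv n) f r a = f n r a
mapL-agr (st U) f r a = mapS-agr U f r a
mapS-agr (σ ⊸ τ) {ω = ω} f (fn m r) a = cong₂ fn (mapM-agr σ f m (++⁻ˡ (lvM σ ω m) a)) (mapT-agr τ f r (++⁻ʳ (lvM σ ω m) a))
mapS-agr (σ ⊸ τ) f (pt i) a = refl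
mapS-agr (σ ⊸ τ) f un a = refl
mapS-agr (∀' U) f r a = mapS-agr U (agr-∷ f) r a
mapT-agr (lin A) f r a = mapL-agr A f r a
mapT-agr (! σ) f r a = refl
mapM-agr σ f nothing a = refl
mapM-agr σ f (just r) a = cong just (mapT-agr σ f r a)

-- Interpretation of typing derivations.
-- γ offers at most one token for each linear variable, θ is a relation for each duplicable one.

inst : (ℕ → Raw) → RMap
inst φ zero    (pt i) = φ i
inst φ zero    r = r
inst φ (suc n) r = r

⟦_⟧ : ∀ {C t σ} → C ⊢ t ∶ σ → PWeb → PWeb → (ℕ → Maybe Raw) → Raw → Set
⟦ ax-Γ {x = x} _ ⟧ E θ γ b = γ x ≡ just b
⟦ ax-Θ {x = x} _ ⟧ E θ γ b = θ x b
⟦ ⊸I {A = A} d ⟧ E θ γ (fn m b) = HasM (lin A) E m × ⟦ d ⟧ E ((λ _ → ⊥) ∷ᶠ θ) (m ∷ᶠ γ) b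
⟦ ⊸I d ⟧ E θ γ _ = ⊥
⟦ ⊸I! {σ = σ} d ⟧ E θ γ (fn m b) = HasM (! σ) E m × ⟦ d ⟧ E ((λ _ → ⊥) ∷ᶠ θ) (nothing ∷ᶠ γ) b
⟦ ⊸I! d ⟧ E θ γ _ = ⊥
⟦ ⊸E {σ = σ} _ d d' ⟧ E θ γ b = Σ (Maybe Raw) λ m → HasM σ E m × ⟦ d ⟧ E θ γ (fn m b) × AllM (⟦ d' ⟧ E θ γ) m
⟦ ∀I {S = U} d ⟧ E θ γ b = ⟦ d ⟧ (Col U ∷ᶠ E) θ γ b
⟦ ∀E {S = U} A d ⟧ E θ γ b = Σ Raw λ p → Σ (ℕ → Raw) λ φ → HasS (∀' U) E p × (∀ i → i ≤ cnt U → HasL A E (φ i)) × ⟦ d ⟧ E θ γ p × mapS U (inst φ) p ≡ b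
⟦ !I _ _ ⟧ E θ γ b = b ≡ un

Θ-map : Ctx → RMap → PWeb → PWeb → Set
Θ-map C ρ θ θ' = ∀ x {σ} r → C x ≡ inΘ σ → θ x r → θ' x (mapT σ ρ r)

Γ-map : Ctx → RMap → (ℕ → Maybe Raw) → (ℕ → Maybe Raw) → Set
Γ-map C ρ γ γ' = ∀ x {A} → C x ≡ inΓ A → γ' x ≡ mapM (lin A) ρ (γ x)

sp-Γ₁ : ∀ {s s₁ s₂ A} → SplitSlot s s₁ s₂ → s₁ ≡ inΓ A → s ≡ inΓ A
sp-Γ₁ sp-Γl refl = refl
sp-Γ₂ : ∀ {s s₁ s₂ A} → SplitSlot s s₁ s₂ → s₂ ≡ inΓ A → s ≡ inΓ A
sp-Γ₂ sp-Γr refl = refl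
sp-Θ₁ : ∀ {s s₁ s₂ σ} → SplitSlot s s₁ s₂ → s₁ ≡ inΘ σ → s ≡ inΘ σ
sp-Θ₁ sp-Θ refl = refl
sp-Θ₂ : ∀ {s s₁ s₂ σ} → SplitSlot s s₁ s₂ → s₂ ≡ inΘ σ → s ≡ inΘ σ
sp-Θ₂ sp-Θ refl = refl

sh-Γ : ∀ {s A} → shiftSlot s ≡ inΓ A → Σ LTy λ B → s ≡ inΓ B × A ≡ renL suc B
sh-Γ {inΓ B} refl = B , refl , refl

sh-Θ : ∀ {s σ} → shiftSlot s ≡ inΘ σ → Σ Ty λ τ → s ≡ inΘ τ × σ ≡ renT suc τ
sh-Θ {inΘ B} refl = B , refl , refl

sh-Θ-map : ∀ {C ρ ρ₀ θ θ'} → Θ-map C ρ θ θ' → Θ-map (shiftCtx C) (ρ₀ ∷ᶠ ρ) θ θ'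
sh-Θ-map {C} {θ' = θ'} f x r q t with sh-Θ {C x} q
... | τ , q' , refl = subst (θ' x) (sym (mapT-ren τ (λ _ _ → refl) r)) (f x r q' t)

sh-Γ-map : ∀ {C ρ ρ₀ γ γ'} → Γ-map C ρ γ γ' → Γ-map (shiftCtx C) (ρ₀ ∷ᶠ ρ) γ γ'
sh-Γ-map {C} {γ = γ} f x q with sh-Γ {C x} q
... | A , q' , refl = trans (f x q') (sym (mapM-ren (lin A) (λ _ _ → refl) (γ x)))

-- Naturality, the semantic form of parametricity: a derivation treats the tokens of type variables
-- as black boxes, so any maps between the webs of these variables carry its tokens along.
-- Instantiating patterns and doubling points are both instances.
func : ∀ {C t σ} (d : C ⊢ t ∶ σ) {E E' ρ θ θ' γ γ'} → (∀ n r → E n r → E' n (ρ n r)) → Θ-map C ρ θ θ' → Γ-map C ρ γ γ' →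
       ∀ b → ⟦ d ⟧ E θ γ b → ⟦ d ⟧ E' θ' γ' (mapT σ ρ b)
func (ax-Γ {x = x} {A} p) {ρ = ρ} e f g b h = trans (g x p) (cong (mapM (lin A) ρ) h)
func (ax-Θ {x = x} p) e f g b h = f x b p h
func (⊸I {A = A} d) e f g (fn m b) (h , h') = HasM-map (lin A) e m h ,
   func d e (λ { (suc x) r q t → f x r q t }) (λ { zero refl → refl ; (suc x) q → g x q }) b h'
func (⊸I! d) e f g (fn m b) (h , h') = HasM-map (! _) e m h ,
   func d e (λ { (suc x) r q t → f x r q t }) (λ { (suc x) q → g x q }) b h'
func (⊸E {σ = σ} p d d') {ρ = ρ} e f g b (m , h , h₁ , h₂) = mapM σ ρ m , HasM-map σ e m h ,
   func d e (λ x r q → f x r (sp-Θ₁ (p x) q)) (λ x q → g x (sp-Γ₁ (p x) q)) (fn m b) h₁ , go m h₂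
  where
  go : ∀ m → AllM _ m → AllM _ (mapM σ ρ m)
  go nothing  _ = tt
  go (just a) h = func d' e (λ x r q → f x r (sp-Θ₂ (p x) q)) (λ x q → g x (sp-Γ₂ (p x) q)) a h
func (∀I d) {ρ = ρ} {θ' = θ'} e f g b h = func d (λ { zero r c → c ; (suc n) r c → e n r c }) (sh-Θ-map {ρ = ρ} {θ' = θ'} f) (sh-Γ-map g) b h
-- The colours of the pattern are left alone; its leaves at free type variables and the values of
-- its colours are moved.
func (∀E {S = U} A d) {E} {ρ = ρ} e f g b (p , φ , hp , hφ , h , q) =
   mapS U (id ∷ᶠ ρ) p , (λ i → mapL A ρ (φ i)) , HasS-map (∀' U) e p hp , (λ i l → HasL-map A e _ (hφ i l)) , func d e f g p h ,
   trans (mapS-∘ U (λ _ _ → refl) p)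
     (trans (mapS-congH U {E = Col U ∷ᶠ E} (λ { zero r (i , _ , refl) → refl ; (suc n) r _ → refl }) p hp)
       (trans (sym (mapS-∘ U {mapL A ρ ∷ᶠ ρ} {inst φ} (λ _ _ → refl) p))
         (trans (sym (mapS-sub U {κ = mapL A ρ ∷ᶠ ρ} (λ { zero r → refl ; (suc n) r → refl }) (mapS U (inst φ) p))) (cong (mapS (instS U A) ρ) q))))
func (!I _ d) e f g b h = h

mono : ∀ {C t σ} (d : C ⊢ t ∶ σ) {E E' θ θ' : PWeb} {γ γ'} → (∀ n r → E n r → E' n r) → (∀ x {σ} r → C x ≡ inΘ σ → θ x r → θ' x r) →
       (∀ x {A} → C x ≡ inΓ A → γ' x ≡ γ x) → ∀ b → ⟦ d ⟧ E θ γ b → ⟦ d ⟧ E' θ' γ' b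
mono {σ = σ} d {E' = E'} {θ' = θ'} {γ = γ} {γ'} e f g b h = subst (⟦ d ⟧ E' θ' γ') (mapT-id σ (λ _ _ → refl) b)
  (func d {ρ = λ _ r → r} e (λ x {τ} r q t → subst (θ' x) (sym (mapT-id τ (λ _ _ → refl) r)) (f x r q t))
     (λ x {A} q → trans (g x q) (sym (mapM-id (lin A) (λ _ _ → refl) (γ x)))) b h)

_≟ᴿ_ : (a b : Raw) → Dec (a ≡ b)
_≟ᴹ_ : (a b : Maybe Raw) → Dec (a ≡ b)
pt i ≟ᴿ pt j with i ℕ.≟ j
... | yes refl = yes refl
... | no n = no λ { refl → n refl }
pt i ≟ᴿ un = no λ ()
pt i ≟ᴿ fn _ _ = no λ ()
un ≟ᴿ pt _ = no λ ()
un ≟ᴿ un = yes refl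
un ≟ᴿ fn _ _ = no λ ()
fn _ _ ≟ᴿ pt _ = no λ ()
fn _ _ ≟ᴿ un = no λ ()
fn m a ≟ᴿ fn m' b with m ≟ᴹ m' | a ≟ᴿ b
... | yes refl | yes refl = yes refl
... | no n | _ = no λ { refl → n refl }
... | _ | no n = no λ { refl → n refl }
nothing ≟ᴹ nothing = yes refl
nothing ≟ᴹ just _ = no λ ()
just _ ≟ᴹ nothing = no λ ()
just a ≟ᴹ just b with a ≟ᴿ b
... | yes refl = yes refl
... | no n = no λ { refl → n refl }

-- Retraction: a token over any web is the image of a pattern whose colours number its leaves.

idx : Raw → List Raw → ℕ
idx r [] = 0
idx r (a ∷ as) with r ≟ᴿ a
... | yes _ = 0
... | no _ = suc (idx r as)

nth : Raw → ℕ → List Raw → Raw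
nth z _ [] = z
nth z zero (a ∷ as) = a
nth z (suc i) (a ∷ as) = nth z i as

idx-≤ : ∀ r as → idx r as ≤ length as
idx-≤ r [] = z≤n
idx-≤ r (a ∷ as) with r ≟ᴿ a
... | yes _ = z≤n
... | no _ = s≤s (idx-≤ r as)

nth-idx : ∀ {z r} as → r ∈ as → nth z (idx r as) as ≡ r
nth-idx {z} {r} (a ∷ as) m with r ≟ᴿ a
nth-idx (a ∷ as) m | yes refl = refl
nth-idx (a ∷ as) (here refl) | no n = ⊥-elim (n refl)
nth-idx (a ∷ as) (there m) | no n = nth-idx as m

nth-All : ∀ {P : Raw → Set} {z} → P z → ∀ i as → All P as → P (nth z i as)
nth-All pz i [] [] = pz
nth-All pz zero (a ∷ as) (p ∷ _) = p
nth-All pz (suc i) (a ∷ as) (_ ∷ ps) = nth-All pz i as ps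

lvL-Has : ∀ A {E : PWeb} {P : Raw → Set} {ω} → (∀ n r → E n r → All P (ω n r)) → ∀ r → HasL A E r → All P (lvL A ω r)
lvS-Has : ∀ U {E : PWeb} {P : Raw → Set} {ω} → (∀ n r → E n r → All P (ω n r)) → ∀ r → HasS U E r → All P (lvS U ω r)
lvT-Has : ∀ σ {E : PWeb} {P : Raw → Set} {ω} → (∀ n r → E n r → All P (ω n r)) → ∀ r → HasT σ E r → All P (lvT σ ω r)
lvM-Has : ∀ σ {E : PWeb} {P : Raw → Set} {ω} → (∀ n r → E n r → All P (ω n r)) → ∀ m → HasM σ E m → All P (lvM σ ω m)
lvL-Has (tv n) f r h = f n r h
lvL-Has (st U) f r h = lvS-Has U f r h
lvS-Has (σ ⊸ τ) f (fn m r) (h , h') = ++⁺ (lvM-Has σ f m h) (lvT-Has τ f r h')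
lvS-Has (∀' U) f r h = lvS-Has U (λ { zero r _ → [] ; (suc n) r c → f n r c }) r h
lvT-Has (lin A) f r h = lvL-Has A f r h
lvT-Has (! σ) f r h = []
lvM-Has σ f nothing h = []
lvM-Has σ f (just r) h = lvT-Has σ f r h

Θ-map-id : ∀ C θ → Θ-map C (λ _ r → r) θ θ
Θ-map-id C θ x {σ} r q t = subst (θ x) (sym (mapT-id σ (λ _ _ → refl) r)) t

Γ-map-id : ∀ C γ → Γ-map C (λ _ r → r) γ γ
Γ-map-id C γ x {A} q = sym (mapM-id (lin A) (λ _ _ → refl) (γ x))

retract : ∀ {C t} U (d : shiftCtx C ⊢ t ∶ lin (st U)) {E : PWeb} {Q : Raw → Set} {θ γ z} b → Q z → HasS U (Q ∷ᶠ E) b → ⟦ d ⟧ (Q ∷ᶠ E) θ γ b →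
          Σ Raw λ p → Σ (ℕ → Raw) λ φ → HasS (∀' U) E p × (∀ i → i ≤ cnt U → Q (φ i)) × ⟦ d ⟧ (Col U ∷ᶠ E) θ γ p × mapS U (inst φ) p ≡ b
retract {C} U d {E} {Q} {θ} {γ} {z} b qz hb h =
   -- Each leaf is replaced by the index of its first occurrence in the list of leaves, and `φ`
   -- reads that list. The extra value `z` answers for indices beyond the list.
   mapS U ρ b , φ , HasS-map U e b hb , (λ i _ → nth-All qz i ls allQ) ,
   func d e (sh-Θ-map {ρ₀ = ψ} {θ' = θ} (Θ-map-id C θ)) (sh-Γ-map (Γ-map-id C γ)) b h ,
   trans (mapS-∘ U {κ = κ} (λ { zero r → refl ; (suc n) r → refl }) b)
     (trans (mapS-agr U {P = _∈ ls} (λ { zero r (m ∷ _) → nth-idx ls m ; (suc n) r _ → refl }) b (All.tabulate id))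
            (mapS-id U {λ _ r → r} (λ _ _ → refl) b))
  where
  pick : Pick
  pick = (λ r → r ∷ []) ∷ᶠ λ _ _ → []
  ls = lvS U pick b
  ψ : Raw → Raw
  ψ r = pt (idx r ls)
  φ : ℕ → Raw
  φ i = nth z i ls
  ρ κ : RMap
  ρ = ψ ∷ᶠ λ _ r → r
  κ = (λ r → φ (idx r ls)) ∷ᶠ λ _ r → r
  len : length ls ≤ cnt U
  len = lvS-len U (λ { zero r → ≤-refl ; (suc n) r → z≤n }) b
  e : ∀ n r → (Q ∷ᶠ E) n r → (Col U ∷ᶠ E) n (ρ n r)
  e zero r _ = idx r ls , ≤-trans (idx-≤ r ls) len , refl
  e (suc n) r h = h
  allQ : All Q ls
  allQ = lvS-Has U (λ { zero r q → q ∷ [] ; (suc n) r _ → [] }) b hb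

-- Every type has some token over non-empty base webs. It is the value given to colours that do not
-- occur in a pattern.
dflL : LTy → Raw
dflS : STy → Raw
dflT : Ty → Raw
dflL (tv n) = pt 0
dflL (st U) = dflS U
dflS (σ ⊸ τ) = fn nothing (dflT τ)
dflS (∀' U) = dflS U
dflT (lin A) = dflL A
dflT (! σ) = un

dflL-Has : ∀ A {E : PWeb} → (∀ n → E n (pt 0)) → HasL A E (dflL A)
dflS-Has : ∀ U {E : PWeb} → (∀ n → E n (pt 0)) → HasS U E (dflS U)
dflT-Has : ∀ σ {E : PWeb} → (∀ n → E n (pt 0)) → HasT σ E (dflT σ)
dflL-Has (tv n) f = f n
dflL-Has (st U) f = dflS-Has U f
dflS-Has (σ ⊸ τ) f = tt , dflT-Has τ f
dflS-Has (∀' U) f = dflS-Has U (λ { zero → 0 , z≤n , refl ; (suc n) → f n })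
dflT-Has (lin A) f = dflL-Has A f
dflT-Has (! σ) f = refl

-- The model is exact along runs of the machine

record Web (Λ : Set) : Set where
  field
    N    : ℕ
    act  : Λ → ℕ → ℕ
    act< : ∀ a v → v < N → act a v < N
    x₀   : ℕ
    x₀<  : x₀ < N

  Pts : Raw → Set
  Pts r = Σ ℕ λ v → v < N × r ≡ pt v

  E₀ : PWeb
  E₀ _ = Pts

  E₀-0 : ∀ n → E₀ n (pt 0)
  E₀-0 n = 0 , ≤-trans (s≤s z≤n) x₀< , refl

  webs : TSub → PWeb
  webs η n = HasL (η n) E₀

  letterTok : Λ → Raw → Set
  letterTok a r = Σ ℕ λ v → v < N × r ≡ fn (just (pt v)) (pt (act a v))

chainΛ : {Λ : Set} → (Λ → Tm) → List Λ → Tm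
chainΛ φ []      = var 0
chainΛ φ (a ∷ u) = app (φ a) (chainΛ φ u)

module BoxSem (n : ℕ) {s Λ : Set} (W : Web Λ) where
  open Boxes n
  open Web W

  SemBox : ∀ {τ} → Box s Λ ⊥ τ → Raw → Set
  SemTh : ∀ {η a} → ThE s Λ ⊥ η a → Raw → Set
  SemBox (bx d η _ env) b = ⟦ d ⟧ (webs η) (λ x → SemTh (env x)) (λ _ → nothing) b
  SemBox (pr (S₀ _)) b = ⊥
  SemBox (pr (F₀ a)) b = letterTok a b
  SemBox (pr X₀) b = b ≡ pt x₀
  SemTh t∅ b = ⊥
  SemTh (th B _) b = SemBox B b

module Run (n : ℕ) {Λ : Set} (φ : Λ → Tm) where
  open Boxes n
  open Eval n {⊥} {Λ} {⊥} {⊥} {⊥} (λ ()) φ (λ ())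
  open Closures {⊥} {Λ} {⊥} {⊥} {⊥}
  
  open Res

  module Sem (W : Web Λ) where
    open Web W
    open BoxSem n {⊥} W public

    TokClo : ∀ {τ} → Clo τ → Raw → Set
    GOk : ∀ {η a} → Ent η a → Maybe Raw → Set
    θE : ∀ {η a} → Ent η a → Raw → Set
    TokClo (clo {τ = τ} d η _ env) b = HasT τ E₀ b × Σ (ℕ → Maybe Raw) λ γ → (∀ x → GOk (env x) (γ x)) × ⟦ d ⟧ (webs η) (λ x → θE (env x)) γ b
    TokClo (vbox _) b = b ≡ un
    GOk (eΓ k _) nothing = ⊤
    GOk (eΓ k _) (just a) = TokClo k a
    GOk _ m = ⊤
    θE (eΘ B _) b = SemBox B b
    θE _ b = ⊥

    StkSem : ∀ {τ ρ} → Stk τ ρ → Raw → Raw → Set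
    StkSem nil b r = b ≡ r
    StkSem (arg k s) (fn m b) r = AllM (TokClo k) m × StkSem s b r
    StkSem (arg k s) _ r = ⊥
    StkSem (tyap {U = U} A _ s) p r = Σ (ℕ → Raw) λ φ → (∀ i → i ≤ cnt U → HasL A E₀ (φ i)) × StkSem s (mapS U (inst φ) p) r

    StSem : ∀ {C t σ} → C ⊢ t ∶ σ → (η : TSub) → ∀ {τ ρ} → Env η C → Stk τ ρ → Raw → Set
    StSem d η {τ} env s r = Σ Raw λ b → HasT τ E₀ b × (Σ (ℕ → Maybe Raw) λ γ → (∀ x → GOk (env x) (γ x)) × ⟦ d ⟧ (webs η) (λ x → θE (env x)) γ b) × StkSem s b r

    CloSt : ∀ {τ ρ} → Clo τ → Stk τ ρ → Raw → Set
    CloSt k s r = Σ Raw λ b → TokClo k b × StkSem s b r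

    BoxSt : ∀ {τ ρ} → Box ⊥ Λ ⊥ τ → Stk τ ρ → Raw → Set
    BoxSt {τ} B s r = Σ Raw λ b → HasT τ E₀ b × SemBox B b × StkSem s b r

    GOk-Γ : ∀ {η a A m b} (E : Ent η a) (q : a ≡ inΓ A) → GOk E m → m ≡ just b → TokClo (proj₁ (proj₂ (getΓ E q))) b
    GOk-Γ (eΓ k _) refl h refl = h

    GOk-Γ⁻ : ∀ {η a A b} (E : Ent η a) (q : a ≡ inΓ A) → TokClo (proj₁ (proj₂ (getΓ E q))) b → GOk E (just b)
    GOk-Γ⁻ (eΓ k _) refl h = h

    GOk-nothing : ∀ {η a} (E : Ent η a) → GOk E nothing
    GOk-nothing e∅ = tt
    GOk-nothing (eΓ _ _) = tt
    GOk-nothing (eΔ _ _) = tt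
    GOk-nothing (eΘ _ _) = tt

    θE-Θ : ∀ {η a σ b} (E : Ent η a) (q : a ≡ inΘ σ) → θE E b → SemBox (proj₁ (proj₂ (getΘ E q))) b
    θE-Θ (eΘ B _) refl h = h

    θE-Θ⁻ : ∀ {η a σ b} (E : Ent η a) (q : a ≡ inΘ σ) → SemBox (proj₁ (proj₂ (getΘ E q))) b → θE E b
    θE-Θ⁻ (eΘ B _) refl h = h

    single : ℕ → Raw → ℕ → Maybe Raw
    single zero    b zero    = just b
    single zero    b (suc x) = nothing
    single (suc k) b zero    = nothing
    single (suc k) b (suc x) = single k b x

    single-at : ∀ k b → single k b k ≡ just b
    single-at zero    b = refl
    single-at (suc k) b = single-at k b

    single-ok : ∀ {η C} k b (env : Env η C) → GOk (env k) (just b) → ∀ x → GOk (env x) (single k b x)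
    single-ok zero    b env h zero    = h
    single-ok zero    b env h (suc x) = GOk-nothing (env (suc x))
    single-ok (suc k) b env h zero    = GOk-nothing (env 0)
    single-ok {η} {C} (suc k) b env h (suc x) = single-ok {η} {C ∘ suc} k b (λ x → env (suc x)) h x

    TokHas : ∀ {τ} (k : Clo τ) b → TokClo k b → HasT τ E₀ b
    TokHas (clo _ _ _ _) b (h , _) = h
    TokHas (vbox _) b h = h

    CloSt→ : ∀ {τ ρ C t σ η} {d : C ⊢ t ∶ σ} {e : τ ≡ subT η σ} {env : Env η C} {s : Stk τ ρ} {r} → CloSt (clo d η e env) s r → StSem d η env s r
    CloSt→ (b , (h , g) , q) = b , h , g , q

    CloSt← : ∀ {τ ρ C t σ η} {d : C ⊢ t ∶ σ} {e : τ ≡ subT η σ} {env : Env η C} {s : Stk τ ρ} {r} → StSem d η env s r → CloSt (clo d η e env) s r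
    CloSt← (b , h , g , q) = b , (h , g) , q

    semΓ→ : ∀ {C x A η τ ρ} (q : C x ≡ inΓ A) (env : Env η C) (s : Stk (lin (subL η A)) ρ) {r k e} →
            getΓ (env x) q ≡ (τ , k , e) → (s' : Stk τ ρ) → subst (λ τ → Stk τ ρ) e s' ≡ s → StSem (ax-Γ {x = x} q) η env s r → CloSt k s' r
    semΓ→ q env s eq s' refl (b , h , (γ , g , p) , h') with getΓ (env _) q | GOk-Γ (env _) q (g _) p
    semΓ→ q env s {e = refl} refl s' refl (b , h , (γ , g , p) , h') | _ | t = b , t , h'

    semΓ← : ∀ {C x A η τ ρ} (q : C x ≡ inΓ A) (env : Env η C) (s : Stk (lin (subL η A)) ρ) {r k e} →
            getΓ (env x) q ≡ (τ , k , e) → (s' : Stk τ ρ) → subst (λ τ → Stk τ ρ) e s' ≡ s → CloSt k s' r → StSem (ax-Γ {x = x} q) η env s r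
    semΓ← {x = x} q env s eq s' refl (b , t , h') with getΓ (env x) q | (λ b → GOk-Γ⁻ {b = b} (env x) q)
    semΓ← {x = x} q env s {e = refl} refl s' refl (b , t , h') | _ | f = b , TokHas _ b t , (single x b , single-ok x b env (f b t) , single-at x b) , h'

    semΘ→ : ∀ {C x σ η τ ρ} (q : C x ≡ inΘ σ) (env : Env η C) (s : Stk (subT η σ) ρ) {r k e} →
            getΘ (env x) q ≡ (τ , k , e) → (s' : Stk τ ρ) → subst (λ τ → Stk τ ρ) e s' ≡ s → StSem (ax-Θ {x = x} q) η env s r → BoxSt k s' r
    semΘ→ q env s eq s' refl (b , h , (γ , g , p) , h') with getΘ (env _) q | θE-Θ (env _) q p
    semΘ→ q env s {e = refl} refl s' refl (b , h , (γ , g , p) , h') | _ | t = b , h , t , h'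

    semΘ← : ∀ {C x σ η τ ρ} (q : C x ≡ inΘ σ) (env : Env η C) (s : Stk (subT η σ) ρ) {r k e} →
            getΘ (env x) q ≡ (τ , k , e) → (s' : Stk τ ρ) → subst (λ τ → Stk τ ρ) e s' ≡ s → BoxSt k s' r → StSem (ax-Θ {x = x} q) η env s r
    semΘ← {x = x} q env s eq s' refl (b , h , t , h') with getΘ (env x) q | (λ b → θE-Θ⁻ {b = b} (env x) q)
    semΘ← {x = x} q env s {e = refl} refl s' refl (b , h , t , h') | _ | f = b , h , ((λ _ → nothing) , (λ x → GOk-nothing (env x)) , f b t) , h'

    thE-θ : ∀ {η a} (E : ThE ⊥ Λ ⊥ η a) b → SemTh E b → θE (thE E) b
    thE-θ (th B _) b h = h
    thE-θ⁻ : ∀ {η a} (E : ThE ⊥ Λ ⊥ η a) b → θE (thE E) b → SemTh E b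
    thE-θ⁻ (th B _) b h = h

    not-Γ : ∀ {η a A} {X : Set} → ThE ⊥ Λ ⊥ η a → a ≡ inΓ A → X
    not-Γ t∅ ()
    not-Γ (th _ _) ()

    semBx→ : ∀ {C t σ η τ ρ} (d : C ⊢ t ∶ σ) (e : τ ≡ subT η σ) (env : ∀ x → ThE ⊥ Λ ⊥ η (C x)) (s : Stk τ ρ) {r} →
             BoxSt (bx d η e env) s r → StSem d η (λ x → thE (env x)) s r
    semBx→ d e env s (b , h , t , h') = b , h , ((λ _ → nothing) , (λ x → GOk-nothing (thE (env x))) ,
       mono d (λ _ _ h → h) (λ x r _ → thE-θ (env x) r) (λ _ _ → refl) b t) , h'

    semBx← : ∀ {C t σ η τ ρ} (d : C ⊢ t ∶ σ) (e : τ ≡ subT η σ) (env : ∀ x → ThE ⊥ Λ ⊥ η (C x)) (s : Stk τ ρ) {r} →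
             StSem d η (λ x → thE (env x)) s r → BoxSt (bx d η e env) s r
    semBx← d e env s (b , h , (γ , g , t) , h') = b , h ,
       mono d (λ _ _ h → h) (λ x r _ → thE-θ⁻ (env x) r) (λ x q → not-Γ (env x) q) b t , h'

    HasM-η : ∀ σ {η} m → HasM σ (webs η) m → HasM (subT η σ) E₀ m
    HasM-η σ m h = HasM-sub⁻ σ (λ _ _ h → h) m h

    HasM-η⁻ : ∀ σ {η} m → HasM (subT η σ) E₀ m → HasM σ (webs η) m
    HasM-η⁻ σ m h = HasM-sub σ (λ _ _ h → h) m h

    TokHasM : ∀ {τ} (k : Clo τ) m → AllM (TokClo k) m → HasM τ E₀ m
    TokHasM k nothing h = tt
    TokHasM k (just b) h = TokHas k b h

    semI→ : ∀ {C A t τ η ρ} (d : (inΓ A ∷ᶜ C) ⊢ t ∶ τ) (env : Env η C) (k : Clo (lin (subL η A))) (s : Stk (subT η τ) ρ) {r} →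
            StSem (⊸I d) η env (arg k s) r → StSem d η (eΓ k refl ∷ᵉ env) s r
    semI→ {A = A} d env k s (fn m b , (hm , hb) , (γ , g , hm' , t) , hk , h') = b , hb ,
       ((m ∷ᶠ γ) , (λ { zero → go m hk ; (suc x) → g x }) , mono d (λ _ _ h → h) (λ { (suc x) r _ h → h }) (λ _ _ → refl) b t) , h'
      where
      go : ∀ m → AllM (TokClo k) m → GOk (eΓ {A = A} k refl) m
      go nothing _ = tt
      go (just a) h = h

    semI← : ∀ {C A t τ η ρ} (d : (inΓ A ∷ᶜ C) ⊢ t ∶ τ) (env : Env η C) (k : Clo (lin (subL η A))) (s : Stk (subT η τ) ρ) {r} →
            StSem d η (eΓ k refl ∷ᵉ env) s r → StSem (⊸I d) η env (arg k s) r
    semI← {A = A} d env k s (b , hb , (γ , g , t) , h') = fn (γ 0) b , (TokHasM k (γ 0) k0 , hb) ,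
       ((γ ∘ suc) , (g ∘ suc) , HasM-η⁻ (lin A) (γ 0) (TokHasM k (γ 0) k0) ,
         mono d (λ _ _ h → h) (λ { (suc x) r _ h → h }) (λ { zero _ → refl ; (suc x) _ → refl }) b t) , k0 , h'
      where
      go : ∀ m → GOk (eΓ {A = A} k refl) m → AllM (TokClo k) m
      go nothing _ = tt
      go (just a) h = h
      k0 = go (γ 0) (g 0)

    semI!→ : ∀ {C a t τ η ρ τ₁} (d : (inΔ a ∷ᶜ C) ⊢ t ∶ τ) (env : Env η C) (k : Clo (! (subT η a))) B (e : τ₁ ≡ subT η a) (s : Stk (subT η τ) ρ) {r} →
            StSem (⊸I! d) η env (arg k s) r → StSem d η (eΔ B e ∷ᵉ env) s r
    semI!→ d env k B e s (fn m b , (hm , hb) , (γ , g , hm' , t) , hk , h') = b , hb ,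
       ((nothing ∷ᶠ γ) , (λ { zero → tt ; (suc x) → g x }) , mono d (λ _ _ h → h) (λ { (suc x) r _ h → h }) (λ _ _ → refl) b t) , h'

    semI!← : ∀ {C a t τ η ρ τ₁} (d : (inΔ a ∷ᶜ C) ⊢ t ∶ τ) (env : Env η C) (k : Clo (! (subT η a))) B (e : τ₁ ≡ subT η a) (s : Stk (subT η τ) ρ) {r} →
            StSem d η (eΔ B e ∷ᵉ env) s r → StSem (⊸I! d) η env (arg k s) r
    semI!← d env k B e s (b , hb , (γ , g , t) , h') = fn nothing b , (tt , hb) ,
       ((γ ∘ suc) , (g ∘ suc) , tt , mono d (λ _ _ h → h) (λ { (suc x) r _ h → h }) (λ { (suc x) _ → refl }) b t) , tt , h'

    GOk-L : ∀ {η a a₁ a₂} (p : SplitSlot a a₁ a₂) (E : Ent η a) m → GOk E m → GOk (splitL p E) m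
    GOk-L sp-none E m h = h
    GOk-L sp-Γl E m h = h
    GOk-L sp-Γr E m h = tt
    GOk-L sp-Δ E m h = h
    GOk-L sp-Θ E m h = h

    GOk-R : ∀ {η a a₁ a₂} (p : SplitSlot a a₁ a₂) (E : Ent η a) m → GOk E m → GOk (splitR p E) m
    GOk-R sp-none E m h = h
    GOk-R sp-Γl E m h = tt
    GOk-R sp-Γr E m h = h
    GOk-R sp-Δ E m h = h
    GOk-R sp-Θ E m h = h

    θE-L : ∀ {η a a₁ a₂ σ} (p : SplitSlot a a₁ a₂) (E : Ent η a) r → a₁ ≡ inΘ σ → θE E r → θE (splitL p E) r
    θE-L sp-Θ E r q h = h
    θE-R : ∀ {η a a₁ a₂ σ} (p : SplitSlot a a₁ a₂) (E : Ent η a) r → a₂ ≡ inΘ σ → θE E r → θE (splitR p E) r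
    θE-R sp-Θ E r q h = h
    θE-L⁻ : ∀ {η a a₁ a₂ σ} (p : SplitSlot a a₁ a₂) (E : Ent η a) r → a₁ ≡ inΘ σ → θE (splitL p E) r → θE E r
    θE-L⁻ sp-Θ E r q h = h
    θE-R⁻ : ∀ {η a a₁ a₂ σ} (p : SplitSlot a a₁ a₂) (E : Ent η a) r → a₂ ≡ inΘ σ → θE (splitR p E) r → θE E r
    θE-R⁻ sp-Θ E r q h = h

    -- A linear variable is live in one premise only, so the two premises can choose their tokens
    -- independently and the choices never clash. This makes the interpretation of application exact
    -- in both directions.
    merge : ∀ {a a₁ a₂} → SplitSlot a a₁ a₂ → Maybe Raw → Maybe Raw → Maybe Raw
    merge sp-Γl m m' = m
    merge sp-Γr m m' = m'
    merge _ m m' = nothing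

    merge-ok : ∀ {η a a₁ a₂} (p : SplitSlot a a₁ a₂) (E : Ent η a) m m' → GOk (splitL p E) m → GOk (splitR p E) m' → GOk E (merge p m m')
    merge-ok sp-none E m m' h h' = GOk-nothing E
    merge-ok sp-Γl E m m' h h' = h
    merge-ok sp-Γr E m m' h h' = h'
    merge-ok sp-Δ E m m' h h' = GOk-nothing E
    merge-ok sp-Θ E m m' h h' = GOk-nothing E

    merge-l : ∀ {a a₁ a₂ A} (p : SplitSlot a a₁ a₂) {m m'} → a₁ ≡ inΓ A → merge p m m' ≡ m
    merge-l sp-Γl q = refl
    merge-r : ∀ {a a₁ a₂ A} (p : SplitSlot a a₁ a₂) {m m'} → a₂ ≡ inΓ A → merge p m m' ≡ m'
    merge-r sp-Γr q = refl

    semE→ : ∀ {C C₁ C₂ t u σ τ η ρ} (p : Split C C₁ C₂) (d : C₁ ⊢ t ∶ lin (st (σ ⊸ τ))) (d' : C₂ ⊢ u ∶ σ) (env : Env η C) (s : Stk (subT η τ) ρ) {r} →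
            StSem (⊸E p d d') η env s r →
            StSem d η (λ x → splitL (p x) (env x)) (arg (clo d' η refl (λ x → splitR (p x) (env x))) s) r
    semE→ {σ = σ} {η = η} p d d' env s (b , hb , (γ , g , m , hm , t , t') , h') = fn m b , (HasM-η σ m hm , hb) ,
       (γ , (λ x → GOk-L (p x) (env x) _ (g x)) , mono d (λ _ _ h → h) (λ x r q → θE-L (p x) (env x) r q) (λ _ _ → refl) _ t) , go m hm t' , h'
      where
      go : ∀ m → HasM σ (webs η) m → AllM (⟦ d' ⟧ (webs η) (λ x → θE (env x)) γ) m → AllM (TokClo (clo d' η refl (λ x → splitR (p x) (env x)))) m
      go nothing _ _ = tt
      go (just a) h t' = HasM-η σ (just a) h , γ , (λ x → GOk-R (p x) (env x) _ (g x)) ,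
         mono d' (λ _ _ h → h) (λ x r q → θE-R (p x) (env x) r q) (λ _ _ → refl) _ t'

    semE← : ∀ {C C₁ C₂ t u σ τ η ρ} (p : Split C C₁ C₂) (d : C₁ ⊢ t ∶ lin (st (σ ⊸ τ))) (d' : C₂ ⊢ u ∶ σ) (env : Env η C) (s : Stk (subT η τ) ρ) {r} →
            StSem d η (λ x → splitL (p x) (env x)) (arg (clo d' η refl (λ x → splitR (p x) (env x))) s) r →
            StSem (⊸E p d d') η env s r
    semE← {σ = σ} {η = η} p d d' env s (fn nothing b , (hm , hb) , (γ , g , t) , _ , h') = b , hb ,
       ((λ x → merge (p x) (γ x) nothing) , (λ x → merge-ok (p x) (env x) (γ x) nothing (g x) (GOk-nothing (splitR (p x) (env x)))) , nothing , tt ,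
        mono d (λ _ _ h → h) (λ x r q → θE-L⁻ (p x) (env x) r q) (λ x q → merge-l (p x) q) _ t , tt) , h'
    semE← {σ = σ} {η = η} p d d' env s (fn (just a) b , (hm , hb) , (γ , g , t) , (ha , γ' , g' , t') , h') = b , hb ,
       ((λ x → merge (p x) (γ x) (γ' x)) , (λ x → merge-ok (p x) (env x) (γ x) (γ' x) (g x) (g' x)) , just a , HasM-η⁻ σ (just a) hm ,
        mono d (λ _ _ h → h) (λ x r q → θE-L⁻ (p x) (env x) r q) (λ x q → merge-l (p x) q) _ t ,
        mono d' (λ _ _ h → h) (λ x r q → θE-R⁻ (p x) (env x) r q) (λ x q → merge-r (p x) q) _ t') , h'

    GOk-sh : ∀ {η a} B (E : Ent η a) m → GOk E m → GOk (shiftE B E) m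
    GOk-sh B e∅ m h = tt
    GOk-sh B (eΓ _ _) nothing h = tt
    GOk-sh B (eΓ _ _) (just _) h = h
    GOk-sh B (eΔ _ _) m h = tt
    GOk-sh B (eΘ _ _) m h = tt
    GOk-sh⁻ : ∀ {η a} B (E : Ent η a) m → GOk (shiftE B E) m → GOk E m
    GOk-sh⁻ B e∅ m h = tt
    GOk-sh⁻ B (eΓ _ _) nothing h = tt
    GOk-sh⁻ B (eΓ _ _) (just _) h = h
    GOk-sh⁻ B (eΔ _ _) m h = tt
    GOk-sh⁻ B (eΘ _ _) m h = tt
    θE-sh : ∀ {η a} B (E : Ent η a) r → θE E r → θE (shiftE B E) r
    θE-sh B (eΘ _ _) r h = h
    θE-sh⁻ : ∀ {η a} B (E : Ent η a) r → θE (shiftE B E) r → θE E r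
    θE-sh⁻ B (eΘ _ _) r h = h

    webs-∷ : ∀ η A n r → (HasL A E₀ ∷ᶠ webs η) n r → webs (A ∷ᵗ η) n r
    webs-∷ η A zero    r h = h
    webs-∷ η A (suc n) r h = h
    webs-∷⁻ : ∀ η A n r → webs (A ∷ᵗ η) n r → (HasL A E₀ ∷ᶠ webs η) n r
    webs-∷⁻ η A zero    r h = h
    webs-∷⁻ η A (suc n) r h = h

    map-ext : ∀ U η (φ : ℕ → Raw) p → mapS (subS (extS η) U) (inst φ) p ≡ mapS U (inst φ) p
    map-ext U η φ p = mapS-sub U (λ { zero r → refl ; (suc n) r → trans (mapL-ren (η n) (λ _ _ → refl) r) (mapL-id (η n) (λ _ _ → refl) r) }) p

    sem∀I→ : ∀ {C t U V η ρ} A (e : V ≡ instS (subS (extS η) U) A) (d : shiftCtx C ⊢ t ∶ lin (st U)) (env : Env η C) (s : Stk (lin (st V)) ρ) {r} →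
             StSem (∀I d) η env (tyap A e s) r → StSem d (A ∷ᵗ η) (λ x → shiftE A (env x)) s r
    sem∀I→ {C} {U = U} {η = η} A refl d env s {r} (p , hp , (γ , g , t) , φ , hφ , h') = mapS U (inst φ) p , hb' ,
       (γ , (λ x → GOk-sh A (env x) _ (g x)) ,
        func d {ρ = inst φ} (λ n r h → webs-∷ η A n _ (e' n r h)) (λ x {σ} r q h → subst (θE (shiftE A (env x))) (sym (mp x q r)) (θE-sh A (env x) r h))
            (λ x q → sym (mpΓ x q (γ x))) p t) ,
       subst (λ b → StkSem s b r) (map-ext U η φ p) h'
      where
      φ< : ∀ i → i ≤ cnt U → HasL A E₀ (φ i)
      φ< i l = hφ i (≤-trans l (≤-reflexive (sym (cnt-sub η U))))
      e' : ∀ n r → (Col U ∷ᶠ webs η) n r → (HasL A E₀ ∷ᶠ webs η) n (inst φ n r)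
      e' zero r (i , l , refl) = φ< i l
      e' (suc n) r h = h
      hp' : HasS U (Col U ∷ᶠ webs η) p
      hp' = HasS-sub (∀' U) {η} {E₀} {webs η} (λ _ _ h → h) p hp
      hb : HasS U (HasL A E₀ ∷ᶠ webs η) (mapS U (inst φ) p)
      hb = HasS-map U e' p hp'
      hb' : HasS (instS (subS (extS η) U) A) E₀ (mapS U (inst φ) p)
      hb' = subst (λ V → HasS V E₀ (mapS U (inst φ) p)) (inst-ext η A U) (HasS-sub⁻ U (λ { zero r h → h ; (suc n) r h → h }) _ hb)
      mp : ∀ x {σ} → shiftCtx C x ≡ inΘ σ → ∀ r → mapT σ (inst φ) r ≡ r
      mp x q r with sh-Θ {C x} q
      ... | τ , _ , refl = trans (mapT-ren τ (λ _ _ → refl) r) (mapT-id τ (λ _ _ → refl) r)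
      mpΓ : ∀ x {B} → shiftCtx C x ≡ inΓ B → ∀ m → mapM (lin B) (inst φ) m ≡ m
      mpΓ x q m with sh-Γ {C x} q
      ... | B , _ , refl = trans (mapM-ren (lin B) (λ _ _ → refl) m) (mapM-id (lin B) (λ _ _ → refl) m)

    -- The direction that needs `retract`: the machine has computed a token over the web of `A`, and
    -- it must be seen to come from a pattern, the only kind of token a quantified type has. The
    -- converse instantiates the pattern by `func`.
    sem∀I← : ∀ {C t U V η ρ} A (e : V ≡ instS (subS (extS η) U) A) (d : shiftCtx C ⊢ t ∶ lin (st U)) (env : Env η C) (s : Stk (lin (st V)) ρ) {r} →
             StSem d (A ∷ᵗ η) (λ x → shiftE A (env x)) s r → StSem (∀I d) η env (tyap A e s) r
    sem∀I← {C} {U = U} {η = η} A refl d env s {r} (b , hb , (γ , g , t) , h')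
      with retract {C} U d {webs η} {HasL A E₀} {λ x → θE (env x)} {γ} {dflL A} b (dflL-Has A E₀-0)
             (HasS-sub U (λ { zero r h → h ; (suc n) r h → h }) b (subst (λ V → HasS V E₀ b) (sym (inst-ext η A U)) hb))
             (mono d (webs-∷⁻ η A) (λ x r _ → θE-sh⁻ A (env x) r) (λ _ _ → refl) b t)
    ... | p , φ , hp , hφ , t' , refl = p , HasS-sub⁻ (∀' U) {η} {E₀} {webs η} (λ _ _ h → h) p hp ,
         (γ , (λ x → GOk-sh⁻ A (env x) _ (g x)) , t') , φ , (λ i l → hφ i (≤-trans l (≤-reflexive (cnt-sub η U)))) ,
         subst (λ b → StkSem s b r) (sym (map-ext U η φ p)) h'

    sem∀E→ : ∀ {C t U η ρ} A (d : C ⊢ t ∶ lin (st (∀' U))) (env : Env η C) (s : Stk (lin (st (subS η (instS U A)))) ρ) {r} →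
             StSem (∀E A d) η env s r → StSem d η env (tyap (subL η A) (sub-inst η A U) s) r
    sem∀E→ {U = U} {η} A d env s {r} (b , hb , (γ , g , p , φ , hp , hφ , t , refl) , h') = p , HasS-sub⁻ (∀' U) {η} {E₀} {webs η} (λ _ _ h → h) p hp ,
       (γ , g , t) , φ , (λ i l → HasL-sub⁻ A (λ _ _ h → h) _ (hφ i (≤-trans l (≤-reflexive (cnt-sub η U))))) ,
       subst (λ b → StkSem s b r) (sym (map-ext U η φ p)) h'

    sem∀E← : ∀ {C t U η ρ} A (d : C ⊢ t ∶ lin (st (∀' U))) (env : Env η C) (s : Stk (lin (st (subS η (instS U A)))) ρ) {r} →
             StSem d η env (tyap (subL η A) (sub-inst η A U) s) r → StSem (∀E A d) η env s r
    sem∀E← {U = U} {η} A d env s {r} (p , hp , (γ , g , t) , φ , hφ , h') = mapS U (inst φ) p ,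
       HasS-sub⁻ (instS U A) (λ _ _ h → h) _ (HasS-sub⁻ U {E' = HasL A (webs η) ∷ᶠ webs η} (λ { zero r h → h ; (suc n) r h → h }) _
          (HasS-map U (λ { zero r (i , l , refl) → hφ' i l ; (suc n) r h → h }) p hp')) ,
       (γ , g , p , φ , hp' , hφ' , t , refl) , subst (λ b → StkSem s b r) (map-ext U η φ p) h'
      where
      hp' : HasS U (Col U ∷ᶠ webs η) p
      hp' = HasS-sub (∀' U) {η} {E₀} {webs η} (λ _ _ h → h) p hp
      hφ' : ∀ i → i ≤ cnt U → HasL A (webs η) (φ i)
      hφ' i l = HasL-sub A (λ _ _ h → h) _ (hφ i (≤-trans l (≤-reflexive (sym (cnt-sub η U)))))

module RunBase (n : ℕ) {Λ : Set} (φ : Λ → Tm) where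
  open Boxes n
  open Eval n {⊥} {Λ} {⊥} {⊥} {⊥} (λ ()) φ (λ ())
  open Closures {⊥} {Λ} {⊥} {⊥} {⊥}
  open RBw [] using (rbStk; rbEnv; rbClo; rb₁; rbStk-cong; rb-getΓ; rb-getΘ; rb-∷; rb-E; rb-shiftE; rb-thE)
  open Res
  open Run n φ
  module Wt (ω : Λ → ℕ) = Sizes 0 0 ω
  open Web using (act; x₀)

  base : Ty
  base = lin (tv 0)

  -- One word accounts for everything at once: for the term up to `=β`, for any weighting of the
  -- letters, and for the tokens in every finite web. As the word does not depend on the web,
  -- different webs may be compared on the same output.
  record RunRes (rb : Tm) (wt : (Λ → ℕ) → ℕ) (Sm : Web Λ → Raw → Set) : Set₁ where
    constructor runRes
    field
      word : List Λ
      βw   : rb =β chainΛ φ word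
      wts  : ∀ ω → sum (map ω word) ≤ wt ω
      sem→ : ∀ W r → Sm W r → r ≡ pt (foldr (act W) (x₀ W) word)
      sem← : ∀ W → Sm W (pt (foldr (act W) (x₀ W) word))
  open RunRes

  via : ∀ {rb rb' wt wt'} {Sm Sm' : Web Λ → Raw → Set} → rb' =β rb → (∀ ω → wt ω ≤ wt' ω) → (∀ W r → Sm' W r → Sm W r) → (∀ W r → Sm W r → Sm' W r) →
        RunRes rb wt Sm → RunRes rb' wt' Sm'
  via b w f g r = runRes (word r) (β-trans b (βw r)) (λ ω → ≤-trans (wts r ω) (w ω)) (λ W x h → sem→ r W x (f W x h)) (λ W → g W _ (sem← r W))

  -- Stacks end in the base type here, so the head may become a letter, which contributes itself to
  -- the word, or the base point, which ends it.
  run : ∀ k {C t σ τ} (d : C ⊢ t ∶ σ) (η : TSub) (e : τ ≡ subT η σ) (env : Env η C) (s : Stk τ base) → Sz.szSt d env s ≤ k →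
        RunRes (rbStk (subTm (rbEnv env) t) s) (λ ω → Wt.szSt ω d env s) (λ W → Sem.StSem W d η env s)
  runClo : ∀ k {τ} (c : Clo τ) (s : Stk τ base) → Sz.szClo c + Sz.szStk s ≤ k →
        RunRes (rbStk (rbClo c) s) (λ ω → Wt.szClo ω c + Wt.szStk ω s) (λ W → Sem.CloSt W c s)
  runBox : ∀ k {τ} (B : Box ⊥ Λ ⊥ τ) (s : Stk τ base) → Sz.szBox B + Sz.szStk s ≤ k →
        RunRes (rbStk (rb₁ B) s) (λ ω → Wt.szBox ω B + Wt.szStk ω s) (λ W → Sem.BoxSt W B s)

  run zero d η e env s p = ⊥-elim (<⇒≱ (szD-pos d _) (≤-trans (m≤m+n _ _) p))
  run (suc k) (ax-Γ {x = x} q) η refl env s p with getΓ (env x) q in eq | Sz.sz-getΓ (env x) q | (λ ω → Wt.sz-getΓ ω (env x) q) | rb-getΓ (env x) q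
  ... | _ , c , refl | z | ct | r =
    via (rbStk-cong s (≡⇒β r)) (λ ω → ≤-reflexive (cong (_+ Wt.szStk ω s) (ct ω)))
        (λ W x → Sem.semΓ→ W q env s eq s refl) (λ W x → Sem.semΓ← W q env s eq s refl)
        (runClo k c s (≤-trans (≤-reflexive (cong (_+ Sz.szStk s) z)) (s≤s⁻¹ p)))
  run (suc k) (ax-Θ {x = x} q) η refl env s p with getΘ (env x) q in eq | Sz.sz-getΘ (env x) q | (λ ω → Wt.sz-getΘ ω (env x) q) | rb-getΘ (env x) q
  ... | _ , c , refl | z | ct | r =
    via (rbStk-cong s (≡⇒β r)) (λ ω → ≤-reflexive (cong (_+ Wt.szStk ω s) (ct ω)))
        (λ W x → Sem.semΘ→ W q env s eq s refl) (λ W x → Sem.semΘ← W q env s eq s refl)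
        (runBox k c s (≤-trans (≤-reflexive (cong (_+ Sz.szStk s) z)) (s≤s⁻¹ p)))
  run (suc k) (⊸I {t = t} d) η refl env (arg c s) p =
    via (rbStk-cong s (β-trans (β-lamˢ {rbEnv env} {t}) (≡⇒β (subTm-cong (rb-∷ (eΓ c refl) env) t))))
        (λ ω → Wt.stepI ω d env c refl s) (λ W x → Sem.semI→ W d env c s) (λ W x → Sem.semI← W d env c s)
        (run k d η refl (eΓ c refl ∷ᵉ env) s (s≤s⁻¹ (≤-trans (Sz.stepI d env c refl s) p)))
  run (suc k) (⊸I! {t = t} {σ = a} d) η refl env (arg c s) p =
    let m = s≤s⁻¹ p
        r₁ = evalClo k c nil (≤-trans (+-monoʳ-≤ (Sz.szClo c) z≤n) (≤-trans (m≤n+m _ (szD 1 d (0 ∷ⁿ Sz.szEnv env))) m))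
        B = val r₁
        E = eΔ B refl
    in via (rbStk-cong s (β-trans (β-appc β-refl (β r₁ [])) (β-trans (β-bangˢ {rbEnv env} {t}) (≡⇒β (subTm-cong (rb-∷ E env) t)))))
           (λ ω → ≤-trans (Wt.stepI! ω d env B refl s) (+-monoʳ-≤ (szD 0 d (0 ∷ⁿ Wt.szEnv ω env)) (m≤n+m _ (Wt.szClo ω c))))
           (λ W x → Sem.semI!→ W d env c B refl s) (λ W x → Sem.semI!← W d env c B refl s)
           (run k d η refl (E ∷ᵉ env) s
              (≤-trans (Sz.stepI! d env B refl s) (≤-trans (+-monoʳ-≤ (szD 1 d (0 ∷ⁿ Sz.szEnv env)) (m≤n+m _ (Sz.szClo c))) m)))
  run (suc k) (⊸E q d d') η refl env s p =
    via (rbStk-cong s (≡⇒β (rb-E q d d' env))) (λ ω → Wt.stepE ω q d d' env s)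
        (λ W x → Sem.semE→ W q d d' env s) (λ W x → Sem.semE← W q d d' env s)
        (run k d η refl (λ x → splitL (q x) (env x)) (arg (clo d' η refl (λ x → splitR (q x) (env x))) s)
            (s≤s⁻¹ (≤-trans (Sz.stepE q d d' env s) p)))
  run (suc k) (∀I {t = t} {S = U} d) η refl env (tyap A e s) p =
    via (rbStk-cong s (≡⇒β (agree d (λ x _ → rb-shiftE A (env x))))) (λ ω → Wt.step∀I ω A d env s)
        (λ W x → Sem.sem∀I→ W A e d env s) (λ W x → Sem.sem∀I← W A e d env s)
        (run k d (A ∷ᵗ η) (cong (lin ∘ st) (trans e (sym (inst-ext η A U)))) (λ x → shiftE A (env x)) s
            (≤-trans (Sz.step∀I A d env s) (s≤s⁻¹ p)))
  run (suc k) (∀E {S = U} A d) η refl env s p =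
    via β-refl (λ ω → ≤-refl) (λ W x → Sem.sem∀E→ W A d env s) (λ W x → Sem.sem∀E← W A d env s)
        (run k d η refl env (tyap (subL η A) (sub-inst η A U) s) (s≤s⁻¹ p))

  runClo k (clo d η e env) s p =
    via β-refl (λ ω → ≤-refl) (λ W x → Sem.CloSt→ W {d = d} {e} {env} {s}) (λ W x → Sem.CloSt← W {d = d} {e} {env} {s}) (run k d η e env s p)

  runBox k (bx {t = t} d η e env) s p =
    via (rbStk-cong s (≡⇒β (subTm-cong (λ x → rb-thE (env x)) t))) (λ ω → Wt.stepΘ ω d env s)
        (λ W x → Sem.semBx→ W d e env s) (λ W x → Sem.semBx← W d e env s)
        (run k d η e (λ x → thE (env x)) s (≤-trans (Sz.stepΘ d env s) p))
  runBox k (pr (F₀ a)) (arg c nil) p with runClo k c nil (≤-trans (m≤n+m _ 1) p)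
  ... | r = runRes (a ∷ word r) (β-appc β-refl (βw r)) (λ ω → +-monoʳ-≤ (ω a) (≤-trans (wts r ω) (≤-reflexive refl)))
     (λ { W x (_ , _ , (v , _ , refl) , h , refl) → go W v (sem→ r W (pt v) (pt v , h , refl)) })
     (λ W → mk W (sem← r W))
    where
    go : ∀ W v → pt v ≡ pt (foldr (act W) (x₀ W) (word r)) → pt (act W a v) ≡ pt (foldr (act W) (x₀ W) (a ∷ word r))
    go W v refl = refl
    mk : ∀ W → Sem.CloSt W c nil (pt (foldr (act W) (x₀ W) (word r))) → Sem.BoxSt W (pr (F₀ a)) (arg c nil) (pt (foldr (act W) (x₀ W) (a ∷ word r)))
    mk W (b , h , refl) with Sem.TokHas W c b h
    ... | v , v< , refl = fn (just (pt v)) _ , ((v , v< , refl) , (_ , Web.act< W a v v< , refl)) , (v , v< , refl) , h , refl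
  runBox k (pr X₀) nil p = runRes [] β-refl (λ ω → z≤n) (λ { W _ (_ , _ , refl , refl) → refl })
     (λ W → pt (x₀ W) , (x₀ W , Web.x₀< W , refl) , refl , refl)

-- Boxes at a given input string: every letter is labelled by the positions of the iterations it comes from, innermost first.

ltr : ∀ {m} → Word (suc m) → ℕ → Fin (suc m)
ltr []      q       = fz
ltr (c ∷ w) zero    = c
ltr (c ∷ w) (suc q) = ltr w q

-- The body of an unrolled iteration. Every position has its own variable, so that copies of the
-- same letter box can carry different labels.
cT : ∀ {m} → ℕ → Word m → Tm
cT k []      = var 0
cT k (c ∷ w) = app (var (suc k)) (cT (suc k) w)

posC : LTy → Ctx
posC A x = inΘ (A ⊸ᴸ A)

cT-split : ∀ A → Split (inΓ A ∷ᶜ posC A) (none ∷ᶜ posC A) (inΓ A ∷ᶜ posC A)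
cT-split A zero    = sp-Γr
cT-split A (suc x) = sp-Θ

cT-ty : ∀ {m} A k (w : Word m) → (inΓ A ∷ᶜ posC A) ⊢ cT k w ∶ lin A
cT-ty A k []      = ax-Γ refl
cT-ty A k (c ∷ w) = ⊸E (cT-split A) (ax-Θ refl) (cT-ty A (suc k) w)

module At (n : ℕ) {F : Set} where
  open Boxes n

  BoxI : Ty → Set
  BoxI = Box ⊥ F ⊤

  Box∙ : Ty → Set
  Box∙ = Box ⊥ (F × List ℕ) ⊥

  at-word : Word (suc n) → List ℕ → ∀ {τ} → BoxI τ → Box∙ τ
  at-th : Word (suc n) → List ℕ → ∀ {η a} → ThE ⊥ F ⊤ η a → ThE ⊥ (F × List ℕ) ⊥ η a
  at-word w ps (bx d η e env) = bx d η e (λ x → at-th w ps (env x))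
  at-word w ps (pr (F₀ a)) = pr (F₀ (a , ps))
  at-word w ps (pr X₀) = pr X₀
  at-word w ps (it _ A ds) = bx (⊸I (cT-ty A 0 w)) tv (sym (subT-id (λ _ → refl) (A ⊸ᴸ A)))
                               (λ q → th (at-word w (q ∷ ps) (ds (ltr w q))) (sym (subT-id (λ _ → refl) (A ⊸ᴸ A))))
  at-th w ps t∅ = t∅
  at-th w ps (th B e) = th (at-word w ps B) e

  rb-at : ∀ (φ : F → Tm) w ps {τ} (B : BoxI τ) → Readback.rbBox {⊥} (φ ∘ proj₁) [] (at-word w ps B) ≡ Readback.rbBox φ w B
  rb-at-th : ∀ (φ : F → Tm) w ps {η a} (B : ThE ⊥ F ⊤ η a) → Readback.rbTh {⊥} (φ ∘ proj₁) [] (at-th w ps B) ≡ Readback.rbTh φ w B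
  rb-at φ w ps (bx {t = t} d η e env) = subTm-cong (λ x → rb-at-th φ w ps (env x)) t
  rb-at φ w ps (pr (F₀ a)) = refl
  rb-at φ w ps (pr X₀) = refl
  rb-at φ w ps (it _ A ds) = cong lam (go 0 w (λ j → rb-at φ w (j ∷ ps) (ds (ltr w j))))
    where
    go : ∀ k v → (∀ j → Readback.rbBox {⊥} (φ ∘ proj₁) [] (at-word w (k + j ∷ ps) (ds (ltr w (k + j)))) ≡ Readback.rbBox φ w (ds (ltr v j))) →
         subTm (extTm (λ q → Readback.rbBox {⊥} (φ ∘ proj₁) [] (at-word w (q ∷ ps) (ds (ltr w q))))) (cT k v) ≡ itBody (λ c → Readback.rbBox φ w (ds c)) v
    go k [] h = refl
    go k (c ∷ v) h = cong₂ app (cong (renTm suc) (trans (cong (λ j → Readback.rbBox {⊥} (φ ∘ proj₁) [] (at-word w (j ∷ ps) (ds (ltr w j)))) (sym (+-identityʳ k))) (h 0)))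
       (go (suc k) v (λ j → trans (cong (λ j → Readback.rbBox {⊥} (φ ∘ proj₁) [] (at-word w (j ∷ ps) (ds (ltr w j)))) (sym (+-suc k j))) (h (suc j))))
  rb-at-th φ w ps t∅ = refl
  rb-at-th φ w ps (th B e) = rb-at φ w ps B

-- Finite types, up to retraction

record Finite (A : Set) : Set where
  field
    size    : ℕ
    code    : A → Fin size
    decode  : Fin size → A
    decode-code : ∀ a → decode (code a) ≡ a

module _ where
  open Finite

  fin-Fin : ∀ n → Finite (Fin n)
  fin-Fin n = record { size = n ; code = id ; decode = id ; decode-code = λ _ → refl }

  fin-× : ∀ {A B} → Finite A → Finite B → Finite (A × B)
  fin-× {A} {B} f g = record
    { size = size f * size g ; code = λ (a , b) → combine (code f a) (code g b) ; decode = dec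
    ; decode-code = λ (a , b) → trans (cong (λ (p , q) → decode f p , decode g q) (remQuot-combine {size f} (code f a) (code g b)))
                                      (cong₂ _,_ (decode-code f a) (decode-code g b)) }
    where
    dec : Fin (size f * size g) → A × B
    dec i = decode f (proj₁ (remQuot {size f} (size g) i)) , decode g (proj₂ (remQuot {size f} (size g) i))

  fin-retract : ∀ {A B : Set} (f : A → B) (g : B → A) → (∀ a → g (f a) ≡ a) → Finite B → Finite A
  fin-retract f g e F = record { size = size F ; code = code F ∘ f ; decode = g ∘ decode F
    ; decode-code = λ a → trans (cong g (decode-code F (f a))) (e a) }

  fin-⊤ : Finite ⊤
  fin-⊤ = fin-retract (λ _ → fz) (λ _ → tt) (λ _ → refl) (fin-Fin 1)

  fin-Bool : Finite Bool
  fin-Bool = fin-retract (λ { false → fz ; true → fs fz }) (λ { fz → false ; (fs _) → true }) (λ { false → refl ; true → refl }) (fin-Fin 2)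

  fin-⊎ : ∀ {A B} → Finite A → Finite B → A → B → Finite (A ⊎ B)
  fin-⊎ {A} {B} f g a₀ b₀ = fin-retract
    (λ { (inj₁ a) → false , a , b₀ ; (inj₂ b) → true , a₀ , b }) (λ { (false , a , _) → inj₁ a ; (true , _ , b) → inj₂ b })
    (λ { (inj₁ _) → refl ; (inj₂ _) → refl }) (fin-× fin-Bool (fin-× f g))

  fin-Maybe : ∀ {A} → Finite A → Finite (Maybe A)
  fin-Maybe {A} f = record { size = suc (size f) ; code = λ { nothing → fz ; (just a) → fs (code f a) }
    ; decode = λ { fz → nothing ; (fs i) → just (decode f i) } ; decode-code = λ { nothing → refl ; (just a) → cong just (decode-code f a) } }

  fin-Vec : ∀ {A} → Finite A → ∀ n → Finite (Vec A n)
  fin-Vec f zero = fin-retract (λ _ → tt) (λ _ → []) (λ { [] → refl }) fin-⊤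
  fin-Vec f (suc n) = fin-retract (λ { (a ∷ v) → a , v }) (λ (a , v) → a ∷ v) (λ { (a ∷ v) → refl }) (fin-× f (fin-Vec f n))

  elems : ∀ {A} → Finite A → List A
  elems f = map (decode f) (Data.List.allFin (size f))

  elems-∈ : ∀ {A} (f : Finite A) a → a ∈ elems f
  elems-∈ f a = subst (_∈ elems f) (decode-code f a) (∈-map⁺ (decode f) (∈-allFin (code f a)))

-- Regular languages

record FDFA (a : ℕ) : Set₁ where
  field
    St    : Set
    fin   : Finite St
    init  : St
    step  : St → Fin a → St
    final : St → Bool

module _ {a : ℕ} where
  open FDFA
  open Finite
  open Equivalence using (to; from)

  runF : (D : FDFA a) → St D → Word a → St D
  runF D q w = foldl (step D) q w

  toDFA : FDFA a → DFA a
  toDFA D = record { Q = size (fin D) ; start = code (fin D) (init D)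
    ; δ = λ q c → code (fin D) (step D (decode (fin D) q) c) ; acc = final D ∘ decode (fin D) }

  toDFA-run : ∀ D q w → decode (fin D) (foldl (DFA.δ (toDFA D)) (code (fin D) q) w) ≡ runF D q w
  toDFA-run D q [] = decode-code (fin D) q
  toDFA-run D q (c ∷ w) = trans (cong (λ q' → decode (fin D) (foldl (DFA.δ (toDFA D)) (code (fin D) (step D q' c)) w)) (decode-code (fin D) q))
                                (toDFA-run D (step D q c) w)

  Reg : (Word a → Set) → Set
  Reg P = RegularLang P

  reg-FDFA : ∀ {P} (D : FDFA a) → (∀ w → P w ⇔ (final D (runF D (init D) w) ≡ true)) → Reg P
  reg-FDFA {P} D e = toDFA D , λ w → mk⇔ (λ p → trans (cong (final D) (toDFA-run D (init D) w)) (to (e w) p))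
                                      (λ q → from (e w) (trans (cong (final D) (sym (toDFA-run D (init D) w))) q))

  reg-⇔ : ∀ {P Q : Word a → Set} → (∀ w → P w → Q w) → (∀ w → Q w → P w) → Reg P → Reg Q
  reg-⇔ f g (D , e) = D , λ w → mk⇔ (λ q → to (e w) (g w q)) (λ p → f w (from (e w) p))

  reg-dec : ∀ {P} → Reg P → ∀ w → Dec (P w)
  reg-dec (D , e) w with accepts D w in eq
  ... | true  = yes (from (e w) eq)
  ... | false = no λ p → case-⊥ (trans (sym eq) (to (e w) p))
    where
    case-⊥ : false ≡ true → ⊥
    case-⊥ ()

  reg-const : ∀ {P : Set} → Dec P → Reg (λ _ → P)
  reg-const {P} d = reg-FDFA (record { St = ⊤ ; fin = fin-⊤ ; init = tt ; step = λ _ _ → tt ; final = λ _ → does d })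
      (λ w → mk⇔ (yes-does d) (does-yes d))
    where
    yes-does : (d : Dec P) → P → does d ≡ true
    yes-does (yes _) _ = refl
    yes-does (no n) p = ⊥-elim (n p)
    does-yes : (d : Dec P) → does d ≡ true → P
    does-yes (yes p) _ = p

  run2 : ∀ {A B : Set} (f : A → Fin a → A) (g : B → Fin a → B) x y w →
         foldl (λ (p , q) c → f p c , g q c) (x , y) w ≡ (foldl f x w , foldl g y w)
  run2 f g x y [] = refl
  run2 f g x y (c ∷ w) = run2 f g (f x c) (g y c) w

  prodF : (D D' : DFA a) → (Bool → Bool → Bool) → FDFA a
  prodF D D' op = record { St = Fin (DFA.Q D) × Fin (DFA.Q D') ; fin = fin-× (fin-Fin _) (fin-Fin _) ; init = DFA.start D , DFA.start D'
    ; step = λ (p , q) c → DFA.δ D p c , DFA.δ D' q c ; final = λ (p , q) → op (DFA.acc D p) (DFA.acc D' q) }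

  prodF-run : ∀ D D' op w → FDFA.final (prodF D D' op) (runF (prodF D D' op) (FDFA.init (prodF D D' op)) w) ≡ op (accepts D w) (accepts D' w)
  prodF-run D D' op w = cong (FDFA.final (prodF D D' op)) (run2 (DFA.δ D) (DFA.δ D') (DFA.start D) (DFA.start D') w)

  reg-× : ∀ {P Q : Word a → Set} → Reg P → Reg Q → Reg (λ w → P w × Q w)
  reg-× (D , e) (D' , e') = reg-FDFA (prodF D D' _∧_) λ w → mk⇔
      (λ (p , q) → trans (prodF-run D D' _∧_ w) (cong₂ _∧_ (to (e w) p) (to (e' w) q)))
      (λ r → let (b , b') = split (accepts D w) (accepts D' w) (trans (sym (prodF-run D D' _∧_ w)) r) in from (e w) b , from (e' w) b')
    where
    split : ∀ b b' → b ∧ b' ≡ true → b ≡ true × b' ≡ true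
    split true true refl = refl , refl

  reg-⊎ : ∀ {P Q : Word a → Set} → Reg P → Reg Q → Reg (λ w → P w ⊎ Q w)
  reg-⊎ {P} {Q} (D , e) (D' , e') = reg-FDFA (prodF D D' _∨_) λ w → mk⇔
      (λ h → trans (prodF-run D D' _∨_ w) (fwd w h))
      (λ r → bwd w (trans (sym (prodF-run D D' _∨_ w)) r))
    where
    fwd : ∀ w → P w ⊎ Q w → accepts D w ∨ accepts D' w ≡ true
    fwd w (inj₁ p) = cong (_∨ accepts D' w) (to (e w) p)
    fwd w (inj₂ q) with accepts D w
    ... | true = refl
    ... | false = to (e' w) q
    bwd : ∀ w → accepts D w ∨ accepts D' w ≡ true → P w ⊎ Q w
    bwd w r with accepts D w in eq
    ... | true = inj₁ (from (e w) eq)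
    ... | false = inj₂ (from (e' w) r)

  reg-¬ : ∀ {P : Word a → Set} → Reg P → Reg (λ w → ¬ P w)
  reg-¬ {P} (D , e) = record { Q = DFA.Q D ; start = DFA.start D ; δ = DFA.δ D ; acc = not ∘ DFA.acc D } ,
    λ w → mk⇔ (fwd w) (bwd w)
    where
    fwd : ∀ w → ¬ P w → not (accepts D w) ≡ true
    fwd w n with accepts D w in eq
    ... | true = ⊥-elim (n (from (e w) eq))
    ... | false = refl
    bwd : ∀ w → not (accepts D w) ≡ true → ¬ P w
    bwd w r p rewrite to (e w) p with r
    ... | ()

  reg-∃ : ∀ {X : Set} {P : X → Word a → Set} (l : List X) → (∀ x → Reg (P x)) → Reg (λ w → Σ X λ x → x ∈ l × P x w)
  reg-∃ [] r = reg-⇔ (λ w ()) (λ { w (x , () , _) }) (reg-const {⊥} (no λ ()))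
  reg-∃ (y ∷ l) r = reg-⇔ (λ { w (inj₁ p) → y , here refl , p ; w (inj₂ (x , m , p)) → x , there m , p })
                          (λ { w (x , here refl , p) → inj₁ p ; w (x , there m , p) → inj₂ (x , m , p) })
                          (reg-⊎ (r y) (reg-∃ l r))

  reg-∀ : ∀ {k} {P : Fin k → Word a → Set} → (∀ i → Reg (P i)) → Reg (λ w → ∀ i → P i w)
  reg-∀ {zero} r = reg-⇔ (λ w _ ()) (λ w _ → tt) (reg-const (yes tt))
  reg-∀ {suc k} {P} r = reg-⇔ (λ w (p , q) → λ { fz → p ; (fs i) → q i }) (λ w h → h fz , λ i → h (fs i))
                            (reg-× (r fz) (reg-∀ {k} {P ∘ fs} (r ∘ fs)))

  tabB : ∀ {k} {P : Fin k → Set} → (∀ i → Dec (P i)) → Vec Bool k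
  tabB d = tabulate (λ i → does (d i))

  -- A language may depend on the truth values of finitely many regular properties of the whole word.
  reg-guess : ∀ {k} {P : Fin k → Word a → Set} {Q : Vec Bool k → Word a → Set} → (∀ i → Reg (P i)) → (∀ D → Reg (Q D)) →
              (Z : Word a → Set) →
              (∀ w D → (∀ i → (lookup D i ≡ true → P i w) × (P i w → lookup D i ≡ true)) → (Z w → Q D w) × (Q D w → Z w)) → Reg Z
  reg-guess {k} {P} {Q} rP rQ Z h =
    reg-⇔ (λ w (D , _ , c , q) → proj₂ (h w D c) q) (λ w z → D₀ w , elems-∈ finD (D₀ w) , ok w , proj₁ (h w (D₀ w) (ok w)) z)
      (reg-∃ {P = λ D w → (∀ i → (lookup D i ≡ true → P i w) × (P i w → lookup D i ≡ true)) × Q D w} (elems finD) λ D → reg-× (reg-∀ λ i → side (lookup D i) (rP i)) (rQ D))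
    where
    finD : Finite (Vec Bool k)
    finD = fin-Vec fin-Bool k
    side : ∀ b {P : Word a → Set} → Reg P → Reg (λ w → (b ≡ true → P w) × (P w → b ≡ true))
    side true r = reg-⇔ (λ w p → (λ _ → p) , λ _ → refl) (λ w (f , _) → f refl) r
    side false r = reg-⇔ (λ w n → (λ ()) , λ p → ⊥-elim (n p)) (λ w (_ , g) p → fe (g p)) (reg-¬ r)
      where
      fe : false ≡ true → ⊥
      fe ()
    D₀ : Word a → Vec Bool k
    D₀ w = tabB (λ i → reg-dec (rP i) w)
    ok : ∀ w i → (lookup (D₀ w) i ≡ true → P i w) × (P i w → lookup (D₀ w) i ≡ true)
    ok w i rewrite lookup∘tabulate (λ i → does (reg-dec (rP i) w)) i with reg-dec (rP i) w
    ... | yes p = (λ _ → p) , λ _ → refl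
    ... | no n = (λ ()) , λ p → ⊥-elim (n p)

  -- Paths: the automaton keeps the set of reachable tokens; Nothing means that no further token is demanded.
  module PathLang {k : ℕ} (D : Fin a → Maybe (Fin k) → Fin k → Bool) (goal : Fin k → Bool) where
    Path : Word a → Fin k → Set
    Path [] b = goal b ≡ true
    Path (c ∷ w) b = D c nothing b ≡ true ⊎ Σ (Fin k) λ b' → D c (just b') b ≡ true × Path w b'

    anyB : (Fin k → Bool) → Bool
    anyB f = does (any? λ i → f i Data.Bool.≟ true)

    anyB→ : ∀ f → anyB f ≡ true → Σ (Fin k) λ i → f i ≡ true
    anyB→ f e with any? (λ i → f i Data.Bool.≟ true)
    ... | yes p = p

    anyB← : ∀ f i → f i ≡ true → anyB f ≡ true
    anyB← f i e with any? (λ i → f i Data.Bool.≟ true)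
    ... | yes p = refl
    ... | no n = ⊥-elim (n (i , e))

    PSt : Set
    PSt = Vec Bool k × Bool

    pstep : PSt → Fin a → PSt
    pstep (v , fl) c = tabulate (λ b' → anyB (λ b → lookup v b ∧ D c (just b') b)) , (fl ∨ anyB (λ b → lookup v b ∧ D c nothing b))

    pfin : PSt → Bool
    pfin (v , fl) = fl ∨ anyB (λ b → lookup v b ∧ goal b)

    Acc : PSt → Word a → Set
    Acc (v , fl) w = fl ≡ true ⊎ Σ (Fin k) λ b → lookup v b ≡ true × Path w b

    ∧→ : ∀ {x y} → x ∧ y ≡ true → x ≡ true × y ≡ true
    ∧→ {true} {true} refl = refl , refl

    ∨→ : ∀ {x y} → x ∨ y ≡ true → x ≡ true ⊎ y ≡ true
    ∨→ {true} e = inj₁ refl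
    ∨→ {false} e = inj₂ e

    ∨← : ∀ {x y} → x ≡ true ⊎ y ≡ true → x ∨ y ≡ true
    ∨← {true} _ = refl
    ∨← {false} (inj₂ e) = e

    acc→ : ∀ w q → Acc q w → pfin (foldl pstep q w) ≡ true
    acc→ [] (v , fl) (inj₁ e) = ∨← (inj₁ e)
    acc→ [] (v , fl) (inj₂ (b , e , g)) = ∨← {fl} (inj₂ (anyB← _ b (cong₂ _∧_ e g)))
    acc→ (c ∷ w) q@(v , fl) (inj₁ e) = acc→ w (pstep q c) (inj₁ (∨← (inj₁ e)))
    acc→ (c ∷ w) q@(v , fl) (inj₂ (b , e , inj₁ d)) = acc→ w (pstep q c) (inj₁ (∨← {fl} (inj₂ (anyB← _ b (cong₂ _∧_ e d)))))
    acc→ (c ∷ w) q@(v , fl) (inj₂ (b , e , inj₂ (b' , d , p))) = acc→ w (pstep q c)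
      (inj₂ (b' , trans (lookup∘tabulate _ b') (anyB← _ b (cong₂ _∧_ e d)) , p))

    acc← : ∀ w q → pfin (foldl pstep q w) ≡ true → Acc q w
    acc← [] (v , fl) e with ∨→ {fl} e
    ... | inj₁ e' = inj₁ e'
    ... | inj₂ e' with anyB→ _ e'
    ... | b , e'' = inj₂ (b , ∧→ e'')
    acc← (c ∷ w) q@(v , fl) e with acc← w (pstep q c) e
    ... | inj₂ (b' , e' , p) with anyB→ _ (trans (sym (lookup∘tabulate _ b')) e')
    ... | b , e'' = inj₂ (b , proj₁ (∧→ e'') , inj₂ (b' , proj₂ (∧→ {lookup v b} e'') , p))
    acc← (c ∷ w) q@(v , fl) e | inj₁ e' with ∨→ {fl} e'
    ... | inj₁ e'' = inj₁ e''
    ... | inj₂ e'' with anyB→ _ e''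
    ... | b , h = inj₂ (b , proj₁ (∧→ h) , inj₁ (proj₂ (∧→ {lookup v b} h)))

    reg-Path : ∀ b → Reg (λ w → Path w b)
    reg-Path b = reg-FDFA (record { St = PSt ; fin = fin-× (fin-Vec fin-Bool k) fin-Bool
         ; init = tabulate (λ i → does (i Data.Fin.≟ b)) , false ; step = pstep ; final = pfin })
      λ w → mk⇔ (λ p → acc→ w _ (inj₂ (b , trans (lookup∘tabulate _ b) (self b) , p)))
                (λ e → bwd w (acc← w _ e))
      where
      self : ∀ b → does (b Data.Fin.≟ b) ≡ true
      self b with b Data.Fin.≟ b
      ... | yes _ = refl
      ... | no n = ⊥-elim (n refl)
      un-self : ∀ b' → does (b' Data.Fin.≟ b) ≡ true → b' ≡ b
      un-self b' e with b' Data.Fin.≟ b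
      ... | yes p = p
      bwd : ∀ w → Acc (tabulate (λ i → does (i Data.Fin.≟ b)) , false) w → Path w b
      bwd w (inj₂ (b' , e , p)) with un-self b' (trans (sym (lookup∘tabulate _ b')) e)
      ... | refl = p

open import Data.List.Membership.DecPropositional _≟ᴿ_ using () renaming (_∈?_ to _∈ᴿ?_)

-- Finiteness of the webs and regularity of the token relations

FinW : {X : Set} → (X → Set) → Set
FinW {X} P = Σ (List X) λ l → (∀ r → P r → r ∈ l) × (∀ r → r ∈ l → P r)

fin-HasM : ∀ σ {E} → FinW (HasT σ E) → FinW (HasM σ E)
fin-HasM σ (l , f , g) = nothing ∷ map just l , (λ { nothing _ → here refl ; (just r) h → there (∈-map⁺ just (f r h)) }) ,
   λ { nothing _ → tt ; (just r) (there m) → case (∈-map⁻ just m) }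
  where
  case : ∀ {r} → Σ Raw (λ x → x ∈ l × just r ≡ just x) → _
  case (_ , m , refl) = g _ m

finL : ∀ A {E} → (∀ n → FinW (E n)) → FinW (HasL A E)
finS : ∀ U {E} → (∀ n → FinW (E n)) → FinW (HasS U E)
fin-HasT : ∀ σ {E} → (∀ n → FinW (E n)) → FinW (HasT σ E)

finCol : ∀ U → FinW (Col U)
finCol U = map pt (upTo (suc (cnt U))) , (λ { r (i , l , refl) → ∈-map⁺ pt (∈-upTo⁺ (s≤s l)) }) , λ r m → case (∈-map⁻ pt m)
  where
  case : ∀ {r} → Σ ℕ (λ x → x ∈ upTo (suc (cnt U)) × r ≡ pt x) → Col U r
  case (i , m , e) = i , s≤s⁻¹ (∈-upTo⁻ m) , e

finCons : ∀ {E P} → FinW P → (∀ n → FinW (E n)) → ∀ n → FinW ((P ∷ᶠ E) n)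
finCons p e zero    = p
finCons p e (suc n) = e n

finL (tv n) e = e n
finL (st U) e = finS U e
finS (σ ⊸ τ) {E} e with fin-HasM σ (fin-HasT σ e) | fin-HasT τ e
... | l , f , g | l' , f' , g' = cartesianProductWith fn l l' ,
   (λ { (fn m b) (h , h') → ∈-cartesianProductWith⁺ fn (f m h) (f' b h') }) ,
   λ r m → case (∈-cartesianProductWith⁻ fn l l' m)
  where
  case : ∀ {r} → ∃ (λ a → ∃ (λ b → a ∈ l × b ∈ l' × r ≡ fn a b)) → HasS (σ ⊸ τ) E r
  case (a , b , p , q , refl) = g a p , g' b q
finS (∀' U) e = finS U (finCons (finCol U) e)
fin-HasT (lin A) e = finL A e
fin-HasT (! σ) e = un ∷ [] , (λ { r refl → here refl }) , λ { r (here refl) → refl }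

decT : ∀ σ {E} → (∀ n → FinW (E n)) → ∀ r → Dec (HasT σ E r)
decT σ e r with fin-HasT σ e
... | l , f , g = map′ (g r) (f r) (r ∈ᴿ? l)

decM : ∀ σ {E} → (∀ n → FinW (E n)) → ∀ m → Dec (HasM σ E m)
decM σ e nothing = yes tt
decM σ e (just r) = decT σ e r

module _ {a : ℕ} where

  reg-fin : ∀ {X : Set} {P : X → Set} {Q : X → Word a → Set} → FinW P → (∀ x → Reg (Q x)) → Reg (λ w → Σ X λ x → P x × Q x w)
  reg-fin (l , f , g) r = reg-⇔ (λ { w (x , m , q) → x , g x m , q }) (λ { w (x , p , q) → x , f x p , q }) (reg-∃ l r)

  -- Only the first k values of the function matter, so it is guessed value by value as a finite
  -- disjunction.
  reg-fun : ∀ k {P : Raw → Set} → FinW P → (Q : (ℕ → Raw) → Word a → Set) → (∀ φ φ' w → (∀ i → i < k → φ i ≡ φ' i) → Q φ w → Q φ' w) →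
            (∀ φ → Reg (Q φ)) → Reg (λ w → Σ (ℕ → Raw) λ φ → (∀ i → i < k → P (φ i)) × Q φ w)
  reg-fun zero p Q e r = reg-⇔ (λ w q → (λ _ → pt 0) , (λ _ ()) , q) (λ { w (φ , _ , q) → e φ (λ _ → pt 0) w (λ _ ()) q }) (r (λ _ → pt 0))
  reg-fun (suc k) {P} p Q e r = reg-⇔
     (λ { w (x , px , φ , h , q) → (x ∷ᶠ φ) , (λ { zero _ → px ; (suc i) (s≤s l) → h i l }) , q })
     (λ { w (φ , h , q) → φ 0 , h 0 (s≤s z≤n) , (φ ∘ suc) , (λ i l → h (suc i) (s≤s l)) , e φ _ w (λ { zero _ → refl ; (suc i) _ → refl }) q })
     (reg-fin p (λ x → reg-fun k p (λ φ → Q (x ∷ᶠ φ)) (λ φ φ' w h → e _ _ w (λ { zero _ → refl ; (suc i) (s≤s l) → h i l })) (λ φ → r (x ∷ᶠ φ))))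

  reg-⊥ : Reg {a} (λ _ → ⊥)
  reg-⊥ = reg-const (no λ ())

  -- The word enters only through the variables of Θ. Everything else is a finite combination of
  -- conjunctions and of existential quantifiers over finite webs, under which regular languages are
  -- closed.
  regD : ∀ {C t σ} (d : C ⊢ t ∶ σ) {E : PWeb} → (∀ n → FinW (E n)) → {θ : Word a → PWeb} → (∀ x {σ} → C x ≡ inΘ σ → ∀ r → Reg (λ w → θ w x r)) → ∀ γ b →
         Reg (λ w → ⟦ d ⟧ E (θ w) γ b)
  regD (ax-Γ {x = x} _) e t γ b = reg-const (γ x ≟ᴹ just b)
  regD (ax-Θ {x = x} q) e t γ b = t x q b
  regD (⊸I {A = A} d) e t γ (fn m b) = reg-× (reg-const (decM (lin A) e m)) (regD d e (λ { (suc x) q r → t x q r }) (m ∷ᶠ γ) b)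
  regD (⊸I d) e t γ (pt _) = reg-⊥
  regD (⊸I d) e t γ un = reg-⊥
  regD (⊸I! {σ = σ} d) e t γ (fn m b) = reg-× (reg-const (decM (! σ) e m)) (regD d e (λ { (suc x) q r → t x q r }) (nothing ∷ᶠ γ) b)
  regD (⊸I! d) e t γ (pt _) = reg-⊥
  regD (⊸I! d) e t γ un = reg-⊥
  regD (⊸E {σ = σ} p d d') {E} e {θ} t γ b = reg-fin (fin-HasM σ (fin-HasT σ e)) λ m →
     reg-× (regD d e (λ x q → t x (sp-Θ₁ (p x) q)) γ (fn m b)) (go m)
    where
    go : ∀ m → Reg (λ w → AllM (⟦ d' ⟧ E (θ w) γ) m)
    go nothing = reg-const (yes tt)
    go (just c) = regD d' e (λ x q → t x (sp-Θ₂ (p x) q)) γ c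
  regD (∀I {C} {S = U} d) e {θ} t γ b = regD d (finCons (finCol U) e) {θ} (λ x q r → t' x q r) γ b
    where
    t' : ∀ x {σ} → shiftCtx C x ≡ inΘ σ → ∀ r → Reg (λ w → θ w x r)
    t' x q r with sh-Θ {C x} q
    ... | _ , q' , _ = t x q' r
  regD (∀E {S = U} A d) {E} e t γ b = reg-⇔
     (λ { w (p , hp , (φ , hφ , hp' , q) , h) → p , φ , hp , (λ i l → hφ i (s≤s l)) , h , q })
     (λ { w (p , φ , hp , hφ , h , q) → p , hp , (φ , (λ i l → hφ i (s≤s⁻¹ l)) , hp , q) , h })
     (reg-fin (finS (∀' U) e) λ p → reg-×
        (reg-fun (suc (cnt U)) (finL A e) (λ φ _ → HasS (∀' U) E p × mapS U (inst φ) p ≡ b)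
           (λ { φ φ' w h (hp , q) → hp , trans (sym (mapS-congH U (λ { zero r (i , l , refl) → h i (s≤s l) ; (suc n) r _ → refl }) p hp)) q })
           (λ φ → reg-× (reg-const (decT (lin (st (∀' U))) e p)) (reg-const (mapS U (inst φ) p ≟ᴿ b))))
        (regD d e t γ p))
  regD (!I _ _) e t γ b = reg-const (b ≟ᴿ un)

-- Boxes over decorated inputs: letters act according to a finite flag computed from the decorations along the path.

record Deco (n a : ℕ) (F : Set) : Set₁ where
  field
    lett  : Fin a → Fin (suc n)
    Fl    : Set
    fl₀   : Fl
    fstep : Fl → Fin a → Fl
    N x₀  : ℕ
    fact  : F → Fl → ℕ → ℕ
    fact< : ∀ c fl v → v < N → fact c fl v < N
    x₀<   : x₀ < N

look : ∀ {m} → Word m → ℕ → Maybe (Fin m)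
look []      _       = nothing
look (c ∷ w) zero    = just c
look (c ∷ w) (suc q) = look w q

look-++ : ∀ {m} (u : Word m) c v → look (u ++ c ∷ v) (length u) ≡ just c
look-++ [] c v = refl
look-++ (x ∷ u) c v = look-++ u c v

stepM : ∀ {Fl X : Set} → (Fl → X → Fl) → Fl → Maybe X → Fl
stepM f fl nothing  = fl
stepM f fl (just c) = f fl c

flagOf : ∀ {a} {Fl : Set} → Fl → (Fl → Fin a → Fl) → Word a → List ℕ → Fl
flagOf fl₀ f W []       = fl₀
flagOf fl₀ f W (q ∷ ps) = stepM f (flagOf fl₀ f W ps) (look W q)

module DecoSem {n a : ℕ} {F : Set} (K : Deco n a F) where
  open Boxes n
  open At n {F}
  open Deco K

  flag : Word a → List ℕ → Fl
  flag = flagOf fl₀ fstep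

  web : Word a → Web (F × List ℕ)
  web W = record { N = N ; act = λ (c , ps) → fact c (flag W ps) ; act< = λ (c , ps) → fact< c (flag W ps) ; x₀ = x₀ ; x₀< = x₀< }

  Pts : Raw → Set
  Pts r = Σ ℕ λ v → v < N × r ≡ pt v

  E₀ : PWeb
  E₀ _ = Pts

  wbs : TSub → PWeb
  wbs η n = HasL (η n) E₀

  -- The semantics of the unrolled boxes, restated so that the word is a parameter. An iteration is
  -- a chain of tokens along the word with the output token at the left end. Flags replace the lists
  -- of positions, of which there are infinitely many.
  RBox : Word a → Fl → ∀ {τ} → BoxI τ → Raw → Set
  RTh : Word a → Fl → ∀ {η s} → ThE ⊥ F ⊤ η s → Raw → Set
  Chain : Word a → Fl → (A : LTy) → (Fin (suc n) → BoxI (A ⊸ᴸ A)) → Maybe Raw → Word a → Raw → Set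
  RBox W fl (bx d η _ env) r = ⟦ d ⟧ (wbs η) (λ x → RTh W fl (env x)) (λ _ → nothing) r
  RBox W fl (pr (F₀ c)) r = Σ ℕ λ v → v < N × r ≡ fn (just (pt v)) (pt (fact c fl v))
  RBox W fl (pr X₀) r = r ≡ pt x₀
  RBox W fl (it _ A ds) (fn m b) = HasM (lin A) E₀ m × Chain W fl A ds m W b
  RBox W fl (it _ A ds) _ = ⊥
  RTh W fl t∅ r = ⊥
  RTh W fl (th B _) r = RBox W fl B r
  Chain W fl A ds m [] b = m ≡ just b
  Chain W fl A ds m (c ∷ w) b = Σ (Maybe Raw) λ m' → HasM (lin A) E₀ m' × RBox W (fstep fl c) (ds (lett c)) (fn m' b) × AllM (Chain W fl A ds m w) m'

  module _ (W : Word a) where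
    open BoxSem n {⊥} (web W)

    w : Word (suc n)
    w = map lett W

    ltr-lett : ∀ u c v → ltr (map lett (u ++ c ∷ v)) (length u) ≡ lett c
    ltr-lett [] c v = refl
    ltr-lett (x ∷ u) c v = ltr-lett u c v

    flag-step : ∀ ps u c v → W ≡ u ++ c ∷ v → flag W (length u ∷ ps) ≡ fstep (flag W ps) c
    flag-step ps u c v refl rewrite look-++ u c v = refl

    sem-flag : ∀ ps {τ} (B : BoxI τ) r → SemBox (at-word w ps B) r → RBox W (flag W ps) B r
    sem-flag⁻ : ∀ ps {τ} (B : BoxI τ) r → RBox W (flag W ps) B r → SemBox (at-word w ps B) r
    sem-flagT : ∀ ps {η s} (B : ThE ⊥ F ⊤ η s) r → SemTh (at-th w ps B) r → RTh W (flag W ps) B r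
    sem-flagT⁻ : ∀ ps {η s} (B : ThE ⊥ F ⊤ η s) r → RTh W (flag W ps) B r → SemTh (at-th w ps B) r

    θc : List ℕ → (A : LTy) → (Fin (suc n) → BoxI (A ⊸ᴸ A)) → PWeb
    θc ps A ds q r = SemBox (at-word w (q ∷ ps) (ds (ltr w q))) r

    chain→ : ∀ ps A ds m u v → W ≡ u ++ v → ∀ b →
             ⟦ cT-ty A (length u) (map lett v) ⟧ (wbs tv) ((λ _ → ⊥) ∷ᶠ θc ps A ds) (m ∷ᶠ λ _ → nothing) b → Chain W (flag W ps) A ds m v b
    chain→ ps A ds m u [] e b h = h
    chain→ ps A ds m u (c ∷ v) e b (m' , hm , h , h') = m' , hm ,
        subst (λ f → RBox W f (ds (lett c)) (fn m' b)) (flag-step ps u c v e)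
          (sem-flag (length u ∷ ps) (ds (lett c)) (fn m' b)
            (subst (λ l → SemBox (at-word w (length u ∷ ps) (ds l)) (fn m' b)) (trans (cong (λ W → ltr (map lett W) (length u)) e) (ltr-lett u c v)) h)) ,
        go m' h'
      where
      eq : length (u ++ c ∷ []) ≡ suc (length u)
      eq = trans (length-++ u) (+-comm (length u) 1)
      go : ∀ m' → AllM (⟦ cT-ty A (suc (length u)) (map lett v) ⟧ (wbs tv) ((λ _ → ⊥) ∷ᶠ θc ps A ds) (m ∷ᶠ λ _ → nothing)) m' → AllM (Chain W (flag W ps) A ds m v) m'
      go nothing _ = tt
      go (just b') h = chain→ ps A ds m (u ++ c ∷ []) v (trans e (sym (++-assoc u (c ∷ []) v))) b'
         (subst (λ k → ⟦ cT-ty A k (map lett v) ⟧ (wbs tv) ((λ _ → ⊥) ∷ᶠ θc ps A ds) (m ∷ᶠ λ _ → nothing) b') (sym eq) h)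

    chain← : ∀ ps A ds m u v → W ≡ u ++ v → ∀ b → Chain W (flag W ps) A ds m v b →
             ⟦ cT-ty A (length u) (map lett v) ⟧ (wbs tv) ((λ _ → ⊥) ∷ᶠ θc ps A ds) (m ∷ᶠ λ _ → nothing) b
    chain← ps A ds m u [] e b h = h
    chain← ps A ds m u (c ∷ v) e b (m' , hm , h , h') = m' , hm ,
        subst (λ l → SemBox (at-word w (length u ∷ ps) (ds l)) (fn m' b)) (sym (trans (cong (λ W → ltr (map lett W) (length u)) e) (ltr-lett u c v)))
          (sem-flag⁻ (length u ∷ ps) (ds (lett c)) (fn m' b)
            (subst (λ f → RBox W f (ds (lett c)) (fn m' b)) (sym (flag-step ps u c v e)) h)) ,
        go m' h'
      where
      eq : length (u ++ c ∷ []) ≡ suc (length u)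
      eq = trans (length-++ u) (+-comm (length u) 1)
      go : ∀ m' → AllM (Chain W (flag W ps) A ds m v) m' → AllM (⟦ cT-ty A (suc (length u)) (map lett v) ⟧ (wbs tv) ((λ _ → ⊥) ∷ᶠ θc ps A ds) (m ∷ᶠ λ _ → nothing)) m'
      go nothing _ = tt
      go (just b') h = subst (λ k → ⟦ cT-ty A k (map lett v) ⟧ (wbs tv) ((λ _ → ⊥) ∷ᶠ θc ps A ds) (m ∷ᶠ λ _ → nothing) b') eq
         (chain← ps A ds m (u ++ c ∷ []) v (trans e (sym (++-assoc u (c ∷ []) v))) b' h)

    sem-flag ps (bx d η e env) r h = mono d (λ _ _ h → h) (λ x r _ → sem-flagT ps (env x) r) (λ _ _ → refl) r h
    sem-flag ps (pr (F₀ c)) r h = h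
    sem-flag ps (pr X₀) r h = h
    sem-flag ps (it _ A ds) (fn m b) (hm , h) = hm , chain→ ps A ds m [] W refl b h
    sem-flag⁻ ps (bx d η e env) r h = mono d (λ _ _ h → h) (λ x r _ → sem-flagT⁻ ps (env x) r) (λ _ _ → refl) r h
    sem-flag⁻ ps (pr (F₀ c)) r h = h
    sem-flag⁻ ps (pr X₀) r h = h
    sem-flag⁻ ps (it _ A ds) (fn m b) (hm , h) = hm , chain← ps A ds m [] W refl b h
    sem-flagT ps (th B _) r h = sem-flag ps B r h
    sem-flagT⁻ ps (th B _) r h = sem-flag⁻ ps B r h

  finPts : FinW Pts
  finPts = map pt (upTo N) , (λ { r (v , l , refl) → ∈-map⁺ pt (∈-upTo⁺ l) }) , λ r m → case (∈-map⁻ pt m)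
    where
    case : ∀ {r} → Σ ℕ (λ x → x ∈ upTo N × r ≡ pt x) → Pts r
    case (i , m , e) = i , ∈-upTo⁻ m , e

  finWbs : ∀ η n → FinW (wbs η n)
  finWbs η n = finL (η n) (λ _ → finPts)

  -- In an iteration, whether the box of a letter relates two tokens depends on the whole word,
  -- through the iterations nested in it. These are finitely many questions, each regular by
  -- induction; once the answers are guessed, what remains is a path of a finite automaton.
  regBox : ∀ {τ} (B : BoxI τ) fl r → Reg (λ W → RBox W fl B r)
  regTh : ∀ {η s} (B : ThE ⊥ F ⊤ η s) fl r → Reg (λ W → RTh W fl B r)
  regTh t∅ fl r = reg-⊥
  regTh (th B _) fl r = regBox B fl r
  regBox (bx d η _ env) fl r = regD d (finWbs η) {λ W x → RTh W fl (env x)} (λ x _ r → regTh (env x) fl r) (λ _ → nothing) r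
  regBox (pr (F₀ c)) fl r = reg-const (dec r)
    where
    dec : ∀ r → Dec (Σ ℕ λ v → v < N × r ≡ fn (just (pt v)) (pt (fact c fl v)))
    dec (fn (just (pt v)) b) with v ℕ.<? N | b ≟ᴿ pt (fact c fl v)
    ... | yes p | yes refl = yes (v , p , refl)
    ... | no p | _ = no λ { (_ , q , refl) → p q }
    ... | _ | no p = no λ { (_ , q , refl) → p refl }
    dec (pt _) = no λ { (_ , _ , ()) }
    dec un = no λ { (_ , _ , ()) }
    dec (fn nothing _) = no λ { (_ , _ , ()) }
    dec (fn (just un) _) = no λ { (_ , _ , ()) }
    dec (fn (just (fn _ _)) _) = no λ { (_ , _ , ()) }
  regBox (pr X₀) fl r = reg-const (r ≟ᴿ pt x₀)
  regBox (it _ A ds) fl (pt _) = reg-⊥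
  regBox (it _ A ds) fl un = reg-⊥
  regBox (it _ A ds) fl (fn m b) = reg-× (reg-const (decM (lin A) (λ _ → finPts) m))
      (reg-guess {P = λ i → PP (Finite.decode finJ i)} (λ i → regPP (Finite.decode finJ i)) (λ D → PathLang.reg-Path (DD D) goal fz) (λ W → Chain W fl A ds m W b)
        (λ W D ok → (λ h → fwd W D ok W fz h) , (λ h → bwd W D ok W fz h)))
    where
    fA = finL A {E₀} (λ _ → finPts)
    -- The target token comes without a proof that it lies in the web, so it is added at index 0,
    -- where the path starts.
    l = b ∷ proj₁ fA
    Ix = Fin (length l)
    tok : Ix → Raw
    tok = List.lookup l
    Jx = Fin a × Maybe Ix × Ix
    finJ : Finite Jx
    finJ = fin-× (fin-Fin a) (fin-× (fin-Maybe (fin-Fin _)) (fin-Fin _))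
    mtok : Maybe Ix → Maybe Raw
    mtok nothing = nothing
    mtok (just i) = just (tok i)
    PP : Jx → Word a → Set
    PP (c , m' , b') W = HasM (lin A) E₀ (mtok m') × RBox W (fstep fl c) (ds (lett c)) (fn (mtok m') (tok b'))
    regPP : ∀ j → Reg (PP j)
    regPP (c , m' , b') = reg-× (reg-const (decM (lin A) (λ _ → finPts) (mtok m'))) (regBox (ds (lett c)) (fstep fl c) (fn (mtok m') (tok b')))
    DD : Vec Bool (Finite.size finJ) → Fin a → Maybe Ix → Ix → Bool
    DD D c m' b' = lookup D (Finite.code finJ (c , m' , b'))
    goal : Ix → Bool
    goal i = Relation.Nullary.does (m ≟ᴹ just (tok i))
    goal→ : ∀ i → goal i ≡ true → m ≡ just (tok i)
    goal→ i e with m ≟ᴹ just (tok i)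
    ... | yes p = p
    goal← : ∀ i → m ≡ just (tok i) → goal i ≡ true
    goal← i e with m ≟ᴹ just (tok i)
    ... | yes p = refl
    ... | no n = ⊥-elim (n e)
    OK : Word a → Vec Bool (Finite.size finJ) → Set
    OK W D = ∀ i → (lookup D i ≡ true → PP (Finite.decode finJ i) W) × (PP (Finite.decode finJ i) W → lookup D i ≡ true)
    dd→ : ∀ W D → OK W D → ∀ c m' b' → DD D c m' b' ≡ true → PP (c , m' , b') W
    dd→ W D ok c m' b' e = subst (λ j → PP j W) (Finite.decode-code finJ (c , m' , b')) (proj₁ (ok _) e)
    dd← : ∀ W D → OK W D → ∀ c m' b' → PP (c , m' , b') W → DD D c m' b' ≡ true
    dd← W D ok c m' b' h = proj₂ (ok _) (subst (λ j → PP j W) (sym (Finite.decode-code finJ (c , m' , b'))) h)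
    fwd : ∀ W D → OK W D → ∀ v i → Chain W fl A ds m v (tok i) → PathLang.Path (DD D) goal v i
    fwd W D ok [] i h = goal← i h
    fwd W D ok (c ∷ v) i (nothing , hm , h , _) = inj₁ (dd← W D ok c nothing i (hm , h))
    fwd W D ok (c ∷ v) i (just t , hm , h , h') = inj₂ (j , dd← W D ok c (just j) i (subst (λ t → HasL A E₀ t × RBox W (fstep fl c) (ds (lett c)) (fn (just t) (tok i))) e (hm , h)) ,
        fwd W D ok v j (subst (Chain W fl A ds m v) e h'))
      where
      mem : t ∈ l
      mem = there (proj₁ (proj₂ fA) t hm)
      j = Any.index mem
      e : t ≡ tok j
      e = lookup-index mem
    bwd : ∀ W D → OK W D → ∀ v i → PathLang.Path (DD D) goal v i → Chain W fl A ds m v (tok i)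
    bwd W D ok [] i h = goal→ i h
    bwd W D ok (c ∷ v) i (inj₁ e) with dd→ W D ok c nothing i e
    ... | hm , h = nothing , hm , h , tt
    bwd W D ok (c ∷ v) i (inj₂ (j , e , p)) with dd→ W D ok c (just j) i e
    ... | hm , h = just (tok j) , hm , h , bwd W D ok v j p

-- The labelled output and the recognizability of its values

toℕ-map-inj : ∀ {m} (u v : Word m) → map toℕ u ≡ map toℕ v → u ≡ v
toℕ-map-inj [] [] e = refl
toℕ-map-inj (x ∷ u) (y ∷ v) e = cong₂ _∷_ (toℕ-injective (proj₁ (∷-injective e))) (toℕ-map-inj u v (proj₂ (∷-injective e)))

module CoreOut {nΓ nΣ ℓ : ℕ} {f : Word (suc nΓ) → Word (suc nΣ)} (K : Core nΓ nΣ ℓ f) where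
  open Boxes nΓ
  open Core K
  F : Set
  F = Fin (suc nΣ)
  open At nΓ {F}
  Λ : Set
  Λ = F × List ℕ
  open RunBase nΓ {Λ} (letter ∘ proj₁)
  open Run nΓ {Λ} (letter ∘ proj₁)
  open Closures {⊥} {Λ} {⊥} {⊥} {⊥}

  Vw : Word (suc nΓ) → Box∙ endo
  Vw w = at-word w [] body

  x₀-env : Env tv (inΘ (lin (tv 0)) ∷ᶜ emptyCtx)
  x₀-env = eΘ (pr X₀) refl ∷ᵉ (λ _ → e∅)

  outS : Stk endo base
  outS = arg (clo (ax-Θ {x = 0} refl) tv refl x₀-env) nil

  Arg : ℕ → Maybe Raw → Set
  Arg x m = AllM (_≡ pt x) m

  open RunRes
  open Eval nΓ {⊥} {Λ} {⊥} {⊥} {⊥} (λ ()) (letter ∘ proj₁) (λ ()) using (module RBw)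

  abstract
    out-run : ∀ w → RunRes (RBw.rbStk [] (RBw.rb₁ [] (Vw w)) outS) (λ ω → Wt.szBox ω (Vw w) + Wt.szStk ω outS) (λ W → Sem.BoxSt W (Vw w) outS)
    out-run w = runBox _ (Vw w) outS ≤-refl

    O : Word (suc nΓ) → List Λ
    O w = word (out-run w)

    O-f : ∀ w → map proj₁ (O w) ≡ f w
    O-f w = toℕ-map-inj _ _ (chain-inj (β-trans (≡⇒β (sym (chainΛ-chain (O w)))) (β-trans (β-sym (βw (out-run w)))
       (β-trans (β-appc (≡⇒β (rb-at letter w [] body)) β-refl) (sound w)))))
      where
      chainΛ-chain : ∀ u → chainΛ {Λ} (letter ∘ proj₁) u ≡ chain (map toℕ (map proj₁ u))
      chainΛ-chain [] = refl
      chainΛ-chain (a ∷ u) = cong (app _) (chainΛ-chain u)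

    O-wt : ∀ w ω → sum (map ω (O w)) ≤ Wt.szBox ω (Vw w)
    O-wt w ω = ≤-trans (wts (out-run w) ω) (≤-reflexive (+-identityʳ _))

    O-exists : ∀ w (W : Web Λ) → Σ (Maybe Raw) λ m → Arg (Web.x₀ W) m × BoxSem.SemBox nΓ {⊥} W (Vw w) (fn m (pt (foldr (Web.act W) (Web.x₀ W) (O w))))
    O-exists w W with sem← (out-run w) W
    ... | fn nothing b , h , t , _ , refl = nothing , tt , t
    ... | fn (just a) b , h , t , (_ , _ , _ , e) , refl = just a , e , t

    -- Determinism of the model: whatever token is found for the body in some web tells the value of
    -- the output word there. Conclusions about the output are drawn by exhibiting tokens.
    O-unique : ∀ w (W : Web Λ) m y → Arg (Web.x₀ W) m → y < Web.N W → BoxSem.SemBox nΓ {⊥} W (Vw w) (fn m (pt y)) → y ≡ foldr (Web.act W) (Web.x₀ W) (O w)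
    O-unique w W m y a l t with sem→ (out-run w) W (pt y) (fn m (pt y) , (hm m a , (y , l , refl)) , t , go m a , refl)
      where
      open Sem W
      hm : ∀ m → Arg (Web.x₀ W) m → HasM (lin (tv 0)) (Web.E₀ W) m
      hm nothing _ = tt
      hm (just _) refl = _ , Web.x₀< W , refl
      go : ∀ m → Arg (Web.x₀ W) m → AllM (TokClo (clo (ax-Θ {x = 0} refl) tv refl x₀-env)) m
      go nothing _ = tt
      go (just _) refl = (_ , Web.x₀< W , refl) , (λ _ → nothing) , (λ { zero → tt ; (suc x) → tt }) , refl
    ... | refl = refl

  -- Folding the output with values in a finite type is recognizable, even on decorated inputs.
  module ValReg {a : ℕ} (lett : Fin a → Fin (suc nΓ)) {Fl : Set} (fl₀ : Fl) (fstep : Fl → Fin a → Fl)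
                {X : Set} (fin : Finite X) (x₀ : X) (g : F → Fl → X → X) where
    open Finite fin

    num : X → ℕ
    num x = toℕ (code x)

    unnum : ℕ → X
    unnum v with v ℕ.<? size
    ... | yes p = decode (fromℕ< p)
    ... | no _ = x₀

    unnum-num : ∀ x → unnum (num x) ≡ x
    unnum-num x with num x ℕ.<? size
    ... | yes p = trans (cong decode (fromℕ<-toℕ (code x) p)) (decode-code x)
    ... | no n = ⊥-elim (n (toℕ<n (code x)))

    deco : Deco nΓ a F
    deco = record { lett = lett ; Fl = Fl ; fl₀ = fl₀ ; fstep = fstep ; N = size ; x₀ = num x₀
      ; fact = λ c fl v → num (g c fl (unnum v)) ; fact< = λ c fl v _ → toℕ<n (code (g c fl (unnum v))) ; x₀< = toℕ<n (code x₀) }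

    open DecoSem deco using (web; RBox; sem-flag; sem-flag⁻; regBox)

    val : Word a → X
    val W = foldr (λ (c , ps) → g c (flagOf fl₀ fstep W ps)) x₀ (O (map lett W))

    val-num : ∀ W u → foldr (Web.act (web W)) (Web.x₀ (web W)) u ≡ num (foldr (λ (c , ps) → g c (flagOf fl₀ fstep W ps)) x₀ u)
    val-num W [] = refl
    val-num W ((c , ps) ∷ u) = cong (λ v → num (g c (flagOf fl₀ fstep W ps) v)) (trans (cong unnum (val-num W u)) (unnum-num _))

    val-reg : ∀ x → Reg (λ W → val W ≡ x)
    val-reg x = reg-⇔
        (λ { W (m , _ , a , t) → trans (sym (unnum-num (val W))) (trans (cong unnum (sym (trans (O-unique (map lett W) (web W) m (num x) a (toℕ<n (code x))
                 (sem-flag⁻ W [] body _ t)) (val-num W (O (map lett W)))))) (unnum-num x)) })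
        (λ { W refl → let (m , a , t) = O-exists (map lett W) (web W) in m , mem m a , a ,
                 sem-flag W [] body _ (subst (λ y → BoxSem.SemBox nΓ {⊥} (web W) (Vw (map lett W)) (fn m (pt y))) (val-num W (O (map lett W))) t) })
        (reg-∃ {P = λ m W → Arg (num x₀) m × RBox W fl₀ body (fn m (pt (num x)))} (nothing ∷ just (pt (num x₀)) ∷ [])
           (λ m → reg-× (reg-const (decA m)) (regBox body fl₀ (fn m (pt (num x))))))
      where
      decA : ∀ m → Dec (Arg (num x₀) m)
      decA nothing = yes tt
      decA (just r) = r ≟ᴿ pt (num x₀)
      mem : ∀ m → Arg (num x₀) m → m ∈ (nothing ∷ just (pt (num x₀)) ∷ [])
      mem nothing _ = here refl
      mem (just _) refl = there (here refl)

-- Letters act on the value of the rest of the output, as in a right fold. So the value of a suffix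
-- is the set of states of `D` from which that suffix is accepted.
core-regular : ∀ {nΓ nΣ ℓ f} → Core nΓ nΣ ℓ f → RegularityPreserving (suc nΓ) (suc nΣ) f
core-regular {nΓ} {nΣ} {ℓ} {f} K lang (D , e) =
   reg-⇔ {Q = λ w → lang (f w)} (λ { w (x , _ , q , v) → Equivalence.from (e (f w)) (trans (sym (fin-acc (f w) (start))) (trans (cong (λ x → lookup x start) (trans (sym (vals w)) q)) v)) })
         (λ w h → _ , elems-∈ finX (val w) , refl , trans (cong (λ x → lookup x start) (vals w)) (trans (fin-acc (f w) start) (Equivalence.to (e (f w)) h)))
         (reg-∃ {P = λ x w → val w ≡ x × lookup x start ≡ true} (elems finX) (λ x → reg-× (val-reg x) (reg-const (lookup x start Data.Bool.≟ true))))
  where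
  open CoreOut K
  open DFA D
  finX : Finite (Vec Bool Q)
  finX = fin-Vec fin-Bool Q
  g : Fin (suc nΣ) → ⊤ → Vec Bool Q → Vec Bool Q
  g c _ v = tabulate (λ q → lookup v (δ q c))
  open ValReg {suc nΓ} id tt (λ _ _ → tt) finX (tabulate acc) g
  fin-acc : ∀ u q → lookup (foldr (λ c → g c tt) (tabulate acc) u) q ≡ acc (foldl δ q u)
  fin-acc [] q = lookup∘tabulate acc q
  fin-acc (c ∷ u) q = trans (lookup∘tabulate _ q) (fin-acc u (δ q c))
  vals : ∀ w → val w ≡ foldr (λ c → g c tt) (tabulate acc) (f w)
  vals w = trans (cong (λ u → foldr _ (tabulate acc) (O u)) (map-id w)) (trans (go (O w)) (cong (foldr _ (tabulate acc)) (O-f w)))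
    where
    go : ∀ u → foldr (λ (c , ps) → g c (flagOf tt (λ _ _ → tt) w ps)) (tabulate acc) u ≡ foldr (λ c → g c tt) (tabulate acc) (map proj₁ u)
    go [] = refl
    go (c ∷ u) = cong (g (proj₁ c) tt) (go u)

-- Words in which adjacent equal mergeable symbols are identified

module Red {Sy : Set} (_≟_ : (x y : Sy) → Dec (x ≡ y)) (mer : Sy → Bool) where

  Merges : Sy → List Sy → Set
  Merges x s = mer x ≡ true × Σ (List Sy) λ s' → s ≡ x ∷ s'

  merges? : ∀ x s → Dec (Merges x s)
  merges? x [] = no λ { (_ , _ , ()) }
  merges? x (y ∷ s) with mer x in e | x ≟ y
  ... | true  | yes refl = yes (refl , s , refl)
  ... | true  | no n = no λ { (_ , _ , refl) → n refl }
  ... | false | _ = no λ { (() , _) }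

  push : Sy → List Sy → List Sy
  push x s with merges? x s
  ... | yes _ = s
  ... | no _  = x ∷ s

  push-m : ∀ {x s} → Merges x s → push x s ≡ s
  push-m {x} {s} m with merges? x s
  ... | yes _ = refl
  ... | no n = ⊥-elim (n m)

  push-n : ∀ {x s} → ¬ Merges x s → push x s ≡ x ∷ s
  push-n {x} {s} n with merges? x s
  ... | yes m = ⊥-elim (n m)
  ... | no _ = refl

  red : List Sy → List Sy
  red = foldr push []

  redOn : List Sy → List Sy → List Sy
  redOn s u = foldr push s u

  redOn-pre : ∀ s u → Σ (List Sy) λ p → redOn s u ≡ p ++ s
  redOn-pre s [] = [] , refl
  redOn-pre s (x ∷ u) with redOn-pre s u | merges? x (redOn s u)
  ... | p , e | yes _ = p , e
  ... | p , e | no _ = x ∷ p , cong (x ∷_) e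

  push-len : ∀ x s → length s ≤ length (push x s)
  push-len x s with merges? x s
  ... | yes _ = ≤-refl
  ... | no _ = n≤1+n _

  redOn-len : ∀ s u → length s ≤ length (redOn s u)
  redOn-len s [] = ≤-refl
  redOn-len s (x ∷ u) = ≤-trans (redOn-len s u) (push-len x (redOn s u))

  red-len : ∀ u → length (red u) ≤ length u
  red-len [] = z≤n
  red-len (x ∷ u) with merges? x (red u)
  ... | yes _ = ≤-trans (red-len u) (n≤1+n _)
  ... | no _ = s≤s (red-len u)

  -- Reduced words: between two occurrences of a mergeable symbol z there is another symbol.
  module Count (z : Sy) (zm : mer z ≡ true) where
    others : List Sy → ℕ
    others [] = 0
    others (x ∷ s) with x ≟ z
    ... | yes _ = others s
    ... | no _ = suc (others s)

    NoZ : List Sy → Set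
    NoZ s = ¬ (Σ (List Sy) λ s' → s ≡ z ∷ s')

    red-count : ∀ u → length (red u) ≤ 2 * others (red u) + 1 × (NoZ (red u) → length (red u) ≤ 2 * others (red u))
    red-count [] = z≤n , λ _ → z≤n
    red-count (x ∷ u) with merges? x (red u)
    ... | yes _ = red-count u
    ... | no n with x ≟ z
    ... | yes refl = ≤-trans (s≤s (proj₂ (red-count u) (λ (s' , e) → n (zm , s' , e)))) (≤-reflexive (+-comm 1 _)) , λ nz → ⊥-elim (nz (_ , refl))
    ... | no _ = ≤-trans h (m≤m+n _ 1) , λ _ → h
      where
      h : suc (length (red u)) ≤ 2 * suc (others (red u))
      h = ≤-trans (s≤s (proj₁ (red-count u))) (≤-reflexive (trans (+-comm 1 _) (trans (+-assoc (2 * others (red u)) 1 1) (trans (+-comm _ 2) (sym (*-suc 2 (others (red u))))))))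

-- Lists cut off at length k, in a form whose finiteness is evident. Patterns of bounded length
-- become states of finite machines in this way.
BL : Set → ℕ → Set
BL A zero    = ⊤
BL A (suc k) = Maybe (A × BL A k)

fin-BL : ∀ {A} → Finite A → ∀ k → Finite (BL A k)
fin-BL f zero    = fin-⊤
fin-BL f (suc k) = fin-Maybe (fin-× f (fin-BL f k))

fromBL : ∀ {A} k → BL A k → List A
fromBL zero    _ = []
fromBL (suc k) nothing = []
fromBL (suc k) (just (a , b)) = a ∷ fromBL k b

toBL : ∀ {A} k → List A → BL A k
toBL zero    _ = tt
toBL (suc k) [] = nothing
toBL (suc k) (a ∷ l) = just (a , toBL k l)

from-toBL : ∀ {A : Set} k (l : List A) → fromBL k (toBL k l) ≡ take k l
from-toBL zero    l = refl
from-toBL (suc k) [] = refl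
from-toBL (suc k) (a ∷ l) = cong (a ∷_) (from-toBL k l)

take-all : ∀ {A : Set} k (l : List A) → length l ≤ k → take k l ≡ l
take-all zero [] _ = refl
take-all (suc k) [] _ = refl
take-all (suc k) (a ∷ l) (s≤s p) = cong (a ∷_) (take-all k l p)

from-toBL-≤ : ∀ {A : Set} k (l : List A) → length l ≤ k → fromBL k (toBL k l) ≡ l
from-toBL-≤ k l p = trans (from-toBL k l) (take-all k l p)

record Moore (a : ℕ) (X : Set) : Set₁ where
  field
    St   : Set
    fin  : Finite St
    init : St
    step : St → Fin a → St
    out  : St → X

mooreM : ∀ {a X} {v : Word a → X} (l : List X) → (∀ x → Reg (λ w → v w ≡ x)) →
         Σ (Moore a (Maybe X)) λ M → ∀ w → (v w ∈ l → Moore.out M (foldl (Moore.step M) (Moore.init M) w) ≡ just (v w))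
mooreM [] r = record { St = ⊤ ; fin = fin-⊤ ; init = tt ; step = λ _ _ → tt ; out = λ _ → nothing } , λ w ()
mooreM {a} {X} {v} (x ∷ l) r with mooreM l r | r x
... | M , h | D , e = record { St = Fin (DFA.Q D) × Moore.St M ; fin = fin-× (fin-Fin _) (Moore.fin M) ; init = DFA.start D , Moore.init M
     ; step = λ (p , q) c → DFA.δ D p c , Moore.step M q c ; out = o } ,
   λ w m → trans (cong o (run2 (DFA.δ D) (Moore.step M) (DFA.start D) (Moore.init M) w)) (go w m)
  where
  o : Fin (DFA.Q D) × Moore.St M → Maybe X
  o (p , q) = if DFA.acc D p then just x else Moore.out M q
  go : ∀ w → v w ∈ x ∷ l → (if accepts D w then just x else Moore.out M (foldl (Moore.step M) (Moore.init M) w)) ≡ just (v w)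
  go w m with accepts D w in eq
  ... | true = cong just (sym (Equivalence.from (e w) eq))
  go w (here p) | false = ⊥-elim (ft (trans (sym eq) (Equivalence.to (e w) p)))
    where
    ft : false ≡ true → ⊥
    ft ()
  go w (there m) | false = h w m

-- Automata for all values run side by side and the first accepting one names the value; `x₀` fills
-- in where none accepts.
moore : ∀ {a X} (v : Word a → X) → Finite X → X → (∀ x → Reg (λ w → v w ≡ x)) →
        Σ (Moore a X) λ M → ∀ w → Moore.out M (foldl (Moore.step M) (Moore.init M) w) ≡ v w
moore {a} {X} v f x₀ r with mooreM (elems f) r
... | M , h = record { St = Moore.St M ; fin = Moore.fin M ; init = Moore.init M ; step = Moore.step M ; out = o ∘ Moore.out M } ,
     λ w → cong o (h w (elems-∈ f (v w)))
  where
  o : Maybe X → X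
  o nothing = x₀
  o (just x) = x

data Distinct {A : Set} : List A → Set where
  []  : Distinct []
  _∷_ : ∀ {x l} → ¬ (x ∈ l) → Distinct l → Distinct (x ∷ l)

remove : ∀ {A : Set} {x : A} l → x ∈ l → Σ (List A) λ l' → length l ≡ suc (length l') × (∀ y → y ∈ l → y ≡ x ⊎ y ∈ l')
remove (x ∷ l) (here refl) = l , refl , λ { y (here e) → inj₁ e ; y (there m) → inj₂ m }
remove (z ∷ l) (there m) with remove l m
... | l' , e , f = z ∷ l' , cong suc e , λ { y (here refl) → inj₂ (here refl) ; y (there m) → case (f y m) }
  where
  case : ∀ {y} → y ≡ _ ⊎ y ∈ l' → y ≡ _ ⊎ y ∈ z ∷ l'
  case (inj₁ e) = inj₁ e
  case (inj₂ m) = inj₂ (there m)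

distinct-≤ : ∀ {A : Set} (l m : List A) → Distinct l → (∀ x → x ∈ l → x ∈ m) → length l ≤ length m
distinct-≤ [] m d s = z≤n
distinct-≤ (x ∷ l) m (n ∷ d) s with remove m (s x (here refl))
... | m' , e , f = ≤-trans (s≤s (distinct-≤ l m' d (λ y p → case y p (f y (s y (there p)))))) (≤-reflexive (sym e))
  where
  case : ∀ y → y ∈ l → y ≡ x ⊎ y ∈ m' → y ∈ m'
  case y p (inj₁ refl) = ⊥-elim (n p)
  case y p (inj₂ q) = q

-- Static bounds on the number of output letters

sumF : ∀ {k} → (Fin k → ℕ) → ℕ
sumF {zero} f = 0
sumF {suc k} f = f fz + sumF (f ∘ fs)

sumF-≥ : ∀ {k} (f : Fin k → ℕ) i → f i ≤ sumF f
sumF-≥ f fz = m≤m+n _ _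
sumF-≥ f (fs i) = ≤-trans (sumF-≥ (f ∘ fs) i) (m≤n+m _ (f fz))

szD-scale : ∀ {C t σ} (d : C ⊢ t ∶ σ) e e' P → (∀ x → e' x ≤ e x * P) → szD 0 d e' ≤ szD 0 d e * P
szD-scale (ax-Γ _) e e' P h = h _
szD-scale (ax-Θ _) e e' P h = h _
szD-scale (⊸I d) e e' P h = szD-scale d _ _ P (λ { zero → z≤n ; (suc x) → h x })
szD-scale (⊸I! d) e e' P h = szD-scale d _ _ P (λ { zero → z≤n ; (suc x) → h x })
szD-scale (⊸E _ d d') e e' P h = ≤-trans (+-mono-≤ (szD-scale d e e' P h) (szD-scale d' e e' P h)) (≤-reflexive (sym (*-distribʳ-+ P (szD 0 d e) _)))
szD-scale (∀I d) e e' P h = szD-scale d e e' P h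
szD-scale (∀E _ d) e e' P h = szD-scale d e e' P h
szD-scale (!I _ d) e e' P h = z≤n

cT-sum : ∀ {m} A k (v : Word m) e M → (∀ q → q < k + length v → e (suc q) ≤ M) → szD 0 (cT-ty A k v) e ≤ e 0 + length v * M
cT-sum A k [] e M h = ≤-reflexive (sym (+-identityʳ _))
cT-sum A k (c ∷ v) e M h = ≤-trans (+-mono-≤ (h k (≤-trans (s≤s (m≤m+n k _)) (≤-reflexive (sym (+-suc k _)))))
      (cT-sum A (suc k) v e M (λ q l → h q (≤-trans l (≤-reflexive (sym (+-suc k _)))))))
   (≤-reflexive (trans (sym (+-assoc M (e 0) _)) (trans (cong (_+ length v * M) (+-comm M (e 0))) (+-assoc (e 0) M _))))

cT-zero : ∀ {m} A k (v : Word m) e → (∀ q → k ≤ q → e (suc q) ≡ 0) → szD 0 (cT-ty A k v) e ≡ e 0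
cT-zero A k [] e h = refl
cT-zero A k (c ∷ v) e h = cong₂ _+_ (h k ≤-refl) (cT-zero A (suc k) v e (λ q l → h q (≤-trans (n≤1+n k) l)))

cT-one : ∀ {m} A k (v : Word m) e M → e 0 ≡ 0 → (∀ q → e (suc q) ≤ M) → (∀ q q' → ¬ e (suc q) ≡ 0 → ¬ e (suc q') ≡ 0 → q ≡ q') → szD 0 (cT-ty A k v) e ≤ M
cT-one A k [] e M z h u = ≤-trans (≤-reflexive z) z≤n
cT-one A k (c ∷ v) e M z h u with e (suc k) ℕ.≟ 0
... | yes p = ≤-trans (≤-reflexive (cong (_+ szD 0 (cT-ty A (suc k) v) e) p)) (cT-one A (suc k) v e M z h u)
... | no n = ≤-trans (≤-reflexive (trans (cong (e (suc k) +_) (trans (cT-zero A (suc k) v e later) z)) (+-identityʳ _))) (h k)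
  where
  later : ∀ q → suc k ≤ q → e (suc q) ≡ 0
  later q l with e (suc q) ℕ.≟ 0
  ... | yes p = p
  ... | no n' = ⊥-elim (<⇒≢ l (u k q n n'))

module Bounds (n : ℕ) {F : Set} where
  open Boxes n
  open At n {F}
  open Closures {⊥} {F × List ℕ} {⊥} {⊥} {⊥} using (module Sizes)

  bndB : ∀ {τ} → BoxI τ → ℕ
  bndT : ∀ {η s} → ThE ⊥ F ⊤ η s → ℕ
  bndB (bx d _ _ env) = szD 0 d (λ x → bndT (env x))
  bndB (pr (F₀ _)) = 1
  bndB (pr X₀) = 0
  bndB (it _ _ ds) = sumF (λ c → bndB (ds c))
  bndT t∅ = 0
  bndT (th B _) = bndB B

  ite : Bool → ℕ → ℕ
  ite b k = if b then k else 0

  module _ (w : Word (suc n)) (e : List ℕ → Bool) (down : ∀ q ps → e (q ∷ ps) ≡ true → e ps ≡ true)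
           (uniq : ∀ q q' ps → e (q ∷ ps) ≡ true → e (q' ∷ ps) ≡ true → q ≡ q') where
    open Sizes 0 0 (λ (c , ps) → ite (e ps) 1)

    -- At most one position is selected below each path, so at most one copy in an unrolled
    -- iteration has non-zero size, and it is bounded by the sum over the letters. The bound is thus
    -- independent of the word.
    few : ∀ ps {τ} (B : BoxI τ) → szBox (at-word w ps B) ≤ ite (e ps) (bndB B)
    fewT : ∀ ps {η s} (B : ThE ⊥ F ⊤ η s) → szTh (at-th w ps B) ≤ ite (e ps) (bndT B)
    few ps (bx d η _ env) with e ps in eq
    ... | true = szD-mono 0 d (λ x → ≤-trans (fewT ps (env x)) (≤-reflexive (cong (λ b → ite b (bndT (env x))) eq)))
    ... | false = ≤-reflexive (szD-closed d _ (λ x → n≤0⇒n≡0 (≤-trans (fewT ps (env x)) (≤-reflexive (cong (λ b → ite b (bndT (env x))) eq)))))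
    few ps (pr (F₀ _)) = ≤-refl
    few ps (pr X₀) = z≤n
    few ps (it _ A ds) = cT-one A 0 w _ _ refl
       (λ q → ≤-trans (few (q ∷ ps) (ds (ltr w q))) (le q))
       (λ q q' a b → uniq q q' ps (nz q a) (nz q' b))
      where
      le : ∀ q → ite (e (q ∷ ps)) (bndB (ds (ltr w q))) ≤ ite (e ps) (sumF (λ c → bndB (ds c)))
      le q with e (q ∷ ps) in eq
      ... | false = z≤n
      ... | true rewrite down q ps eq = sumF-≥ (λ c → bndB (ds c)) (ltr w q)
      nz : ∀ q → ¬ szBox (at-word w (q ∷ ps) (ds (ltr w q))) ≡ 0 → e (q ∷ ps) ≡ true
      nz q h with e (q ∷ ps) in eq
      ... | true = refl
      ... | false = ⊥-elim (h (n≤0⇒n≡0 (≤-trans (few (q ∷ ps) (ds (ltr w q))) (≤-reflexive (cong (λ b → ite b (bndB (ds (ltr w q)))) eq)))))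
    fewT ps t∅ = z≤n
    fewT ps (th B _) = few ps B

  module _ (w : Word (suc n)) where
    open Sizes 0 0 (λ (_ : F × List ℕ) → 1)

    -- Each level of iteration multiplies the count by the number of positions.
    total : ∀ ps ℓ {τ} (B : BoxI τ) → Lvl ℓ B → szBox (at-word w ps B) ≤ bndB B * suc (length w) ^ ℓ
    totalT : ∀ ps ℓ {η s} (B : ThE ⊥ F ⊤ η s) → LvlTh ℓ B → szTh (at-th w ps B) ≤ bndT B * suc (length w) ^ ℓ
    total ps ℓ (bx d η _ env) l = szD-scale d _ _ _ (λ x → totalT ps ℓ (env x) (l x))
    total ps ℓ (pr (F₀ _)) l = ≤-trans (m^n>0 (suc (length w)) ℓ) (≤-reflexive (sym (+-identityʳ _)))
    total ps ℓ (pr X₀) l = z≤n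
    total ps ℓ (it _ A ds) (k , kl , l) = ≤-trans (cT-sum A 0 w _ M (λ q _ → ≤-trans (total (q ∷ ps) k (ds (ltr w q)) (l _)) (*-monoˡ-≤ (S' ^ k) (sumF-≥ (λ c → bndB (ds c)) (ltr w q)))))
       (≤-trans (*-monoˡ-≤ M (n≤1+n (length w))) (≤-trans (≤-reflexive (trans (sym (*-assoc S' b _)) (trans (cong (_* S' ^ k) (*-comm S' b)) (*-assoc b S' _)))) (*-monoʳ-≤ b (^-monoʳ-≤ S' kl))))
      where
      -- The base is length plus one, since powers of it grow with the exponent even for the empty
      -- word.
      S' = suc (length w)
      b = sumF (λ c → bndB (ds c))
      M = b * S' ^ k
    totalT ps ℓ t∅ l = z≤n
    totalT ps ℓ (th B _) l = total ps ℓ B l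

  module _ (w : Word (suc n)) (ω : F × List ℕ → ℕ) where
    open Sizes 0 0 ω

    -- A weight that vanishes on admissible paths gives the box weight 0. Applied to the weight that
    -- punishes bad labels, this shows that all labels of output letters are admissible.
    paths : ∀ ps ℓ {τ} (B : BoxI τ) → Lvl ℓ B → (∀ c qs → length qs ≤ ℓ → All (_< length w) qs → ω (c , qs ++ ps) ≡ 0) → szBox (at-word w ps B) ≡ 0
    pathsT : ∀ ps ℓ {η s} (B : ThE ⊥ F ⊤ η s) → LvlTh ℓ B → (∀ c qs → length qs ≤ ℓ → All (_< length w) qs → ω (c , qs ++ ps) ≡ 0) → szTh (at-th w ps B) ≡ 0
    paths ps ℓ (bx d η _ env) l h = szD-closed d _ (λ x → pathsT ps ℓ (env x) (l x) h)
    paths ps ℓ (pr (F₀ c)) l h = h c [] z≤n []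
    paths ps ℓ (pr X₀) l h = refl
    paths ps ℓ (it _ A ds) (k , kl , l) h = n≤0⇒n≡0 (≤-trans (cT-sum A 0 w _ 0 (λ q ql → ≤-reflexive (paths (q ∷ ps) k (ds (ltr w q)) (l _)
        (λ c qs len a → trans (cong (λ p → ω (c , p)) (sym (++-assoc qs (q ∷ []) ps)))
            (h c (qs ++ q ∷ []) (≤-trans (≤-reflexive (trans (length-++ qs) (+-comm _ 1))) (≤-trans (s≤s len) kl)) (++⁺ a (ql ∷ [])))))))
        (≤-reflexive (*-zeroʳ (length w))))
    pathsT ps ℓ t∅ l h = refl
    pathsT ps ℓ (th B _) l h = paths ps ℓ B l h

-- A bound on the number of blocks around a position

module TwoDeco {n a : ℕ} {F : Set} (lett : Fin a → Fin (suc n)) {Fl : Set} (fl₀ : Fl) (fstep : Fl → Fin a → Fl) (x₀ : ℕ)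
   (N : ℕ) (fact : F → Fl → ℕ → ℕ) (fact< : ∀ c fl v → v < N → fact c fl v < N) (x₀< : x₀ < N)
   (N' : ℕ) (fact' : F → Fl → ℕ → ℕ) (fact'< : ∀ c fl v → v < N' → fact' c fl v < N') (x₀<' : x₀ < N') where
  open Boxes n
  open At n {F}

  K₁ K₂ : Deco n a F
  K₁ = record { lett = lett ; Fl = Fl ; fl₀ = fl₀ ; fstep = fstep ; N = N ; x₀ = x₀ ; fact = fact ; fact< = fact< ; x₀< = x₀< }
  K₂ = record { lett = lett ; Fl = Fl ; fl₀ = fl₀ ; fstep = fstep ; N = N' ; x₀ = x₀ ; fact = fact' ; fact< = fact'< ; x₀< = x₀<' }

  module D₁ = DecoSem K₁
  module D₂ = DecoSem K₂

  ptm : (ℕ → ℕ) → Raw → Raw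
  ptm χ (pt v) = pt (χ v)
  ptm χ r = r

  module _ (χ : ℕ → ℕ) (χ< : ∀ v → v < N → χ v < N') (χx : χ x₀ ≡ x₀) (P : Fl → Set) (Pstep : ∀ fl c → P fl → P (fstep fl c))
           (eqv : ∀ fl c v → P fl → v < N → χ (fact c fl v) ≡ fact' c fl (χ v)) where
    ρ : RMap
    ρ _ = ptm χ

    ρη : TSub → RMap
    ρη η n = mapL (η n) ρ

    e₀ : ∀ n r → D₁.E₀ n r → D₂.E₀ n (ρ n r)
    e₀ n r (v , l , refl) = χ v , χ< v l , refl

    -- `func` extended through iterations. The map `χ` has to commute with the letters under flags
    -- satisfying `P` only, so different maps may be used for letters of different colours.
    funcBox : ∀ W fl {τ} (B : BoxI τ) r → P fl → D₁.RBox W fl B r → D₂.RBox W fl B (mapT τ ρ r)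
    funcTh : ∀ W fl {η s σ} (B : ThE ⊥ F ⊤ η s) r → s ≡ inΘ σ → P fl → D₁.RTh W fl B r → D₂.RTh W fl B (mapT σ (ρη η) r)
    funcChain : ∀ W fl A ds m v b → P fl → D₁.Chain W fl A ds m v b → D₂.Chain W fl A ds (mapM (lin A) ρ m) v (mapL A ρ b)
    funcBox W fl (bx {σ = σ} d η refl env) r p h = subst (D₂.RBox W fl (bx d η refl env)) (sym (mapT-sub σ (λ _ _ → refl) r))
       (func d {ρ = ρη η} (λ n r → HasL-map (η n) e₀ r) (λ x r q → funcTh W fl (env x) r q p) (λ x q → refl) r h)
    funcBox W fl (pr (F₀ c)) r p (v , l , refl) = χ v , χ< v l , cong (λ y → fn (just (pt (χ v))) (pt y)) (eqv fl c v p l)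
    funcBox W fl (pr X₀) r p refl = cong pt χx
    funcBox W fl (it _ A ds) (fn m b) p (hm , h) = HasM-map (lin A) e₀ m hm , funcChain W fl A ds m W b p h
    funcTh W fl {η} (th {σ = σ} B refl) r refl p h = subst (D₂.RBox W fl B) (mapT-sub σ (λ _ _ → refl) r) (funcBox W fl B r p h)
    funcChain W fl A ds m [] b p refl = refl
    funcChain W fl A ds m (c ∷ v) b p (m' , hm , h , h') = mapM (lin A) ρ m' , HasM-map (lin A) e₀ m' hm ,
        funcBox W (fstep fl c) (ds (lett c)) (fn m' b) (Pstep fl c p) h , go m' h'
      where
      go : ∀ m' → AllM (D₁.Chain W fl A ds m v) m' → AllM (D₂.Chain W fl A ds (mapM (lin A) ρ m) v) (mapM (lin A) ρ m')
      go nothing _ = tt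
      go (just b') h = funcChain W fl A ds m v b' p h

-- Colouring of the positions: left of, at, or right of a chosen one.  Letters inherit the colour of their outermost position.
data Col3 : Set where
  cl cc cr : Col3

stepC : ∀ {a} → (Fin a → Col3) → Maybe Col3 → Fin a → Maybe Col3
stepC color nothing  c = just (color c)
stepC color (just κ) c = just κ

oneT : Ty → ℕ
oneT = cwT (λ _ → 1)

-- Finite support.  A value θ on which no interface token between the right part and the rest depends
-- can be split into two copies θ and N + θ such that only the right part sees the second one.
module Support {n a : ℕ} {F : Set} (lett : Fin a → Fin (suc n)) (color : Fin a → Col3) (x₀ N : ℕ)
   (fact : F → Maybe Col3 → ℕ → ℕ) (fact< : ∀ c fl v → v < N → fact c fl v < N) (x₀< : x₀ < N) where
  open Boxes n
  open At n {F}

  Fl = Maybe Col3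

  -- The base point must stay in the first copy. Right letters must fix `θ`, as they do when `θ` is
  -- the value of a word that begins with a block of right letters.
  Good : ℕ → Set
  Good θ = θ < N × ¬ θ ≡ x₀ × (∀ c → fact c (just cr) θ ≡ θ)

  splitR₀ : ℕ → ℕ → ℕ → ℕ
  splitR₀ θ v y with y ℕ.≟ θ | v ℕ.≟ θ
  ... | yes _ | no _ = N + θ
  ... | _ | _ = y

  fact₁ : ℕ → F → Fl → ℕ → ℕ
  fact₁ θ c (just cr) v = splitR₀ θ v (fact c (just cr) v)
  fact₁ θ c fl v = fact c fl v

  -- A right letter leading into `θ` from another point is redirected to the second copy, and from
  -- the second copy no letter leads back. A run that enters `θ` through a right letter therefore
  -- ends above N.
  fact' : ℕ → F → Fl → ℕ → ℕ
  fact' θ c fl v with v ℕ.<? N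
  ... | yes _ = fact₁ θ c fl v
  ... | no _  = N + fact c fl (v ∸ N)

  split< : ∀ θ v y → θ < N → y < N → splitR₀ θ v y < N + N
  split< θ v y t l with y ℕ.≟ θ | v ℕ.≟ θ
  ... | yes _ | no _ = +-monoʳ-< N t
  ... | yes _ | yes _ = ≤-trans l (m≤m+n N N)
  ... | no _ | yes _ = ≤-trans l (m≤m+n N N)
  ... | no _ | no _ = ≤-trans l (m≤m+n N N)

  fact₁< : ∀ θ → θ < N → ∀ c fl v → v < N → fact₁ θ c fl v < N + N
  fact₁< θ t c (just cr) v l = split< θ v _ t (fact< c (just cr) v l)
  fact₁< θ t c (just cl) v l = ≤-trans (fact< c (just cl) v l) (m≤m+n N N)
  fact₁< θ t c (just cc) v l = ≤-trans (fact< c (just cc) v l) (m≤m+n N N)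
  fact₁< θ t c nothing v l = ≤-trans (fact< c nothing v l) (m≤m+n N N)

  fact'< : ∀ θ → θ < N → ∀ c fl v → v < N + N → fact' θ c fl v < N + N
  fact'< θ t c fl v l with v ℕ.<? N
  ... | yes p = fact₁< θ t c fl v p
  ... | no p = +-monoʳ-< N (fact< c fl (v ∸ N) (+-cancelˡ-< N _ _ (≤-trans (s≤s (≤-reflexive (m+[n∸m]≡n (≮⇒≥ p)))) l)))

  fact'-old : ∀ θ c fl v → v < N → fact' θ c fl v ≡ fact₁ θ c fl v
  fact'-old θ c fl v l with v ℕ.<? N
  ... | yes _ = refl
  ... | no n = ⊥-elim (n l)

  fact'-new : ∀ θ c fl v → N ≤ v → N ≤ fact' θ c fl v
  fact'-new θ c fl v l with v ℕ.<? N
  ... | yes p = ⊥-elim (<⇒≱ p l)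
  ... | no _ = m≤m+n N _

  χ : ℕ → ℕ → ℕ
  χ θ v with v ℕ.≟ θ
  ... | yes _ = N + θ
  ... | no _ = v

  χ-≢ : ∀ θ v → ¬ v ≡ θ → χ θ v ≡ v
  χ-≢ θ v h with v ℕ.≟ θ
  ... | yes p = ⊥-elim (h p)
  ... | no _ = refl

  module At-θ (θ : ℕ) (g : Good θ) where
    open TwoDeco lett {Fl} nothing (stepC color) x₀ N fact fact< x₀< (N + N) (fact' θ) (fact'< θ (proj₁ g)) (≤-trans x₀< (m≤m+n N N)) public

    χ< : ∀ v → v < N → χ θ v < N + N
    χ< v l with v ℕ.≟ θ
    ... | yes _ = +-monoʳ-< N (proj₁ g)
    ... | no _ = ≤-trans l (m≤m+n N N)

    eqvR : ∀ fl (c : F) v → fl ≡ just cr → v < N → χ θ (fact c fl v) ≡ fact' θ c fl (χ θ v)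
    eqvR fl c v refl l with v ℕ.≟ θ
    ... | yes refl with (N + θ) ℕ.<? N
    ...   | yes p = ⊥-elim (<⇒≱ p (m≤m+n N θ))
    ...   | no _ rewrite m+n∸m≡n N θ | proj₂ (proj₂ g) c with θ ℕ.≟ θ
    ...      | yes _ = refl
    ...      | no q = ⊥-elim (q refl)
    eqvR fl c v refl l | no h with v ℕ.<? N
    ... | no q = ⊥-elim (q l)
    ... | yes _ with fact c (just cr) v ℕ.≟ θ | v ℕ.≟ θ
    ...   | yes e | yes q = ⊥-elim (h q)
    ...   | yes e | no _ = cong (N +_) refl
    ...   | no _ | yes q = ⊥-elim (h q)
    ...   | no _ | no _ = refl

    -- Among right letters, moving `θ` to its copy commutes with the action: a right letter that
    -- enters `θ` now enters the copy, and the copy is fixed as `θ` was.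
    Rights : ∀ W {τ} (B : BoxI τ) r → D₁.RBox W (just cr) B r → D₂.RBox W (just cr) B (mapT τ (λ _ → ptm (χ θ)) r)
    Rights W B r h = funcBox (χ θ) χ< (χ-≢ θ x₀ (λ e → proj₁ (proj₂ g) (sym e))) (_≡ just cr) (λ { fl c refl → refl }) eqvR W (just cr) B r refl h

    data NotR : Fl → Set where
      isL : NotR (just cl)
      isC : NotR (just cc)

    ptm-id : ∀ (n : ℕ) r → ptm id r ≡ r
    ptm-id n (pt _) = refl
    ptm-id n un = refl
    ptm-id n (fn _ _) = refl

    -- Letters that are not on the right act on the first copy as before, so here the inclusion of
    -- the first copy is the equivariant map.
    Others : ∀ W fl → NotR fl → ∀ {τ} (B : BoxI τ) r → D₁.RBox W fl B r → D₂.RBox W fl B r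
    Others W fl nr {τ} B r h = subst (D₂.RBox W fl B) (mapT-id τ ptm-id r)
      (funcBox id (λ v l → ≤-trans l (m≤m+n N N)) refl NotR (λ { _ c isL → isL ; _ c isC → isC })
         (λ { _ c v isL l → sym (fact'-old θ c (just cl) v l) ; _ c v isC l → sym (fact'-old θ c (just cc) v l) }) W fl B r nr h)

  -- The list is a support: doubling a good point outside it leaves the fact `Z` true. What matters
  -- is that its length is bounded before the word is known.
  Supp : ℕ → ((θ : ℕ) → Good θ → Set) → Set
  Supp k Z = Σ (List ℕ) λ ls → length ls ≤ k × (∀ θ g → ¬ (θ ∈ ls) → Z θ g)

  supp-pure : ∀ {Z k} → (∀ θ g → Z θ g) → Supp k Z
  supp-pure z = [] , z≤n , λ θ g _ → z θ g

  supp-map : ∀ {Z Z' : (θ : ℕ) → Good θ → Set} {k} → (∀ θ g → Z θ g → Z' θ g) → Supp k Z → Supp k Z'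
  supp-map f (ls , l , h) = ls , l , λ θ g n → f θ g (h θ g n)

  supp-× : ∀ {Z Z' : (θ : ℕ) → Good θ → Set} {k k'} → Supp k Z → Supp k' Z' → Supp (k + k') (λ θ g → Z θ g × Z' θ g)
  supp-× (ls , l , h) (ls' , l' , h') = ls ++ ls' , ≤-trans (≤-reflexive (length-++ ls)) (+-mono-≤ l l') ,
     λ θ g n → h θ g (n ∘ ∈-++⁺ˡ) , h' θ g (n ∘ ∈-++⁺ʳ ls)

  -- For a given token, each use of a variable of Θ demands one token of it and contributes the
  -- support of that demand. The uses outside boxes are counted by `szD`, and their supports are
  -- concatenated.
  suppD : ∀ {C t σ} (d : C ⊢ t ∶ σ) {E E' : PWeb} → (∀ n r → E n r → E' n r) → {θ₁ : PWeb} {θ₂ : (θ : ℕ) → Good θ → PWeb} {k : ℕ → ℕ} →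
          (∀ x {σ} r → C x ≡ inΘ σ → θ₁ x r → Supp (k x) (λ θ g → θ₂ θ g x r)) → ∀ γ b → ⟦ d ⟧ E θ₁ γ b →
          Supp (szD 0 d k) (λ θ g → ⟦ d ⟧ E' (θ₂ θ g) γ b)
  suppD (ax-Γ _) e t γ b h = supp-pure (λ _ _ → h)
  suppD (ax-Θ {x = x} q) e t γ b h = t x b q h
  suppD (⊸I {A = A} d) e t γ (fn m b) (hm , h) = supp-map (λ _ _ h → subst (HasM (lin A) _) (mapM-id (lin A) (λ _ _ → refl) m) (HasM-map (lin A) e m hm) , h)
     (suppD d e (λ { (suc x) r q → t x r q }) (m ∷ᶠ γ) b h)
  suppD (⊸I! {σ = σ} d) e t γ (fn m b) (hm , h) = supp-map (λ _ _ h → subst (HasM (! σ) _) (mapM-id (! σ) (λ _ _ → refl) m) (HasM-map (! σ) e m hm) , h)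
     (suppD d e (λ { (suc x) r q → t x r q }) (nothing ∷ᶠ γ) b h)
  suppD (⊸E {σ = σ} p d d') {E} {E'} e {θ₁} {θ₂} {k} t γ b (m , hm , h , h') =
     supp-map (λ _ _ (h , h') → m , subst (HasM σ _) (mapM-id σ (λ _ _ → refl) m) (HasM-map σ e m hm) , h , h')
       (supp-× (suppD d e (λ x r q → t x r (sp-Θ₁ (p x) q)) γ (fn m b) h) (go m h'))
    where
    go : ∀ m → AllM (⟦ d' ⟧ E θ₁ γ) m → Supp (szD 0 d' k) (λ θ g → AllM (⟦ d' ⟧ E' (θ₂ θ g) γ) m)
    go nothing _ = supp-pure (λ _ _ → tt)
    go (just c) h = suppD d' e (λ x r q → t x r (sp-Θ₂ (p x) q)) γ c h
  suppD (∀I {C} {S = U} d) {E} {E'} e {θ₁} {θ₂} {k} t γ b h = suppD d {Col U ∷ᶠ E} {Col U ∷ᶠ E'} (λ { zero r c → c ; (suc n) r c → e n r c }) {θ₁} {θ₂} (λ x r q h → t' x r q h) γ b h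
    where
    t' : ∀ x {σ} r → shiftCtx C x ≡ inΘ σ → θ₁ x r → Supp (k x) (λ θ g → θ₂ θ g x r)
    t' x r q h with sh-Θ {C x} q
    ... | _ , q' , _ = t x r q' h
  suppD (∀E {S = U} A d) e t γ b (p , φ , hp , hφ , h , q) =
     supp-map (λ _ _ h → p , φ , HasT-mono (lin (st (∀' U))) e p hp , (λ i l → HasL-mono A e _ (hφ i l)) , h , q) (suppD d e t γ p h)
  suppD (!I _ _) e t γ b h = supp-pure (λ _ _ → h)

  -- An iteration is cut once, where the right part begins. Its support consists of the leaves of
  -- the token at the cut and of the token fed in at the end of the word; hence two summands.
  bI : ∀ {τ} → BoxI τ → ℕ
  bITh : ∀ {η s} → ThE ⊥ F ⊤ η s → ℕ
  bI (bx d _ _ env) = szD 0 d (λ x → bITh (env x))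
  bI (pr _) = 0
  bI (it _ A ds) = oneT (lin A) + oneT (lin A)
  bITh t∅ = 0
  bITh (th B _) = bI B

  toks : List Raw → List ℕ
  toks [] = []
  toks (pt v ∷ l) = v ∷ toks l
  toks (_ ∷ l) = 0 ∷ toks l

  toks-len : ∀ l → length (toks l) ≡ length l
  toks-len [] = refl
  toks-len (pt v ∷ l) = cong suc (toks-len l)
  toks-len (un ∷ l) = cong suc (toks-len l)
  toks-len (fn _ _ ∷ l) = cong suc (toks-len l)

  allPick : Pick
  allPick _ r = r ∷ []

  fixes : ∀ θ (ψ : ℕ → ℕ) → (∀ v → ¬ v ≡ θ → ψ v ≡ v) → (f : (ℕ → ℕ) → Raw → Raw) → (∀ v → f ψ (pt v) ≡ pt (ψ v)) → f ψ un ≡ un → (∀ m b → f ψ (fn m b) ≡ fn m b) →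
          ∀ l → ¬ (θ ∈ toks l) → All (λ r → f ψ r ≡ r) l
  fixes θ ψ h f a b c [] n = []
  fixes θ ψ h f a b c (pt v ∷ l) n = trans (a v) (cong pt (h v (λ e → n (here (sym e))))) ∷ fixes θ ψ h f a b c l (n ∘ there)
  fixes θ ψ h f a b c (un ∷ l) n = b ∷ fixes θ ψ h f a b c l (n ∘ there)
  fixes θ ψ h f a b c (fn x y ∷ l) n = c x y ∷ fixes θ ψ h f a b c l (n ∘ there)

  module _ (W U V : Word a) (eW : W ≡ U ++ V) (notR : All (λ c → ¬ color c ≡ cr) U) (allR : All (λ c → color c ≡ cr) V) where

    deco₁ : Deco n a F
    deco₁ = record { lett = lett ; Fl = Fl ; fl₀ = nothing ; fstep = stepC color ; N = N ; x₀ = x₀ ; fact = fact ; fact< = fact< ; x₀< = x₀< }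
    module K1 = DecoSem deco₁

    chainR : ∀ θ g A ds m v b → All (λ c → color c ≡ cr) v → K1.Chain W nothing A ds m v b →
             At-θ.D₂.Chain θ g W nothing A ds (mapM (lin A) (λ _ → At-θ.ptm θ g (χ θ)) m) v (mapL A (λ _ → At-θ.ptm θ g (χ θ)) b)
    chainR θ g A ds m [] b r refl = refl
    chainR θ g A ds m (c ∷ v) b (q ∷ r) (m' , hm , h , h') = mapM (lin A) _ m' ,
       HasM-map (lin A) (λ { n r (v , l , refl) → χ θ v , At-θ.χ< θ g v l , refl }) m' hm , piece q h , go m' h'
      where
      piece : color c ≡ cr → K1.RBox W (just (color c)) (ds (lett c)) (fn m' b) →
              At-θ.D₂.RBox θ g W (just (color c)) (ds (lett c)) (fn (mapM (lin A) (λ _ → At-θ.ptm θ g (χ θ)) m') (mapL A (λ _ → At-θ.ptm θ g (χ θ)) b))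
      piece q h rewrite q = At-θ.Rights θ g W (ds (lett c)) (fn m' b) h
      go : ∀ m' → AllM (K1.Chain W nothing A ds m v) m' → AllM (At-θ.D₂.Chain θ g W nothing A ds (mapM (lin A) (λ _ → At-θ.ptm θ g (χ θ)) m) v) (mapM (lin A) (λ _ → At-θ.ptm θ g (χ θ)) m')
      go nothing _ = tt
      go (just b') h = chainR θ g A ds m v b' r h

    -- Left of the cut the chain is carried over by the inclusion, right of it by `χ θ`. The two fit
    -- together when `χ θ` fixes the token at the cut and the token at the end, that is, when `θ` is
    -- not a leaf of either.
    suppChain : ∀ A ds m u b → All (λ c → ¬ color c ≡ cr) u → K1.Chain W nothing A ds m (u ++ V) b →
                Supp (oneT (lin A) + oneT (lin A)) (λ θ g → At-θ.D₂.Chain θ g W nothing A ds m (u ++ V) b)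
    suppChain A ds m [] b nr h = toks lb ++ toks lm ,
        ≤-trans (≤-reflexive (length-++ (toks lb))) (+-mono-≤ (≤-trans (≤-reflexive (toks-len lb)) (lvL-len A (λ _ _ → ≤-refl) b))
              (≤-trans (≤-reflexive (toks-len lm)) (lvM-len (lin A) (λ _ _ → ≤-refl) m))) ,
        λ θ g n → subst₂ (λ m b → At-θ.D₂.Chain θ g W nothing A ds m V b)
             (trans (mapM-agr (lin A) {P = λ r → At-θ.ptm θ g (χ θ) r ≡ r} {ω = allPick} {ρ' = λ _ r → r} (λ { _ r (p ∷ []) → p }) m (fx θ g lm (n ∘ ∈-++⁺ʳ (toks lb)))) (mapM-id (lin A) (λ _ _ → refl) m))
             (trans (mapL-agr A {P = λ r → At-θ.ptm θ g (χ θ) r ≡ r} {ω = allPick} {ρ' = λ _ r → r} (λ { _ r (p ∷ []) → p }) b (fx θ g lb (n ∘ ∈-++⁺ˡ))) (mapL-id A (λ _ _ → refl) b))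
             (chainR θ g A ds m V b allR h)
      where
      lb = lvL A allPick b
      lm = lvM (lin A) allPick m
      fx : ∀ θ g l → ¬ (θ ∈ toks l) → All (λ r → At-θ.ptm θ g (χ θ) r ≡ r) l
      fx θ g l = fixes θ (χ θ) (χ-≢ θ) (At-θ.ptm θ g) (λ _ → refl) refl (λ _ _ → refl) l
    suppChain A ds m (c ∷ u) b (q ∷ nr) (m' , hm , h , h') = supp-map
        (λ θ g h' → m' , subst (HasM (lin A) _) (mapM-id (lin A) (λ _ _ → refl) m') (HasM-map (lin A) (λ { n r (v , l , e) → v , ≤-trans l (m≤m+n N N) , e }) m' hm) ,
            At-θ.Others θ g W (just (color c)) (nr? θ g (color c) q) (ds (lett c)) (fn m' b) h , h') (go m' h')
      where
      nr? : ∀ θ g κ → ¬ κ ≡ cr → At-θ.NotR θ g (just κ)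
      nr? θ g cl _ = At-θ.isL
      nr? θ g cc _ = At-θ.isC
      nr? θ g cr n = ⊥-elim (n refl)
      go : ∀ m' → AllM (K1.Chain W nothing A ds m (u ++ V)) m' → Supp (oneT (lin A) + oneT (lin A)) (λ θ g → AllM (At-θ.D₂.Chain θ g W nothing A ds m (u ++ V)) m')
      go nothing _ = supp-pure (λ _ _ → tt)
      go (just b') h = suppChain A ds m u b' nr h

    supp : ∀ {τ} (B : BoxI τ) r → K1.RBox W nothing B r → Supp (bI B) (λ θ g → At-θ.D₂.RBox θ g W nothing B r)
    suppTh : ∀ {η s} (B : ThE ⊥ F ⊤ η s) r → K1.RTh W nothing B r → Supp (bITh B) (λ θ g → At-θ.D₂.RTh θ g W nothing B r)
    supp (bx d η _ env) r h = suppD d {K1.wbs η} {λ n → HasL (η n) (λ _ r → Σ ℕ λ v → v < N + N × r ≡ pt v)} (λ n → HasL-mono (η n) (λ { n r (v , l , e) → v , ≤-trans l (m≤m+n N N) , e }))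
       {λ x → K1.RTh W nothing (env x)} {λ θ g x → At-θ.D₂.RTh θ g W nothing (env x)} (λ x r _ → suppTh (env x) r) (λ _ → nothing) r h
    supp (pr (F₀ c)) r (v , l , refl) = supp-pure (λ θ g → v , ≤-trans l (m≤m+n N N) , cong (λ y → fn (just (pt v)) (pt y)) (sym (fact'-old θ c nothing v l)))
    supp (pr X₀) r h = supp-pure (λ _ _ → h)
    supp (it _ A ds) (fn m b) (hm , h) = supp-map
        (λ θ g h → subst (HasM (lin A) _) (mapM-id (lin A) (λ _ _ → refl) m) (HasM-map (lin A) (λ { n r (v , l , e) → v , ≤-trans l (m≤m+n N N) , e }) m hm) ,
                   subst (λ V → At-θ.D₂.Chain θ g W nothing A ds m V b) (sym eW) h)
        (suppChain A ds m U b notR (subst (λ V → K1.Chain W nothing A ds m V b) eW h))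
    suppTh (th B _) r h = supp B r h

-- ls, rs: a block of letters from the left or right; cs a: a letter from the chosen position; vs a: a letter from no position.
data Sy (F : Set) : Set where
  ls rs : Sy F
  cs vs : F → Sy F

module _ {m : ℕ} where
  _≟ˢ_ : (x y : Sy (Fin m)) → Dec (x ≡ y)
  ls ≟ˢ ls = yes refl
  ls ≟ˢ rs = no λ ()
  ls ≟ˢ cs _ = no λ ()
  ls ≟ˢ vs _ = no λ ()
  rs ≟ˢ ls = no λ ()
  rs ≟ˢ rs = yes refl
  rs ≟ˢ cs _ = no λ ()
  rs ≟ˢ vs _ = no λ ()
  cs _ ≟ˢ ls = no λ ()
  cs _ ≟ˢ rs = no λ ()
  cs a ≟ˢ cs b with a Fin.≟ b
  ... | yes refl = yes refl
  ... | no n = no λ { refl → n refl }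
  cs _ ≟ˢ vs _ = no λ ()
  vs _ ≟ˢ ls = no λ ()
  vs _ ≟ˢ rs = no λ ()
  vs _ ≟ˢ cs _ = no λ ()
  vs a ≟ˢ vs b with a Fin.≟ b
  ... | yes refl = yes refl
  ... | no n = no λ { refl → n refl }

  merS : Sy (Fin m) → Bool
  merS ls = true
  merS rs = true
  merS _  = false

  open Red _≟ˢ_ merS public

  fin-Sy : Fin m → Finite (Sy (Fin m))
  fin-Sy d = fin-retract {B = Fin 4 × Fin m} (λ { ls → fz , d ; rs → fs fz , d ; (cs a) → fs (fs fz) , a ; (vs a) → fs (fs (fs fz)) , a })
    (λ { (fz , _) → ls ; (fs fz , _) → rs ; (fs (fs fz) , a) → cs a ; (fs (fs (fs _)) , a) → vs a })
    (λ { ls → refl ; rs → refl ; (cs _) → refl ; (vs _) → refl }) (fin-× (fin-Fin 4) (fin-Fin m))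

  -- One entry for each block of right letters: the reduced suffix that begins with the block.
  -- Further to the front these suffixes are strictly longer, so different blocks give different
  -- entries, ready for a pigeonhole argument.
  starts : List (Sy (Fin m)) → List (List (Sy (Fin m)))
  starts [] = []
  starts (x ∷ u) with x ≟ˢ rs | merges? x (red u)
  ... | yes _ | no _ = (x ∷ red u) ∷ starts u
  ... | _ | _ = starts u

  inners : List (Sy (Fin m)) → ℕ
  inners [] = 0
  inners (x ∷ u) = (if merS x then 0 else 1) + inners u

  open Count ls refl

  others-≤ : ∀ u → others (red u) ≤ length (starts u) + inners u
  others-≤ [] = z≤n
  others-≤ (x ∷ u) with x ≟ˢ rs | merges? x (red u)
  ... | yes refl | yes _ = others-≤ u
  ... | yes refl | no _ = s≤s (others-≤ u)
  others-≤ (ls ∷ u) | no n | no _ = others-≤ u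
  others-≤ (rs ∷ u) | no n | no _ = ⊥-elim (n refl)
  others-≤ (cs a ∷ u) | no n | no _ = ≤-trans (s≤s (others-≤ u)) (≤-reflexive (sym (+-suc _ _)))
  others-≤ (vs a ∷ u) | no n | no _ = ≤-trans (s≤s (others-≤ u)) (≤-reflexive (sym (+-suc _ _)))
  others-≤ (ls ∷ u) | no n | yes (e , _) = others-≤ u
  others-≤ (rs ∷ u) | no n | yes (e , _) = ⊥-elim (n refl)
  others-≤ (cs a ∷ u) | no n | yes (() , _)
  others-≤ (vs a ∷ u) | no n | yes (() , _)

  starts-len : ∀ u s → s ∈ starts u → length s ≤ length (red u)
  starts-len (x ∷ u) s i with x ≟ˢ rs | merges? x (red u)
  starts-len (x ∷ u) s (here refl) | yes _ | no _ = ≤-refl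
  starts-len (x ∷ u) s (there i) | yes _ | no _ = ≤-trans (starts-len u s i) (n≤1+n _)
  starts-len (x ∷ u) s i | yes _ | yes _ = starts-len u s i
  starts-len (x ∷ u) s i | no _ | yes _ = starts-len u s i
  starts-len (x ∷ u) s i | no _ | no _ = ≤-trans (starts-len u s i) (n≤1+n _)

  starts-distinct : ∀ u → Distinct (starts u)
  starts-distinct [] = []
  starts-distinct (x ∷ u) with x ≟ˢ rs | merges? x (red u)
  ... | yes _ | no _ = (λ i → <⇒≱ (n<1+n _) (starts-len u _ i)) ∷ starts-distinct u
  ... | yes _ | yes _ = starts-distinct u
  ... | no _ | yes _ = starts-distinct u
  ... | no _ | no _ = starts-distinct u

  starts-∈ : ∀ u s → s ∈ starts u → Σ (List (Sy (Fin m))) λ u₁ → Σ (List (Sy (Fin m))) λ u₂ → u ≡ u₁ ++ rs ∷ u₂ × s ≡ rs ∷ red u₂ × ¬ Merges rs (red u₂)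
  starts-∈ (x ∷ u) s i with x ≟ˢ rs | merges? x (red u)
  starts-∈ (x ∷ u) s (here refl) | yes refl | no n = [] , u , refl , refl , n
  starts-∈ (x ∷ u) s (there i) | yes refl | no n with starts-∈ u s i
  ... | u₁ , u₂ , refl , e , h = x ∷ u₁ , u₂ , refl , e , h
  starts-∈ (x ∷ u) s i | yes _ | yes _ with starts-∈ u s i
  ... | u₁ , u₂ , refl , e , h = x ∷ u₁ , u₂ , refl , e , h
  starts-∈ (x ∷ u) s i | no _ | yes _ with starts-∈ u s i
  ... | u₁ , u₂ , refl , e , h = x ∷ u₁ , u₂ , refl , e , h
  starts-∈ (x ∷ u) s i | no _ | no _ with starts-∈ u s i
  ... | u₁ , u₂ , refl , e , h = x ∷ u₁ , u₂ , refl , e , h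

map-split : ∀ {A B : Set} (f : A → B) (u : List A) {x v₁ v₂} → map f u ≡ v₁ ++ x ∷ v₂ →
            Σ (List A) λ u₁ → Σ A λ a → Σ (List A) λ u₂ → u ≡ u₁ ++ a ∷ u₂ × f a ≡ x × map f u₂ ≡ v₂
map-split f (a ∷ u) {v₁ = []} refl = [] , a , u , refl , refl , refl
map-split f (a ∷ u) {v₁ = _ ∷ v₁} e with map-split f u {v₁ = v₁} (proj₂ (∷-injective e))
... | u₁ , b , u₂ , refl , e' , e'' = a ∷ u₁ , b , u₂ , refl , e' , e''

symOf : ∀ {F} → F → Maybe Col3 → Sy F
symOf a nothing   = vs a
symOf a (just cl) = ls
symOf a (just cc) = cs a
symOf a (just cr) = rs

symOf-rs : ∀ {F} (a : F) fl → symOf a fl ≡ rs → fl ≡ just cr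
symOf-rs a (just cr) refl = refl

toCol : Fin 3 → Col3
toCol fz = cl
toCol (fs fz) = cc
toCol (fs (fs _)) = cr

fromCol : Col3 → Fin 3
fromCol cl = fz
fromCol cc = fs fz
fromCol cr = fs (fs fz)

to-fromCol : ∀ κ → toCol (fromCol κ) ≡ κ
to-fromCol cl = refl
to-fromCol cc = refl
to-fromCol cr = refl

module Decorate (n : ℕ) where
  a₃ : ℕ
  a₃ = suc n * 3

  mk : Fin (suc n) → Col3 → Fin a₃
  mk c κ = combine c (fromCol κ)

  lett₃ : Fin a₃ → Fin (suc n)
  lett₃ x = proj₁ (remQuot {suc n} 3 x)

  color₃ : Fin a₃ → Col3
  color₃ x = toCol (proj₂ (remQuot {suc n} 3 x))

  lett-mk : ∀ c κ → lett₃ (mk c κ) ≡ c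
  lett-mk c κ = cong proj₁ (remQuot-combine {suc n} c (fromCol κ))

  color-mk : ∀ c κ → color₃ (mk c κ) ≡ κ
  color-mk c κ = trans (cong (toCol ∘ proj₂) (remQuot-combine {suc n} c (fromCol κ))) (to-fromCol κ)

  -- the colouring around position p; if p is beyond the end every position is on the left
  decAt : ℕ → Word (suc n) → Word a₃
  decAt p [] = []
  decAt zero (c ∷ w) = mk c cc ∷ map (λ c → mk c cr) w
  decAt (suc p) (c ∷ w) = mk c cl ∷ decAt p w

  colAt : ℕ → ℕ → Col3
  colAt zero zero = cc
  colAt zero (suc q) = cr
  colAt (suc p) zero = cl
  colAt (suc p) (suc q) = colAt p q

  lett-map : ∀ κ w → map lett₃ (map (λ c → mk c κ) w) ≡ w
  lett-map κ [] = refl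
  lett-map κ (c ∷ w) = cong₂ _∷_ (lett-mk c κ) (lett-map κ w)

  lett-decAt : ∀ p w → map lett₃ (decAt p w) ≡ w
  lett-decAt p [] = refl
  lett-decAt zero (c ∷ w) = cong₂ _∷_ (lett-mk c cc) (lett-map cr w)
  lett-decAt (suc p) (c ∷ w) = cong₂ _∷_ (lett-mk c cl) (lett-decAt p w)

  flag₁ : Word a₃ → List ℕ → Maybe Col3
  flag₁ = flagOf nothing (stepC color₃)

  flag-map : ∀ κ w q → q < length w → stepM (stepC color₃) nothing (look (map (λ c → mk c κ) w) q) ≡ just κ
  flag-map κ (c ∷ w) zero l = cong just (color-mk c κ)
  flag-map κ (c ∷ w) (suc q) (s≤s l) = flag-map κ w q l

  flag-decAt : ∀ p w q → q < length w → flag₁ (decAt p w) (q ∷ []) ≡ just (colAt p q)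
  flag-decAt zero (c ∷ w) zero l = cong just (color-mk c cc)
  flag-decAt zero (c ∷ w) (suc q) (s≤s l) = flag-map cr w q l
  flag-decAt (suc p) (c ∷ w) zero l = cong just (color-mk c cl)
  flag-decAt (suc p) (c ∷ w) (suc q) (s≤s l) = flag-decAt p w q l

  decAt-split : ∀ p w → Σ (Word a₃) λ U → Σ (Word a₃) λ V → decAt p w ≡ U ++ V × All (λ c → ¬ color₃ c ≡ cr) U × All (λ c → color₃ c ≡ cr) V
  decAt-split p [] = [] , [] , refl , [] , []
  decAt-split zero (c ∷ w) = mk c cc ∷ [] , map (λ c → mk c cr) w , refl , (λ e → bad (trans (sym (color-mk c cc)) e)) ∷ [] , all w
    where
    bad : cc ≡ cr → ⊥
    bad ()
    all : ∀ w → All (λ c → color₃ c ≡ cr) (map (λ c → mk c cr) w)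
    all [] = []
    all (c ∷ w) = color-mk c cr ∷ all w
  decAt-split (suc p) (c ∷ w) with decAt-split p w
  ... | U , V , e , h , h' = mk c cl ∷ U , V , cong (mk c cl ∷_) e , (λ e → bad (trans (sym (color-mk c cl)) e)) ∷ h , h'
    where
    bad : cl ≡ cr → ⊥
    bad ()

module PatternBound {nΓ nΣ : ℕ} {f : Word (suc nΓ) → Word (suc nΣ)} (K : Core nΓ nΣ 1 f) where
  open CoreOut K public
  open Core K
  open Boxes nΓ
  open At nΓ {F}
  open Decorate nΓ public

  symsAt : Word a₃ → List Λ → List (Sy F)
  symsAt W = map (λ (c , ps) → symOf c (flag₁ W ps))

  -- The values are complete reduced words, so the web must be large enough for this particular
  -- output and grows with it. This is harmless, because the support bound does not depend on the
  -- web.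
  module _ (w : Word (suc nΓ)) (p : ℕ) (finX : Finite (BL (Sy F) (length (O w)))) where
    W = decAt p w
    k = length (O w)

    gX : F → Maybe Col3 → BL (Sy F) k → BL (Sy F) k
    gX c fl x = toBL k (push (symOf c fl) (fromBL k x))

    open ValReg lett₃ nothing (stepC color₃) finX (toBL k []) gX using (deco; num; unnum; unnum-num)
    open Finite finX using (size)

    fold-red : ∀ u → length u ≤ k → foldr (λ (c , ps) → gX c (flag₁ W ps)) (toBL k []) u ≡ toBL k (red (symsAt W u))
    fold-red [] l = refl
    fold-red ((c , ps) ∷ u) l = cong (λ s → toBL k (push (symOf c (flag₁ W ps)) s))
      (trans (cong (fromBL k) (fold-red u (≤-trans (n≤1+n _) l)))
             (from-toBL-≤ k (red (symsAt W u)) (≤-trans (red-len (symsAt W u)) (≤-trans (≤-reflexive (length-map _ u)) (≤-trans (n≤1+n _) l)))))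

    open Deco deco using (fact; fact<; x₀<; x₀; N)
    module Su = Support lett₃ color₃ x₀ N fact fact< x₀<
    module D₁ = DecoSem deco

    val₁ : List Λ → ℕ
    val₁ = foldr (Web.act (D₁.web W)) x₀

    val₁-num : ∀ u → length u ≤ k → val₁ u ≡ num (toBL k (red (symsAt W u)))
    val₁-num u l = trans (go u) (cong num (fold-red u l))
      where
      go : ∀ u → val₁ u ≡ num (foldr (λ (c , ps) → gX c (flag₁ W ps)) (toBL k []) u)
      go [] = refl
      go ((c , ps) ∷ u) = cong (λ v → num (gX c (flag₁ W ps) v)) (trans (cong unnum (go u)) (unnum-num _))

    num-inj : ∀ {s s' : List (Sy F)} → length s ≤ k → length s' ≤ k → num (toBL k s) ≡ num (toBL k s') → s ≡ s'
    num-inj {s} {s'} l l' e = trans (sym (from-toBL-≤ k s l)) (trans (cong (fromBL k) (trans (sym (unnum-num _)) (trans (cong unnum e) (unnum-num _)))) (from-toBL-≤ k s' l'))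

    module _ (θ : ℕ) (g : Su.Good θ) where
      val₂ : List Λ → ℕ
      val₂ = foldr (λ (c , ps) → Su.fact' θ c (flag₁ W ps)) x₀

      val₁< : ∀ u → val₁ u < N
      val₁< [] = x₀<
      val₁< ((c , ps) ∷ u) = fact< c (flag₁ W ps) _ (val₁< u)

      fact₁-cases : ∀ c fl v → Su.fact₁ θ c fl v ≡ fact c fl v ⊎ N ≤ Su.fact₁ θ c fl v
      fact₁-cases c nothing v = inj₁ refl
      fact₁-cases c (just cl) v = inj₁ refl
      fact₁-cases c (just cc) v = inj₁ refl
      fact₁-cases c (just cr) v with fact c (just cr) v ℕ.≟ θ | v ℕ.≟ θ
      ... | yes _ | no _ = inj₂ (m≤m+n N θ)
      ... | yes _ | yes _ = inj₁ refl
      ... | no _ | yes _ = inj₁ refl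
      ... | no _ | no _ = inj₁ refl

      copies : ∀ u → val₂ u ≡ val₁ u ⊎ N ≤ val₂ u
      copies [] = inj₁ refl
      copies ((c , ps) ∷ u) with copies u
      ... | inj₂ l = inj₂ (Su.fact'-new θ c (flag₁ W ps) _ l)
      ... | inj₁ e rewrite e | Su.fact'-old θ c (flag₁ W ps) (val₁ u) (val₁< u) = fact₁-cases c (flag₁ W ps) (val₁ u)

      -- Up to this letter the run in the doubled web either agrees with the original one or has
      -- left the first copy. At this letter it enters `θ` through a right letter and leaves it at
      -- the latest.
      escape : ∀ u₁ c ps u₂ → flag₁ W ps ≡ just cr → ¬ val₁ u₂ ≡ θ → val₁ ((c , ps) ∷ u₂) ≡ θ → N ≤ val₂ (u₁ ++ (c , ps) ∷ u₂)
      escape (x ∷ u₁) c ps u₂ a b e = Su.fact'-new θ (proj₁ x) (flag₁ W (proj₂ x)) _ (escape u₁ c ps u₂ a b e)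
      escape [] c ps u₂ a b e with copies u₂
      ... | inj₂ l = Su.fact'-new θ c (flag₁ W ps) _ l
      ... | inj₁ e' rewrite e' | Su.fact'-old θ c (flag₁ W ps) (val₁ u₂) (val₁< u₂) | a with fact c (just cr) (val₁ u₂) ℕ.≟ θ | val₁ u₂ ℕ.≟ θ
      ... | yes _ | no _ = m≤m+n N θ
      ... | yes _ | yes q = ⊥-elim (b q)
      ... | no q | _ = ⊥-elim (q e)

    -- The suffix at a right block has a value `θ` that right letters fix. Outside the support,
    -- doubling `θ` would keep the token of the body, so by uniqueness the final value would stay
    -- below N, whereas `escape` puts it above. So all these values lie in the support.
    right-bound : length (starts (symsAt W (O w))) ≤ Su.bI body
    right-bound = ≤-trans (≤-reflexive (sym (length-map code (starts (symsAt W (O w))))))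
                   (≤-trans (distinct-≤ (map code (starts (symsAt W (O w)))) sl (dist (starts (symsAt W (O w))) (λ s i → i) (starts-distinct (symsAt W (O w)))) sub) sl≤)
      where
      code : List (Sy F) → ℕ
      code s = num (toBL k s)
      Wsplit = decAt-split p w
      ex = O-exists w (D₁.web W)
      m = proj₁ ex
      wW : map lett₃ W ≡ w
      wW = lett-decAt p w
      h₁ : D₁.RBox W nothing body (fn m (pt (val₁ (O w))))
      h₁ = D₁.sem-flag W [] body _ (subst (λ v → BoxSem.SemBox nΓ {⊥} (D₁.web W) (at-word v [] body) (fn m (pt (val₁ (O w))))) (sym wW) (proj₂ (proj₂ ex)))
      sp : Su.Supp (Su.bI body) _
      sp = Su.supp W (proj₁ Wsplit) (proj₁ (proj₂ Wsplit)) (proj₁ (proj₂ (proj₂ Wsplit))) (proj₁ (proj₂ (proj₂ (proj₂ Wsplit)))) (proj₂ (proj₂ (proj₂ (proj₂ Wsplit)))) body _ h₁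
      sl = proj₁ sp
      sl≤ = proj₁ (proj₂ sp)
      short : ∀ s → s ∈ starts (symsAt W (O w)) → length s ≤ k
      short s i = ≤-trans (starts-len (symsAt W (O w)) s i) (≤-trans (red-len (symsAt W (O w))) (≤-reflexive (length-map _ (O w))))
      dist : ∀ l → (∀ s → s ∈ l → s ∈ starts (symsAt W (O w))) → Distinct l → Distinct (map code l)
      dist [] f [] = []
      dist (s ∷ l) f (n ∷ d) = (λ i → n (back l i (λ s' i' → f s' (there i')))) ∷ dist l (λ s i → f s (there i)) d
        where
        back : ∀ l → code s ∈ map code l → (∀ s' → s' ∈ l → s' ∈ starts (symsAt W (O w))) → s ∈ l
        back (s' ∷ l) (here e) f' = here (num-inj (short s (f s (here refl))) (short s' (f' s' (here refl))) e)
        back (s' ∷ l) (there i) f' = there (back l i (λ s i → f' s (there i)))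
      sub : ∀ x → x ∈ map code (starts (symsAt W (O w))) → x ∈ sl
      sub x i with ∈-map⁻ code i
      ... | s , j , refl with code s ∈? sl
        where open import Data.List.Membership.DecPropositional ℕ._≟_ using (_∈?_)
      ...   | yes q = q
      ...   | no q with starts-∈ (symsAt W (O w)) s j
      ...     | v₁ , v₂ , e , refl , nm with map-split (λ (c , ps) → symOf c (flag₁ W ps)) (O w) e
      ...       | u₁ , (c , ps) , u₂ , eO , ec , refl = ⊥-elim (<⇒≱ (val₁< (code s) gd (O w)) (≤-trans (subst (λ u → N ≤ val₂ (code s) gd u) (sym eO) esc) (≤-reflexive (sym y≡))))
        where
        sk : length (rs ∷ red (symsAt W u₂)) ≤ k
        sk = short _ j
        lu : length u₂ < k
        lu = ≤-trans (≤-trans (m≤n+m (suc (length u₂)) (length u₁)) (≤-reflexive (sym (length-++ u₁)))) (≤-reflexive (cong length (sym eO)))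
        gd : Su.Good (code (rs ∷ red (symsAt W u₂)))
        gd = toℕ<n _ , (λ e → nonempty (num-inj sk z≤n e)) ,
             (λ c → cong num (trans (cong (λ x → toBL k (push rs (fromBL k x))) (unnum-num (toBL k (rs ∷ red (symsAt W u₂)))))
                (cong (toBL k) (trans (cong (push rs) (from-toBL-≤ k _ sk)) (push-m (refl , _ , refl))))))
          where
          nonempty : rs ∷ red (symsAt W u₂) ≡ [] → ⊥
          nonempty ()
        cr-flag : flag₁ W ps ≡ just cr
        cr-flag = symOf-rs c _ ec
        before : ¬ val₁ u₂ ≡ code (rs ∷ red (symsAt W u₂))
        before e' = nm (refl , red (symsAt W u₂) , num-inj (≤-trans (n≤1+n _) sk) sk (trans (sym (val₁-num u₂ (≤-trans (n≤1+n _) lu))) e'))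
        after : val₁ ((c , ps) ∷ u₂) ≡ code (rs ∷ red (symsAt W u₂))
        after = trans (val₁-num ((c , ps) ∷ u₂) lu) (cong code (trans (cong (λ x → push x (red (symsAt W u₂))) ec) (push-n nm)))
        esc : N ≤ val₂ (code (rs ∷ red (symsAt W u₂))) gd (u₁ ++ (c , ps) ∷ u₂)
        esc = escape (code (rs ∷ red (symsAt W u₂))) gd u₁ c ps u₂ cr-flag before after
        module Aθ = Su.At-θ (code (rs ∷ red (symsAt W u₂))) gd
        h₂ : Aθ.D₂.RBox W nothing body (fn m (pt (val₁ (O w))))
        h₂ = proj₂ (proj₂ sp) _ gd q
        y≡ : val₁ (O w) ≡ val₂ (code (rs ∷ red (symsAt W u₂))) gd (O w)
        y≡ = O-unique w (Aθ.D₂.web W) m (val₁ (O w)) (proj₁ (proj₂ ex)) (≤-trans (val₁< _ gd (O w)) (m≤m+n N N))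
               (subst (λ v → BoxSem.SemBox nΓ {⊥} (Aθ.D₂.web W) (at-word v [] body) (fn m (pt (val₁ (O w))))) wW (Aθ.D₂.sem-flag⁻ W [] body _ h₂))

sum-zero : ∀ {A : Set} (ω : A → ℕ) u → sum (map ω u) ≤ 0 → All (λ a → ω a ≡ 0) u
sum-zero ω [] _ = []
sum-zero ω (a ∷ u) p = n≤0⇒n≡0 (≤-trans (m≤m+n _ _) p) ∷ sum-zero ω u (≤-trans (m≤n+m _ (ω a)) p)

sum-one : ∀ {A : Set} (u : List A) → sum (map (λ _ → 1) u) ≡ length u
sum-one [] = refl
sum-one (a ∷ u) = cong suc (sum-one u)

badness : {P : Set} → Dec P → ℕ
badness (yes _) = 0
badness (no _)  = 1

badness-0 : {P : Set} (d : Dec P) → P → badness d ≡ 0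
badness-0 (yes _) p = refl
badness-0 (no n) p = ⊥-elim (n p)

badness-0⁻ : {P : Set} (d : Dec P) → badness d ≡ 0 → P
badness-0⁻ (yes p) _ = p

module Labels {nΓ nΣ ℓ : ℕ} {f : Word (suc nΓ) → Word (suc nΣ)} (K : Core nΓ nΣ ℓ f) where
  open CoreOut K using (F; Λ; O; O-wt)
  open Core K
  open Boxes nΓ
  open Bounds nΓ {F} public using (bndB)
  open Bounds nΓ {F} using (few; total; paths; ite)

  GoodL : ℕ → Λ → Set
  GoodL n (c , ps) = length ps ≤ ℓ × All (_< n) ps

  good? : ∀ n l → Dec (GoodL n l)
  good? n (c , ps) = (length ps ℕ.≤? ℓ) ×-dec all? (ℕ._<? n) ps

  -- Bad labels get weight 1 and good ones weight 0; a total weight of 0 then says that every label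
  -- is good.
  labels : ∀ w → All (GoodL (length w)) (O w)
  labels w = All.map (λ {l} → conv l) (sum-zero ω (O w) (≤-trans (O-wt w ω) (≤-reflexive (paths w ω [] ℓ body level
       (λ c qs l a → good-0 (c , qs ++ []) (subst (λ p → length p ≤ ℓ) (sym (++-identityʳ qs)) l , subst (All (_< length w)) (sym (++-identityʳ qs)) a))))))
    where
    ω : Λ → ℕ
    ω l = badness (good? (length w) l)
    good-0 : ∀ l → GoodL (length w) l → ω l ≡ 0
    good-0 l = badness-0 (good? (length w) l)
    conv : ∀ l → ω l ≡ 0 → GoodL (length w) l
    conv l = badness-0⁻ (good? (length w) l)

  length-O : ∀ w → length (O w) ≤ bndB body * suc (length w) ^ ℓ
  length-O w = ≤-trans (≤-reflexive (sym (sum-one (O w)))) (≤-trans (O-wt w (λ _ → 1)) (total w [] ℓ body level))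

  few-O : ∀ w (e : List ℕ → Bool) → (∀ q ps → e (q ∷ ps) ≡ true → e ps ≡ true) → (∀ q q' ps → e (q ∷ ps) ≡ true → e (q' ∷ ps) ≡ true → q ≡ q') →
          sum (map (λ (c , ps) → if e ps then 1 else 0) (O w)) ≤ bndB body
  few-O w e d u = ≤-trans (O-wt w _) (≤-trans (few w e d u [] body) (le (e [])))
    where
    le : ∀ b → ite b (bndB body) ≤ bndB body
    le true = ≤-refl
    le false = z≤n

symP : ℕ → ∀ {F} → ℕ → F × Maybe ℕ → Sy F
symP n p (c , nothing) = vs c
symP n p (c , just q)  = symOf c (just (Decorate.colAt n p q))

-- The interface to the linear machine: at most one position for each letter, patterns of bounded
-- length, and an automaton that reads the pattern off the word coloured around a position.
record LinSpec (nΓ nΣ : ℕ) (f : Word (suc nΓ) → Word (suc nΣ)) : Set₁ where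
  open Decorate nΓ
  F : Set
  F = Fin (suc nΣ)
  field
    OL    : Word (suc nΓ) → List (F × Maybe ℕ)
    OL-f  : ∀ w → map proj₁ (OL w) ≡ f w
    OL-<  : ∀ w → All (λ l → ∀ q → proj₂ l ≡ just q → q < length w) (OL w)
    NB    : ℕ
    bound : ∀ w p → length (red (map (symP nΓ p) (OL w))) ≤ NB
    mach  : Moore a₃ (BL (Sy F) NB)
    mach-ok : ∀ w p → Moore.out mach (foldl (Moore.step mach) (Moore.init mach) (decAt p w)) ≡ toBL NB (red (map (symP nΓ p) (OL w)))

module _ {nΓ nΣ : ℕ} {f : Word (suc nΓ) → Word (suc nΣ)} (K : Core nΓ nΣ 1 f) where
  open Decorate nΓ
  open Labels K
  open Core K
  open PatternBound K using (symsAt; right-bound)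
  open CoreOut K using (F; Λ; O; O-f; module ValReg)

  headM : List ℕ → Maybe ℕ
  headM [] = nothing
  headM (q ∷ _) = just q

  OL' : Word (suc nΓ) → List (F × Maybe ℕ)
  OL' w = map (λ (c , ps) → c , headM ps) (O w)

  symP' : ℕ → F × Maybe ℕ → Sy F
  symP' = symP nΓ

  syms-eq : ∀ p w → symsAt (decAt p w) (O w) ≡ map (symP' p) (OL' w)
  syms-eq p w = go (O w) (labels w)
    where
    go : ∀ u → All (GoodL (length w)) u → symsAt (decAt p w) u ≡ map (symP' p) (map (λ (c , ps) → c , headM ps) u)
    go [] [] = refl
    go ((c , []) ∷ u) (_ ∷ g) = cong (vs c ∷_) (go u g)
    go ((c , q ∷ []) ∷ u) ((_ , l ∷ _) ∷ g) = cong₂ _∷_ (cong (symOf c) (flag-decAt p w q l)) (go u g)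
    go ((c , q ∷ q' ∷ ps) ∷ u) ((s≤s () , _) ∷ g)

  inner-≤ : ∀ p w → inners (map (symP' p) (OL' w)) ≤ bndB body
  inner-≤ p w = ≤-trans (go (O w) (labels w)) (few-O w e d u)
    where
    isC : Col3 → Bool
    isC cc = true
    isC _ = false
    e : List ℕ → Bool
    e [] = true
    e (q ∷ []) = isC (colAt p q)
    e (_ ∷ _ ∷ _) = false
    d : ∀ q ps → e (q ∷ ps) ≡ true → e ps ≡ true
    d q [] h = refl
    d q (_ ∷ _) ()
    same : ∀ p q q' → isC (colAt p q) ≡ true → isC (colAt p q') ≡ true → q ≡ q'
    same zero zero zero _ _ = refl
    same (suc p) (suc q) (suc q') h h' = cong suc (same p q q' h h')
    u : ∀ q q' ps → e (q ∷ ps) ≡ true → e (q' ∷ ps) ≡ true → q ≡ q'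
    u q q' [] h h' = same p q q' h h'
    u q q' (_ ∷ _) () _
    go : ∀ u → All (GoodL (length w)) u → inners (map (symP' p) (map (λ (c , ps) → c , headM ps) u)) ≤ sum (map (λ (c , ps) → if e ps then 1 else 0) u)
    go [] [] = z≤n
    go ((c , []) ∷ u) (_ ∷ g) = s≤s (go u g)
    go ((c , q ∷ []) ∷ u) (_ ∷ g) with colAt p q
    ... | cl = go u g
    ... | cc = s≤s (go u g)
    ... | cr = go u g
    go ((c , q ∷ q' ∷ ps) ∷ u) ((s≤s () , _) ∷ g)

  -- Symbols other than left blocks are right blocks, bounded by the support, or letters from the
  -- chosen position or from none, bounded statically. Two left blocks are separated by one of them;
  -- hence the factor 2 and the final 1. The one-point model is a placeholder, as `bI` agrees for
  -- all models (`bI-eq`).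
  NB' : ℕ
  NB' = 2 * (Support.bI {nΓ} {a₃} {F} lett₃ color₃ 0 1 (λ _ _ _ → 0) (λ _ _ _ _ → s≤s z≤n) (s≤s z≤n) body + bndB body) + 1

  bI-eq : ∀ {x N fact p q x' N' fact' p' q' τ} (B : Boxes.Box nΓ ⊥ F ⊤ τ) →
          Support.bI {nΓ} {a₃} {F} lett₃ color₃ x N fact p q B ≡ Support.bI {nΓ} {a₃} {F} lett₃ color₃ x' N' fact' p' q' B
  bI-eqT : ∀ {x N fact p q x' N' fact' p' q' η s} (B : Boxes.ThE nΓ ⊥ F ⊤ η s) →
          Support.bITh {nΓ} {a₃} {F} lett₃ color₃ x N fact p q B ≡ Support.bITh {nΓ} {a₃} {F} lett₃ color₃ x' N' fact' p' q' B
  bI-eq {x} {N} {fact} {p} {q} {x'} {N'} {fact'} {p'} {q'} (Boxes.bx d η _ env) =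
     ≤-antisym (szD-mono 0 d (λ y → ≤-reflexive (bI-eqT {x} {N} {fact} {p} {q} {x'} {N'} {fact'} {p'} {q'} (env y))))
               (szD-mono 0 d (λ y → ≤-reflexive (sym (bI-eqT {x} {N} {fact} {p} {q} {x'} {N'} {fact'} {p'} {q'} (env y)))))
  bI-eq (Boxes.pr _) = refl
  bI-eq (Boxes.it _ A ds) = refl
  bI-eqT Boxes.t∅ = refl
  bI-eqT {x} {N} {fact} {p} {q} {x'} {N'} {fact'} {p'} {q'} (Boxes.th B _) = bI-eq {x} {N} {fact} {p} {q} {x'} {N'} {fact'} {p'} {q'} B

  bound' : ∀ w p → length (red (map (symP' p) (OL' w))) ≤ NB'
  bound' w p = ≤-trans (proj₁ (Red.Count.red-count _≟ˢ_ merS ls refl (map (symP' p) (OL' w))))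
     (+-monoˡ-≤ 1 (*-monoʳ-≤ 2 (≤-trans (others-≤ (map (symP' p) (OL' w)))
       (+-mono-≤ (≤-trans (≤-reflexive (cong (length ∘ starts) (sym (syms-eq p w))))
                    (≤-trans (right-bound w p (fin-BL (fin-Sy fz) _)) (≤-reflexive (bI-eq body)))) (inner-≤ p w)))))

  linSpec : LinSpec nΓ nΣ f
  linSpec = record
    { OL = OL' ; OL-f = λ w → trans (sym (map-∘ (O w))) (O-f w)
    ; OL-< = λ w → go {w} (labels w)
    ; NB = NB' ; bound = bound'
    ; mach = proj₁ M ; mach-ok = λ w p → trans (proj₂ M (decAt p w)) (val-eq p w) }
    where
    gX : F → Maybe Col3 → BL (Sy F) NB' → BL (Sy F) NB'
    gX c fl x = toBL NB' (+push c fl (fromBL NB' x))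
      where
      +push : F → Maybe Col3 → List (Sy F) → List (Sy F)
      +push c fl s = push (symOf c fl) s
    module VR = ValReg lett₃ nothing (stepC color₃) (fin-BL (fin-Sy fz) NB') (toBL NB' []) gX
    M = moore VR.val (fin-BL (fin-Sy fz) NB') (toBL NB' []) VR.val-reg
    go : ∀ {w : Word (suc nΓ)} {u} → All (GoodL (length w)) u → All (λ l → ∀ q → proj₂ l ≡ just q → q < length w) (map (λ (c , ps) → c , headM ps) u)
    go [] = []
    go {w} {u = (c , []) ∷ u} (_ ∷ g) = (λ q ()) ∷ go {w} g
    go {w} {u = (c , x ∷ ps) ∷ u} ((_ , l ∷ _) ∷ g) = (λ { q refl → l }) ∷ go {w} g
    fold-red : ∀ p w u → (∀ v₁ v₂ → u ≡ v₁ ++ v₂ → length (red (symsAt (decAt p w) v₂)) ≤ NB') →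
               foldr (λ (c , ps) → gX c (flag₁ (decAt p w) ps)) (toBL NB' []) u ≡ toBL NB' (red (symsAt (decAt p w) u))
    fold-red p w [] h = refl
    fold-red p w ((c , ps) ∷ u) h = cong (λ s → toBL NB' (push (symOf c (flag₁ (decAt p w) ps)) s))
      (trans (cong (fromBL NB') (fold-red p w u (λ v₁ v₂ e → h ((c , ps) ∷ v₁) v₂ (cong ((c , ps) ∷_) e)))) (from-toBL-≤ NB' _ (h ((c , ps) ∷ []) u refl)))
    -- The fold passes through suffixes of the output. Prepending letters never shortens a reduced
    -- word, so the bound for the whole output covers them and nothing is cut off.
    suffix-≤ : ∀ p w v₁ v₂ → O w ≡ v₁ ++ v₂ → length (red (symsAt (decAt p w) v₂)) ≤ NB'
    suffix-≤ p w v₁ v₂ e = ≤-trans (≤-trans (redOn-len (red (symsAt (decAt p w) v₂)) (symsAt (decAt p w) v₁))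
        (≤-reflexive (cong length (trans (sym (foldr-++ push [] (symsAt (decAt p w) v₁) (symsAt (decAt p w) v₂)))
           (trans (cong red (sym (map-++ _ v₁ v₂))) (trans (cong (red ∘ symsAt (decAt p w)) (sym e)) (cong red (syms-eq p w))))))))
        (bound' w p)
    val-eq : ∀ p w → VR.val (decAt p w) ≡ toBL NB' (red (map (symP' p) (OL' w)))
    val-eq p w = trans (cong (λ v → foldr (λ (c , ps) → gX c (flag₁ (decAt p w) ps)) (toBL NB' []) (O v)) (lett-decAt p w))
       (trans (fold-red p w (O w) (suffix-≤ p w)) (cong (toBL NB' ∘ red) (syms-eq p w)))

-- Machines with one work tape that emit their output letter by letter

record WTape (A : Set) : Set where
  constructor wt
  field
    lft : List (Maybe A)
    hd  : Maybe A
    rgt : List (Maybe A)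

moveW : ∀ {A} → Move → WTape A → WTape A
moveW L (wt []      h r) = wt [] nothing (h ∷ r)
moveW L (wt (c ∷ l) h r) = wt l c (h ∷ r)
moveW R (wt l h [])      = wt (h ∷ l) nothing []
moveW R (wt l h (c ∷ r)) = wt (h ∷ l) c r
moveW S t                = t

record WM (k m : ℕ) : Set₁ where
  field
    Q A  : Set
    finQ : Finite Q
    finA : Finite A
    a₀   : A
    q₀   : Q
    inj  : Fin k → A
    δ    : Q → Maybe A → Maybe (Q × Maybe A × Move × Maybe (Fin m))

emit : ∀ {m} → Maybe (Fin m) → List (Fin m) → List (Fin m)
emit nothing  u = u
emit (just c) u = c ∷ u

module WRun {k m : ℕ} (M : WM k m) where
  open WM M

  Cfg : Set
  Cfg = Q × WTape A

  data Runs : Cfg → ℕ → List (Fin m) → Cfg → Set where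
    stop : ∀ {c} → Runs c 0 [] c
    step : ∀ {q l h r q' c mv o t u e} → δ q h ≡ just (q' , c , mv , o) → Runs (q' , moveW mv (wt l c r)) t u e → Runs (q , wt l h r) (suc t) (emit o u) e

  _then_ : ∀ {c d e t t' u u'} → Runs c t u d → Runs d t' u' e → Runs c (t + t') (u ++ u') e
  stop then b = b
  step {o = nothing} p a then b = step {o = nothing} p (a then b)
  step {o = just _} p a then b = step {o = just _} p (a then b)

  runs-len : ∀ {c t u d} → Runs c t u d → length u ≤ t
  runs-len stop = z≤n
  runs-len (step {o = nothing} p a) = ≤-trans (runs-len a) (n≤1+n _)
  runs-len (step {o = just _} p a) = s≤s (runs-len a)

  inTape : List A → WTape A
  inTape []      = wt [] nothing []
  inTape (a ∷ w) = wt [] (just a) (map just w)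

  Computes : (List (Fin k) → List (Fin m)) → (ℕ → ℕ) → Set
  Computes f T = ∀ w → Σ ℕ λ t → Σ Cfg λ c → t ≤ T (length w) × Runs (q₀ , inTape (map inj w)) t (f w) c × δ (proj₁ c) (WTape.hd (proj₂ c)) ≡ nothing

-- Compilation: the output is written on the second tape, whose head is finally moved back.

module Compile {k m' : ℕ} (M : WM k (suc m')) where
  open WM M
  open WRun M
  m = suc m'

  B : Set
  B = A ⊎ Fin m
  finB : Finite B
  finB = fin-⊎ finA (fin-Fin m) a₀ fz
  TQ : Set
  TQ = Q ⊎ Bool
  finT : Finite TQ
  finT = fin-⊎ finQ fin-Bool q₀ false
  open Finite

  sA : A → Fin (size finB)
  sA = code finB ∘ inj₁
  sO : Fin m → Fin (size finB)
  sO = code finB ∘ inj₂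

  asA : Maybe (Fin (size finB)) → Maybe A
  asA nothing = nothing
  asA (just x) with decode finB x
  ... | inj₁ a = just a
  ... | inj₂ _ = nothing

  asA-sA : ∀ h → asA (Maybe.map sA h) ≡ h
  asA-sA nothing = refl
  asA-sA (just a) rewrite decode-code finB (inj₁ a) = refl

  outp' : Fin (size finB) → Maybe (Fin m)
  outp' x with decode finB x
  ... | inj₁ _ = nothing
  ... | inj₂ c = just c

  outp-sO : ∀ c → outp' (sO c) ≡ just c
  outp-sO c rewrite decode-code finB (inj₂ c) = refl

  C : Set
  C = Cell (size finB)

  TMStep : Set
  TMStep = Maybe (Fin (size finT) × Vec (C × Move) 2)

  outAct : Maybe (Fin m) → C → C × Move
  outAct nothing h = h , S
  outAct (just c) h = just (sO c) , R

  trans' : TQ → C → C → TMStep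
  trans' (inj₁ q) h₀ h₁ with δ q (asA h₀)
  ... | nothing = just (code finT (inj₂ false) , (h₀ , S) ∷ (h₁ , L) ∷ [])
  ... | just (q' , c , mv , o) = just (code finT (inj₁ q') , (Maybe.map sA c , mv) ∷ outAct o h₁ ∷ [])
  trans' (inj₂ false) h₀ nothing  = just (code finT (inj₂ true) , (h₀ , S) ∷ (nothing , R) ∷ [])
  trans' (inj₂ false) h₀ (just x) = just (code finT (inj₂ false) , (h₀ , S) ∷ (just x , L) ∷ [])
  trans' (inj₂ true) h₀ h₁ = nothing

  tm : TM k m
  tm = record { Q = size finT ; k = 0 ; m = size finB ; q₀ = code finT (inj₁ q₀)
    ; δ = λ { q (h₀ ∷ h₁ ∷ []) → trans' (decode finT q) h₀ h₁ } ; inp = sA ∘ inj ; outp = outp' }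

  tapeOf : WTape A → Tape (size finB)
  tapeOf (wt l h r) = tape (map (Maybe.map sA) l) (Maybe.map sA h) (map (Maybe.map sA) r)

  move-tapeOf : ∀ mv t → moveT mv (tapeOf t) ≡ tapeOf (moveW mv t)
  move-tapeOf L (wt [] h r) = refl
  move-tapeOf L (wt (_ ∷ l) h r) = refl
  move-tapeOf R (wt l h []) = refl
  move-tapeOf R (wt l h (_ ∷ r)) = refl
  move-tapeOf S t = refl

  outT : List (Fin m) → Tape (size finB)
  outT v = tape (map (just ∘ sO) v) nothing []

  iter-+ : ∀ t t' c {d e} → iterTM tm t c ≡ just d → iterTM tm t' d ≡ just e → iterTM tm (t + t') c ≡ just e
  iter-+ zero t' c refl q = q
  iter-+ (suc t) t' c p q with stepTM tm c
  ... | just c' = iter-+ t t' c' p q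

  cfg : Q → WTape A → List (Fin m) → Config tm
  cfg q t v = code finT (inj₁ q) , (tapeOf t ∷ outT v ∷ [])

  sim1 : ∀ q l h r v {q' c mv o} → δ q h ≡ just (q' , c , mv , o) → stepTM tm (cfg q (wt l h r) v) ≡ just (cfg q' (moveW mv (wt l c r)) (emit o v))
  sim1 q l h r v {q'} {c} {mv} {o} e rewrite decode-code finT (inj₁ q) | asA-sA h | e | move-tapeOf mv (wt l c r) with o
  ... | nothing = refl
  ... | just _ = refl

  sim : ∀ {q T t u q' T'} → Runs (q , T) t u (q' , T') → ∀ v → iterTM tm t (cfg q T v) ≡ just (cfg q' T' (u ʳ++ v))
  sim stop v = refl
  sim (step {q} {l} {h} {r} {o = o} e a) v rewrite sim1 q l h r v e with o
  ... | nothing = sim a v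
  ... | just c = sim a (c ∷ v)

  rew : Fin (size finT)
  rew = code finT (inj₂ false)
  fin' : Fin (size finT)
  fin' = code finT (inj₂ true)

  sim-halt : ∀ q T v → δ q (WTape.hd T) ≡ nothing → stepTM tm (cfg q T v) ≡ just (rew , (tapeOf T ∷ moveT L (outT v) ∷ []))
  sim-halt q (wt l h r) v e rewrite decode-code finT (inj₁ q) | asA-sA h | e = refl

  rewind : ∀ t₀ v r → iterTM tm (suc (length v)) (rew , (t₀ ∷ moveT L (tape (map (just ∘ sO) v) nothing r) ∷ [])) ≡
           just (fin' , (t₀ ∷ moveT R (tape [] nothing (map (just ∘ sO) (reverse v) ++ nothing ∷ r)) ∷ []))
  rewind' : ∀ t₀ v x r → iterTM tm (suc (suc (length v))) (rew , (t₀ ∷ tape (map (just ∘ sO) v) (just (sO x)) r ∷ [])) ≡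
           just (fin' , (t₀ ∷ moveT R (tape [] nothing (map (just ∘ sO) (v ʳ++ x ∷ []) ++ r)) ∷ []))
  rewind'' : ∀ t₀ v x w r → iterTM tm (suc (suc (length v))) (rew , (t₀ ∷ tape (map (just ∘ sO) v) (just (sO x)) (map (just ∘ sO) w ++ r) ∷ [])) ≡
           just (fin' , (t₀ ∷ moveT R (tape [] nothing (map (just ∘ sO) (v ʳ++ x ∷ w) ++ r)) ∷ []))
  rewind'' (tape _ _ _) [] x w r rewrite decode-code finT (inj₂ false) | decode-code finT (inj₂ false) = refl
  rewind'' (tape a b c) (y ∷ v) x w r rewrite decode-code finT (inj₂ false) = rewind'' (tape a b c) v y (x ∷ w) r
  rewind' t₀ v x r = rewind'' t₀ v x [] r
  rewind (tape _ _ _) [] r rewrite decode-code finT (inj₂ false) = refl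
  rewind t₀ (x ∷ v) r = rewind' t₀ v x (nothing ∷ r)

  readOut-ok : ∀ u → readOut tm (map (just ∘ sO) u ++ nothing ∷ []) ≡ u
  readOut-ok [] = refl
  readOut-ok (c ∷ u) rewrite outp-sO c = cong (c ∷_) (readOut-ok u)

  out-ok : ∀ t₀ u → outputTM tm (fin' , (t₀ ∷ moveT R (tape [] nothing (map (just ∘ sO) u ++ nothing ∷ [])) ∷ [])) ≡ u
  out-ok t₀ [] = refl
  out-ok t₀ (c ∷ u) = readOut-ok (c ∷ u)

  halted : ∀ ts → stepTM tm (fin' , ts) ≡ nothing
  halted (a ∷ b ∷ []) rewrite decode-code finT (inj₂ true) = refl

  init-ok : ∀ w → initTM tm w ≡ cfg q₀ (inTape (map inj w)) []
  init-ok [] = refl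
  init-ok (a ∷ w) = cong (λ l → code finT (inj₁ q₀) , (tape [] (just (sA (inj a))) l ∷ outT [] ∷ [])) (go w)
    where
    go : ∀ w → map (λ b → just (sA (inj b))) w ≡ map (Maybe.map sA) (map just (map inj w))
    go [] = refl
    go (b ∷ w) = cong (_ ∷_) (go w)

  rev-rev : (u : List (Fin m)) → reverse (u ʳ++ []) ≡ u
  rev-rev u = reverse-involutive u

  -- A step emits at most one letter, so rewinding the output tape takes at most two more steps than
  -- the run itself.
  compile : ∀ f T → Computes f T → ComputesWithin tm f (λ n → 2 * T n + 3)
  compile f T h w with h w
  ... | t , (q , t₀) , l , r , e = t + suc (suc (length v)) , le , _ , it , halted _ ,
        trans (cong (λ u → outputTM tm (fin' , (tapeOf t₀ ∷ moveT R (tape [] nothing (map (just ∘ sO) u ++ nothing ∷ [])) ∷ []))) (rev-rev (f w))) (out-ok (tapeOf t₀) (f w))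
    where
    v = f w ʳ++ []
    len : length v ≤ T (length w)
    len = ≤-trans (≤-reflexive (length-reverse (f w))) (≤-trans (runs-len r) l)
    le : t + suc (suc (length v)) ≤ 2 * T (length w) + 3
    le = ≤-trans (+-mono-≤ l (s≤s (s≤s len))) (≤-trans (≤-reflexive (trans (cong (T (length w) +_) (+-comm 2 _)) (sym (+-assoc (T (length w)) _ 2))))
          (+-mono-≤ (≤-reflexive (cong (T (length w) +_) (sym (+-identityʳ _)))) (n≤1+n 2)))
    it : iterTM tm (t + suc (suc (length v))) (initTM tm w) ≡ just (fin' , (tapeOf t₀ ∷ moveT R (tape [] nothing (map (just ∘ sO) (reverse v) ++ nothing ∷ [])) ∷ []))
    it rewrite init-ok w = iter-+ t _ _ (sim r []) go
      where
      go : iterTM tm (suc (suc (length v))) (cfg q t₀ v) ≡ just (fin' , (tapeOf t₀ ∷ moveT R (tape [] nothing (map (just ∘ sO) (reverse v) ++ nothing ∷ [])) ∷ []))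
      go rewrite sim-halt q t₀ v e = rewind (tapeOf t₀) v []

-- Linear time: a walk on the annotated tape

module Walk (n m : ℕ) where
  open Decorate n using (colAt)

  F : Set
  F = Fin m

  red-head : ∀ (x : Sy F) u → Σ (List (Sy F)) λ t → red (x ∷ u) ≡ x ∷ t
  red-head x u with merges? x (red u)
  ... | yes (_ , t , e) = t , e
  ... | no _ = red u , refl

  push-idem : ∀ (x : Sy F) s → merS x ≡ true → push x (push x s) ≡ push x s
  push-idem x s e with merges? x s
  ... | yes m = push-m m
  ... | no _ = push-m (e , s , refl)

  Keeps : (Sy F → Sy F) → Set
  Keeps f = ∀ x → merS x ≡ true → merS (f x) ≡ true

  -- Merged symbols have equal images, which are mergeable again, so reducing before the map loses
  -- nothing. Patterns stored in reduced form can be re-read through a coarser view.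
  red-map : ∀ f → Keeps f → ∀ u → red (map f (red u)) ≡ red (map f u)
  red-map f k [] = refl
  red-map f k (x ∷ u) with merges? x (red u)
  ... | no _ = cong (push (f x)) (red-map f k u)
  ... | yes (e , t , e') = trans (red-map f k u) (trans (sym (red-map f k u)) (trans (cong (λ s → red (map f s)) e')
         (trans (sym (push-idem (f x) (red (map f t)) (k x e))) (cong (push (f x)) (trans (cong (λ s → red (map f s)) (sym e')) (red-map f k u))))))

  -- own letters count as left, resp. right
  ownL ownR : Sy F → Sy F
  ownL (cs _) = ls
  ownL x = x
  ownR (cs _) = rs
  ownR x = x

  ownL-keeps : Keeps ownL
  ownL-keeps ls e = refl
  ownL-keeps rs e = refl
  ownR-keeps : Keeps ownR
  ownR-keeps ls e = refl
  ownR-keeps rs e = refl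

  _≟ᴸ_ : (s t : List (Sy F)) → Dec (s ≡ t)
  _≟ᴸ_ = ≡-dec _≟ˢ_

  match : (Sy F → Sy F) → List (Sy F) → List (Sy F) → List (Sy F)
  match f [] y = []
  match f (x ∷ s) y with red (map f (x ∷ s)) ≟ᴸ y
  ... | yes _ = x ∷ s
  ... | no _ = match f s y

  match-self : ∀ f s → match f s (red (map f s)) ≡ s
  match-self f [] = refl
  match-self f (x ∷ s) with red (map f (x ∷ s)) ≟ᴸ red (map f (x ∷ s))
  ... | yes _ = refl
  ... | no n = ⊥-elim (n refl)

  match-skip : ∀ f pre s → (∀ p₁ p₂ → pre ≡ p₁ ++ p₂ → ¬ p₂ ≡ [] → length (red (map f s)) < length (red (map f (p₂ ++ s)))) → match f (pre ++ s) (red (map f s)) ≡ s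
  match-skip f [] s h = match-self f s
  match-skip f (x ∷ pre) s h with red (map f (x ∷ pre ++ s)) ≟ᴸ red (map f s)
  ... | yes e = ⊥-elim (<⇒≢ (h [] (x ∷ pre) refl (λ ())) (cong length (sym e)))
  ... | no _ = match-skip f pre s (λ p₁ p₂ e → h (x ∷ p₁) p₂ (cong (x ∷_) e))

  -- As the symbol in front of `s` does not merge in the coarse view, every longer suffix looks
  -- strictly longer there. The first suffix that fits is therefore `s` itself.
  match-ok : ∀ f pre z s → ¬ Merges (f z) (red (map f s)) → match f ((pre ++ z ∷ []) ++ s) (red (map f s)) ≡ s
  match-ok f pre z s n = match-skip f (pre ++ z ∷ []) s (λ p₁ p₂ e nz → go pre p₁ p₂ e nz)
    where
    long : ∀ q → length (red (map f s)) < length (red (map f ((q ++ z ∷ []) ++ s)))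
    long q = ≤-trans (≤-reflexive (cong length (sym (push-n n)))) (≤-trans (redOn-len (push (f z) (red (map f s))) (map f q))
        (≤-reflexive (cong length (trans (sym (foldr-++ push [] (map f q) (f z ∷ map f s))) (cong red (trans (sym (map-++ f q (z ∷ s))) (cong (map f) (sym (++-assoc q (z ∷ []) s)))))))))
    go : ∀ pre p₁ p₂ → pre ++ z ∷ [] ≡ p₁ ++ p₂ → ¬ p₂ ≡ [] → length (red (map f s)) < length (red (map f (p₂ ++ s)))
    go pre [] p₂ refl nz = long pre
    go [] (x ∷ []) [] e nz = ⊥-elim (nz refl)
    go [] (x ∷ []) (y ∷ p₂) () nz
    go [] (x ∷ x' ∷ p₁) p₂ () nz
    go (x ∷ pre) (y ∷ p₁) p₂ e nz = go pre p₁ p₂ (proj₂ (∷-injective e)) nz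

  -- On arrival at a cell the index is the longest suffix of its pattern compatible with what was known before.
  NotLike : ∀ {Λ : Set} → (Sy F → Sy F) → (Λ → Sy F) → List Λ → Λ → Set
  NotLike f g O₁ h = O₁ ≡ [] ⊎ Σ (List _) λ O₁' → Σ _ λ x → O₁ ≡ O₁' ++ x ∷ [] × ¬ f (g x) ≡ f (g h) × ¬ g x ≡ g h

  arrive : ∀ {Λ : Set} f (g : Λ → Sy F) → Keeps f → ∀ O₁ h O₃ → NotLike f g O₁ h →
           match f (red (map g (O₁ ++ h ∷ O₃))) (red (map f (map g (h ∷ O₃)))) ≡ red (map g (h ∷ O₃))
  arrive f g k O₁ h O₃ nl = trans (cong (match f (red (map g (O₁ ++ h ∷ O₃)))) (sym (red-map f k (map g (h ∷ O₃))))) (go O₁ nl)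
    where
    s = red (map g (h ∷ O₃))
    no-m : ∀ {x y} u → ¬ x ≡ y → ¬ Merges x (red (y ∷ u))
    no-m {x} {y} u d (_ , t , e) = d (sym (proj₁ (∷-injective (trans (sym (proj₂ (red-head y u))) e))))
    go : ∀ O₁ → NotLike f g O₁ h → match f (red (map g (O₁ ++ h ∷ O₃))) (red (map f s)) ≡ s
    go O₁ (inj₁ refl) = match-self f s
    go O₁ (inj₂ (O₁' , x , refl , d , d')) = trans (cong (λ P → match f P (red (map f s))) eqP)
        (match-ok f (proj₁ pr) (g x) s (λ mm → no-m (map f (map g O₃)) d (subst (Merges (f (g x))) (red-map f k (map g (h ∷ O₃))) mm)))
      where
      pr = redOn-pre (g x ∷ s) (map g O₁')
      eqP : red (map g ((O₁' ++ x ∷ []) ++ h ∷ O₃)) ≡ (proj₁ pr ++ g x ∷ []) ++ s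
      eqP = trans (cong (red ∘ map g) (++-assoc O₁' (x ∷ []) (h ∷ O₃)))
           (trans (cong red (map-++ g O₁' (x ∷ h ∷ O₃))) (trans (foldr-++ push [] (map g O₁') (map g (x ∷ h ∷ O₃)))
           (trans (cong (λ z → redOn z (map g O₁')) (push-n (no-m (map g O₃) d'))) (trans (proj₂ pr) (sym (++-assoc (proj₁ pr) (g x ∷ []) s))))))

  Λ : Set
  Λ = F × Maybe ℕ

  sP : ℕ → Λ → Sy F
  sP = symP n

  pat : ℕ → List Λ → List (Sy F)
  pat p u = red (map (sP p) u)

  data Cmp (p q : ℕ) : Col3 → Set where
    lt : q < p → Cmp p q cl
    eq : q ≡ p → Cmp p q cc
    gt : p < q → Cmp p q cr

  cmp : ∀ p q → Cmp p q (colAt p q)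
  cmp zero zero = eq refl
  cmp zero (suc q) = gt (s≤s z≤n)
  cmp (suc p) zero = lt (s≤s z≤n)
  cmp (suc p) (suc q) with colAt p q | cmp p q
  ... | _ | lt l = lt (s≤s l)
  ... | _ | eq e = eq (cong suc e)
  ... | _ | gt l = gt (s≤s l)

  sP-lt : ∀ {p q c} → q < p → sP p (c , just q) ≡ ls
  sP-lt {p} {q} l with colAt p q | cmp p q
  ... | _ | lt _ = refl
  ... | _ | eq e = ⊥-elim (<⇒≢ l e)
  ... | _ | gt l' = ⊥-elim (<-asym l l')

  sP-eq : ∀ {p c} → sP p (c , just p) ≡ cs c
  sP-eq {p} with colAt p p | cmp p p
  ... | _ | lt l = ⊥-elim (<-irrefl refl l)
  ... | _ | eq e = refl
  ... | _ | gt l = ⊥-elim (<-irrefl refl l)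

  sP-gt : ∀ {p q c} → p < q → sP p (c , just q) ≡ rs
  sP-gt {p} {q} l with colAt p q | cmp p q
  ... | _ | lt l' = ⊥-elim (<-asym l l')
  ... | _ | eq e = ⊥-elim (<⇒≢ l (sym e))
  ... | _ | gt _ = refl

  -- The common view from two neighbouring positions: both sides say on which side of the cut
  -- between p and p + 1 the letter lies.
  cut : ∀ p l → ownL (sP p l) ≡ ownR (sP (suc p) l)
  cut p (c , nothing) = refl
  cut p (c , just q) with <-cmp q p
  ... | tri< l _ _ rewrite sP-lt {p} {q} {c} l | sP-lt {suc p} {q} {c} (≤-trans l (n≤1+n p)) = refl
  ... | tri≈ _ refl _ rewrite sP-eq {p} {c} | sP-lt {suc p} {p} {c} ≤-refl = refl
  ... | tri> _ _ l with m≤n⇒m<n∨m≡n l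
  ...   | inj₁ l' rewrite sP-gt {p} {q} {c} l | sP-gt {suc p} {q} {c} l' = refl
  ...   | inj₂ refl rewrite sP-gt {p} {suc p} {c} ≤-refl | sP-eq {suc p} {c} = refl

  cut-map : ∀ p u → map ownL (map (sP p) u) ≡ map ownR (map (sP (suc p)) u)
  cut-map p [] = refl
  cut-map p (l ∷ u) = cong₂ _∷_ (cut p l) (cut-map p u)

  -- the last letter already produced is on the near side
  LastL LastR : ℕ → List Λ → Set
  LastL p O₁ = O₁ ≡ [] ⊎ Σ (List Λ) λ O₁' → Σ Λ λ x → O₁ ≡ O₁' ++ x ∷ [] × (∀ q → proj₂ x ≡ just q → q ≤ p)
  LastR p O₁ = O₁ ≡ [] ⊎ Σ (List Λ) λ O₁' → Σ Λ λ x → O₁ ≡ O₁' ++ x ∷ [] × (∀ q → proj₂ x ≡ just q → p ≤ q)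

  -- The next letter lies right of the cut and the last one written does not, so a block boundary of
  -- the common view separates them. This makes the remaining output recognizable in the pattern of
  -- the new cell from its view across the cut.
  arriveR : ∀ p O₁ c q O₃ → p < q → LastL p O₁ →
            match ownR (pat (suc p) (O₁ ++ (c , just q) ∷ O₃)) (red (map ownL (pat p ((c , just q) ∷ O₃)))) ≡ pat (suc p) ((c , just q) ∷ O₃)
  arriveR p O₁ c q O₃ l la = trans (cong (match ownR (pat (suc p) (O₁ ++ h ∷ O₃))) (trans (red-map ownL ownL-keeps (map (sP p) (h ∷ O₃))) (cong red (cut-map p (h ∷ O₃)))))
      (arrive ownR (sP (suc p)) ownR-keeps O₁ h O₃ (nl la))
    where
    h : Λ
    h = c , just q
    own-h : ownR (sP (suc p) h) ≡ rs
    own-h = trans (sym (cut p h)) (cong ownL (sP-gt l))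
    h-≢ : ∀ {x} → ¬ ownR x ≡ rs → ¬ x ≡ sP (suc p) h
    h-≢ d e = d (trans (cong ownR e) own-h)
    far : ∀ x → (∀ q → proj₂ x ≡ just q → q ≤ p) → ¬ ownR (sP (suc p) x) ≡ rs
    far (_ , nothing) f ()
    far (c' , just q') f e with trans (sym (cong ownR (sP-lt {suc p} {q'} {c'} (s≤s (f q' refl))))) e
    ... | ()
    nl : LastL p O₁ → NotLike ownR (sP (suc p)) O₁ h
    nl (inj₁ e) = inj₁ e
    nl (inj₂ (O₁' , x , e , f)) = inj₂ (O₁' , x , e , (λ e' → far x f (trans e' own-h)) , h-≢ (far x f))

  arriveL : ∀ p O₁ c q O₃ → q < suc p → LastR (suc p) O₁ →
            match ownL (pat p (O₁ ++ (c , just q) ∷ O₃)) (red (map ownR (pat (suc p) ((c , just q) ∷ O₃)))) ≡ pat p ((c , just q) ∷ O₃)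
  arriveL p O₁ c q O₃ l la = trans (cong (match ownL (pat p (O₁ ++ h ∷ O₃))) (trans (red-map ownR ownR-keeps (map (sP (suc p)) (h ∷ O₃))) (cong red (sym (cut-map p (h ∷ O₃))))))
      (arrive ownL (sP p) ownL-keeps O₁ h O₃ (nl la))
    where
    h : Λ
    h = c , just q
    own-h : ownL (sP p h) ≡ ls
    own-h = trans (cut p h) (cong ownR (sP-lt l))
    h-≢ : ∀ {x} → ¬ ownL x ≡ ls → ¬ x ≡ sP p h
    h-≢ d e = d (trans (cong ownL e) own-h)
    far : ∀ x → (∀ q → proj₂ x ≡ just q → suc p ≤ q) → ¬ ownL (sP p x) ≡ ls
    far (_ , nothing) f ()
    far (c' , just q') f e with trans (sym (cong ownL (sP-gt {p} {q'} {c'} (f q' refl)))) e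
    ... | ()
    nl : LastR (suc p) O₁ → NotLike ownL (sP p) O₁ h
    nl (inj₁ e) = inj₁ e
    nl (inj₂ (O₁' , x , e , f)) = inj₂ (O₁' , x , e , (λ e' → far x f (trans e' own-h)) , h-≢ (far x f))

  -- Potential: the current cell counts as a letter in front of the remaining output.
  cell : F → ℕ → ℕ → List Λ → ℕ
  cell d p r u = length (pat r ((d , just p) ∷ u))

  Σ≤ : ℕ → (ℕ → ℕ) → ℕ
  Σ≤ zero    f = f 0
  Σ≤ (suc k) f = f (suc k) + Σ≤ k f

  Σ≤-mono : ∀ k {f g : ℕ → ℕ} → (∀ r → f r ≤ g r) → Σ≤ k f ≤ Σ≤ k g
  Σ≤-mono zero h = h 0
  Σ≤-mono (suc k) h = +-mono-≤ (h (suc k)) (Σ≤-mono k h)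

  Σ≤-strict : ∀ k {f g : ℕ → ℕ} r → r ≤ k → (∀ r → f r ≤ g r) → suc (f r) ≤ g r → suc (Σ≤ k f) ≤ Σ≤ k g
  Σ≤-strict zero zero l h s = s
  Σ≤-strict (suc k) r l h s with m≤n⇒m<n∨m≡n l
  ... | inj₂ refl = +-mono-≤ s (Σ≤-mono k h)
  ... | inj₁ l' = ≤-trans (≤-reflexive (sym (+-suc _ _))) (+-mono-≤ (h (suc k)) (Σ≤-strict k r (s≤s⁻¹ l') h s))

  Σ≤-const : ∀ k {f : ℕ → ℕ} B → (∀ r → f r ≤ B) → Σ≤ k f ≤ suc k * B
  Σ≤-const zero B h = ≤-trans (h 0) (≤-reflexive (sym (+-identityʳ B)))
  Σ≤-const (suc k) B h = +-mono-≤ (h (suc k)) (Σ≤-const k B h)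

  push-≤ : ∀ (x : Sy F) s → length (push x s) ≤ suc (length s)
  push-≤ x s with merges? x s
  ... | yes _ = n≤1+n _
  ... | no _ = ≤-refl

  push-red : ∀ (x : Sy F) y u → merS x ≡ true → x ≡ y → push x (red (y ∷ u)) ≡ red (y ∷ u)
  push-red x y u e refl = push-m (e , red-head y u)

  push-diff : ∀ (x : Sy F) y u → ¬ x ≡ y → push x (red (y ∷ u)) ≡ x ∷ red (y ∷ u)
  push-diff x y u d = push-n λ { (_ , t , e) → d (sym (proj₁ (∷-injective (trans (sym (proj₂ (red-head y u))) e)))) }

  push-own : ∀ c (s : List (Sy F)) → push (cs c) s ≡ cs c ∷ s
  push-own c s = push-n λ { (() , _) }
  push-vs : ∀ c (s : List (Sy F)) → push (vs c) s ≡ vs c ∷ s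
  push-vs c s = push-n λ { (() , _) }

  ls≢ : ¬ (Sy F ∋ ls) ≡ rs
  ls≢ ()
  rs≢ : ¬ (Sy F ∋ rs) ≡ ls
  rs≢ ()

  -- In the count of cell p the walker turns from an own letter into a right one and merges with the
  -- next letter, which saves 1. In that of cell p + 1 it turns from an isolated left block into an
  -- own letter, which costs nothing. The other counts do not change.
  moveR-pot : ∀ d p c q O₃ k → p < q → p ≤ k → suc (Σ≤ k (λ r → cell d (suc p) r ((c , just q) ∷ O₃))) ≤ Σ≤ k (λ r → cell d p r ((c , just q) ∷ O₃))
  moveR-pot d p c q O₃ k l pk = Σ≤-strict k p pk le drp
    where
    h : Λ
    h = c , just q
    drp : suc (cell d (suc p) p (h ∷ O₃)) ≤ cell d p p (h ∷ O₃)
    drp rewrite sP-eq {p} {d} | sP-gt {p} {suc p} {d} ≤-refl | push-own d (pat p (h ∷ O₃)) | push-red rs (sP p h) (map (sP p) O₃) refl (sym (sP-gt l)) = ≤-refl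
    le : ∀ r → cell d (suc p) r (h ∷ O₃) ≤ cell d p r (h ∷ O₃)
    le r with <-cmp r p
    ... | tri< a _ _ rewrite sP-gt {r} {suc p} {d} (≤-trans a (n≤1+n p)) | sP-gt {r} {p} {d} a = ≤-refl
    ... | tri≈ _ refl _ = ≤-trans (n≤1+n _) drp
    ... | tri> _ _ a with m≤n⇒m<n∨m≡n a
    ...   | inj₁ b rewrite sP-lt {r} {suc p} {d} b | sP-lt {r} {p} {d} a = ≤-refl
    ...   | inj₂ refl rewrite sP-eq {suc p} {d} | sP-lt {suc p} {p} {d} ≤-refl | push-own d (pat (suc p) (h ∷ O₃))
              | push-diff ls (sP (suc p) h) (map (sP (suc p)) O₃) (λ e → ls≢ (trans (cong ownR e) (trans (sym (cut p h)) (cong ownL (sP-gt l))))) = ≤-refl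

  moveL-pot : ∀ d p c q O₃ k → q < suc p → suc p ≤ k → suc (Σ≤ k (λ r → cell d p r ((c , just q) ∷ O₃))) ≤ Σ≤ k (λ r → cell d (suc p) r ((c , just q) ∷ O₃))
  moveL-pot d p c q O₃ k l pk = Σ≤-strict k (suc p) pk le drp
    where
    h : Λ
    h = c , just q
    drp : suc (cell d p (suc p) (h ∷ O₃)) ≤ cell d (suc p) (suc p) (h ∷ O₃)
    drp rewrite sP-eq {suc p} {d} | sP-lt {suc p} {p} {d} ≤-refl | push-own d (pat (suc p) (h ∷ O₃)) | push-red ls (sP (suc p) h) (map (sP (suc p)) O₃) refl (sym (sP-lt l)) = ≤-refl
    le : ∀ r → cell d p r (h ∷ O₃) ≤ cell d (suc p) r (h ∷ O₃)
    le r with <-cmp r p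
    ... | tri< a _ _ rewrite sP-gt {r} {suc p} {d} (≤-trans a (n≤1+n p)) | sP-gt {r} {p} {d} a = ≤-refl
    ... | tri≈ _ refl _ rewrite sP-eq {p} {d} | sP-gt {p} {suc p} {d} ≤-refl | push-own d (pat p (h ∷ O₃))
              | push-diff rs (sP p h) (map (sP p) O₃) (λ e → rs≢ (trans (cong ownL e) (trans (cut p h) (cong ownR (sP-lt l))))) = ≤-refl
    ... | tri> _ _ a with m≤n⇒m<n∨m≡n a
    ...   | inj₁ b rewrite sP-lt {r} {suc p} {d} b | sP-lt {r} {p} {d} a = ≤-refl
    ...   | inj₂ refl = ≤-trans (n≤1+n _) drp

  -- The count of the own cell loses the letter written; seen from any other cell, that letter is in
  -- one block with the walker.
  emit-pot : ∀ d p c O₃ k → p ≤ k → suc (Σ≤ k (λ r → cell d p r O₃)) ≤ Σ≤ k (λ r → cell d p r ((c , just p) ∷ O₃))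
  emit-pot d p c O₃ k pk = Σ≤-strict k p pk le drp
    where
    drp : suc (cell d p p O₃) ≤ cell d p p ((c , just p) ∷ O₃)
    drp rewrite sP-eq {p} {d} | sP-eq {p} {c} | push-own c (pat p O₃) | push-own d (pat p O₃) | push-own d (cs c ∷ pat p O₃) = ≤-refl
    le : ∀ r → cell d p r O₃ ≤ cell d p r ((c , just p) ∷ O₃)
    le r with <-cmp r p
    ... | tri< a _ _ rewrite sP-gt {r} {p} {d} a | sP-gt {r} {p} {c} a | push-idem rs (pat r O₃) refl = ≤-refl
    ... | tri≈ _ refl _ = ≤-trans (n≤1+n _) drp
    ... | tri> _ _ a rewrite sP-lt {r} {p} {d} a | sP-lt {r} {p} {c} a | push-idem ls (pat r O₃) refl = ≤-refl

  emitV-pot : ∀ d p c O₃ k → suc (Σ≤ k (λ r → cell d p r O₃)) ≤ Σ≤ k (λ r → cell d p r ((c , nothing) ∷ O₃))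
  emitV-pot d p c O₃ k = Σ≤-strict k 0 z≤n (λ r → ≤-trans (n≤1+n _) (drp r)) (drp 0)
    where
    drp : ∀ r → suc (cell d p r O₃) ≤ cell d p r ((c , nothing) ∷ O₃)
    drp r rewrite push-vs c (pat r O₃) = ≤-trans (s≤s (push-≤ (sP r (d , just p)) (pat r O₃))) (≤-reflexive (cong length (sym (push-n {x = sP r (d , just p)} {s = vs c ∷ pat r O₃} nm))))
      where
      nm : ¬ Merges (sP r (d , just p)) (vs c ∷ pat r O₃)
      nm (e , t , e') with trans (cong merS (proj₁ (∷-injective e'))) e
      ... | ()

module Walker {nΓ nΣ : ℕ} {f : Word (suc nΓ) → Word (suc nΣ)} (Sp : LinSpec nΓ nΣ f) where
  open LinSpec Sp
  open Decorate nΓ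
  open Moore mach renaming (St to MSt; fin to finM; init to init₀; step to δM; out to outM)
  open Finite finM using (size; code; decode; decode-code)
  open Walk nΓ (suc nΣ) hiding (F)

  X : Set
  X = BL (Sy F) NB

  finX : Finite X
  finX = fin-BL (fin-Sy fz) NB

  Tab : Set
  Tab = Vec X size

  data QS : Set where
    fwd : MSt → QS
    bwd : Tab → QS
    start : QS
    walk arrR arrL : X → QS

  data Sym : Set where
    raw : Fin (suc nΓ) → Sym
    mid : Fin (suc nΓ) → MSt → Sym
    ann : X → Sym

  x₀ : X
  x₀ = toBL NB []

  tab₀ : Tab
  tab₀ = Vec.replicate size x₀

  finQS : Finite QS
  finQS = fin-retract {B = Fin 6 × MSt × Tab × X}
    (λ { (fwd s) → fz , s , tab₀ , x₀ ; (bwd b) → fs fz , init₀ , b , x₀ ; start → fs (fs fz) , init₀ , tab₀ , x₀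
       ; (walk x) → fs (fs (fs fz)) , init₀ , tab₀ , x ; (arrR x) → fs (fs (fs (fs fz))) , init₀ , tab₀ , x ; (arrL x) → fs (fs (fs (fs (fs fz)))) , init₀ , tab₀ , x })
    (λ { (fz , s , _ , _) → fwd s ; (fs fz , _ , b , _) → bwd b ; (fs (fs fz) , _) → start ; (fs (fs (fs fz)) , _ , _ , x) → walk x
       ; (fs (fs (fs (fs fz))) , _ , _ , x) → arrR x ; (fs (fs (fs (fs (fs _)))) , _ , _ , x) → arrL x })
    (λ { (fwd s) → refl ; (bwd b) → refl ; start → refl ; (walk x) → refl ; (arrR x) → refl ; (arrL x) → refl })
    (fin-× (fin-Fin 6) (fin-× finM (fin-× (fin-Vec finX size) finX)))

  finSym : Finite Sym
  finSym = fin-retract {B = Fin 3 × Fin (suc nΓ) × MSt × X}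
    (λ { (raw c) → fz , c , init₀ , x₀ ; (mid c s) → fs fz , c , s , x₀ ; (ann x) → fs (fs fz) , fz , init₀ , x })
    (λ { (fz , c , _) → raw c ; (fs fz , c , s , _) → mid c s ; (fs (fs _) , _ , _ , x) → ann x })
    (λ { (raw c) → refl ; (mid c s) → refl ; (ann x) → refl })
    (fin-× (fin-Fin 3) (fin-× (fin-Fin _) (fin-× finM finX)))

  look₀ : Tab → MSt → X
  look₀ b s = lookup b (code s)

  tabOf : (MSt → X) → Tab
  tabOf g = tabulate (g ∘ decode)

  look-tab : ∀ g s → look₀ (tabOf g) s ≡ g s
  look-tab g s = trans (lookup∘tabulate _ (code s)) (cong g (decode-code s))

  Act : Set
  Act = Maybe (QS × Maybe Sym × Move × Maybe F)

  dispatch : List (Sy F) → Maybe Sym → Act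
  dispatch [] h = nothing
  dispatch s@(ls ∷ _) h = just (arrL (toBL NB (red (map ownR s))) , h , L , nothing)
  dispatch s@(rs ∷ _) h = just (arrR (toBL NB (red (map ownL s))) , h , R , nothing)
  dispatch (cs c ∷ t) h = just (walk (toBL NB t) , h , S , just c)
  dispatch (vs c ∷ t) h = just (walk (toBL NB t) , h , S , just c)

  -- The forward pass stores in each cell the state of `mach` after a prefix coloured left. The
  -- backward pass carries, as a table over all states, the output of `mach` after the suffix
  -- coloured right. Together they give the pattern around each cell. Afterwards the head of the
  -- remaining pattern says whether to write, or in which direction the next letter lies.
  δW : QS → Maybe Sym → Act
  δW (fwd s) (just (raw c)) = just (fwd (δM s (mk c cl)) , just (mid c s) , R , nothing)
  -- The blank after the word is annotated too, for a colouring with all positions on the left. It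
  -- is the cell on which the walk takes place if the word is empty.
  δW (fwd s) nothing = just (bwd (tabOf outM) , just (ann (outM s)) , L , nothing)
  δW (fwd s) _ = nothing
  δW (bwd b) (just (mid c s)) = just (bwd (tabOf (λ s → look₀ b (δM s (mk c cr)))) , just (ann (look₀ b (δM s (mk c cc)))) , L , nothing)
  δW (bwd b) nothing = just (start , nothing , R , nothing)
  δW (bwd b) _ = nothing
  δW start (just (ann x)) = just (walk x , just (ann x) , S , nothing)
  δW start _ = nothing
  δW (walk x) h = dispatch (fromBL NB x) h
  δW (arrR y) (just (ann x)) = just (walk (toBL NB (match ownR (fromBL NB x) (fromBL NB y))) , just (ann x) , S , nothing)
  δW (arrR y) _ = nothing
  δW (arrL y) (just (ann x)) = just (walk (toBL NB (match ownL (fromBL NB x) (fromBL NB y))) , just (ann x) , S , nothing)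
  δW (arrL y) _ = nothing

  wm : WM (suc nΓ) (suc nΣ)
  wm = record { Q = QS ; A = Sym ; finQ = finQS ; finA = finSym ; a₀ = raw fz ; q₀ = fwd init₀ ; inj = raw ; δ = δW }

  open WRun wm

  module _ (w : Word (suc nΓ)) where
    m = length w

    cellX : ℕ → X
    cellX p = toBL NB (pat p (OL w))

    lft : ℕ → List (Maybe Sym)
    lft zero = nothing ∷ []
    lft (suc p) = just (ann (cellX p)) ∷ lft p

    rgt : ℕ → ℕ → List (Maybe Sym)
    rgt p zero = []
    rgt p (suc j) = just (ann (cellX (suc p))) ∷ rgt (suc p) j

    at : ℕ → ℕ → WTape Sym
    at p j = wt (lft p) (just (ann (cellX p))) (rgt p j)

    suffix-≤ : ∀ O₁ O₂ p → O₁ ++ O₂ ≡ OL w → length (pat p O₂) ≤ NB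
    suffix-≤ O₁ O₂ p e = ≤-trans (≤-trans (redOn-len (pat p O₂) (map (sP p) O₁))
       (≤-reflexive (cong length (trans (sym (foldr-++ push [] (map (sP p) O₁) (map (sP p) O₂))) (trans (cong red (sym (map-++ (sP p) O₁ O₂))) (cong (pat p) e)))))) (bound w p)

    fromPat : ∀ O₁ O₂ p → O₁ ++ O₂ ≡ OL w → fromBL NB (toBL NB (pat p O₂)) ≡ pat p O₂
    fromPat O₁ O₂ p e = from-toBL-≤ NB _ (suffix-≤ O₁ O₂ p e)

    Good : Λ → Set
    Good l = ∀ q → proj₂ l ≡ just q → q < m

    Halt : Cfg → Set
    Halt c = δW (proj₁ c) (WTape.hd (proj₂ c)) ≡ nothing

    Ψ : ℕ → List Λ → ℕ
    Ψ p u = Σ≤ m (λ r → cell fz p r u)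

    Out : Cfg → ℕ → List F → Set
    Out c b u = Σ ℕ λ t → Σ Cfg λ d → t ≤ b × Runs c t u d × Halt d

    cut-≤ : ∀ g → Keeps g → ∀ s → length (red (map g s)) ≤ length s
    cut-≤ g k s = ≤-trans (red-len (map g s)) (≤-reflexive (length-map g s))

    dispatch-R : ∀ p O₂ {t} → pat p O₂ ≡ rs ∷ t → fromBL NB (toBL NB (pat p O₂)) ≡ pat p O₂ →
                 δW (walk (toBL NB (pat p O₂))) (just (ann (cellX p))) ≡ just (arrR (toBL NB (red (map ownL (pat p O₂)))) , just (ann (cellX p)) , R , nothing)
    dispatch-R p O₂ e f = trans (cong (λ s → dispatch s (just (ann (cellX p)))) (trans f e)) (cong (λ s → just (arrR (toBL NB (red (map ownL s))) , just (ann (cellX p)) , R , nothing)) (sym e))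

    dispatch-L : ∀ p O₂ {t} → pat p O₂ ≡ ls ∷ t → fromBL NB (toBL NB (pat p O₂)) ≡ pat p O₂ →
                 δW (walk (toBL NB (pat p O₂))) (just (ann (cellX p))) ≡ just (arrL (toBL NB (red (map ownR (pat p O₂)))) , just (ann (cellX p)) , L , nothing)
    dispatch-L p O₂ e f = trans (cong (λ s → dispatch s (just (ann (cellX p)))) (trans f e)) (cong (λ s → just (arrL (toBL NB (red (map ownR s))) , just (ann (cellX p)) , L , nothing)) (sym e))

    emit-step : ∀ p {b u} c s O₃ → fromBL NB (toBL NB s) ≡ s → s ≡ cs c ∷ pat p O₃ ⊎ s ≡ vs c ∷ pat p O₃ → ∀ j →
                Out (walk (toBL NB (pat p O₃)) , at p j) b u → Out (walk (toBL NB s) , at p j) (suc b) (c ∷ u)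
    emit-step p c s O₃ f e j (t , d , l , r , h) = suc t , d , s≤s l , step {o = just c} (eqn e f) r , h
      where
      eqn : s ≡ cs c ∷ pat p O₃ ⊎ s ≡ vs c ∷ pat p O₃ → fromBL NB (toBL NB s) ≡ s → δW (walk (toBL NB s)) (just (ann (cellX p))) ≡ just (walk (toBL NB (pat p O₃)) , just (ann (cellX p)) , S , just c)
      eqn (inj₁ refl) f = cong (λ s → dispatch s (just (ann (cellX p)))) f
      eqn (inj₂ refl) f = cong (λ s → dispatch s (just (ann (cellX p)))) f

    two : ∀ {a b} → suc a ≤ b → suc (suc (2 * a)) ≤ 2 * b
    two {a} {b} l = ≤-trans (≤-reflexive (sym (*-suc 2 a))) (*-monoʳ-≤ 2 l)

    weaken : ∀ {c b b' u} → b ≤ b' → Out c b u → Out c b' u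
    weaken p (t , d , l , r , h) = t , d , ≤-trans l p , r , h

    moveR-step : ∀ O₁ c q O₃ p j → O₁ ++ (c , just q) ∷ O₃ ≡ OL w → p < q → LastL p O₁ → ∀ {b u} →
                 Out (walk (toBL NB (pat (suc p) ((c , just q) ∷ O₃))) , at (suc p) j) b u →
                 Out (walk (toBL NB (pat p ((c , just q) ∷ O₃))) , at p (suc j)) (suc (suc b)) u
    moveR-step O₁ c q O₃ p j e l la (t , d , lt' , r , h) = suc (suc t) , d , s≤s (s≤s lt') ,
       step {o = nothing} (dispatch-R p ((c , just q) ∷ O₃) hd (fromPat O₁ _ p e)) (step {o = nothing} (cong (λ x → just (walk x , just (ann (cellX (suc p))) , S , nothing)) eqm) r) , h
      where
      hd : pat p ((c , just q) ∷ O₃) ≡ rs ∷ proj₁ (red-head (sP p (c , just q)) (map (sP p) O₃))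
      hd = trans (proj₂ (red-head (sP p (c , just q)) (map (sP p) O₃))) (cong (_∷ proj₁ (red-head (sP p (c , just q)) (map (sP p) O₃))) (sP-gt l))
      s = pat p ((c , just q) ∷ O₃)
      eqm : toBL NB (match ownR (fromBL NB (cellX (suc p))) (fromBL NB (toBL NB (red (map ownL s))))) ≡ toBL NB (pat (suc p) ((c , just q) ∷ O₃))
      eqm = cong (toBL NB) (trans (cong₂ (match ownR) (fromPat [] (OL w) (suc p) refl) (from-toBL-≤ NB _ (≤-trans (cut-≤ ownL ownL-keeps s) (suffix-≤ O₁ _ p e))))
              (trans (cong (λ u → match ownR (pat (suc p) u) (red (map ownL s))) (sym e)) (arriveR p O₁ c q O₃ l la)))

    moveL-step : ∀ O₁ c q O₃ p j → O₁ ++ (c , just q) ∷ O₃ ≡ OL w → q < suc p → LastR (suc p) O₁ → ∀ {b u} →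
                 Out (walk (toBL NB (pat p ((c , just q) ∷ O₃))) , at p (suc j)) b u →
                 Out (walk (toBL NB (pat (suc p) ((c , just q) ∷ O₃))) , at (suc p) j) (suc (suc b)) u
    moveL-step O₁ c q O₃ p j e l la (t , d , lt' , r , h) = suc (suc t) , d , s≤s (s≤s lt') ,
       step {o = nothing} (dispatch-L (suc p) ((c , just q) ∷ O₃) hd (fromPat O₁ _ (suc p) e)) (step {o = nothing} (cong (λ x → just (walk x , just (ann (cellX p)) , S , nothing)) eqm) r) , h
      where
      hd : pat (suc p) ((c , just q) ∷ O₃) ≡ ls ∷ proj₁ (red-head (sP (suc p) (c , just q)) (map (sP (suc p)) O₃))
      hd = trans (proj₂ (red-head (sP (suc p) (c , just q)) (map (sP (suc p)) O₃))) (cong (_∷ proj₁ (red-head (sP (suc p) (c , just q)) (map (sP (suc p)) O₃))) (sP-lt l))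
      s = pat (suc p) ((c , just q) ∷ O₃)
      eqm : toBL NB (match ownL (fromBL NB (cellX p)) (fromBL NB (toBL NB (red (map ownR s))))) ≡ toBL NB (pat p ((c , just q) ∷ O₃))
      eqm = cong (toBL NB) (trans (cong₂ (match ownL) (fromPat [] (OL w) p refl) (from-toBL-≤ NB _ (≤-trans (cut-≤ ownR ownR-keeps s) (suffix-≤ O₁ _ (suc p) e))))
              (trans (cong (λ u → match ownL (pat p u) (red (map ownR s))) (sym e)) (arriveL p O₁ c q O₃ l la)))

    lastOf : ∀ {P : ℕ → Set} O₁ (x : Λ) → (∀ q → proj₂ x ≡ just q → P q) →
             O₁ ++ x ∷ [] ≡ [] ⊎ Σ (List Λ) λ O₁' → Σ Λ λ y → O₁ ++ x ∷ [] ≡ O₁' ++ y ∷ [] × (∀ q → proj₂ y ≡ just q → P q)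
    lastOf O₁ x h = inj₂ (O₁ , x , refl , h)

    lastL-suc : ∀ {p O₁} → LastL p O₁ → LastL (suc p) O₁
    lastL-suc (inj₁ e) = inj₁ e
    lastL-suc (inj₂ (a , x , e , h)) = inj₂ (a , x , e , λ q e → ≤-trans (h q e) (n≤1+n _))

    lastR-pred : ∀ {p O₁} → LastR (suc p) O₁ → LastR p O₁
    lastR-pred (inj₁ e) = inj₁ e
    lastR-pred (inj₂ (a , x , e , h)) = inj₂ (a , x , e , λ q e → ≤-trans (n≤1+n _) (h q e))

    -- The distance to the next letter is travelled cell by cell. A move takes two steps, one to the
    -- neighbour and one to find the place in its pattern, and lowers the potential by at least 1;
    -- hence the factor 2.
    goW : ∀ O₂ O₁ p j → p + j ≡ m → O₁ ++ O₂ ≡ OL w → All Good O₂ → LastL p O₁ → LastR p O₁ →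
          Out (walk (toBL NB (pat p O₂)) , at p j) (2 * Ψ p O₂) (map proj₁ O₂)
    here-emit : ∀ O₃ O₁ c p j → p + j ≡ m → O₁ ++ (c , just p) ∷ O₃ ≡ OL w → All Good O₃ →
          Out (walk (toBL NB (pat p ((c , just p) ∷ O₃))) , at p j) (2 * Ψ p ((c , just p) ∷ O₃)) (c ∷ map proj₁ O₃)
    travR : ∀ O₃ d O₁ c q p j → p + j ≡ m → q ≡ p + d → q < m → O₁ ++ (c , just q) ∷ O₃ ≡ OL w → All Good O₃ → LastL p O₁ →
          Out (walk (toBL NB (pat p ((c , just q) ∷ O₃))) , at p j) (2 * Ψ p ((c , just q) ∷ O₃)) (c ∷ map proj₁ O₃)
    travL : ∀ O₃ d O₁ c q p j → p + j ≡ m → p ≡ q + d → O₁ ++ (c , just q) ∷ O₃ ≡ OL w → All Good O₃ → LastR p O₁ →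
          Out (walk (toBL NB (pat p ((c , just q) ∷ O₃))) , at p j) (2 * Ψ p ((c , just q) ∷ O₃)) (c ∷ map proj₁ O₃)

    goW [] O₁ p j pj e g la ra = 0 , _ , z≤n , stop , halt-eq (fromPat O₁ [] p e)
      where
      halt-eq : fromBL NB (toBL NB []) ≡ [] → δW (walk (toBL NB [])) (just (ann (cellX p))) ≡ nothing
      halt-eq f = cong (λ s → dispatch s (just (ann (cellX p)))) f
    goW ((c , nothing) ∷ O₃) O₁ p j pj e (g ∷ gs) la ra =
      weaken (≤-trans (n≤1+n _) (two (emitV-pot fz p c O₃ m)))
        (emit-step p c _ O₃ (fromPat O₁ _ p e) (inj₂ (push-vs c (pat p O₃))) j
          (goW O₃ (O₁ ++ (c , nothing) ∷ []) p j pj (trans (++-assoc O₁ _ O₃) e) gs (lastOf O₁ _ (λ _ ())) (lastOf O₁ _ (λ _ ()))))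
    goW ((c , just q) ∷ O₃) O₁ p j pj e (g ∷ gs) la ra with ≤-total p q
    ... | inj₁ l = travR O₃ (q ∸ p) O₁ c q p j pj (sym (m+[n∸m]≡n l)) (g q refl) e gs la
    ... | inj₂ l = travL O₃ (p ∸ q) O₁ c q p j pj (sym (m+[n∸m]≡n l)) e gs ra

    here-emit O₃ O₁ c p j pj e gs =
      weaken (≤-trans (n≤1+n _) (two (emit-pot fz p c O₃ m (≤-trans (m≤m+n p j) (≤-reflexive pj)))))
        (emit-step p c _ O₃ (fromPat O₁ _ p e) (inj₁ (trans (cong (λ x → push x (pat p O₃)) (sP-eq {p} {c})) (push-own c (pat p O₃)))) j
          (goW O₃ (O₁ ++ (c , just p) ∷ []) p j pj (trans (++-assoc O₁ _ O₃) e) gs (lastOf O₁ _ (λ { q refl → ≤-refl })) (lastOf O₁ _ (λ { q refl → ≤-refl }))))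

    travR O₃ zero O₁ c q p j pj qe qm e gs la with trans qe (+-identityʳ p)
    ... | refl = here-emit O₃ O₁ c p j pj e gs
    travR O₃ (suc d) O₁ c q p zero pj qe qm e gs la = ⊥-elim (<⇒≱ qm (≤-trans (≤-reflexive (trans (sym pj) (+-identityʳ p))) (≤-trans (m≤m+n p (suc d)) (≤-reflexive (sym qe)))))
    travR O₃ (suc d) O₁ c q p (suc j) pj qe qm e gs la =
      weaken (two (moveR-pot fz p c q O₃ m p<q (≤-trans (m≤m+n p (suc j)) (≤-reflexive pj))))
        (moveR-step O₁ c q O₃ p j e p<q la
          (travR O₃ d O₁ c q (suc p) j (trans (sym (+-suc p j)) pj) (trans qe (+-suc p d)) qm e gs (lastL-suc la)))
      where
      p<q : p < q
      p<q = ≤-trans (≤-trans (s≤s (m≤m+n p d)) (≤-reflexive (sym (+-suc p d)))) (≤-reflexive (sym qe))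

    travL O₃ zero O₁ c q p j pj pe e gs ra with trans pe (+-identityʳ q)
    ... | refl = here-emit O₃ O₁ c p j pj e gs
    travL O₃ (suc d) O₁ c q p j pj pe e gs ra with trans pe (+-suc q d)
    ... | refl =
      weaken (two (moveL-pot fz (q + d) c q O₃ m (s≤s (m≤m+n q d)) (≤-trans (m≤m+n _ j) (≤-reflexive pj))))
        (moveL-step O₁ c q O₃ (q + d) j e (s≤s (m≤m+n q d)) ra
          (travL O₃ d O₁ c q (q + d) (suc j) (trans (+-suc (q + d) j) pj) refl e gs (lastR-pred ra)))

    runM : MSt → Word a₃ → MSt
    runM = foldl δM

    stR : Word (suc nΓ) → MSt
    stR [] = init₀
    stR (c ∷ rw) = δM (stR rw) (mk c cl)

    lmid : Word (suc nΓ) → List (Maybe Sym)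
    lmid [] = []
    lmid (c ∷ rw) = just (mid c (stR rw)) ∷ lmid rw

    sufT : List (Maybe Sym) → Word (suc nΓ) → WTape Sym
    sufT l [] = wt l nothing []
    sufT l (c ∷ v) = wt l (just (raw c)) (map just (map raw v))

    sufT-move : ∀ l x v → moveW R (wt l x (map just (map raw v))) ≡ sufT (x ∷ l) v
    sufT-move l x [] = refl
    sufT-move l x (_ ∷ v) = refl

    fwd-run : ∀ v rw → Runs (fwd (stR rw) , sufT (lmid rw) v) (length v) [] (fwd (stR (v ʳ++ rw)) , wt (lmid (v ʳ++ rw)) nothing [])
    fwd-run [] rw = stop
    fwd-run (c ∷ v) rw = step {o = nothing} refl (subst (λ T → Runs (fwd (stR (c ∷ rw)) , T) (length v) [] (fwd (stR (v ʳ++ c ∷ rw)) , wt (lmid (v ʳ++ c ∷ rw)) nothing [])) (sym (sufT-move (lmid rw) (just (mid c (stR rw))) v)) (fwd-run v (c ∷ rw)))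

    TabOk : Tab → Word (suc nΓ) → Set
    TabOk b v = ∀ s → look₀ b s ≡ outM (runM s (map (λ c → mk c cr) v))

    stR-run : ∀ rw → runM init₀ (map (λ c → mk c cl) (reverse rw)) ≡ stR rw
    stR-run [] = refl
    stR-run (c ∷ rw) = trans (cong (runM init₀ ∘ map _) (unfold-reverse c rw)) (trans (cong (runM init₀) (map-++ _ (reverse rw) (c ∷ [])))
       (trans (foldl-++ δM init₀ (map _ (reverse rw)) _) (cong (λ s → δM s (mk c cl)) (stR-run rw))))

    decAt-app : ∀ u c v → decAt (length u) (u ++ c ∷ v) ≡ map (λ c → mk c cl) u ++ mk c cc ∷ map (λ c → mk c cr) v
    decAt-app [] c v = refl
    decAt-app (x ∷ u) c v = cong (mk x cl ∷_) (decAt-app u c v)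

    decAt-end : ∀ u → decAt (length u) u ≡ map (λ c → mk c cl) u
    decAt-end [] = refl
    decAt-end (x ∷ u) = cong (mk x cl ∷_) (decAt-end u)

    ann-ok : ∀ b c rw v → reverse rw ++ c ∷ v ≡ w → TabOk b v → look₀ b (δM (stR rw) (mk c cc)) ≡ cellX (length rw)
    ann-ok b c rw v e ok = trans (ok _) (trans (cong outM eqs) (mach-ok w (length rw)))
      where
      eqs : runM (δM (stR rw) (mk c cc)) (map (λ c → mk c cr) v) ≡ foldl δM init₀ (decAt (length rw) w)
      eqs = trans (cong (λ s → runM (δM s (mk c cc)) (map (λ c → mk c cr) v)) (sym (stR-run rw))) (trans (sym (foldl-++ δM init₀ (map (λ c → mk c cl) (reverse rw)) (mk c cc ∷ map (λ c → mk c cr) v)))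
         (cong (foldl δM init₀) (trans (sym (decAt-app (reverse rw) c v)) (cong₂ decAt (length-reverse rw) e))))

    bwd-run : ∀ rw v b j → reverse rw ++ v ≡ w → TabOk b v →
              Runs (bwd b , moveW L (wt (lmid rw) (just (ann (cellX (length rw)))) (rgt (length rw) j))) (suc (length rw)) [] (start , at 0 (length rw + j))
    bwd-run [] v b j e ok = step {o = nothing} refl stop
    bwd-run (c ∷ rw) v b j e ok = step {o = nothing} (cong (λ x → just (bwd (tabOf (λ s → look₀ b (δM s (mk c cr)))) , just (ann x) , L , nothing)) (ann-ok b c rw v e' ok))
        (subst (λ k → Runs (bwd (tabOf (λ s → look₀ b (δM s (mk c cr)))) , moveW L (wt (lmid rw) (just (ann (cellX (length rw)))) (rgt (length rw) (suc j)))) (suc (length rw)) [] (start , at 0 k)) (+-suc (length rw) j)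
          (bwd-run rw (c ∷ v) _ (suc j) e' (λ s → trans (look-tab _ s) (ok _))))
      where
      e' : reverse rw ++ c ∷ v ≡ w
      e' = trans (sym (trans (cong (_++ v) (unfold-reverse c rw)) (++-assoc (reverse rw) (c ∷ []) v))) e

    total : Σ ℕ λ t → Σ Cfg λ c → t ≤ (m + (suc (suc m))) + suc (2 * (suc m * suc NB)) × Runs (fwd init₀ , inTape (map raw w)) t (f w) c × Halt c
    total with goW (OL w) [] 0 m refl refl (OL-< w) (inj₁ refl) (inj₁ refl)
    ... | t , d , l , r , h = (m + suc (suc m)) + suc t , d , +-monoʳ-≤ (m + suc (suc m)) (s≤s (≤-trans l (*-monoʳ-≤ 2 (Σ≤-const m (suc NB) (λ r → ≤-trans (push-≤ (sP r (fz , just 0)) (pat r (OL w))) (s≤s (bound w r))))))) ,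
        subst (λ u → Runs (fwd init₀ , inTape (map raw w)) ((m + suc (suc m)) + suc t) u d) (OL-f w) (run-all then step {o = nothing} refl r) , h
      where
      rw = w ʳ++ []
      rw-len : length rw ≡ m
      rw-len = length-reverse w
      P-ok : outM (stR rw) ≡ cellX (length rw)
      P-ok = trans (cong outM (trans (sym (stR-run rw)) (cong (foldl δM init₀) (trans (sym (decAt-end (reverse rw))) (cong₂ decAt (length-reverse rw) (reverse-involutive w)))))) (mach-ok w (length rw))
      inT : inTape (map raw w) ≡ sufT [] w
      inT = go w
        where
        go : ∀ w → inTape (map raw w) ≡ sufT [] w
        go [] = refl
        go (c ∷ w) = refl
      bw : Runs (bwd (tabOf outM) , moveW L (wt (lmid rw) (just (ann (outM (stR rw)))) [])) (suc m) [] (start , at 0 m)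
      bw rewrite P-ok = subst₂ (λ a b → Runs (bwd (tabOf outM) , moveW L (wt (lmid rw) (just (ann (cellX (length rw)))) [])) (suc a) [] (start , at 0 b)) rw-len (trans (+-identityʳ _) rw-len)
           (bwd-run rw [] (tabOf outM) 0 (trans (++-identityʳ _) (reverse-involutive w)) (look-tab outM))
      run-all : Runs (fwd init₀ , inTape (map raw w)) (m + (suc (suc m))) [] (start , at 0 m)
      run-all rewrite inT = fwd-run w [] then step {o = nothing} refl bw

  linear : LinearTime (suc nΓ) (suc nΣ) f
  linear = tm , a , λ w → let (t , l , h) = compile f T (λ w → total w) w in t , ≤-trans l (fit (length w)) , h
    where
    open Compile wm
    T : ℕ → ℕ
    T n = (n + suc (suc n)) + suc (2 * (suc n * suc NB))
    -- With k = NB + 1 the total is (4 + 4k) n + (9 + 4k). The slack 9 n + 4 makes both coefficients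
    -- equal to 13 + 4k.
    a = 13 + 4 * suc NB
    fit : ∀ n → 2 * T n + 3 ≤ a * n + a
    fit n = ≤-trans (m≤m+n _ (9 * n + 4)) (≤-reflexive (lem n (suc NB)))
      where
      open +-*-Solver
      lem : ∀ n k → (2 * ((n + (2 + n)) + (1 + 2 * ((1 + n) * k))) + 3) + (9 * n + 4) ≡ (13 + 4 * k) * n + (13 + 4 * k)
      lem = solve 2 (λ n k → (con 2 :* ((n :+ (con 2 :+ n)) :+ (con 1 :+ con 2 :* ((con 1 :+ n) :* k))) :+ con 3) :+ (con 9 :* n :+ con 4) := (con 13 :+ con 4 :* k) :* n :+ (con 13 :+ con 4 :* k)) refl

-- Polynomial time: search for the next letter with an odometer

-- em c e e' : an output letter c whose path agrees with the first (e) or the second (e') mark; zz : a block of other letters.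
data Ps (F : Set) : Set where
  zz : Ps F
  em : F → Bool → Bool → Ps F

module _ {m : ℕ} where
  _≟ᵖ_ : (x y : Ps (Fin m)) → Dec (x ≡ y)
  zz ≟ᵖ zz = yes refl
  zz ≟ᵖ em _ _ _ = no λ ()
  em _ _ _ ≟ᵖ zz = no λ ()
  em a b c ≟ᵖ em a' b' c' with a Fin.≟ a' | b Bool.≟ b' | c Bool.≟ c'
  ... | yes refl | yes refl | yes refl = yes refl
  ... | no n | _ | _ = no λ { refl → n refl }
  ... | _ | no n | _ = no λ { refl → n refl }
  ... | _ | _ | no n = no λ { refl → n refl }

  merP : Ps (Fin m) → Bool
  merP zz = true
  merP _ = false

  module RP = Red _≟ᵖ_ merP

  fin-Ps : Fin m → Finite (Ps (Fin m))
  fin-Ps d = fin-retract {B = Bool × Fin m × Bool × Bool} (λ { zz → false , d , false , false ; (em a b c) → true , a , b , c })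
    (λ { (false , _) → zz ; (true , a , b , c) → em a b c }) (λ { zz → refl ; (em _ _ _) → refl })
    (fin-× fin-Bool (fin-× (fin-Fin m) (fin-× fin-Bool fin-Bool)))

  ems : List (Ps (Fin m)) → ℕ
  ems [] = 0
  ems (zz ∷ u) = ems u
  ems (em _ _ _ ∷ u) = suc (ems u)

  open RP.Count zz refl

  others-ems : ∀ u → others (RP.red u) ≤ ems u
  others-ems [] = z≤n
  others-ems (x ∷ u) with RP.merges? x (RP.red u)
  others-ems (zz ∷ u) | yes _ = others-ems u
  others-ems (em _ _ _ ∷ u) | yes (() , _)
  others-ems (zz ∷ u) | no _ = others-ems u
  others-ems (em _ _ _ ∷ u) | no _ = s≤s (others-ems u)

  red-ems : ∀ u → length (RP.red u) ≤ 2 * ems u + 1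
  red-ems u = ≤-trans (proj₁ (red-count u)) (+-monoˡ-≤ 1 (*-monoʳ-≤ 2 (others-ems u)))

Mark : ℕ → Set
Mark ℓ = Vec ℕ ℓ

digit : ∀ {ℓ} → Mark ℓ → ℕ → ℕ → Bool
digit [] i q = false
digit (d ∷ ds) zero q = d ≡ᵇ q
digit (d ∷ ds) (suc i) q = digit ds i q

-- marks list the outermost position first, paths the innermost one
mt : ∀ {ℓ} → Mark ℓ → List ℕ → Bool
mt v [] = true
mt v (q ∷ ps) = mt v ps ∧ digit v (length ps) q

bitsAt : ∀ {ℓ} → Mark ℓ → ℕ → Vec Bool ℓ
bitsAt v p = Vec.map (_≡ᵇ p) v

bit : ∀ {ℓ} → Vec Bool ℓ → ℕ → Bool
bit [] i = false
bit (b ∷ bs) zero = b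
bit (b ∷ bs) (suc i) = bit bs i

bit-bitsAt : ∀ {ℓ} (v : Mark ℓ) i p → bit (bitsAt v p) i ≡ digit v i p
bit-bitsAt [] i p = refl
bit-bitsAt (d ∷ v) zero p = refl
bit-bitsAt (d ∷ v) (suc i) p = bit-bitsAt v i p

digit-uniq : ∀ {ℓ} (v : Mark ℓ) i q q' → digit v i q ≡ true → digit v i q' ≡ true → q ≡ q'
digit-uniq (d ∷ v) zero q q' e e' = trans (sym (≡ᵇ⇒≡ d q (subst Bool.T (sym e) tt))) (≡ᵇ⇒≡ d q' (subst Bool.T (sym e') tt))
digit-uniq (d ∷ v) (suc i) q q' e e' = digit-uniq v i q q' e e'

∧-l : ∀ {x y} → x ∧ y ≡ true → x ≡ true
∧-l {true} e = refl
∧-r : ∀ {x y} → x ∧ y ≡ true → y ≡ true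
∧-r {true} e = e

-- The first mark is that of the last letter written, the second a candidate for the next one. The
-- pattern with both shows where the former ends and whether the latter comes directly after it.
symPs : ∀ {F : Set} {ℓ} → Mark ℓ → Mark ℓ → F × List ℕ → Ps F
symPs v v' (c , ps) = if mt v ps ∨ mt v' ps then em c (mt v ps) (mt v' ps) else zz

Cl : ℕ → ℕ → Set
Cl n ℓ = Fin (suc n) × Vec Bool ℓ × Vec Bool ℓ

finCl : ∀ n ℓ → Finite (Cl n ℓ)
finCl n ℓ = fin-× (fin-Fin _) (fin-× (fin-Vec fin-Bool ℓ) (fin-Vec fin-Bool ℓ))

renderFrom : ∀ {n ℓ} → ℕ → Word (suc n) → Mark ℓ → Mark ℓ → List (Cl n ℓ)
renderFrom k [] v v' = []
renderFrom k (c ∷ w) v v' = (c , bitsAt v k , bitsAt v' k) ∷ renderFrom (suc k) w v v'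

render : ∀ {n ℓ} → Word (suc n) → Mark ℓ → Mark ℓ → List (Cl n ℓ)
render = renderFrom 0

record PolySpec (nΓ nΣ : ℕ) (f : Word (suc nΓ) → Word (suc nΣ)) : Set₁ where
  F : Set
  F = Fin (suc nΣ)
  field
    ℓ     : ℕ
    O     : Word (suc nΓ) → List (F × List ℕ)
    O-f   : ∀ w → map proj₁ (O w) ≡ f w
    O-lab : ∀ w → All (λ l → length (proj₂ l) ≤ ℓ × All (_< length w) (proj₂ l)) (O w)
    bO    : ℕ
    O-len : ∀ w → length (O w) ≤ bO * suc (length w) ^ ℓ
    NB    : ℕ
    bound : ∀ w v v' → length (RP.red (map (symPs {ℓ = ℓ} v v') (O w))) ≤ NB
    mach  : Moore (Finite.size (finCl nΓ ℓ)) (BL (Ps F) NB)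
    mach-ok : ∀ w v v' → Moore.out mach (foldl (Moore.step mach) (Moore.init mach) (map (Finite.code (finCl nΓ ℓ)) (render w v v')))
                         ≡ toBL NB (RP.red (map (symPs {ℓ = ℓ} v v') (O w)))

module _ {nΓ nΣ ℓ : ℕ} {f : Word (suc nΓ) → Word (suc nΣ)} (K : Core nΓ nΣ ℓ f) where
  open Labels K
  open Core K
  open CoreOut K using (F; Λ; O; O-f; module ValReg)
  open Finite (finCl nΓ ℓ)

  lettP : Fin size → Fin (suc nΓ)
  lettP x = proj₁ (decode x)

  FlP : Set
  FlP = ℕ × Bool × Bool

  fstepP : FlP → Fin size → FlP
  fstepP (i , e , e') x = suc i , (e ∧ bit (proj₁ (proj₂ (decode x))) i) , (e' ∧ bit (proj₂ (proj₂ (decode x))) i)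

  fl₀P : FlP
  fl₀P = 0 , true , true

  symFl : F → FlP → Ps F
  symFl c (_ , e , e') = if e ∨ e' then em c e e' else zz

  codeR : Word (suc nΓ) → Mark ℓ → Mark ℓ → Word size
  codeR w v v' = map code (render w v v')

  lett-render : ∀ k w (v v' : Mark ℓ) → map lettP (map code (renderFrom k w v v')) ≡ w
  lett-render k [] v v' = refl
  lett-render k (c ∷ w) v v' = cong₂ _∷_ (cong proj₁ (decode-code _)) (lett-render (suc k) w v v')

  look-render : ∀ k w (v v' : Mark ℓ) q → q < length w → Σ (Fin (suc nΓ)) λ c → look (map code (renderFrom k w v v')) q ≡ just (code (c , bitsAt v (k + q) , bitsAt v' (k + q)))
  look-render k (c ∷ w) v v' zero l = c , cong (λ k → just (code (c , bitsAt v k , bitsAt v' k))) (sym (+-identityʳ k))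
  look-render k (c ∷ w) v v' (suc q) (s≤s l) with look-render (suc k) w v v' q l
  ... | c' , e = c' , trans e (cong (λ k → just (code (c' , bitsAt v k , bitsAt v' k))) (sym (+-suc k q)))

  flagP : ∀ w v v' ps → All (_< length w) ps → flagOf fl₀P fstepP (codeR w v v') ps ≡ (length ps , mt v ps , mt v' ps)
  flagP w v v' [] [] = refl
  flagP w v v' (q ∷ ps) (l ∷ as) with look-render 0 w v v' q l
  ... | c , e = trans (cong₂ (stepM fstepP) (flagP w v v' ps as) e)
    (trans (cong (λ y → suc (length ps) , (mt v ps ∧ bit (proj₁ (proj₂ y)) (length ps)) , (mt v' ps ∧ bit (proj₂ (proj₂ y)) (length ps))) (decode-code (c , bitsAt v q , bitsAt v' q)))
      (cong₂ (λ x y → suc (length ps) , (mt v ps ∧ x) , (mt v' ps ∧ y)) (bit-bitsAt v (length ps) q) (bit-bitsAt v' (length ps) q)))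

  ems-≤ : ∀ (v v' : Mark ℓ) u → ems (map (symPs v v') u) ≤ sum (map (λ (c , ps) → if mt v ps then 1 else 0) u) + sum (map (λ ((c , ps) : Λ) → if mt v' ps then 1 else 0) u)
  ems-≤ v v' [] = z≤n
  ems-≤ v v' ((c , ps) ∷ u) with mt v ps | mt v' ps
  ... | false | false = ems-≤ v v' u
  ... | true | false = s≤s (ems-≤ v v' u)
  ... | false | true = ≤-trans (s≤s (ems-≤ v v' u)) (≤-reflexive (sym (+-suc _ _)))
  ... | true | true = s≤s (≤-trans (ems-≤ v v' u) (+-monoʳ-≤ _ (n≤1+n _)))

  few-mt : ∀ w (v : Mark ℓ) → sum (map (λ ((c , ps) : Λ) → if mt v ps then 1 else 0) (O w)) ≤ bndB body
  few-mt w v = few-O w (mt v) (λ q ps e → ∧-l e) (λ q q' ps e e' → digit-uniq v (length ps) q q' (∧-r {mt v ps} e) (∧-r {mt v ps} e'))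

  -- A mark agrees with one position at each depth, so with at most `bndB body` letters; two marks
  -- are in play, and blocks of other letters alternate with these.
  NBP : ℕ
  NBP = 2 * (bndB body + bndB body) + 1

  boundP : ∀ w v v' → length (RP.red (map (symPs {F} {ℓ} v v') (O w))) ≤ NBP
  boundP w v v' = ≤-trans (red-ems (map (symPs v v') (O w))) (+-monoˡ-≤ 1 (*-monoʳ-≤ 2 (≤-trans (ems-≤ v v' (O w)) (+-mono-≤ (few-mt w v) (few-mt w v')))))

  polySpec : PolySpec nΓ nΣ f
  polySpec = record { ℓ = ℓ ; O = O ; O-f = O-f ; O-lab = labels ; bO = bndB body ; O-len = length-O ; NB = NBP ; bound = boundP
                    ; mach = proj₁ M ; mach-ok = λ w v v' → trans (proj₂ M (codeR w v v')) (val-eq w v v') }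
    where
    gX : F → FlP → BL (Ps F) NBP → BL (Ps F) NBP
    gX c fl x = toBL NBP (RP.push (symFl c fl) (fromBL NBP x))
    module VR = ValReg lettP fl₀P fstepP (fin-BL (fin-Ps fz) NBP) (toBL NBP []) gX
    M = moore VR.val (fin-BL (fin-Ps fz) NBP) (toBL NBP []) VR.val-reg
    val-eq : ∀ w v v' → VR.val (codeR w v v') ≡ toBL NBP (RP.red (map (symPs v v') (O w)))
    val-eq w v v' = trans (cong (λ u → foldr g (toBL NBP []) (O u)) (lett-render 0 w v v')) (go [] (O w) refl (labels w))
      where
      g = λ (l : Λ) → gX (proj₁ l) (flagOf fl₀P fstepP (codeR w v v') (proj₂ l))
      go : ∀ u₁ u → u₁ ++ u ≡ O w → All (GoodL (length w)) u → foldr g (toBL NBP []) u ≡ toBL NBP (RP.red (map (symPs v v') u))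
      go u₁ [] e a = refl
      go u₁ ((c , ps) ∷ u) e ((_ , lp) ∷ a) = cong₂ (λ fl s → toBL NBP (RP.push (symFl c fl) s)) (flagP w v v' ps lp)
         (trans (cong (fromBL NBP) (go (u₁ ++ (c , ps) ∷ []) u e' a)) (from-toBL-≤ NBP _ short))
        where
        e' : (u₁ ++ (c , ps) ∷ []) ++ u ≡ O w
        e' = trans (++-assoc u₁ _ u) e
        short : length (RP.red (map (symPs v v') u)) ≤ NBP
        short = ≤-trans (≤-trans (RP.redOn-len (RP.red (map (symPs v v') u)) (map (symPs v v') (u₁ ++ (c , ps) ∷ [])))
           (≤-reflexive (cong length (trans (sym (foldr-++ RP.push [] (map (symPs v v') (u₁ ++ (c , ps) ∷ [])) (map (symPs v v') u)))
              (cong RP.red (trans (sym (map-++ _ (u₁ ++ (c , ps) ∷ []) u)) (cong (map (symPs v v')) e'))))))) (boundP w v v')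

≡ᵇ-refl : ∀ n → (n ≡ᵇ n) ≡ true
≡ᵇ-refl zero = refl
≡ᵇ-refl (suc n) = ≡ᵇ-refl n

≡ᵇ-≢ : ∀ a b → ¬ a ≡ b → (a ≡ᵇ b) ≡ false
≡ᵇ-≢ zero zero n = ⊥-elim (n refl)
≡ᵇ-≢ zero (suc b) n = refl
≡ᵇ-≢ (suc a) zero n = refl
≡ᵇ-≢ (suc a) (suc b) n = ≡ᵇ-≢ a b (n ∘ cong suc)

-- Applied to the bits of cell 0, this finds the digits that move: those for which all faster digits
-- are 0.
mvs : ∀ {ℓ} → Bool → Vec Bool ℓ → Vec Bool ℓ
mvs b [] = []
mvs b (z ∷ zs) = b ∷ mvs (b ∧ z) zs

sel : ∀ {ℓ} → Vec Bool ℓ → Vec Bool ℓ → Vec Bool ℓ → Vec Bool ℓ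
sel [] [] [] = []
sel (m ∷ ms) (c ∷ bs) (o ∷ os) = (if m then c else o) ∷ sel ms bs os

-- The odometer: digits below n, the first one moves fastest, every step decreases it.

module Odo (n : ℕ) where
  dec : ℕ → ℕ
  dec zero = n ∸ 1
  dec (suc d) = d

  nextV : ∀ {ℓ} → Bool → Mark ℓ → Mark ℓ
  nextV b [] = []
  nextV b (d ∷ ds) = (if b then dec d else d) ∷ nextV (b ∧ (d ≡ᵇ 0)) ds

  next : ∀ {ℓ} → Mark ℓ → Mark ℓ
  next = nextV true

  top : ∀ ℓ → Mark ℓ
  top ℓ = Vec.replicate ℓ (n ∸ 1)

  data Dig : ∀ {ℓ} → Mark ℓ → Set where
    []  : Dig []
    _∷_ : ∀ {ℓ d} {ds : Mark ℓ} → d < n → Dig ds → Dig (d ∷ ds)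

  dig-top : ∀ ℓ → 0 < n → Dig (top ℓ)
  dig-top zero p = []
  dig-top (suc ℓ) p = ∸-monoʳ-< {n} {1} {0} (s≤s z≤n) p ∷ dig-top ℓ p

  dig-next : ∀ {ℓ} b {v : Mark ℓ} → Dig v → Dig (nextV b v)
  dig-next b [] = []
  dig-next true {zero ∷ _} (p ∷ ps) = ∸-monoʳ-< {n} {1} {0} (s≤s z≤n) p ∷ dig-next true ps
  dig-next true {suc d ∷ _} (p ∷ ps) = ≤-trans (n≤1+n _) p ∷ dig-next false ps
  dig-next false {d ∷ _} (p ∷ ps) = p ∷ dig-next false ps

  nextV-false : ∀ {ℓ} (v : Mark ℓ) → nextV false v ≡ v
  nextV-false [] = refl
  nextV-false (d ∷ ds) = cong (d ∷_) (nextV-false ds)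

  it : ∀ {ℓ} → ℕ → Mark ℓ → Mark ℓ
  it zero v = v
  it (suc k) v = it k (next v)

  it-+ : ∀ {ℓ} a b (v : Mark ℓ) → it (a + b) v ≡ it b (it a v)
  it-+ zero b v = refl
  it-+ (suc a) b v = it-+ a b (next v)

  it-down : ∀ {ℓ} a t (ds : Mark ℓ) → it a (a + t ∷ ds) ≡ t ∷ ds
  it-down zero t ds = refl
  it-down (suc a) t ds = trans (cong (it a) (cong (a + t ∷_) (nextV-false ds))) (it-down a t ds)

  module _ (n' : ℕ) (en : n ≡ suc n') where
    it-n : ∀ {ℓ} (ds : Mark ℓ) → it n (n ∸ 1 ∷ ds) ≡ n ∸ 1 ∷ next ds
    it-n ds = trans (cong (λ k → it k (n ∸ 1 ∷ ds)) (trans en (+-comm 1 n'))) (trans (it-+ n' 1 (n ∸ 1 ∷ ds))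
       (cong next (trans (cong (λ k → it n' (k ∷ ds)) (trans (cong (_∸ 1) en) (sym (+-identityʳ n')))) (it-down n' 0 ds))))

    it-nk : ∀ {ℓ} k (ds : Mark ℓ) → it (k * n) (n ∸ 1 ∷ ds) ≡ n ∸ 1 ∷ it k ds
    it-nk zero ds = refl
    it-nk (suc k) ds = trans (it-+ n (k * n) (n ∸ 1 ∷ ds)) (trans (cong (it (k * n)) (it-n ds)) (it-nk k (next ds)))

    -- The slower digits first make k full moves, each worth n steps of the fastest one, which is
    -- then back at n - 1 and goes down to its target.
    reach : ∀ {ℓ} (τ : Mark ℓ) → Dig τ → Σ ℕ λ k → suc k ≤ n ^ ℓ × it k (top ℓ) ≡ τ
    reach [] [] = 0 , ≤-refl , refl
    reach {suc ℓ} (t ∷ τ) (p ∷ ps) with reach τ ps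
    ... | k , kl , e = k * n + (n' ∸ t) , le , trans (it-+ (k * n) (n' ∸ t) _) (trans (cong (it (n' ∸ t)) (it-nk k (top ℓ)))
            (trans (cong (λ x → it (n' ∸ t) (x ∷ it k (top ℓ))) (trans (cong (_∸ 1) en) (sym (m∸n+n≡m t≤)))) (trans (it-down (n' ∸ t) t _) (cong (t ∷_) e))))
      where
      t≤ : t ≤ n'
      t≤ = s≤s⁻¹ (≤-trans p (≤-reflexive en))
      le : suc (k * n + (n' ∸ t)) ≤ n * n ^ ℓ
      le = ≤-trans (≤-trans (≤-reflexive (sym (+-suc (k * n) (n' ∸ t)))) (+-monoʳ-≤ (k * n) (≤-trans (s≤s (m∸n≤m n' t)) (≤-reflexive (sym en)))))
           (≤-trans (≤-reflexive (trans (+-comm (k * n) n) (*-comm (suc k) n))) (*-monoʳ-≤ n kl))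

  Cyc : ℕ → ℕ → Set
  Cyc p r = (r ≡ suc p × suc p < n) ⊎ (r ≡ 0 × suc p ≡ n)

  dec-bit : ∀ {p r} d → Cyc p r → d < n → (d ≡ᵇ r) ≡ (dec d ≡ᵇ p)
  dec-bit {p} zero (inj₁ (refl , l)) dl = sym (≡ᵇ-≢ (n ∸ 1) p (λ e → <⇒≢ (≤-trans (≤-reflexive refl) (∸-monoˡ-≤ 1 l)) (sym e)))
  dec-bit {p} zero (inj₂ (refl , e)) dl = sym (trans (cong (λ k → k ∸ 1 ≡ᵇ p) (sym e)) (≡ᵇ-refl p))
  dec-bit (suc d) (inj₁ (refl , l)) dl = refl
  dec-bit {p} (suc d) (inj₂ (refl , e)) dl = sym (≡ᵇ-≢ d p (λ e' → <⇒≢ dl (trans (cong suc e') e)))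

  -- Decrementing a digit shifts its mark one cell to the left, cyclically. So the new bit of a
  -- moving digit is the old bit of the next cell, and the odometer can be advanced in one sweep
  -- over the tape.
  sel-next : ∀ {ℓ p r} b (v : Mark ℓ) → Cyc p r → Dig v → sel (mvs b (bitsAt v 0)) (bitsAt v r) (bitsAt v p) ≡ bitsAt (nextV b v) p
  sel-next b [] c [] = refl
  sel-next true (d ∷ v) c (p ∷ ps) = cong₂ _∷_ (dec-bit d c p) (sel-next (d ≡ᵇ 0) v c ps)
  sel-next false (d ∷ v) c (p ∷ ps) = cong₂ _∷_ refl (sel-next false v c ps)

  bits-rep : ∀ ℓ d p b → (d ≡ᵇ p) ≡ b → bitsAt (Vec.replicate ℓ d) p ≡ Vec.replicate ℓ b
  bits-rep zero d p b e = refl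
  bits-rep (suc ℓ) d p b e = cong₂ _∷_ e (bits-rep ℓ d p b e)

nthO : List ℕ → ℕ → ℕ
nthO [] i = 0
nthO (q ∷ ps) i = if i ≡ᵇ length ps then q else nthO ps i

marksFrom : (ℕ → ℕ) → ∀ ℓ → Mark ℓ
marksFrom f zero = []
marksFrom f (suc ℓ) = f 0 ∷ marksFrom (f ∘ suc) ℓ

digit-from : ∀ f ℓ i q → i < ℓ → digit (marksFrom f ℓ) i q ≡ (f i ≡ᵇ q)
digit-from f (suc ℓ) zero q l = refl
digit-from f (suc ℓ) (suc i) q (s≤s l) = digit-from (f ∘ suc) ℓ i q l

nthO-at : ∀ qs q ps → nthO (qs ++ q ∷ ps) (length ps) ≡ q
nthO-at [] q ps rewrite ≡ᵇ-refl (length ps) = refl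
nthO-at (x ∷ qs) q ps rewrite ≡ᵇ-≢ (length ps) (length (qs ++ q ∷ ps)) (λ e → <⇒≢ (≤-trans (m≤n+m _ (length qs)) (≤-reflexive (sym (length-++ qs)))) e) = nthO-at qs q ps

mt-from : ∀ ℓ ps₀ qs ps → ps₀ ≡ qs ++ ps → length ps₀ ≤ ℓ → mt (marksFrom (nthO ps₀) ℓ) ps ≡ true
mt-from ℓ ps₀ qs [] e l = refl
mt-from ℓ ps₀ qs (q ∷ ps) e l rewrite mt-from ℓ ps₀ (qs ++ q ∷ []) ps (trans e (sym (++-assoc qs (q ∷ []) ps))) l
  | digit-from (nthO ps₀) ℓ (length ps) q (≤-trans (≤-trans (m≤n+m _ (length qs)) (≤-reflexive (sym (trans (cong length e) (length-++ qs))))) l)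
  = trans (cong (_≡ᵇ q) (trans (cong (λ z → nthO z (length ps)) e) (nthO-at qs q ps))) (≡ᵇ-refl q)

dig-from : ∀ n f ℓ → (∀ i → f i < n) → Odo.Dig n (marksFrom f ℓ)
dig-from n f zero h = Odo.[]
dig-from n f (suc ℓ) h = h 0 Odo.∷ dig-from n (f ∘ suc) ℓ (h ∘ suc)

nthO-< : ∀ n ps → 0 < n → All (_< n) ps → ∀ i → nthO ps i < n
nthO-< n [] p a i = p
nthO-< n (q ∷ ps) p (l ∷ a) i with i ≡ᵇ length ps
... | true = l
... | false = nthO-< n ps p a i

module _ {m : ℕ} where
  isE : Ps (Fin m) → Bool
  isE zz = false
  isE (em _ e _) = e

  cntE cntE' : List (Ps (Fin m)) → ℕ
  cntE [] = 0
  cntE (x ∷ s) = (if isE x then 1 else 0) + cntE s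
  cntE' [] = 0
  cntE' (zz ∷ s) = cntE' s
  cntE' (em _ _ e ∷ s) = (if e then 1 else 0) + cntE' s

  -- Several letters may share the mark of the last one written. The right one is identified by the
  -- number of marked letters that follow it, a number bounded independently of the input.
  afterY : ℕ → List (Ps (Fin m)) → List (Ps (Fin m))
  afterY y [] = []
  afterY y (x ∷ s) = if isE x ∧ (cntE s ≡ᵇ y) then s else afterY y s

  marked : ∀ {ℓ} → Mark ℓ → List ((Fin m) × List ℕ) → ℕ
  marked v [] = 0
  marked v ((c , ps) ∷ u) = (if mt v ps then 1 else 0) + marked v u

  patP : ∀ {ℓ} → Mark ℓ → Mark ℓ → List ((Fin m) × List ℕ) → List (Ps (Fin m))
  patP v v' u = RP.red (map (symPs v v') u)

  pat-em : ∀ {ℓ} (v v' : Mark ℓ) c ps u → mt v ps ∨ mt v' ps ≡ true → patP v v' ((c , ps) ∷ u) ≡ em c (mt v ps) (mt v' ps) ∷ patP v v' u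
  pat-em v v' c ps u e = trans (cong (λ b → RP.push (if b then em c (mt v ps) (mt v' ps) else zz) (patP v v' u)) e) (RP.push-n {x = em c (mt v ps) (mt v' ps)} (λ { (() , _) }))

  cntE-pat : ∀ {ℓ} (v v' : Mark ℓ) u → cntE (patP v v' u) ≡ marked v u
  cntE-pat v v' [] = refl
  cntE-pat v v' ((c , ps) ∷ u) = go (mt v ps ∨ mt v' ps) refl
    where
    go : ∀ b → mt v ps ∨ mt v' ps ≡ b → cntE (patP v v' ((c , ps) ∷ u)) ≡ marked v ((c , ps) ∷ u)
    go true e = trans (cong cntE (pat-em v v' c ps u e)) (cong ((if mt v ps then 1 else 0) +_) (cntE-pat v v' u))
    go false e with mt v ps | mt v' ps
    ... | false | false with RP.merges? zz (patP v v' u)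
    ...   | yes _ = cntE-pat v v' u
    ...   | no _ = cntE-pat v v' u

  cntE'-pat : ∀ {ℓ} (v v' : Mark ℓ) u → cntE' (patP v v' u) ≡ marked v' u
  cntE'-pat v v' [] = refl
  cntE'-pat v v' ((c , ps) ∷ u) = go (mt v ps ∨ mt v' ps) refl
    where
    go : ∀ b → mt v ps ∨ mt v' ps ≡ b → cntE' (patP v v' ((c , ps) ∷ u)) ≡ marked v' ((c , ps) ∷ u)
    go true e = trans (cong cntE' (pat-em v v' c ps u e)) (cong ((if mt v' ps then 1 else 0) +_) (cntE'-pat v v' u))
    go false e with mt v ps | mt v' ps
    ... | false | false with RP.merges? zz (patP v v' u)
    ...   | yes _ = cntE'-pat v v' u
    ...   | no _ = cntE'-pat v v' u

  cntE-≤ : ∀ s → cntE s ≤ length s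
  cntE-≤ [] = z≤n
  cntE-≤ (x ∷ s) with isE x
  ... | true = s≤s (cntE-≤ s)
  ... | false = ≤-trans (cntE-≤ s) (n≤1+n _)

  cntE-++ : ∀ p s → cntE s ≤ cntE (p ++ s)
  cntE-++ [] s = ≤-refl
  cntE-++ (x ∷ p) s = ≤-trans (cntE-++ p s) (m≤n+m _ (if isE x then 1 else 0))

  afterY-ok : ∀ p c e s → afterY (cntE s) (p ++ em c true e ∷ s) ≡ s
  afterY-ok [] c e s rewrite ≡ᵇ-refl (cntE s) = refl
  afterY-ok (x ∷ p) c e s rewrite ≡ᵇ-≢ (cntE (p ++ em c true e ∷ s)) (cntE s) (λ q → <⇒≢ (cntE-++ p (em c true e ∷ s)) (sym q)) with isE x
  ... | true = afterY-ok p c e s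
  ... | false = afterY-ok p c e s

  pat-hit : ∀ {ℓ} (v v' : Mark ℓ) c ps u → mt v ps ≡ true → patP v v' ((c , ps) ∷ u) ≡ em c true (mt v' ps) ∷ patP v v' u
  pat-hit v v' c ps u e = trans (pat-em v v' c ps u (cong (_∨ mt v' ps) e)) (cong (λ b → em c b (mt v' ps) ∷ patP v v' u) e)

  pat-hit' : ∀ {ℓ} (v v' : Mark ℓ) c ps u → mt v' ps ≡ true → patP v v' ((c , ps) ∷ u) ≡ em c (mt v ps) true ∷ patP v v' u
  pat-hit' v v' c ps u e = trans (pat-em v v' c ps u (trans (cong (mt v ps ∨_) e) (∨-zeroʳ _))) (cong (λ b → em c (mt v ps) b ∷ patP v v' u) e)

  afterY-pat : ∀ {ℓ} (v v' : Mark ℓ) O₁ c ps u → mt v ps ≡ true → afterY (marked v u) (patP v v' ((O₁ ++ (c , ps) ∷ []) ++ u)) ≡ patP v v' u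
  afterY-pat v v' O₁ c ps u e = trans (cong₂ afterY (sym (cntE-pat v v' u)) eq) (afterY-ok (proj₁ pr) c (mt v' ps) (patP v v' u))
    where
    pr = RP.redOn-pre (em c true (mt v' ps) ∷ patP v v' u) (map (symPs v v') O₁)
    eq : patP v v' ((O₁ ++ (c , ps) ∷ []) ++ u) ≡ proj₁ pr ++ em c true (mt v' ps) ∷ patP v v' u
    eq = trans (cong (patP v v') (++-assoc O₁ ((c , ps) ∷ []) u)) (trans (cong RP.red (map-++ (symPs v v') O₁ ((c , ps) ∷ u)))
         (trans (foldr-++ RP.push [] (map (symPs v v') O₁) (map (symPs v v') ((c , ps) ∷ u)))
           (trans (cong (λ z → RP.redOn z (map (symPs v v') O₁)) (pat-hit v v' c ps u e)) (proj₂ pr))))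

  data Miss : List (Ps (Fin m)) → Set where
    mz : ∀ {s} → Miss (zz ∷ s)
    me : ∀ {c e s} → Miss (em c e false ∷ s)

  pat-miss : ∀ {ℓ} (v v' : Mark ℓ) c ps u → mt v' ps ≡ false → Miss (patP v v' ((c , ps) ∷ u))
  pat-miss v v' c ps u e' = go (mt v ps) refl
    where
    go : ∀ b → mt v ps ≡ b → Miss (patP v v' ((c , ps) ∷ u))
    go true e = subst Miss (sym (trans (pat-hit v v' c ps u e) (cong (λ b → em c true b ∷ patP v v' u) e'))) me
    go false e = subst Miss (sym (cong₂ (λ b b' → RP.push (if b ∨ b' then em c b b' else zz) (patP v v' u)) e e')) (zz-first (patP v v' u))
      where
      zz-first : ∀ s → Miss (RP.push zz s)
      zz-first s with RP.merges? zz s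
      ... | yes (_ , t , q) = subst Miss (sym q) mz
      ... | no _ = mz

clip : ∀ {N} → ℕ → Fin (suc N)
clip {zero} k = fz
clip {suc N} zero = fz
clip {suc N} (suc k) = fs (clip k)

toℕ-clip : ∀ {N} k → k ≤ N → toℕ (clip {N} k) ≡ k
toℕ-clip {zero} zero z≤n = refl
toℕ-clip {suc N} zero l = refl
toℕ-clip {suc N} (suc k) (s≤s l) = cong suc (toℕ-clip k l)

-- The bound uses n + 1 so that it also covers the empty word, where the only path is empty and any
-- mark agrees with it.
hit : ∀ n ℓ ps → length ps ≤ ℓ → All (_< n) ps → Σ ℕ λ k → suc k ≤ suc n ^ ℓ × mt (Odo.it n k (Odo.top n ℓ)) ps ≡ true
hit zero ℓ [] l a = 0 , m^n>0 1 ℓ , refl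
hit zero ℓ (_ ∷ _) l (() ∷ a)
hit (suc n) ℓ ps l a with Odo.reach (suc n) n refl (marksFrom (nthO ps) ℓ) (dig-from (suc n) (nthO ps) ℓ (nthO-< (suc n) ps (s≤s z≤n) a))
... | k , b , e = k , ≤-trans b (^-monoˡ-≤ ℓ (n≤1+n (suc n))) , trans (cong (λ v → mt v ps) e) (mt-from ℓ ps [] ps refl l)

module PolyMachine {nΓ nΣ : ℕ} {f : Word (suc nΓ) → Word (suc nΣ)} (Sp : PolySpec nΓ nΣ f) where
  open PolySpec Sp hiding (F)
  open Moore mach renaming (St to MSt; fin to finM; init to init₀; step to δM; out to outM)
  open Finite (finCl nΓ ℓ) using (code)

  G : Set
  G = Fin (suc nΣ)
  Cell' : Set
  Cell' = Cl nΓ ℓ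
  Bits : Set
  Bits = Vec Bool ℓ

  -- How many letters with the mark on the first track are still to come after the last one written;
  -- `nothing` before the first letter.
  Cur : Set
  Cur = Maybe (Fin (suc NB))

  -- The work of the returning head: `tk` copies the candidate to the first track and resets the
  -- second track to the top, its flag telling whether the cell is the last one; `adv` advances the
  -- odometer, carrying the digits that move and the old bits of the cell to the right, cyclically.
  data Op : Set where
    tk  : Bool → Op
    adv : Bits → Bits → Op

  data QS : Set where
    set : QS
    fwd : Cur → MSt → Maybe Bits → QS
    ret : Cur → Op → QS

  data Sym : Set where
    raw  : Fin (suc nΓ) → Sym
    cell : Cell' → Sym

  falses : Bits
  falses = Vec.replicate ℓ false

  fin-Op : Finite Op
  fin-Op = fin-retract {B = Bool × Bool × Bits × Bits} (λ { (tk b) → true , b , falses , falses ; (adv a b) → false , false , a , b })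
    (λ { (true , b , _) → tk b ; (false , _ , a , b) → adv a b }) (λ { (tk b) → refl ; (adv a b) → refl })
    (fin-× fin-Bool (fin-× fin-Bool (fin-× (fin-Vec fin-Bool ℓ) (fin-Vec fin-Bool ℓ))))

  fin-QS : Finite QS
  fin-QS = fin-retract {B = Fin 3 × Cur × MSt × Maybe Bits × Op}
    (λ { set → fz , nothing , init₀ , nothing , tk true ; (fwd c s z) → fs fz , c , s , z , tk true ; (ret c o) → fs (fs fz) , c , init₀ , nothing , o })
    (λ { (fz , _) → set ; (fs fz , c , s , z , _) → fwd c s z ; (fs (fs _) , c , _ , _ , o) → ret c o })
    (λ { set → refl ; (fwd c s z) → refl ; (ret c o) → refl })
    (fin-× (fin-Fin 3) (fin-× (fin-Maybe (fin-Fin _)) (fin-× finM (fin-× (fin-Maybe (fin-Vec fin-Bool ℓ)) fin-Op))))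

  fin-Sym : Finite Sym
  fin-Sym = fin-retract {B = Fin (suc nΓ) ⊎ Cell'} (λ { (raw c) → inj₁ c ; (cell x) → inj₂ x }) (λ { (inj₁ c) → raw c ; (inj₂ x) → cell x })
    (λ { (raw c) → refl ; (cell x) → refl }) (fin-⊎ (fin-Fin _) (finCl nΓ ℓ) fz (fz , falses , falses))

  Act : Set
  Act = Maybe (QS × Maybe Sym × Move × Maybe G)

  opNext : Op → Cell' → Op
  opNext (tk _) x = tk false
  opNext (adv mv ca) (c , v , v') = adv mv v'

  opCell : Op → Cell' → Cell'
  opCell (tk b) (c , v , v') = c , v' , Vec.replicate ℓ b
  opCell (adv mv ca) (c , v , v') = c , v , sel mv ca v'

  updz : Maybe Bits → Cell' → Maybe Bits
  updz nothing (_ , _ , v') = just v'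
  updz (just z) x = just z

  suffix : Cur → List (Ps G) → List (Ps G)
  suffix nothing l = l
  suffix (just y) l = afterY (toℕ y) l

  advOp : Maybe Bits → Op
  advOp z = adv (mvs true (fromMaybe falses z)) (fromMaybe falses z)

  decide : Cur → Maybe Bits → List (Ps G) → Act
  decide cur z [] = nothing
  decide cur z (em c e true ∷ t) = just (ret (just (clip (cntE' t))) (tk true) , nothing , L , just c)
  decide cur z (_ ∷ t) = just (ret cur (advOp z) , nothing , L , nothing)

  δP : QS → Maybe Sym → Act
  δP set (just (raw c)) = just (set , just (cell (c , falses , falses)) , R , nothing)
  δP set nothing = just (ret nothing (tk true) , nothing , L , nothing)
  δP set (just (cell _)) = nothing
  δP (fwd cur s z) (just (cell x)) = just (fwd cur (δM s (code x)) (updz z x) , just (cell x) , R , nothing)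
  δP (fwd cur s z) nothing = decide cur z (suffix cur (fromBL NB (outM s)))
  δP (fwd cur s z) (just (raw _)) = nothing
  δP (ret cur op) (just (cell x)) = just (ret cur (opNext op x) , just (cell (opCell op x)) , L , nothing)
  δP (ret cur op) nothing = just (fwd cur init₀ nothing , nothing , R , nothing)
  δP (ret cur op) (just (raw _)) = nothing

  wm : WM (suc nΓ) (suc nΣ)
  wm = record { Q = QS ; A = Sym ; finQ = fin-QS ; finA = fin-Sym ; a₀ = raw fz ; q₀ = set ; inj = raw ; δ = δP }

  open WRun wm

  from≡ : ∀ {q T T' t u d} → T' ≡ T → Runs (q , T) t u d → Runs (q , T') t u d
  from≡ refl r = r

  to≡ : ∀ {q T T' t u c} → T ≡ T' → Runs c t u (q , T) → Runs c t u (q , T')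
  to≡ refl r = r

  jc : Cell' → Maybe Sym
  jc = just ∘ cell

  sufT : List (Maybe Sym) → List Cell' → WTape Sym
  sufT l [] = wt l nothing []
  sufT l (x ∷ xs) = wt l (jc x) (map jc xs ++ nothing ∷ [])

  sufT-R : ∀ l h xs → moveW R (wt l h (map jc xs ++ nothing ∷ [])) ≡ sufT (h ∷ l) xs
  sufT-R l h [] = refl
  sufT-R l h (x ∷ xs) = refl

  retro : Op → List Cell' → List Cell' → List Cell'
  retro op [] acc = acc
  retro op (x ∷ rx) acc = retro (opNext op x) rx (opCell op x ∷ acc)

  opsEnd : Op → List Cell' → Op
  opsEnd = foldl opNext

  endF : Op → List Cell' → Op
  endF op [] = op
  endF op (x ∷ xs) = opNext (endF op xs) x

  retroF : Op → List Cell' → List Cell'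
  retroF op [] = []
  retroF op (x ∷ xs) = opCell (endF op xs) x ∷ retroF op xs

  retro-snoc : ∀ op rx x acc → retro op (rx ++ x ∷ []) acc ≡ opCell (opsEnd op rx) x ∷ retro op rx acc
  retro-snoc op [] x acc = refl
  retro-snoc op (y ∷ rx) x acc = retro-snoc (opNext op y) rx x _

  opsEnd-snoc : ∀ op rx x → opsEnd op (rx ++ x ∷ []) ≡ opNext (opsEnd op rx) x
  opsEnd-snoc op [] x = refl
  opsEnd-snoc op (y ∷ rx) x = opsEnd-snoc (opNext op y) rx x

  opsEnd-rev : ∀ op xs → opsEnd op (reverse xs) ≡ endF op xs
  opsEnd-rev op [] = refl
  opsEnd-rev op (x ∷ xs) = trans (cong (opsEnd op) (unfold-reverse x xs)) (trans (opsEnd-snoc op (reverse xs) x) (cong (λ o → opNext o x) (opsEnd-rev op xs)))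

  retro-rev : ∀ op xs → retro op (reverse xs) [] ≡ retroF op xs
  retro-rev op [] = refl
  retro-rev op (x ∷ xs) = trans (cong (λ r → retro op r []) (unfold-reverse x xs)) (trans (retro-snoc op (reverse xs) x [])
      (cong₂ _∷_ (cong (λ o → opCell o x) (opsEnd-rev op xs)) (retro-rev op xs)))

  ret-run : ∀ cur op rx acc lp h r → lp ≡ [] ⊎ lp ≡ nothing ∷ [] → h ∷ r ≡ map jc acc ++ nothing ∷ [] →
            Runs (ret cur op , moveW L (wt (map jc rx ++ lp) h r)) (suc (length rx)) [] (fwd cur init₀ nothing , sufT (nothing ∷ []) (retro op rx acc))
  ret-run cur op [] acc .[] h r (inj₁ refl) e = step {o = nothing} refl (to≡ (trans (cong (λ r → moveW R (wt [] nothing r)) e) (sufT-R [] nothing acc)) stop)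
  ret-run cur op [] acc .(nothing ∷ []) h r (inj₂ refl) e = step {o = nothing} refl (to≡ (trans (cong (λ r → moveW R (wt [] nothing r)) e) (sufT-R [] nothing acc)) stop)
  ret-run cur op (x ∷ rx) acc lp h r lpg e = step {o = nothing} refl (ret-run cur (opNext op x) rx (opCell op x ∷ acc) lp (jc (opCell op x)) (h ∷ r) lpg (cong (jc (opCell op x) ∷_) e))

  fwd-run : ∀ cur s z xs ry → Runs (fwd cur s z , sufT (map jc ry ++ nothing ∷ []) xs) (length xs) []
              (fwd cur (foldl δM s (map code xs)) (foldl updz z xs) , wt (map jc (xs ʳ++ ry) ++ nothing ∷ []) nothing [])
  fwd-run cur s z [] ry = stop
  fwd-run cur s z (x ∷ xs) ry = step {o = nothing} refl (from≡ (sufT-R (map jc ry ++ nothing ∷ []) (jc x) xs) (fwd-run cur (δM s (code x)) (updz z x) xs (x ∷ ry)))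

  blankC : Fin (suc nΓ) → Cell'
  blankC c = c , falses , falses

  rawT : List (Maybe Sym) → Word (suc nΓ) → WTape Sym
  rawT l [] = wt l nothing []
  rawT l (c ∷ v) = wt l (just (raw c)) (map just (map raw v))

  rawT-R : ∀ l h v → moveW R (wt l h (map just (map raw v))) ≡ rawT (h ∷ l) v
  rawT-R l h [] = refl
  rawT-R l h (_ ∷ v) = refl

  set-run : ∀ u ry → Runs (set , rawT (map jc ry ++ []) u) (length u) [] (set , wt (map jc (map blankC u ʳ++ ry) ++ []) nothing [])
  set-run [] ry = stop
  set-run (c ∷ u) ry = step {o = nothing} refl (from≡ (rawT-R (map jc ry ++ []) (jc (blankC c)) u) (set-run u (blankC c ∷ ry)))

  module _ (w : Word (suc nΓ)) where
    n : ℕ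
    n = length w
    open Odo n using (next; top; it; Dig; dig-top; dig-next; Cyc; sel-next; bits-rep)

    topM : Mark ℓ
    topM = top ℓ

    nxt : ℕ → Word (suc nΓ) → ℕ
    nxt k [] = 0
    nxt k (_ ∷ _) = k

    cyc : ∀ k u → suc k + length u ≡ n → Cyc k (nxt (suc k) u)
    cyc k [] e = inj₂ (refl , trans (sym (+-identityʳ (suc k))) e)
    cyc k (_ ∷ u) e = inj₁ (refl , ≤-trans (s≤s (≤-trans (m≤m+n (suc k) (length u)) (≤-reflexive (sym (+-suc k (length u)))))) (≤-reflexive e))

    nil? : Word (suc nΓ) → Bool
    nil? [] = true
    nil? (_ ∷ _) = false

    top-bit : ∀ k u → suc k + length u ≡ n → (n ∸ 1 ≡ᵇ k) ≡ nil? u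
    top-bit k [] e = trans (cong (λ x → x ∸ 1 ≡ᵇ k) (trans (sym e) (+-identityʳ (suc k)))) (≡ᵇ-refl k)
    top-bit k (_ ∷ u) e = ≡ᵇ-≢ (n ∸ 1) k (λ q → <⇒≢ (≤-trans (s≤s (m≤m+n k (length u))) (≤-reflexive (trans (sym (+-suc k (length u))) (cong (_∸ 1) e)))) (sym q))

    end-tk : ∀ k u v v' → endF (tk true) (renderFrom k u v v') ≡ tk (nil? u)
    end-tk k [] v v' = refl
    end-tk k (c ∷ u) v v' rewrite end-tk (suc k) u v v' = refl

    retro-tk : ∀ k u v v' → k + length u ≡ n → retroF (tk true) (renderFrom k u v v') ≡ renderFrom k u v' topM
    retro-tk k [] v v' e = refl
    retro-tk k (c ∷ u) v v' e = cong₂ _∷_ (trans (cong (λ o → opCell o (c , bitsAt v k , bitsAt v' k)) (end-tk (suc k) u v v'))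
        (cong (λ b → c , bitsAt v' k , b) (sym (bits-rep ℓ (n ∸ 1) k (nil? u) (top-bit k u e'))))) (retro-tk (suc k) u v v' e')
      where
      e' = trans (sym (+-suc k (length u))) e

    module _ (v v' : Mark ℓ) (dv : Dig v') where
      Z = bitsAt v' 0
      mv = mvs true Z

      end-adv : ∀ k u → endF (adv mv Z) (renderFrom k u v v') ≡ adv mv (bitsAt v' (nxt k u))
      end-adv k [] = refl
      end-adv k (c ∷ u) rewrite end-adv (suc k) u = refl

      retro-adv : ∀ k u → k + length u ≡ n → retroF (adv mv Z) (renderFrom k u v v') ≡ renderFrom k u v (next v')
      retro-adv k [] e = refl
      retro-adv k (c ∷ u) e = cong₂ _∷_ (trans (cong (λ o → opCell o (c , bitsAt v k , bitsAt v' k)) (end-adv (suc k) u))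
          (cong (λ b → c , bitsAt v k , b) (sel-next true v' (cyc k u e') dv))) (retro-adv (suc k) u e')
        where
        e' = trans (sym (+-suc k (length u))) e

    run : Mark ℓ → Mark ℓ → MSt
    run v v' = foldl δM init₀ (map code (render w v v'))

    len-render : ∀ k (u : Word (suc nΓ)) (v v' : Mark ℓ) → length (renderFrom {ℓ = ℓ} k u v v') ≡ length u
    len-render k [] v v' = refl
    len-render k (c ∷ u) v v' = cong suc (len-render (suc k) u v v')

    home : Cur → Mark ℓ → Mark ℓ → Cfg
    home cur v v' = fwd cur init₀ nothing , sufT (nothing ∷ []) (render w v v')

    Out : Cfg → ℕ → List G → Set
    Out c b u = Σ ℕ λ t → Σ Cfg λ d → t ≤ b × Runs c t u d × δP (proj₁ d) (WTape.hd (proj₂ d)) ≡ nothing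

    zOf : Mark ℓ → Mark ℓ → Maybe Bits
    zOf v v' = foldl updz nothing (render w v v')

    decision : Cur → Mark ℓ → Mark ℓ → Act
    decision cur v v' = decide cur (zOf v v') (suffix cur (fromBL NB (outM (run v v'))))

    round : ∀ cur v v' cur' op o v₁ v₁' → decision cur v v' ≡ just (ret cur' op , nothing , L , o) → retroF op (render w v v') ≡ render w v₁ v₁' →
            ∀ {b u} → Out (home cur' v₁ v₁') b u → Out (home cur v v') ((2 * n + 2) + b) (emit o u)
    round cur v v' cur' op o v₁ v₁' e eq {b} {u} (t , d , l , r , h) = length xs + suc (suc (length (reverse xs)) + t) , d , le ,
        (fwd-run cur init₀ nothing xs [] then step {o = o} e (to≡ (cong (sufT (nothing ∷ [])) (trans (retro-rev op xs) eq))
           (ret-run cur' op (reverse xs) [] (nothing ∷ []) nothing [] (inj₂ refl) refl) then r)) , h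
      where
      xs = render w v v'
      le : length xs + suc (suc (length (reverse xs)) + t) ≤ (2 * n + 2) + b
      le = ≤-trans (+-mono-≤ (≤-reflexive (len-render 0 w v v')) (s≤s (s≤s (+-mono-≤ (≤-reflexive (trans (length-reverse xs) (len-render 0 w v v'))) l))))
             (≤-reflexive (lem n b))
        where
        open +-*-Solver
        lem : ∀ n b → n + (2 + (n + b)) ≡ (2 * n + 2) + b
        lem = solve 2 (λ n b → n :+ (con 2 :+ (n :+ b)) := (con 2 :* n :+ con 2) :+ b) refl

    Last : Cur → List (G × List ℕ) → List (G × List ℕ) → Mark ℓ → Set
    Last cur O₁ O₂ v = (cur ≡ nothing × O₁ ≡ []) ⊎
      (Σ (List (G × List ℕ)) λ O₁' → Σ G λ c → Σ (List ℕ) λ ps → O₁ ≡ O₁' ++ (c , ps) ∷ [] × mt v ps ≡ true × cur ≡ just (clip (marked v O₂)))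

    suffix-≤ : ∀ O₁ O₂ v v' → O₁ ++ O₂ ≡ O w → length (patP v v' O₂) ≤ NB
    suffix-≤ O₁ O₂ v v' e = ≤-trans (≤-trans (RP.redOn-len (patP v v' O₂) (map (symPs v v') O₁))
       (≤-reflexive (cong length (trans (sym (foldr-++ RP.push [] (map (symPs v v') O₁) (map (symPs v v') O₂))) (trans (cong RP.red (sym (map-++ (symPs v v') O₁ O₂))) (cong (patP v v') e)))))) (bound w v v')

    out-pat : ∀ v v' → fromBL NB (outM (run v v')) ≡ patP v v' (O w)
    out-pat v v' = trans (cong (fromBL NB) (mach-ok w v v')) (from-toBL-≤ NB _ (bound w v v'))

    cnt-≤ : ∀ O₁ O₂ v → O₁ ++ O₂ ≡ O w → marked v O₂ ≤ NB
    cnt-≤ O₁ O₂ v e = ≤-trans (≤-reflexive (sym (cntE-pat v v O₂))) (≤-trans (cntE-≤ (patP v v O₂)) (suffix-≤ O₁ O₂ v v e))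

    suf-ok : ∀ cur O₁ O₂ v v' → O₁ ++ O₂ ≡ O w → Last cur O₁ O₂ v → suffix cur (fromBL NB (outM (run v v'))) ≡ patP v v' O₂
    suf-ok .nothing .[] O₂ v v' e (inj₁ (refl , refl)) = trans (out-pat v v') (cong (patP v v') (sym e))
    suf-ok .(just (clip (marked v O₂))) .(O₁' ++ (c , ps) ∷ []) O₂ v v' e (inj₂ (O₁' , c , ps , refl , m , refl)) =
      trans (cong₂ afterY (toℕ-clip (marked v O₂) (cnt-≤ (O₁' ++ (c , ps) ∷ []) O₂ v e)) (trans (out-pat v v') (cong (patP v v') (sym e)))) (afterY-pat v v' O₁' c ps O₂ m)

    zOf-eq : 0 < n → ∀ v v' → zOf v v' ≡ just (bitsAt v' 0)
    zOf-eq = go w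
      where
      keep : ∀ z xs → foldl updz (just z) xs ≡ just z
      keep z [] = refl
      keep z (x ∷ xs) = keep z xs
      go : ∀ w → 0 < length w → ∀ v v' → foldl updz nothing (render w v v') ≡ just (bitsAt {ℓ} v' 0)
      go (c ∷ u) l v v' = keep _ (renderFrom 1 u v v')

    Rd : ℕ
    Rd = 2 * n + 2

    goP : ∀ O₂ O₁ cur v → O₁ ++ O₂ ≡ O w → All (λ l → length (proj₂ l) ≤ ℓ × All (_< n) (proj₂ l)) O₂ → Last cur O₁ O₂ v →
          Out (home cur v topM) (length O₂ * (suc n ^ ℓ * Rd) + n) (map proj₁ O₂)
    search : ∀ k c ps O₃ O₁ cur v v' → O₁ ++ (c , ps) ∷ O₃ ≡ O w → All (_< n) ps → All (λ l → length (proj₂ l) ≤ ℓ × All (_< n) (proj₂ l)) O₃ →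
          Last cur O₁ ((c , ps) ∷ O₃) v → (0 < n → Dig v') → mt (it k v') ps ≡ true →
          Out (home cur v v') (suc k * Rd + (length O₃ * (suc n ^ ℓ * Rd) + n)) (c ∷ map proj₁ O₃)

    goP [] O₁ cur v e [] la = length xs , _ , ≤-reflexive (len-render 0 w v topM) , fwd-run cur init₀ nothing xs [] ,
        cong (decide cur (zOf v topM)) (suf-ok cur O₁ [] v topM e la)
      where xs = render w v topM
    goP ((c , ps) ∷ O₃) O₁ cur v e ((lp , ap) ∷ as) la with hit n ℓ ps lp ap
    ... | k , kl , m with search k c ps O₃ O₁ cur v topM e ap as la (dig-top ℓ) m
    ... | t , d , l , r , h = t , d , ≤-trans l (≤-trans (+-monoˡ-≤ _ (*-monoˡ-≤ Rd kl)) (≤-reflexive (sym (+-assoc (suc n ^ ℓ * Rd) _ n)))) , r , h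

    search k c ps O₃ O₁ cur v v' e ap as la dv m = by (mt v' ps) refl
      where
      W = length O₃ * (suc n ^ ℓ * Rd) + n
      e' : (O₁ ++ (c , ps) ∷ []) ++ O₃ ≡ O w
      e' = trans (++-assoc O₁ ((c , ps) ∷ []) O₃) e
      pos : ∀ ps → All (_< n) ps → mt v' ps ≡ false → 0 < n
      pos (q ∷ ps) (l ∷ _) _ = ≤-trans (s≤s z≤n) l
      miss : ∀ s → Miss s → decide cur (zOf v v') s ≡ just (ret cur (advOp (zOf v v')) , nothing , L , nothing)
      miss _ mz = refl
      miss _ me = refl
      by : ∀ b → mt v' ps ≡ b → Out (home cur v v') (suc k * Rd + W) (c ∷ map proj₁ O₃)
      by true q with goP O₃ (O₁ ++ (c , ps) ∷ []) (just (clip (marked v' O₃))) v' e' as (inj₂ (O₁ , c , ps , refl , q , refl))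
      ... | r₀ with round cur v v' (just (clip (marked v' O₃))) (tk true) (just c) v' topM dd (retro-tk 0 w v v' refl) r₀
        where
        dd : decision cur v v' ≡ just (ret (just (clip (marked v' O₃))) (tk true) , nothing , L , just c)
        dd = trans (cong (decide cur (zOf v v')) (trans (suf-ok cur O₁ ((c , ps) ∷ O₃) v v' e la) (pat-hit' v v' c ps O₃ q)))
               (cong (λ k → just (ret (just (clip k)) (tk true) , nothing , L , just c)) (cntE'-pat v v' O₃))
      ... | t , d , l , r , h = t , d , ≤-trans l (+-monoˡ-≤ W (m≤m+n Rd (k * Rd))) , r , h
      by false q = more k m
        where
        0<n = pos ps ap q
        more : ∀ k → mt (it k v') ps ≡ true → Out (home cur v v') (suc k * Rd + W) (c ∷ map proj₁ O₃)
        more zero m = ⊥-elim (ft (trans (sym q) m))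
          where
          ft : false ≡ true → ⊥
          ft ()
        more (suc k) m with round cur v v' cur (advOp (zOf v v')) nothing v (next v')
                (trans (cong (decide cur (zOf v v')) (suf-ok cur O₁ ((c , ps) ∷ O₃) v v' e la)) (miss _ (pat-miss v v' c ps O₃ q)))
                (trans (cong (λ z → retroF (advOp z) (render w v v')) (zOf-eq 0<n v v')) (retro-adv v v' (dv 0<n) 0 w refl))
                (search k c ps O₃ O₁ cur v (next v') e ap as la (λ p → dig-next true (dv p)) m)
        ... | t , d , l , r , h = t , d , ≤-trans l (≤-reflexive (sym (+-assoc Rd (suc k * Rd) W))) , r , h

    -- Digits equal to n lie beyond the tape, so this mark is rendered as blank tracks, which is
    -- what the setup pass writes.
    v₀ : Mark ℓ
    v₀ = Vec.replicate ℓ n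

    blank-render : ∀ k u → k + length u ≡ n → map blankC u ≡ renderFrom k u v₀ v₀
    blank-render k [] e = refl
    blank-render k (c ∷ u) e = cong₂ _∷_ (cong₂ (λ a b → c , a , b) (sym z) (sym z)) (blank-render (suc k) u (trans (sym (+-suc k (length u))) e))
      where
      z = bits-rep ℓ n k false (≡ᵇ-≢ n k (λ q → <⇒≢ (≤-trans (s≤s (m≤m+n k (length u))) (≤-reflexive (trans (sym (+-suc k (length u))) e))) (sym q)))

    T₀ : ℕ
    T₀ = (n + suc (suc n)) + (length (O w) * (suc n ^ ℓ * Rd) + n)

    total : Σ ℕ λ t → Σ Cfg λ d → t ≤ T₀ × Runs (set , inTape (map raw w)) t (f w) d × δP (proj₁ d) (WTape.hd (proj₂ d)) ≡ nothing
    total with goP (O w) [] nothing v₀ refl (O-lab w) (inj₁ (refl , refl))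
    ... | t , d , l , r , h = (n + suc (suc (length (reverse xs)))) + t , d , +-mono-≤ (+-monoʳ-≤ n (s≤s (s≤s (≤-reflexive (trans (length-reverse xs) (trans (cong length (blank-render 0 w refl)) (len-render 0 w v₀ v₀))))))) l ,
          subst (λ u → Runs (set , inTape (map raw w)) ((n + suc (suc (length (reverse xs)))) + t) u d) (O-f w) (setup then r) , h
      where
      xs = map blankC w
      inT : ∀ w → inTape (map raw w) ≡ rawT [] w
      inT [] = refl
      inT (c ∷ w) = refl
      setup : Runs (set , inTape (map raw w)) (n + suc (suc (length (reverse xs)))) [] (home nothing v₀ topM)
      setup = from≡ (inT w)
        (set-run w [] then step {o = nothing} refl (to≡ (cong (sufT (nothing ∷ []))
           (trans (retro-rev (tk true) xs) (trans (cong (retroF (tk true)) (blank-render 0 w refl)) (retro-tk 0 w v₀ v₀ refl))))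
           (ret-run nothing (tk true) (reverse xs) [] [] nothing [] (inj₁ refl) refl)))

  *-^ : ∀ a b d → (a * b) ^ d ≡ a ^ d * b ^ d
  *-^ a b zero = refl
  *-^ a b (suc d) = trans (cong (a * b *_) (*-^ a b d)) ([m*n]*[o*p]≡[m*o]*[n*p] a b (a ^ d) (b ^ d))

  suc-^ : ∀ n d → suc n ^ d ≤ 2 ^ d * n ^ d + 1
  suc-^ zero d = ≤-trans (≤-reflexive (^-zeroˡ d)) (m≤n+m 1 _)
  suc-^ (suc n) d = ≤-trans (^-monoˡ-≤ d (≤-trans (s≤s (≤-trans (≤-reflexive (+-comm 1 n)) (+-monoʳ-≤ n (s≤s z≤n)))) (≤-reflexive (cong (suc n +_) (sym (+-identityʳ (suc n)))))))
     (≤-trans (≤-reflexive (*-^ 2 (suc n) d)) (m≤m+n _ 1))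

  poly : PolyTime (suc nΓ) (suc nΣ) f
  poly = tm , a , d , λ w → let (t , l , h) = compile f T (λ w → let (t , d , l , r , h) = total w in t , d , ≤-trans l (fitO w) , r , h) w in t , ≤-trans l (fit (length w)) , h
    where
    open Compile wm
    -- One factor of degree ℓ for the number of letters, one for the candidates tried for each
    -- letter, and one more degree for a sweep over the tape.
    d = suc (ℓ + ℓ)
    c = 9 + 4 * bO
    -- The power of n + 1 is traded for one of n by `suc-^`, at the price of the factor 2 ^ d.
    a = c * 2 ^ d
    T : ℕ → ℕ
    T n = (n + suc (suc n)) + (bO * suc n ^ ℓ * (suc n ^ ℓ * (2 * n + 2)) + n)
    fitO : ∀ w → T₀ w ≤ T (length w)
    fitO w = +-monoʳ-≤ (length w + suc (suc (length w))) (+-monoˡ-≤ (length w) (*-monoˡ-≤ _ (O-len w)))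
    N≤ : ∀ n → suc n ≤ suc n ^ d
    N≤ n = ≤-trans (≤-reflexive (sym (*-identityʳ (suc n)))) (*-monoʳ-≤ (suc n) (m^n>0 (suc n) (ℓ + ℓ)))
    fit : ∀ n → 2 * T n + 3 ≤ a * n ^ d + a
    fit n = ≤-trans (≤-trans (≤-reflexive (lem n bO (suc n ^ ℓ))) (≤-trans (+-monoˡ-≤ _ (≤-trans (m≤m+n _ 2) (≤-trans (≤-trans (≤-reflexive (lem₂ n)) (m≤m+n _ (3 * n))) (≤-trans (≤-reflexive (lem₄ n)) (*-monoʳ-≤ 9 (N≤ n))))))
        (≤-reflexive (trans (cong (λ p → 9 * suc n ^ d + 4 * bO * p) (cong (suc n *_) (sym (^-distribˡ-+-* (suc n) ℓ ℓ)))) (sym (*-distribʳ-+ (suc n ^ d) 9 (4 * bO)))))))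
        (≤-trans (*-monoʳ-≤ c (suc-^ n d)) (≤-trans (≤-reflexive (lem₃ c (2 ^ d) (n ^ d))) (+-monoʳ-≤ (a * n ^ d) (≤-trans (≤-reflexive (sym (*-identityʳ c))) (*-monoʳ-≤ c (m^n>0 2 d))))))
      where
      open +-*-Solver
      lem : ∀ n b P → 2 * ((n + (2 + n)) + (b * P * (P * (2 * n + 2)) + n)) + 3 ≡ (6 * n + 7) + 4 * b * ((1 + n) * (P * P))
      lem = solve 3 (λ n b P → con 2 :* ((n :+ (con 2 :+ n)) :+ (b :* P :* (P :* (con 2 :* n :+ con 2)) :+ n)) :+ con 3 := (con 6 :* n :+ con 7) :+ con 4 :* b :* ((con 1 :+ n) :* (P :* P))) refl
      lem₂ : ∀ n → (6 * n + 7) + 2 ≡ 6 * n + 9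
      lem₂ = solve 1 (λ n → (con 6 :* n :+ con 7) :+ con 2 := con 6 :* n :+ con 9) refl
      lem₄ : ∀ n → (6 * n + 9) + 3 * n ≡ 9 * suc n
      lem₄ = solve 1 (λ n → (con 6 :* n :+ con 9) :+ con 3 :* n := con 9 :* (con 1 :+ n)) refl
      lem₃ : ∀ c p q → c * (p * q + 1) ≡ c * p * q + c
      lem₃ = solve 3 (λ c p q → c :* (p :* q :+ con 1) := c :* p :* q :+ c) refl

-- Weakening and splitting of contexts

data _⊑_ : Slot → Slot → Set where
  ⊑-none : ∀ {s} → none ⊑ s
  ⊑-refl : ∀ {s} → s ⊑ s

⊑-sh : ∀ {s s'} → s ⊑ s' → shiftSlot s ⊑ shiftSlot s'
⊑-sh ⊑-none = ⊑-none
⊑-sh ⊑-refl = ⊑-refl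

⊑-ext : ∀ {C C' : Ctx} {s} → (∀ x → C x ⊑ C' x) → ∀ x → (s ∷ᶜ C) x ⊑ (s ∷ᶜ C') x
⊑-ext h zero = ⊑-refl
⊑-ext h (suc x) = h x

⊑-eq : ∀ {s s' u} → s ⊑ s' → s ≡ u → (u ≡ none → ⊥) → s' ≡ u
⊑-eq ⊑-none refl n = ⊥-elim (n refl)
⊑-eq ⊑-refl e n = e

⊑-split : ∀ {s s₁ s₂ s'} → SplitSlot s s₁ s₂ → s ⊑ s' → Σ Slot λ s₁' → Σ Slot λ s₂' → SplitSlot s' s₁' s₂' × s₁ ⊑ s₁' × s₂ ⊑ s₂'
⊑-split {s' = none} sp-none ⊑-none = _ , _ , sp-none , ⊑-none , ⊑-none
⊑-split {s' = inΓ _} sp-none ⊑-none = _ , _ , sp-Γl , ⊑-none , ⊑-none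
⊑-split {s' = inΔ _} sp-none ⊑-none = _ , _ , sp-Δ , ⊑-none , ⊑-none
⊑-split {s' = inΘ _} sp-none ⊑-none = _ , _ , sp-Θ , ⊑-none , ⊑-none
⊑-split p ⊑-refl = _ , _ , p , ⊑-refl , ⊑-refl

⊑-prom : ∀ {s₀ s s'} → PromSlot s₀ s → s ⊑ s' → PromSlot s₀ s'
⊑-prom pr-none _ = pr-none
⊑-prom pr-Θ ⊑-refl = pr-Θ

weaken : ∀ {C C' t σ} → C ⊢ t ∶ σ → (∀ x → C x ⊑ C' x) → C' ⊢ t ∶ σ
weaken (ax-Γ e) h = ax-Γ (⊑-eq (h _) e λ ())
weaken (ax-Θ e) h = ax-Θ (⊑-eq (h _) e λ ())
weaken (⊸I d) h = ⊸I (weaken d (⊑-ext h))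
weaken (⊸I! d) h = ⊸I! (weaken d (⊑-ext h))
weaken (⊸E p d d') h = ⊸E (λ x → proj₁ (proj₂ (proj₂ (s x)))) (weaken d (λ x → proj₁ (proj₂ (proj₂ (proj₂ (s x)))))) (weaken d' (λ x → proj₂ (proj₂ (proj₂ (proj₂ (s x))))))
  where s = λ x → ⊑-split (p x) (h x)
weaken (∀I d) h = ∀I (weaken d (⊑-sh ∘ h))
weaken (∀E A d) h = ∀E A (weaken d h)
weaken (!I p d) h = !I (λ x → ⊑-prom (p x) (h x)) d

closed⊢ : ∀ {C t σ} → Closed t σ → C ⊢ t ∶ σ
closed⊢ d = weaken d (λ _ → ⊑-none)

closed-sub : ∀ {t σ} → Closed t σ → ∀ s → subTm s t ≡ t
closed-sub {t} d s = trans (agree d {s} {var} (λ _ ())) (subTm-id (λ _ → refl) t)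

closed-ren : ∀ {t σ} → Closed t σ → ∀ ρ → renTm ρ t ≡ t
closed-ren {t} d ρ = trans (sym (subTm-id (λ _ → refl) (renTm ρ t))) (trans (subTm-ren (λ _ → refl) t) (closed-sub d (var ∘ ρ)))

strip : Slot → Slot
strip (inΓ _) = none
strip s = s

stripC : Ctx → Ctx
stripC C = strip ∘ C

only : (ℕ → Bool) → Ctx → Ctx
only P C x = if P x then C x else strip (C x)

only-Θ : ∀ P C x {σ} → C x ≡ inΘ σ → only P C x ≡ inΘ σ
only-Θ P C x e with P x
... | true = e
... | false = cong strip e

split-only : ∀ P C → Split C (only (not ∘ P) C) (only P C)
split-only P C x with P x | C x
... | true | none = sp-none
... | true | inΓ _ = sp-Γr
... | true | inΔ _ = sp-Δ
... | true | inΘ _ = sp-Θ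
... | false | none = sp-none
... | false | inΓ _ = sp-Γl
... | false | inΔ _ = sp-Δ
... | false | inΘ _ = sp-Θ

split-l : ∀ C → Split C C (stripC C)
split-l C x with C x
... | none = sp-none
... | inΓ _ = sp-Γl
... | inΔ _ = sp-Δ
... | inΘ _ = sp-Θ

split-r : ∀ C → Split C (stripC C) C
split-r C x with C x
... | none = sp-none
... | inΓ _ = sp-Γr
... | inΔ _ = sp-Δ
... | inΘ _ = sp-Θ

-- Gives the largest context from which a promotion into the given one is possible.
unΔ : Slot → Slot
unΔ (inΔ σ) = inΘ σ
unΔ _ = none

unΔC : Ctx → Ctx
unΔC C = unΔ ∘ C

prom-unΔ : ∀ C → Prom (unΔC C) C
prom-unΔ C x with C x
... | none = pr-none
... | inΓ _ = pr-none
... | inΔ _ = pr-Θ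
... | inΘ _ = pr-none

extN : ℕ → (ℕ → Tm) → ℕ → Tm
extN zero s = s
extN (suc k) s = extN k (extTm s)

sub-lam!s : ∀ k s t → subTm s (lam!s k t) ≡ lam!s k (subTm (extN k s) t)
sub-lam!s zero s t = refl
sub-lam!s (suc k) s t = cong lam! (sub-lam!s k (extTm s) t)

extN-old : ∀ k s y {c} → s y ≡ c → renTm suc c ≡ c → extN k s (k + y) ≡ c
extN-old zero s y e r = e
extN-old (suc k) s y e r = trans (cong (extN k (extTm s)) (sym (+-suc k y))) (extN-old k (extTm s) (suc y) (trans (cong (renTm suc) e) r) r)

extN-new : ∀ k s x → x < k → extN k s x ≡ var x
extN-new (suc k) s x l = go k (extTm s) 0 (λ { zero _ → refl }) x (≤-trans (s≤s⁻¹ l) (≤-reflexive (sym (+-identityʳ k))))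
  where
  go : ∀ k s j → (∀ y → y ≤ j → s y ≡ var y) → ∀ x → x ≤ k + j → extN k s x ≡ var x
  go zero s j h x p = h x p
  go (suc k) s j h x p = go k (extTm s) (suc j) (λ { zero _ → refl ; (suc y) (s≤s r) → cong (renTm suc) (h y r) }) x (≤-trans p (≤-reflexive (sym (+-suc k j))))

lam!s-cong : ∀ k {t u} → t =β u → lam!s k t =β lam!s k u
lam!s-cong zero e = e
lam!s-cong (suc k) e = β-lam!c (lam!s-cong k e)

-- Typing of Church strings

fctx : ℕ → Ty → Ctx → Ctx
fctx zero σ C = C
fctx (suc k) σ C = fctx k σ (inΔ σ ∷ᶜ C)

fctx-old : ∀ k σ C y → fctx k σ C (k + y) ≡ C y
fctx-old zero σ C y = refl
fctx-old (suc k) σ C y = trans (cong (fctx k σ (inΔ σ ∷ᶜ C)) (sym (+-suc k y))) (fctx-old k σ (inΔ σ ∷ᶜ C) (suc y))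

fctx-at : ∀ n σ C (i : Fin (suc n)) → fctx (suc n) σ C (n ∸ toℕ i) ≡ inΔ σ
fctx-at n σ C fz = trans (cong (fctx n σ (inΔ σ ∷ᶜ C)) (sym (+-identityʳ n))) (fctx-old n σ (inΔ σ ∷ᶜ C) 0)
fctx-at (suc n) σ C (fs i) = fctx-at n σ (inΔ σ ∷ᶜ C) i

arrB : ℕ → Ty → Ty → STy
arrB zero σ τ = (! σ) ⊸ τ
arrB (suc n) σ τ = (! σ) ⊸ lin (st (arrB n σ τ))

arrB-endo : ∀ n → arrB n endo (! endo) ≡ strBody n
arrB-endo zero = refl
arrB-endo (suc n) = cong (λ S → (! endo) ⊸ lin (st S)) (arrB-endo n)

arrB-sub : ∀ n s → subS s (strBody n) ≡ arrB n (subT s endo) (! subT s endo)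
arrB-sub zero s = refl
arrB-sub (suc n) s = cong (λ S → (! subT s endo) ⊸ lin (st S)) (arrB-sub n s)

EndoT : LTy → Ty
EndoT A = lin (st (lin A ⊸ lin A))

str-inst : ∀ {C t} n A → C ⊢ t ∶ StrT n → C ⊢ t ∶ lin (st (arrB n (EndoT A) (! EndoT A)))
str-inst {C} {t} n A d = subst (λ S → C ⊢ t ∶ lin (st S)) (arrB-sub n _) (∀E A d)

str-ren : ∀ n ρ → renS ρ (Str n) ≡ Str n
str-ren n ρ = cong ∀' (go n)
  where
  go : ∀ n → renS (extR ρ) (strBody n) ≡ strBody n
  go zero = refl
  go (suc n) = cong (λ S → (! endo) ⊸ lin (st S)) (go n)

lam!s-typ : ∀ n σ {τ C t} → fctx (suc n) σ C ⊢ t ∶ τ → C ⊢ lam!s (suc n) t ∶ lin (st (arrB n σ τ))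
lam!s-typ zero σ d = ⊸I! d
lam!s-typ (suc n) σ d = ⊸I! (lam!s-typ n σ d)

str-intro : ∀ n {C t} → fctx (suc n) endo (shiftCtx C) ⊢ t ∶ ! endo → C ⊢ lam!s (suc n) t ∶ StrT n
str-intro n {C} {t} d = ∀I (subst (λ S → shiftCtx C ⊢ lam!s (suc n) t ∶ lin (st S)) (arrB-endo n) (lam!s-typ n endo d))

applyArgs : ∀ k → Tm → (Fin (suc k) → Tm) → Tm
applyArgs zero    u as = app u (as fz)
applyArgs (suc k) u as = applyArgs k (app u (as fz)) (as ∘ fs)

applyArgs-β : ∀ k {u v} as ds → u =β v → (∀ i → as i =β bang (ds i)) → applyArgs k u as =β applyBangs k v ds
applyArgs-β zero as ds e h = β-appc e (h fz)
applyArgs-β (suc k) as ds e h = applyArgs-β k (as ∘ fs) (ds ∘ fs) (β-appc e (h fz)) (h ∘ fs)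

sub-applyArgs : ∀ k s u as → subTm s (applyArgs k u as) ≡ applyArgs k (subTm s u) (subTm s ∘ as)
sub-applyArgs zero s u as = refl
sub-applyArgs (suc k) s u as = sub-applyArgs k s (app u (as fz)) (as ∘ fs)

applyArgs-typ : ∀ k σ {τ C u as} → C ⊢ u ∶ lin (st (arrB k σ τ)) → (∀ i → stripC C ⊢ as i ∶ ! σ) → C ⊢ applyArgs k u as ∶ τ
applyArgs-typ zero σ {C = C} d h = ⊸E (split-l C) d (h fz)
applyArgs-typ (suc k) σ {C = C} d h = applyArgs-typ k σ (⊸E (split-l C) d (h fz)) (h ∘ fs)

encBody-typ : ∀ n {C} → C 0 ≡ inΓ (tv 0) → (∀ i → C (suc (n ∸ toℕ i)) ≡ inΘ endo) → ∀ w → C ⊢ encBody n w ∶ lin (tv 0)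
encBody-typ n e h [] = ax-Γ e
encBody-typ n {C} e h (i ∷ w) = ⊸E (split-r C) (ax-Θ (cong strip (h i))) (encBody-typ n e h w)

enc-typ : ∀ n w → Closed (enc n w) (StrT n)
enc-typ n w = str-intro n (!I (prom-unΔ (fctx (suc n) endo (shiftCtx emptyCtx))) (⊸I (encBody-typ n refl (λ i → cong unΔ (fctx-at n endo (shiftCtx emptyCtx) i)) w)))

foldW : ∀ {m} → (Fin m → Tm) → Tm → Word m → Tm
foldW ds b = foldr (λ c t → app (renTm suc (ds c)) t) b

foldW-it : ∀ {m} (ds : Fin m → Tm) w → itBody ds w ≡ foldW ds (var 0) w
foldW-it ds [] = refl
foldW-it ds (c ∷ w) = cong (app _) (foldW-it ds w)

it-app : ∀ {m} (ds : Fin m → Tm) w b → app (renTm suc (itTm ds w)) b =β foldW ds b w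
it-app ds w b = β-trans β-lam (≡⇒β (trans (subTm-ren (λ { zero → refl ; (suc x) → refl }) (itBody ds w)) (go w)))
  where
  go : ∀ w → subTm (b ∷ˢ (λ x → var (suc x))) (itBody ds w) ≡ foldW ds b w
  go [] = refl
  go (c ∷ w) = cong₂ app (trans (subTm-ren (λ _ → refl) (ds c)) (trans (sym (subTm-id (λ _ → refl) (subTm (λ x → var (suc x)) (ds c)))) (trans (sub-subTm {r = λ x → var (suc x)} (λ _ → refl) (ds c)) (sym (trans (sym (subTm-id (λ _ → refl) (renTm suc (ds c)))) (subTm-ren (λ _ → refl) (ds c))))))) (go w)

it-append : ∀ {m} (ds : Fin m → Tm) u v → app (renTm suc (itTm ds u)) (itBody ds v) =β itBody ds (u ++ v)
it-append ds u v = β-trans (it-app ds u (itBody ds v)) (≡⇒β (trans (cong (λ b → foldW ds b u) (foldW-it ds v)) (trans (sym (foldr-++ _ (var 0) u v)) (sym (foldW-it ds (u ++ v))))))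

-- Iterators compose as their words concatenate. Interpreting letter i of `v` by the iterator of
-- `g i` is therefore composition by substitution.
it-concatMap : ∀ {m k} (ds : Fin m → Tm) (g : Fin k → Word m) v → itBody (λ i → itTm ds (g i)) v =β itBody ds (concatMap g v)
it-concatMap ds g [] = β-refl
it-concatMap ds g (i ∷ v) = β-trans (β-appc β-refl (it-concatMap ds g v)) (it-append ds (g i) (concatMap g v))

it-enc : ∀ n w → itTm (λ i → var (n ∸ toℕ i)) w ≡ lam (encBody n w)
it-enc n w = cong lam (go w)
  where
  go : ∀ w → itBody (λ i → var (n ∸ toℕ i)) w ≡ encBody n w
  go [] = refl
  go (i ∷ w) = cong (app _) (go w)

-- Closure properties of expressible functions

module _ {nΓ nΣ : ℕ} where
  lin⇒bang : ∀ {f : Word (suc nΓ) → Word (suc nΣ)} → ExpressibleLin nΓ nΣ f → ExpressibleBang nΓ nΣ f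
  lin⇒bang (t , d , e) = lam! (bang (app t (var 0))) ,
    ⊸I! (!I (prom-unΔ _) (⊸E (split-r _) (closed⊢ d) (ax-Θ refl))) ,
    λ w → β-trans β-bang (β-bangc (β-trans (β-appc (≡⇒β (closed-sub d _)) β-refl) (e w)))

  const-bang : ∀ u → ExpressibleBang nΓ nΣ (λ _ → u)
  const-bang u = lam! (bang (enc nΣ u)) , ⊸I! (!I (prom-unΔ _) (closed⊢ (enc-typ nΣ u))) , λ w → β-trans β-bang (≡⇒β (cong bang (closed-sub (enc-typ nΣ u) _)))

id-bang : ∀ {n} → ExpressibleBang n n id
id-bang = lam! (bang (var 0)) , ⊸I! (!I (prom-unΔ _) (ax-Θ refl)) , λ w → β-bang

-- The input is boxed and may be copied for all the functions. The resulting strings are unboxed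
-- inside one new box, where the string of `f` and those of the `g i` are opened at the type
-- variable of the result.
module Subst {nΓ nI nΣ : ℕ} {f : Word (suc nΓ) → Word (suc nI)} {g : Fin (suc nI) → Word (suc nΓ) → Word (suc nΣ)}
             (Ef : ExpressibleBang nΓ nI f) (Eg : ∀ i → ExpressibleBang nΓ nΣ (g i)) where
  tf = proj₁ Ef
  tg = λ i → proj₁ (Eg i)

  N = suc nΣ
  fvs : Fin N → Tm
  fvs i = var (nΣ ∸ toℕ i)

  inner : Tm
  inner = applyArgs nI (var (N + 0)) (λ i → applyArgs nΣ (var (N + suc (nI ∸ toℕ i))) (bang ∘ fvs))

  M : Tm
  M = lam!s (suc nI) (lam! (bang (lam!s N inner)))

  arg : Tm → Tm
  arg t = app t (bang (var 0))

  body : Tm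
  body = app (applyArgs nI M (arg ∘ tg)) (arg tf)

  C₁ C₂ C₃ : Ctx
  C₁ = fctx (suc nI) (StrT nΣ) emptyCtx
  C₂ = unΔC (inΔ (StrT nI) ∷ᶜ C₁)
  C₃ = fctx N endo (shiftCtx C₂)

  old-slot : ∀ y n → C₂ y ≡ inΘ (StrT n) → C₃ (N + y) ≡ inΘ (StrT n)
  old-slot y n e = trans (fctx-old N endo (shiftCtx C₂) y) (trans (cong shiftSlot e) (cong (λ S → inΘ (lin (st S))) (str-ren n suc)))

  G-slot : ∀ i → C₃ (N + suc (nI ∸ toℕ i)) ≡ inΘ (StrT nΣ)
  G-slot i = old-slot (suc (nI ∸ toℕ i)) nΣ (cong unΔ (fctx-at nI (StrT nΣ) emptyCtx i))

  f-slot : ∀ i → C₃ (nΣ ∸ toℕ i) ≡ inΔ endo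
  f-slot i = fctx-at nΣ endo (shiftCtx C₂) i

  inner-typ : C₃ ⊢ inner ∶ ! endo
  inner-typ = applyArgs-typ nI endo (str-inst nI (tv 0) (ax-Θ (old-slot 0 nI refl)))
    (λ i → applyArgs-typ nΣ endo (str-inst nΣ (tv 0) (ax-Θ (cong strip (G-slot i))))
      (λ j → !I (prom-unΔ (stripC (stripC C₃))) (ax-Θ (cong (unΔ ∘ strip ∘ strip) (f-slot j)))))

  M-typ : Closed M (lin (st (arrB nI (StrT nΣ) (lin (st ((! StrT nI) ⊸ (! StrT nΣ)))))))
  M-typ = lam!s-typ nI (StrT nΣ) (⊸I! (!I (prom-unΔ _) (str-intro nΣ inner-typ)))

  arg-typ : ∀ {n t} → Closed t (BangFunTy nΓ n) → stripC (inΔ (StrT nΓ) ∷ᶜ emptyCtx) ⊢ arg t ∶ ! StrT n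
  arg-typ d = ⊸E (split-l _) (closed⊢ d) (!I (prom-unΔ _) (ax-Θ refl))

  body-typ : (inΔ (StrT nΓ) ∷ᶜ emptyCtx) ⊢ body ∶ ! StrT nΣ
  body-typ = ⊸E (split-l _) (applyArgs-typ nI (StrT nΣ) (closed⊢ M-typ) (λ i → arg-typ (proj₁ (proj₂ (Eg i))))) (arg-typ (proj₁ (proj₂ Ef)))

  module _ (w : Word (suc nΓ)) where
    eG : Fin (suc nI) → Tm
    eG i = enc nΣ (g i w)

    s₁ : ℕ → Tm
    s₁ = enc nI (f w) ∷ˢ extD nI eG var

    inner-β : subTm (extN N s₁) inner =β bang (lam (encBody nΣ (CbS f g w)))
    inner-β = β-trans (≡⇒β (sub-applyArgs nI (extN N s₁) (var (N + 0)) _))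
      (β-trans (applyArgs-β nI _ (λ i → itTm fvs (g i w)) (≡⇒β (extN-old N s₁ 0 refl (closed-ren (enc-typ nI (f w)) suc))) gs)
        (β-trans (enc-β nI (f w) _) (β-bangc (β-trans (β-lamc (it-concatMap fvs (λ i → g i w) (f w))) (≡⇒β (it-enc nΣ (CbS f g w)))))))
      where
      gs : ∀ i → subTm (extN N s₁) (applyArgs nΣ (var (N + suc (nI ∸ toℕ i))) (bang ∘ fvs)) =β bang (itTm fvs (g i w))
      gs i = β-trans (≡⇒β (sub-applyArgs nΣ (extN N s₁) (var (N + suc (nI ∸ toℕ i))) (bang ∘ fvs)))
        (β-trans (applyArgs-β nΣ _ fvs (≡⇒β (extN-old N s₁ (suc (nI ∸ toℕ i)) (extD-new nI eG var i) (closed-ren (enc-typ nΣ (g i w)) suc)))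
           (λ j → ≡⇒β (cong bang (extN-new N s₁ (nΣ ∸ toℕ j) (s≤s (m∸n≤m nΣ (toℕ j)))))))
          (enc-β nΣ (g i w) fvs))

    body-β : subTm (enc nΓ w ∷ˢ var) body =β bang (enc nΣ (CbS f g w))
    body-β = β-trans (β-appc (≡⇒β (sub-applyArgs nI s₀ M (arg ∘ tg))) β-refl)
      (β-trans (β-appc (applyArgs-β nI _ eG (≡⇒β (trans (closed-sub M-typ s₀) (sym (closed-sub M-typ var)))) (λ i → arg-β (proj₁ (proj₂ (Eg i))) (proj₂ (proj₂ (Eg i)) w)))
                       (arg-β (proj₁ (proj₂ Ef)) (proj₂ (proj₂ Ef) w)))
        (β-trans (β-appc (lam!s-β nI var (lam! (bang (lam!s N inner))) eG) β-refl)
          (β-trans (β-bangˢ {extD nI eG var} {bang (lam!s N inner)}) (β-bangc (β-trans (≡⇒β (sub-lam!s N s₁ inner)) (lam!s-cong N inner-β))))))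
      where
      s₀ = enc nΓ w ∷ˢ var
      arg-β : ∀ {n t u} → Closed t (BangFunTy nΓ n) → app t (bang (enc nΓ w)) =β u → subTm s₀ (arg t) =β u
      arg-β d e = β-trans (β-appc (≡⇒β (closed-sub d s₀)) β-refl) e

  cbs-bang : ExpressibleBang nΓ nΣ (CbS f g)
  cbs-bang = lam! body , ⊸I! body-typ , λ w → β-trans (β-trans β-bang (≡⇒β (subTm-cong (λ { zero → refl ; (suc _) → refl }) body))) (body-β w)

growth : ∀ k → Σ (Word 1 → Word 1) λ f → ExpressibleBang 0 0 f × (∀ w → length (f w) ≡ length w ^ k)
growth zero = (λ _ → fz ∷ []) , const-bang (fz ∷ []) , λ _ → refl
growth (suc k) with growth k
... | f , E , e = CbS f (λ _ → id) , Subst.cbs-bang E (λ _ → id-bang) , λ w → trans (len (f w) w) (trans (cong (_* length w) (e w)) (*-comm (length w ^ k) (length w)))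
  where
  len : ∀ u (w : Word 1) → length (concatMap (λ (i : Fin 1) → w) u) ≡ length u * length w
  len [] w = refl
  len (_ ∷ u) w = trans (length-++ w) (cong (length w +_) (len u w))

growing : ∀ k → Σ ℕ λ nΓ → Σ ℕ λ nΣ → Σ (Word (suc nΓ) → Word (suc nΣ)) λ f → ExpressibleBang nΓ nΣ f × GrowsAtLeastPoly k f
growing k with growth k
... | f , E , e = 0 , 0 , f , E , 1 , 0 , ≤-refl , λ w _ → ≤-reflexive (sym (trans (+-identityʳ _) (e w)))

-- Regular functions: encoding of streaming string transducers

-- Iterated linear abstractions and applications: the last argument is bound to variable 0.

lams : ℕ → Tm → Tm
lams zero t = t
lams (suc k) t = lams k (lam t)

apps : ∀ k → Tm → (Fin k → Tm) → Tm
apps zero t us = t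
apps (suc k) t us = app (apps k t (us ∘ fs)) (us fz)

consˢ : ∀ k → (Fin k → Tm) → (ℕ → Tm) → ℕ → Tm
consˢ zero us s = s
consˢ (suc k) us s = us fz ∷ˢ consˢ k (us ∘ fs) s

consˢ-new : ∀ k us s (j : Fin k) → consˢ k us s (toℕ j) ≡ us j
consˢ-new (suc k) us s fz = refl
consˢ-new (suc k) us s (fs j) = consˢ-new k (us ∘ fs) s j

consˢ-old : ∀ k us s x → consˢ k us s (k + x) ≡ s x
consˢ-old zero us s x = refl
consˢ-old (suc k) us s x = consˢ-old k (us ∘ fs) s x

apps-cong : ∀ k {t t'} us us' → t =β t' → (∀ j → us j =β us' j) → apps k t us =β apps k t' us'
apps-cong zero us us' e h = e
apps-cong (suc k) us us' e h = β-appc (apps-cong k (us ∘ fs) (us' ∘ fs) e (h ∘ fs)) (h fz)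

sub-apps : ∀ k s t us → subTm s (apps k t us) ≡ apps k (subTm s t) (subTm s ∘ us)
sub-apps zero s t us = refl
sub-apps (suc k) s t us = cong (λ z → app z (subTm s (us fz))) (sub-apps k s t (us ∘ fs))

lams-β : ∀ k s t us → apps k (subTm s (lams k t)) us =β subTm (consˢ k us s) t
lams-β zero s t us = β-refl
lams-β (suc k) s t us = β-trans (β-appc (lams-β k s (lam t) (us ∘ fs)) β-refl) (β-lamˢ {consˢ k (us ∘ fs) s} {t})

gctx : ℕ → LTy → Ctx → Ctx
gctx zero A C = C
gctx (suc k) A C = inΓ A ∷ᶜ gctx k A C

gctx-new : ∀ k A C (j : Fin k) → gctx k A C (toℕ j) ≡ inΓ A
gctx-new (suc k) A C fz = refl
gctx-new (suc k) A C (fs j) = gctx-new k A C j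

gctx-old : ∀ k A C x → gctx k A C (k + x) ≡ C x
gctx-old zero A C x = refl
gctx-old (suc k) A C x = gctx-old k A C x

tow : ℕ → LTy → STy → STy
tow zero A U = U
tow (suc k) A U = tow k A (lin A ⊸ lin (st U))

tow-sub : ∀ k s A U → subS s (tow k A U) ≡ tow k (subL s A) (subS s U)
tow-sub zero s A U = refl
tow-sub (suc k) s A U = tow-sub k s A (lin A ⊸ lin (st U))

lams-typ : ∀ k {A C t U} → gctx k A C ⊢ t ∶ lin (st U) → C ⊢ lams k t ∶ lin (st (tow k A U))
lams-typ zero d = d
lams-typ (suc k) d = lams-typ k (⊸I d)

apps-typ : ∀ k {A C t us U} → C ⊢ t ∶ lin (st (tow k A U)) → (∀ j → stripC C ⊢ us j ∶ lin A) → C ⊢ apps k t us ∶ lin (st U)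
apps-typ zero d h = d
apps-typ (suc k) {C = C} d h = ⊸E (split-l C) (apps-typ k d (h ∘ fs)) (h fz)

-- The finite type with suc Q' elements

Sel : ℕ → STy
Sel Q' = ∀' (tow Q' (tv 0) (lin (tv 0) ⊸ lin (tv 0)))

choose : ∀ {Q'} → Fin (suc Q') → Tm
choose {Q'} q = lams (suc Q') (var (toℕ q))

choose-typ : ∀ {Q'} (q : Fin (suc Q')) → Closed (choose q) (lin (st (Sel Q')))
choose-typ {Q'} q = ∀I (lams-typ Q' (⊸I (ax-Γ (gctx-new (suc Q') (tv 0) (shiftCtx emptyCtx) q))))

choose-β : ∀ {Q'} (q : Fin (suc Q')) gs → apps (suc Q') (choose q) gs =β gs q
choose-β {Q'} q gs = β-trans (apps-cong (suc Q') gs gs (≡⇒β (sym (closed-sub (choose-typ q) var))) (λ _ → β-refl))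
  (β-trans (lams-β (suc Q') var (var (toℕ q)) gs) (≡⇒β (consˢ-new (suc Q') gs var q)))

-- Only one branch is selected but all are present, so the branches may not contain linear
-- variables. Whatever is linear has to be passed after the selection.
sel-elim : ∀ {Q' C t us} A → C ⊢ t ∶ lin (st (Sel Q')) → (∀ j → stripC C ⊢ us j ∶ lin (st A)) → C ⊢ apps (suc Q') t us ∶ lin (st A)
sel-elim {Q'} {C} {t} {us} A d h = ⊸E (split-l C) (apps-typ Q' (subst (λ U → C ⊢ t ∶ lin (st U)) (tow-sub Q' _ (tv 0) (lin (tv 0) ⊸ lin (tv 0))) (∀E (st A) d)) (h ∘ fs)) (h fz)

E₀ : STy
E₀ = lin (tv 0) ⊸ lin (tv 0)

β-ren : ∀ {t u} ρ → t =β u → renTm ρ t =β renTm ρ u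
β-ren ρ (β-lam {t} {u}) = β-trans β-lam (≡⇒β (trans (subTm-ren {r = renTm ρ u ∷ˢ (var ∘ ρ)} (λ { zero → refl ; (suc x) → refl }) t) (sym (ren-subTm (λ { zero → refl ; (suc x) → refl }) t))))
β-ren ρ (β-bang {t} {u}) = β-trans β-bang (≡⇒β (trans (subTm-ren {r = renTm ρ u ∷ˢ (var ∘ ρ)} (λ { zero → refl ; (suc x) → refl }) t) (sym (ren-subTm (λ { zero → refl ; (suc x) → refl }) t))))
β-ren ρ β-refl = β-refl
β-ren ρ (β-sym e) = β-sym (β-ren ρ e)
β-ren ρ (β-trans e e') = β-trans (β-ren ρ e) (β-ren ρ e')
β-ren ρ (β-lamc e) = β-lamc (β-ren (extR ρ) e)
β-ren ρ (β-lam!c e) = β-lam!c (β-ren (extR ρ) e)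
β-ren ρ (β-appc e e') = β-appc (β-ren ρ e) (β-ren ρ e')
β-ren ρ (β-bangc e) = β-bangc (β-ren ρ e)

only-true : ∀ P C x → P x ≡ true → only P C x ≡ C x
only-true P C x e rewrite e = refl

module RegWords {nΓ nΣ : ℕ} (M : RegTrans nΓ nΣ) where
  nR : ℕ
  nR = RegTrans.R M

  X : Set
  X = Fin nΣ ⊎ Fin nR

  -- A string is kept as an endofunction of the base type, so letters and registers are used alike
  -- and concatenation is composition.
  wordTm : (Fin nΣ → ℕ) → (Fin nR → ℕ) → ℕ → List X → Tm
  wordTm fv rv b [] = var b
  wordTm fv rv b (inj₁ a ∷ w) = app (var (fv a)) (wordTm fv rv b w)
  wordTm fv rv b (inj₂ r ∷ w) = app (var (rv r)) (wordTm fv rv b w)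

  wordFun : (Fin nΣ → ℕ) → (Fin nR → ℕ) → List X → Tm
  wordFun fv rv w = lam (wordTm (suc ∘ fv) (suc ∘ rv) 0 w)

  module _ (f₀ : Fin nΣ → ℕ) where
    V : Word nΣ → Tm
    V = itTm (λ i → var (f₀ i))

    wordFun-β : ∀ s fv rv val → (∀ i → s (fv i) ≡ var (f₀ i)) → (∀ r → s (rv r) =β V (val r)) → ∀ w → subTm s (wordFun fv rv w) =β V (star M val w)
    wordFun-β s fv rv val hf hr w = β-lamc (go w)
      where
      go : ∀ w → subTm (extTm s) (wordTm (suc ∘ fv) (suc ∘ rv) 0 w) =β itBody (λ i → var (f₀ i)) (star M val w)
      go [] = β-refl
      go (inj₁ a ∷ w) = β-appc (≡⇒β (cong (renTm suc) (hf a))) (go w)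
      go (inj₂ r ∷ w) = β-trans (β-appc (β-ren suc (hr r)) (go w)) (it-append (λ i → var (f₀ i)) (val r) (star M val w))

  occ-self : ∀ r w → occ M r (inj₂ r ∷ w) ≡ suc (occ M r w)
  occ-self r w with r Fin.≟ r
  ... | yes _ = refl
  ... | no n = ⊥-elim (n refl)

  occ-++ : ∀ r u v → occ M r (u ++ v) ≡ occ M r u + occ M r v
  occ-++ r [] v = refl
  occ-++ r (inj₁ _ ∷ u) v = occ-++ r u v
  occ-++ r (inj₂ r' ∷ u) v with r Fin.≟ r'
  ... | yes _ = cong suc (occ-++ r u v)
  ... | no _ = occ-++ r u v

  occ-tail : ∀ r x w → occ M r w ≤ occ M r (x ∷ w)
  occ-tail r (inj₁ _) w = ≤-refl
  occ-tail r (inj₂ r') w with r Fin.≟ r'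
  ... | yes _ = n≤1+n _
  ... | no _ = ≤-refl

  mem : (Fin nR → ℕ) → ℕ → List X → Bool
  mem rv x [] = false
  mem rv x (inj₁ _ ∷ w) = mem rv x w
  mem rv x (inj₂ r ∷ w) = (x ≡ᵇ rv r) ∨ mem rv x w

  mem-true : ∀ rv r w → 1 ≤ occ M r w → mem rv (rv r) w ≡ true
  mem-true rv r (inj₁ _ ∷ w) l = mem-true rv r w l
  mem-true rv r (inj₂ r' ∷ w) l with r Fin.≟ r'
  ... | yes refl rewrite ≡ᵇ-refl (rv r) = refl
  ... | no _ rewrite mem-true rv r w l with rv r ≡ᵇ rv r'
  ...   | true = refl
  ...   | false = refl

  mem-false : ∀ rv x w → (∀ r → x ≡ rv r → occ M r w ≡ 0) → mem rv x w ≡ false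
  mem-false rv x [] h = refl
  mem-false rv x (inj₁ _ ∷ w) h = mem-false rv x w h
  mem-false rv x (inj₂ r ∷ w) h rewrite ≡ᵇ-≢ x (rv r) (λ e → 1+n≢0 (trans (sym (occ-self r w)) (h r e))) =
    mem-false rv x w (λ r' e → n≤0⇒n≡0 (≤-trans (occ-tail r' (inj₂ r) w) (≤-reflexive (h r' e))))

  HasF : Ctx → (Fin nΣ → ℕ) → Set
  HasF C fv = ∀ i → C (fv i) ≡ inΘ endo

  hasF-only : ∀ P {C fv} → HasF C fv → HasF (only P C) fv
  hasF-only P {C} {fv} h i = only-Θ P C (fv i) (h i)

  module _ (rv : Fin nR → ℕ) (inj : ∀ r r' → rv r ≡ rv r' → r ≡ r') where
    -- A register is a linear variable and is given to its single occurrence; the rest of the word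
    -- is typed without it.
    word-typ : ∀ w {C fv b} → (∀ r → ¬ b ≡ rv r) → HasF C fv → C b ≡ inΓ (tv 0) → (∀ r → 1 ≤ occ M r w → C (rv r) ≡ inΓ (st E₀)) → (∀ r → occ M r w ≤ 1) →
               C ⊢ wordTm fv rv b w ∶ lin (tv 0)
    word-typ [] nb hf hb hr once = ax-Γ hb
    word-typ (inj₁ a ∷ w) {C} nb hf hb hr once = ⊸E (split-r C) (ax-Θ (cong strip (hf a))) (word-typ w nb hf hb hr once)
    word-typ (inj₂ r ∷ w) {C} {fv} {b} nb hf hb hr once = ⊸E (split-only P C)
        (ax-Γ (trans (only-true (not ∘ P) C (rv r) (cong (not ∘ not) (≡ᵇ-refl (rv r)))) (hr r (≤-trans (s≤s z≤n) (≤-reflexive (sym (occ-self r w)))))))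
        (word-typ w nb (hasF-only P {C} {fv} hf) (trans (keep b (nb r)) hb)
          (λ r' l → trans (keep (rv r') (λ e → <⇒≱ l (≤-trans (≤-reflexive (cong (λ z → occ M z w) (inj r' r e))) gone))) (hr r' (≤-trans l (occ-tail r' (inj₂ r) w))))
          (λ r' → ≤-trans (occ-tail r' (inj₂ r) w) (once r')))
      where
      P : ℕ → Bool
      P x = not (x ≡ᵇ rv r)
      keep : ∀ x → ¬ x ≡ rv r → only P C x ≡ C x
      keep x n = only-true P C x (cong not (≡ᵇ-≢ x (rv r) n))
      gone : occ M r w ≤ 0
      gone = s≤s⁻¹ (≤-trans (≤-reflexive (sym (occ-self r w))) (once r))

  wordFun-typ : ∀ rv → (∀ r r' → rv r ≡ rv r' → r ≡ r') → ∀ w {C fv} → HasF C fv → (∀ r → 1 ≤ occ M r w → C (rv r) ≡ inΓ (st E₀)) → (∀ r → occ M r w ≤ 1) →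
                C ⊢ wordFun fv rv w ∶ lin (st E₀)
  wordFun-typ rv inj w hf hr once = ⊸I (word-typ (suc ∘ rv) (λ r r' → inj r r' ∘ suc-injective) w (λ r ()) hf refl hr once)

  module _ (rv : Fin nR → ℕ) (inj : ∀ r r' → rv r ≡ rv r' → r ≡ r') (fv : Fin nΣ → ℕ) where
    Copyless₁ : List X → Set
    Copyless₁ w = ∀ r → occ M r w ≤ 1

    -- The registers are distributed among the words of the update, which is possible as no register
    -- occurs twice in all of them together. The head must be typable in whatever is left, hence the
    -- assumption for all contexts that agree off the registers.
    regs-typ : ∀ k (g : Fin k → List X) {C t W} → Copyless₁ (concat (List.tabulate g)) → (∀ r → 1 ≤ occ M r (concat (List.tabulate g)) → C (rv r) ≡ inΓ (st E₀)) → HasF C fv →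
               (∀ C' → (∀ x → (∀ r → ¬ x ≡ rv r) → C' x ≡ C x) → C' ⊢ t ∶ lin (st (tow k (st E₀) W))) →
               C ⊢ apps k t (λ j → wordFun fv rv (g j)) ∶ lin (st W)
    regs-typ zero g once hr hf ht = ht _ (λ _ _ → refl)
    regs-typ (suc k) g {C} once hr hf ht = ⊸E (split-only P C)
        (regs-typ k (g ∘ fs) (λ r → ≤-trans (right r) (once r))
          (λ r l → trans (off (rv r) (λ r' e → n≤0⇒n≡0 (s≤s⁻¹ (≤-trans (≤-trans (≤-reflexive (+-comm 1 _)) (+-monoʳ-≤ (occ M r' (g fz)) (≤-trans l (≤-reflexive (cong (λ z → occ M z rest) (inj r r' e)))))) (≤-trans (≤-reflexive (sym (occ-++ r' (g fz) rest))) (once r')))))) (hr r (≤-trans l (right r))))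
          (hasF-only (not ∘ P) {C} {fv} hf) (λ C' h → ht C' (λ x n → trans (h x n) (off x (λ r e → ⊥-elim (n r e))))))
        (wordFun-typ rv inj (g fz) (hasF-only P {C} {fv} hf) (λ r l → trans (only-true P C (rv r) (mem-true rv r (g fz) l)) (hr r (≤-trans l (left r)))) (λ r → ≤-trans (left r) (once r)))
      where
      rest = concat (List.tabulate (g ∘ fs))
      P : ℕ → Bool
      P x = mem rv x (g fz)
      off : ∀ x → (∀ r → x ≡ rv r → occ M r (g fz) ≡ 0) → only (not ∘ P) C x ≡ C x
      off x h = only-true (not ∘ P) C x (cong not (mem-false rv x (g fz) h))
      left : ∀ r → occ M r (g fz) ≤ occ M r (g fz ++ rest)
      left r = ≤-trans (m≤m+n _ _) (≤-reflexive (sym (occ-++ r (g fz) rest)))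
      right : ∀ r → occ M r rest ≤ occ M r (g fz ++ rest)
      right r = ≤-trans (m≤n+m _ _) (≤-reflexive (sym (occ-++ r (g fz) rest)))

-- A state (q , s) is encoded by the selector of q followed by the values of the registers;
-- a letter maps a continuation expecting the next state to one expecting the current state.

module Transducer {nΓ nΣ Q' : ℕ} (nR : ℕ) (qI : Fin (suc Q')) (δ : Fin (suc Q') → Fin (suc nΓ) → Fin (suc Q') × (Fin nR → List (Fin (suc nΣ) ⊎ Fin nR)))
                  (out : Fin (suc Q') → List (Fin (suc nΣ) ⊎ Fin nR)) where
  M : RegTrans (suc nΓ) (suc nΣ)
  M = record { Q = suc Q' ; qI = qI ; R = nR ; δ = δ ; F = out }

  open RegWords M hiding (nR)

  Vars : Set
  Vars = Fin (suc nΣ) → ℕ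

  updTm : Fin (suc nΓ) → Fin (suc Q') → Vars → Fin nR → Tm
  updTm c q fv j = wordFun (λ i → nR + suc (fv i)) toℕ (proj₂ (δ q c) j)

  nextTm : Fin (suc nΓ) → Fin (suc Q') → Vars → Tm
  nextTm c q fv = apps nR (app (var (nR + 0)) (choose (proj₁ (δ q c)))) (updTm c q fv)

  branch : Fin (suc nΓ) → Fin (suc Q') → Vars → Tm
  branch c q fv = lam (lams nR (nextTm c q fv))

  -- The continuation is linear and cannot be mentioned in every branch, so each branch abstracts
  -- over it and it is supplied after the state has been selected.
  caseTm : Fin (suc nΓ) → Vars → Tm
  caseTm c fv = app (apps (suc Q') (var 0) (λ q → branch c q (suc ∘ suc ∘ fv))) (var 1)

  -- In the encoding of a word the first letter is outermost. With continuations the outermost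
  -- letter is the first to act on the configuration, so the word is read from left to right.
  letterTm : Fin (suc nΓ) → Vars → Tm
  letterTm c fv = lam (lam (caseTm c fv))

  outFun : Fin (suc Q') → Vars → Tm
  outFun q fv = wordFun (λ i → nR + fv i) toℕ (out q)

  outTm : Fin (suc Q') → Vars → Tm
  outTm q fv = lams nR (outFun q fv)

  final : Vars → Tm
  final fv = lam (apps (suc Q') (var 0) (λ q → outTm q (suc ∘ fv)))

  N = suc nΣ

  f₀ : Vars
  f₀ i = nΣ ∸ toℕ i

  empties : Fin nR → Tm
  empties _ = lam (var 0)

  start : Tm
  start = apps nR (app (app (var 0) (final (suc ∘ f₀))) (choose qI)) empties

  -- The input occurs once, outside boxes, with boxed letters as arguments. The boxed iterator it
  -- returns is opened under a new box, where `start` supplies the final continuation and the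
  -- initial configuration.
  inner : Tm
  inner = app (lam! (bang start)) (applyArgs nΓ (var (N + 0)) (λ c → bang (letterTm c f₀)))

  term : Tm
  term = lam (lam!s N inner)

  regsT : STy
  regsT = tow nR (st E₀) E₀

  contT : LTy
  contT = st (lin (st (Sel Q')) ⊸ lin (st regsT))

  branchT : STy
  branchT = lin contT ⊸ lin (st regsT)

  not-reg : ∀ x (r : Fin nR) → ¬ nR + x ≡ toℕ r
  not-reg x r e = <⇒≢ (≤-trans (toℕ<n r) (m≤m+n nR x)) (sym e)

  hasF-sh : ∀ {C fv} {A : LTy} → HasF C fv → HasF (gctx nR A C) (λ i → nR + fv i)
  hasF-sh {C} {fv} {A} h i = trans (gctx-old nR A C (fv i)) (h i)

  hasF-strip : ∀ {C fv} → HasF C fv → HasF (stripC C) fv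
  hasF-strip h i = cong strip (h i)

  toℕ-inj : ∀ (r r' : Fin nR) → toℕ r ≡ toℕ r' → r ≡ r'
  toℕ-inj r r' = toℕ-injective

  module Typing (copyless : Copyless M) where
    branch-typ : ∀ c q {C fv} → HasF C fv → C ⊢ branch c q fv ∶ lin (st branchT)
    branch-typ c q {C} {fv} h = ⊸I (lams-typ nR (regs-typ toℕ toℕ-inj _ nR (proj₂ (δ q c))
        (λ r → ≤-trans (≤-reflexive (cong (λ z → occ M r (concat z)) (sym (map-tabulate id (proj₂ (δ q c)))))) (proj₁ copyless q c r))
        (λ r _ → gctx-new nR (st E₀) (inΓ contT ∷ᶜ C) r) (hasF-sh {inΓ contT ∷ᶜ C} {suc ∘ fv} h)
        (λ C' e → ⊸E (split-l C') (ax-Γ (trans (e (nR + 0) (not-reg 0)) (gctx-old nR (st E₀) (inΓ contT ∷ᶜ C) 0))) (closed⊢ (choose-typ (proj₁ (δ q c)))))))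

    letter-typ : ∀ c {C fv} → HasF C fv → C ⊢ letterTm c fv ∶ EndoT contT
    letter-typ c {C} {fv} h = ⊸I (⊸I (⊸E (split-only P Dc) (sel-elim branchT (ax-Γ refl)
        (λ q → branch-typ c q {fv = suc ∘ suc ∘ fv} (hasF-strip {only (not ∘ P) Dc} {suc ∘ suc ∘ fv} (hasF-only (not ∘ P) {Dc} {suc ∘ suc ∘ fv} h)))) (ax-Γ refl)))
      where
      Dc : Ctx
      Dc = inΓ (st (Sel Q')) ∷ᶜ (inΓ contT ∷ᶜ C)
      P : ℕ → Bool
      P x = x ≡ᵇ 1

    out-typ : ∀ q {C fv} → HasF C fv → C ⊢ outTm q fv ∶ lin (st regsT)
    out-typ q {C} {fv} h = lams-typ nR (wordFun-typ toℕ toℕ-inj (out q) (hasF-sh {C} {fv} h) (λ r _ → gctx-new nR (st E₀) C r) (proj₂ copyless q))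

    final-typ : ∀ {C fv} → HasF C fv → C ⊢ final fv ∶ lin contT
    final-typ {C} {fv} h = ⊸I (sel-elim regsT (ax-Γ refl) (λ q → out-typ q {fv = suc ∘ fv} (hasF-strip {inΓ (st (Sel Q')) ∷ᶜ C} {suc ∘ fv} h)))

    C₁ : Ctx
    C₁ = fctx N endo (shiftCtx (inΓ (st (Str nΓ)) ∷ᶜ emptyCtx))

    f-slot : ∀ i → C₁ (f₀ i) ≡ inΔ endo
    f-slot i = fctx-at nΣ endo _ i

    arg-slot : C₁ (N + 0) ≡ inΓ (st (Str nΓ))
    arg-slot = trans (fctx-old N endo _ 0) (cong (λ U → inΓ (st U)) (str-ren nΓ suc))

    inner-typ : C₁ ⊢ inner ∶ ! endo
    inner-typ = ⊸E (split-r C₁)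
      (⊸I! (!I (prom-unΔ _) (apps-typ nR (⊸E (split-l _) (⊸E (split-l _) (ax-Θ refl)
         (final-typ (λ i → cong (strip ∘ unΔ ∘ strip) (f-slot i)))) (closed⊢ (choose-typ qI))) (λ _ → ⊸I (ax-Γ refl)))))
      (applyArgs-typ nΓ (EndoT contT) (str-inst nΓ contT (ax-Γ arg-slot)) (λ c → !I (prom-unΔ _) (letter-typ c (λ i → cong (unΔ ∘ strip) (f-slot i)))))

    term-typ : Closed term (LinFunTy nΓ nΣ)
    term-typ = ⊸I (str-intro nΣ inner-typ)

    C₂ : Ctx
    C₂ = unΔC (fctx N endo emptyCtx)

    live-< : ∀ x → Live (C₂ x) → x < N
    live-< x l with <-≤-connex x N
    ... | inj₁ p = p
    ... | inj₂ p = ⊥-elim (subst Live (trans (cong C₂ (sym (m+[n∸m]≡n p))) (cong unΔ (fctx-old N endo emptyCtx (x ∸ N)))) l)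

    letter-sub : ∀ c s → (∀ x → x < N → s x ≡ var x) → subTm s (letterTm c f₀) ≡ letterTm c f₀
    letter-sub c s h = trans (agree (letter-typ c {C₂} (λ i → cong unΔ (fctx-at nΣ endo emptyCtx i))) (λ x l → h x (live-< x l))) (subTm-id (λ _ → refl) _)

    W : Word N → Tm
    W = V f₀

    foldK : Word (suc nΓ) → Tm → Tm
    foldK [] k = k
    foldK (c ∷ w) k = app (letterTm c f₀) (foldK w k)

    it-K : ∀ w k → app (itTm (λ c → letterTm c f₀) w) k =β foldK w k
    it-K w k = β-trans β-lam (≡⇒β (go w))
      where
      go : ∀ w → itBody (λ c → letterTm c f₀) w [ k ] ≡ foldK w k
      go [] = refl
      go (c ∷ w) = cong₂ app (trans (subTm-ren (λ _ → refl) (letterTm c f₀)) (subTm-id (λ _ → refl) (letterTm c f₀))) (go w)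

    letter-β : ∀ c q k us val → (∀ r → us r =β W (val r)) →
               Σ (Fin nR → Tm) λ us' → apps nR (app (app (letterTm c f₀) k) (choose q)) us =β apps nR (app k (choose (proj₁ (δ q c)))) us' × (∀ r → us' r =β W (star M val (proj₂ (δ q c) r)))
    letter-β c q k us val h = us' ,
      β-trans (apps-cong nR us us
          (β-trans (β-appc (β-trans (β-appc (≡⇒β (sym (subTm-id {var} (λ _ → refl) (letterTm c f₀)))) β-refl) (β-lamˢ {var} {lam (caseTm c f₀)})) β-refl)
            (β-trans (β-lamˢ {k ∷ˢ var} {caseTm c f₀}) (β-trans (β-appc (β-trans (≡⇒β (sub-apps (suc Q') s₂ (var 0) branches)) (choose-β q (subTm s₂ ∘ branches))) β-refl)
               (β-lamˢ {s₂} {lams nR (nextTm c q fv₂)})))) (λ _ → β-refl))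
        (β-trans (lams-β nR (k ∷ˢ s₂) (nextTm c q fv₂) us) (β-trans (≡⇒β (sub-apps nR s₃ (app (var (nR + 0)) (choose (proj₁ (δ q c)))) (updTm c q fv₂)))
          (apps-cong nR us' us' (β-appc (≡⇒β (consˢ-old nR us (k ∷ˢ s₂) 0)) (≡⇒β (closed-sub (choose-typ (proj₁ (δ q c))) s₃))) (λ _ → β-refl)))) ,
      (λ j → wordFun-β f₀ s₃ (λ i → nR + suc (fv₂ i)) toℕ val (λ i → consˢ-old nR us (k ∷ˢ s₂) (suc (fv₂ i))) (λ r → β-trans (≡⇒β (consˢ-new nR us (k ∷ˢ s₂) r)) (h r)) (proj₂ (δ q c) j))
      where
      fv₂ : Vars
      fv₂ = suc ∘ suc ∘ f₀
      branches : Fin (suc Q') → Tm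
      branches q = branch c q fv₂
      s₂ = choose q ∷ˢ k ∷ˢ var
      s₃ = consˢ nR us (k ∷ˢ s₂)
      us' : Fin nR → Tm
      us' j = subTm s₃ (updTm c q fv₂ j)

    result : Fin (suc Q') × Valuation M → Word N
    result (q , s) = star M s (out q)

    final-β : ∀ s fv q us val → (∀ i → s (fv i) ≡ var (f₀ i)) → (∀ r → us r =β W (val r)) → apps nR (app (subTm s (final fv)) (choose q)) us =β W (star M val (out q))
    final-β s fv q us val hs h = β-trans (apps-cong nR us us (β-trans (β-lamˢ {s} {apps (suc Q') (var 0) outs}) (β-trans (≡⇒β (sub-apps (suc Q') s₁ (var 0) outs)) (choose-β q (subTm s₁ ∘ outs)))) (λ _ → β-refl))
      (β-trans (lams-β nR s₁ (outFun q (suc ∘ fv)) us) (wordFun-β f₀ (consˢ nR us s₁) (λ i → nR + suc (fv i)) toℕ val (λ i → trans (consˢ-old nR us s₁ (suc (fv i))) (hs i))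
         (λ r → β-trans (≡⇒β (consˢ-new nR us s₁ r)) (h r)) (out q)))
      where
      s₁ = choose q ∷ˢ s
      outs : Fin (suc Q') → Tm
      outs q = outTm q (suc ∘ fv)

    run-β : ∀ s fv → (∀ i → s (fv i) ≡ var (f₀ i)) → ∀ w q us val → (∀ r → us r =β W (val r)) →
            apps nR (app (foldK w (subTm s (final fv))) (choose q)) us =β W (result (foldl (stepRT M) (q , val) w))
    run-β s fv hs [] q us val h = final-β s fv q us val hs h
    run-β s fv hs (c ∷ w) q us val h with letter-β c q (foldK w (subTm s (final fv))) us val h
    ... | us' , e , h' = β-trans e (run-β s fv hs w (proj₁ (δ q c)) us' _ h')

    inner-β : ∀ w → subTm (extN N (enc nΓ w ∷ˢ var)) inner =β bang (lam (encBody nΣ (runRT M w)))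
    inner-β w = β-trans (β-appc (β-refl {subTm s (lam! (bang start))}) (β-trans (≡⇒β (sub-applyArgs nΓ s (var (N + 0)) (λ c → bang (letterTm c f₀)))) (β-trans (applyArgs-β nΓ _ (λ c → letterTm c f₀)
         (≡⇒β (extN-old N (enc nΓ w ∷ˢ var) 0 refl (closed-ren (enc-typ nΓ w) suc))) (λ c → ≡⇒β (cong bang (letter-sub c s (extN-new N _))))) (enc-β nΓ w _))))
      (β-trans (β-bangˢ {s} {bang start}) (β-bangc (β-trans (≡⇒β (sub-apps nR s' (app (app (var 0) (final (suc ∘ f₀))) (choose qI)) empties))
        (β-trans (apps-cong nR empties empties (β-appc (it-K w _) (≡⇒β (closed-sub (choose-typ qI) s'))) (λ _ → β-refl))
          (β-trans (run-β s' (suc ∘ f₀) (λ i → extN-new N _ (f₀ i) (s≤s (m∸n≤m nΣ (toℕ i)))) w qI empties (λ _ → []) (λ _ → β-refl))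
            (≡⇒β (it-enc nΣ (runRT M w))))))))
      where
      s = extN N (enc nΓ w ∷ˢ var)
      s' = itTm (λ c → letterTm c f₀) w ∷ˢ s

    term-β : ∀ w → app term (enc nΓ w) =β enc nΣ (runRT M w)
    term-β w = β-trans β-lam (β-trans (≡⇒β (trans (subTm-cong (λ { zero → refl ; (suc _) → refl }) (lam!s N inner)) (sub-lam!s N (enc nΓ w ∷ˢ var) inner))) (lam!s-cong N (inner-β w)))

regular-lin : ∀ {nΓ nΣ f} → RegularFun (suc nΓ) (suc nΣ) f → ExpressibleLin nΓ nΣ f
regular-lin (record { Q = zero ; qI = () } , _)
regular-lin {nΓ} {nΣ} (record { Q = suc Q' ; qI = qI ; R = nR ; δ = δ ; F = out } , c , e) = Tr.term , Tt.term-typ , λ w → subst (λ u → app Tr.term (enc nΓ w) =β enc nΣ u) (e w) (Tt.term-β w)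
  where
  module Tr = Transducer nR qI δ out
  module Tt = Tr.Typing c

theorem11 :
  -- (1) linear-type terms: linear time and regularity preserving
  ((nΓ nΣ : ℕ) (f : Word (suc nΓ) → Word (suc nΣ)) →
     ExpressibleLin nΓ nΣ f →
     LinearTime (suc nΓ) (suc nΣ) f × RegularityPreserving (suc nΓ) (suc nΣ) f)
  ×
  -- (1) !-type terms: polynomial time and regularity preserving
  ((nΓ nΣ : ℕ) (f : Word (suc nΓ) → Word (suc nΣ)) →
     ExpressibleBang nΓ nΣ f →
     PolyTime (suc nΓ) (suc nΣ) f × RegularityPreserving (suc nΓ) (suc nΣ) f)
  ×
  -- (2) every regular function is expressible with both types
  ((nΓ nΣ : ℕ) (f : Word (suc nΓ) → Word (suc nΣ)) →
     RegularFun (suc nΓ) (suc nΣ) f →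
     ExpressibleLin nΓ nΣ f × ExpressibleBang nΓ nΣ f)
  ×
  -- (3) closure under composition by substitution
  ((nΓ nI nΣ : ℕ) (f : Word (suc nΓ) → Word (suc nI))
     (g : Fin (suc nI) → Word (suc nΓ) → Word (suc nΣ)) →
     ExpressibleBang nΓ nI f →
     ((i : Fin (suc nI)) → ExpressibleBang nΓ nΣ (g i)) →
     ExpressibleBang nΓ nΣ (CbS f g))
  ×
  -- (3) consequence: polynomial growth of any degree
  ((k : ℕ) → Σ ℕ λ nΓ → Σ ℕ λ nΣ → Σ (Word (suc nΓ) → Word (suc nΣ)) λ f →
     ExpressibleBang nΓ nΣ f × GrowsAtLeastPoly k f)
theorem11 =
  (λ nΓ nΣ f E → let K = coreLin nΓ nΣ f E in Walker.linear (linSpec K) , core-regular K) ,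
  (λ nΓ nΣ f E → let (_ , K) = coreBang nΓ nΣ f E in PolyMachine.poly (polySpec K) , core-regular K) ,
  (λ nΓ nΣ f r → regular-lin r , lin⇒bang (regular-lin r)) ,
  (λ nΓ nI nΣ f g → Subst.cbs-bang) ,
  growing
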